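{- For every integer $e \geq 3$, $$ f_3\left(n,\, e+\frac{18\log e}{\log\log e},\, e\right) = o(n^2) \quad \text{as } n \to \infty . $$ Equivalently: for every integer $e\ge 3$ and every $\varepsilon\in(0,1)$ there is $n_0$ such that every $3$-uniform hypergraph with $n\ge n_0$ vertices and at least $\varepsilon n^2$ edges contains $e$ edges whose union has at most $e+18\log e/\log\log e$ vertices.
   Context: An $r$-uniform hypergraph ($r$-graph) has a vertex set $V$ of size $n$ and an edge set consisting of $r$-element subsets of $V$. A $(v,e)$-configuration is a hypergraph with exactly $e$ edges and at most $v$ vertices; an $r$-graph contains a $(v,e)$-configuration if it has $e$ edges whose union has at most $v$ vertices. $f_r(n,v,e)$ denotes the largest number of edges in an $n$-vertex $r$-graph containing no $(v,e)$-configuration. All logarithms are natural. -}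

module Defs where

open import Data.Nat as ℕ using (ℕ; zero; suc; _∸_; _≤_)
open import Data.Integer using (+_)
open import Data.Rational as ℚ using (ℚ; 0ℚ; 1ℚ; _/_)
open import Data.Product using (Σ; ∃; ∃-syntax; _×_; _,_)
open import Data.Sum using (_⊎_)
open import Data.List using (List; length)
open import Data.List.Relation.Unary.All using (All)
open import Data.List.Relation.Unary.Unique.Propositional using (Unique)
open import Data.List.Relation.Binary.Sublist.Propositional using (_⊆_)
open import Data.Fin.Subset using (Subset; ∣_∣; ⋃)
open import Relation.Binary.PropositionalEquality using (_≡_)

ℕ→ℚ : ℕ → ℚ
ℕ→ℚ k = (+ k) / 1

_^ℚ_ : ℚ → ℕ → ℚ
q ^ℚ zero  = 1ℚ
q ^ℚ suc d = q ℚ.* (q ^ℚ d)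

expTerm : ℚ → ℕ → ℚ
expTerm q zero    = 1ℚ
expTerm q (suc k) = (expTerm q k ℚ.* q) ℚ.* ((+ 1) / suc k)

expPartial : ℚ → ℕ → ℚ
expPartial q zero    = 1ℚ
expPartial q (suc N) = expPartial q N ℚ.+ expTerm q (suc N)

-- For d ≥ 1 and e ≥ 3 (so L = log e > 1 and log log e > 0):
--   d ≤ 18 log e / log log e
--   ⇔ d · log L ≤ 18 L ⇔ L^d ≤ e^18 ⇔ L ≤ c  (c = (e^18)^(1/d))
--   ⇔ e ≤ exp c
--   ⇔ ∀ ε > 0, ∃ rational q with 0 ≤ q, q^d ≤ e^18, and ∃ N, e < S_N(q) + ε
-- (exp c is the supremum of the partial sums S_N(q) over rationals 0 ≤ q ≤ c).
ExcessOK : (e d : ℕ) → Set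
ExcessOK e d =
  (ε : ℚ) → 0ℚ ℚ.< ε →
  ∃[ q ] (0ℚ ℚ.≤ q × (q ^ℚ d) ℚ.≤ ℕ→ℚ (e ℕ.^ 18)
          × ∃[ N ] ℕ→ℚ e ℚ.< expPartial q N ℚ.+ ε)

WithinBound : (e v : ℕ) → Set
WithinBound e v = v ≤ e ⊎ ExcessOK e (v ∸ e)

record ThreeGraph (n : ℕ) : Set where
  field
    edges    : List (Subset n)
    uniform  : All (λ E → ∣ E ∣ ≡ 3) edges
    distinct : Unique edges

open ThreeGraph public

numEdges : ∀ {n} → ThreeGraph n → ℕ
numEdges H = length (edges H)

ContainsConfig : ∀ {n} → ℕ → ThreeGraph n → Set
ContainsConfig e H =
  ∃[ S ] (S ⊆ edges H × length S ≡ e × WithinBound e ∣ ⋃ S ∣)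

{-# OPTIONS --safe #-}
module Submission where

open import Defs
open import Data.Nat using (ℕ; zero; suc; _+_; _*_; _∸_; _^_; _⊓_; _≤_; z≤n; s≤s; _≡ᵇ_; _!) renaming (_<_ to _<ᴺ_)
import Data.Nat as ℕ
import Data.Nat.Properties as ℕP
import Data.Nat.DivMod as DM
open import Data.Nat.Solver using () renaming (module +-*-Solver to ℕS)
import Data.Integer as ℤ
import Data.Integer.Properties as ℤP
import Data.Rational
import Data.Rational as ℚ
open import Data.Rational using (ℚ; 0ℚ; 1ℚ; _<_) renaming (_+_ to infixl 6 _⊕_; _*_ to infixl 7 _⊗_; _-_ to infixl 6 _⊖_; _≤_ to infix 4 _≤ℚ_)
import Data.Rational.Properties as ℚP
import Data.Rational.Unnormalised as ℚᵘ
import Data.Rational.Unnormalised.Properties as ℚᵘP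
open import Data.Rational.Solver using (module +-*-Solver)
open import Data.Bool using (Bool; true; false; if_then_else_; _∧_; _∨_; not; T)
import Data.Bool
open import Data.Bool.ListAction using (any)
open import Data.Bool.Properties using (∧-identityʳ; T?; ¬-not)
open import Data.Unit using (tt; ⊤)
open import Data.Empty using (⊥; ⊥-elim)
open import Data.Product using (Σ; ∃-syntax; _×_; _,_; proj₁; proj₂)
import Data.Product.Properties as ProductP
open import Data.Sum using (_⊎_; inj₁; inj₂; [_,_]′)
import Data.Sum.Properties as SumP
open import Data.List using (List; []; _∷_; length; map; _++_; concatMap; allFin; downFrom; cartesianProduct; filter; filterᵇ; take; tabulate)
import Data.List.Properties as ListP
open import Data.List.Membership.Propositional using (_∈_; lose; find)
open import Data.List.Membership.Propositional.Properties using (∈-allFin; ∈-map⁺; ∈-map⁻; ∈-++⁺ˡ; ∈-++⁺ʳ; ∈-++⁻; ∈-filter⁺; ∈-filter⁻; ∈-concatMap⁺; ∈-concatMap⁻; ∈-cartesianProduct⁺)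
open import Data.List.Relation.Unary.Any using (here; there)
import Data.List.Relation.Unary.Any as Any
open import Data.List.Relation.Unary.All using (All; []; _∷_)
import Data.List.Relation.Unary.All as All
import Data.List.Relation.Unary.All.Properties as AllP
open import Data.List.Relation.Unary.AllPairs using (AllPairs; []; _∷_)
import Data.List.Relation.Unary.AllPairs as AllPairs
import Data.List.Relation.Unary.AllPairs.Properties as AllPairsP
open import Data.List.Relation.Unary.Unique.Propositional using (Unique)
import Data.List.Relation.Unary.Unique.Propositional.Properties as UniqueP
open import Data.List.Relation.Binary.Sublist.Propositional using (_⊆_; []; _∷_; _∷ʳ_)
import Data.List.Relation.Binary.Sublist.Propositional.Properties as SublistP
open import Data.Fin using (Fin; zero; suc)
import Data.Fin
import Data.Fin.Properties as FinP
open import Data.Fin.Subset using (Subset; ∣_∣; ⋃; ⁅_⁆; _∪_) renaming (_∈_ to _∈ˢ_)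
import Data.Fin.Subset as Subset
import Data.Fin.Subset.Properties as SubsetP
open import Data.Vec using (Vec; []; _∷_; lookup; _[_]≔_; replicate)
import Data.Vec as Vec
import Data.Vec.Properties as VecP
open import Function using (_∘_; id)
open import Relation.Binary.Definitions using (DecidableEquality)
open import Relation.Binary.PropositionalEquality
import Relation.Binary.Reasoning.Setoid ℚᵘP.≃-setoid as SetoidReasoning
open import Relation.Nullary using (¬_; Dec; yes; no; does; isYes; _×-dec_; _→-dec_; _⊎-dec_; ¬?)
open import Relation.Nullary.Decidable using (from-yes)
open +-*-Solver using (solve; _:=_; _:+_; _:*_; _:-_; con; :-_)
open ℕS using () renaming (solve to solveℕ; _:=_ to infix 4 _≜_; _:+_ to infixl 6 _⊞_; _:*_ to infixl 7 _⊠_; con to num)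

-- Start from single edges (k = 2) and climb through patterns F_k with k + 1 distinguished roots, with
-- 3·k!/8 edges for k ≥ 4, and with exactly k more vertices than edges.  F_(k+1) consists of k + 1
-- copies of F_k, the i-th having k roots on the i-th facet of a k-simplex and one root off it.
-- In this way quadratically many edges propagate to c·n^k copies of F_k for every k: a simplex
-- removal lemma turns n^k facets, each completed by its own extra root, into a positive
-- proportion of all simplices.
--
-- The removal lemma is an energy-increment argument.  The sets of coordinates are treated in the order of
-- their binary values, each with a coarse and a fine family of colourings, and only lower bounds
-- on the number of points with prescribed colours that avoid small facet sets are tracked.
--
-- Degenerate simplices and copies that are not determined by their roots cannot be numerous: they
-- would form a large sunflower over a kernel of excess at least k, and the union of its petals already
-- contains e edges on few vertices.  Once F_k has at least e edges, the first e edges of one copy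
-- span at most e + 6 (k - 1) vertices.  Finally, with m = ⌈log₂ e⌉, the choice of k gives
-- m^(k-1) ≤ e³, and 2^m ≤ exp m makes m a substitute for log e.

-- The argument runs under the assumption that no `e` edges span at most `e + d` vertices. A vertex
-- set all of whose supersets in the pattern have excess at least `k` then lies in boundedly many
-- copies, once it is placed. So every pattern must have large excess around its roots, and this
-- governs their choice: F_(k+1) keeps four of the off-facet roots and only k - 2 of the k + 1
-- simplex vertices. F_3 is too small for this: two roots in a common edge determine the third
-- vertex. Hence three pairs among the twelve edges of the four copies in F_4 coincide, and 9 =
-- 3·4!/8 remain.
--
-- In the removal lemma the disagreement of coarse and fine densities is small only on average. The
-- points where it is large form facet sets, which the induction hypothesis is asked to avoid;
-- exceptional sets therefore belong to the statement that is proved by induction.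
--
-- Of the excess 6 (k - 1), each level adds one unit for the dimension, one for the roots and four
-- for cutting the edge list. With the exponent 3 in m^(k-1) ≤ e³ this gives 18 = 6·3.

-- Rational arithmetic: finite sums, indicators and counting

-- The format of nearly all polynomial inequalities below: the difference is exhibited as a visibly
-- nonnegative expression, and the ring solver checks the identity.
≤ℚ-by : ∀ {a b} c → 0ℚ ≤ℚ c → b ≡ a ⊕ c → a ≤ℚ b
≤ℚ-by {a} {b} c c≥0 eq = subst₂ _≤ℚ_ (ℚP.+-identityʳ a) (sym eq) (ℚP.+-monoʳ-≤ a c≥0)

0≤⊖ : ∀ {a b} → a ≤ℚ b → 0ℚ ≤ℚ b ⊖ a
0≤⊖ {a} {b} a≤b = subst (_≤ℚ b ⊖ a) (ℚP.+-inverseʳ a) (ℚP.+-monoˡ-≤ (ℚ.- a) a≤b)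

0≤⊕ : ∀ {a b} → 0ℚ ≤ℚ a → 0ℚ ≤ℚ b → 0ℚ ≤ℚ a ⊕ b
0≤⊕ = ℚP.+-mono-≤

⊗-monoˡ-≤ : ∀ {a b c} → 0ℚ ≤ℚ c → a ≤ℚ b → c ⊗ a ≤ℚ c ⊗ b
⊗-monoˡ-≤ {c = c} c≥0 a≤b = ℚP.*-monoˡ-≤-nonNeg c {{ℚ.nonNegative c≥0}} a≤b

0≤⊗ : ∀ {a b} → 0ℚ ≤ℚ a → 0ℚ ≤ℚ b → 0ℚ ≤ℚ a ⊗ b
0≤⊗ {a} {b} a≥0 b≥0 = subst (_≤ℚ a ⊗ b) (ℚP.*-zeroʳ a) (⊗-monoˡ-≤ a≥0 b≥0)

⊗-mono-≤ : ∀ {a b c d} → 0ℚ ≤ℚ b → 0ℚ ≤ℚ c → a ≤ℚ b → c ≤ℚ d → a ⊗ c ≤ℚ b ⊗ d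
⊗-mono-≤ {a} {b} {c} {d} b≥0 c≥0 a≤b c≤d = ℚP.≤-trans
  (subst₂ _≤ℚ_ (ℚP.*-comm c a) (ℚP.*-comm c b) (⊗-monoˡ-≤ c≥0 a≤b)) (⊗-monoˡ-≤ b≥0 c≤d)

0≤sq : ∀ a → 0ℚ ≤ℚ a ⊗ a
0≤sq a with ℚP.≤-total 0ℚ a
... | inj₁ a≥0 = 0≤⊗ a≥0 a≥0

... | inj₂ a≤0 = subst (0ℚ ≤ℚ_) (solve 1 (λ a → (:- a) :* (:- a) := a :* a) refl a) (0≤⊗ -a≥0 -a≥0)
  where -a≥0 = ℚP.neg-antimono-≤ a≤0

abstract

  ι : ℕ → ℚ
  ι = ℕ→ℚ

  ι≡ℕ→ℚ : ∀ a → ι a ≡ ℕ→ℚ a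
  ι≡ℕ→ℚ a = refl

  ι-0 : ι 0 ≡ 0ℚ
  ι-0 = refl

  ι-1 : ι 1 ≡ 1ℚ
  ι-1 = refl

  ι-toℚᵘ : ∀ a → ℚ.toℚᵘ (ι a) ℚᵘ.≃ ℚᵘ.mkℚᵘ (ℤ.+ a) 0
  ι-toℚᵘ a = ℚP.toℚᵘ-fromℚᵘ (ℚᵘ.mkℚᵘ (ℤ.+ a) 0)

  ι-+ : ∀ a b → ι (a + b) ≡ ι a ⊕ ι b
  ι-+ a b = ℚP.toℚᵘ-injective (begin
    ℚ.toℚᵘ (ι (a + b))                    ≈⟨ ι-toℚᵘ (a + b) ⟩
    ℚᵘ.mkℚᵘ (ℤ.+ (a + b)) 0                 ≈⟨ ℚᵘ.*≡* (cong (ℤ._* ℤ.+ 1) (sym (cong₂ ℤ._+_ (ℤP.*-identityʳ (ℤ.+ a)) (ℤP.*-identityʳ (ℤ.+ b))))) ⟩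
    ℚᵘ.mkℚᵘ (ℤ.+ a) 0 ℚᵘ.+ ℚᵘ.mkℚᵘ (ℤ.+ b) 0  ≈⟨ ℚᵘP.+-cong (ι-toℚᵘ a) (ι-toℚᵘ b) ⟨
    ℚ.toℚᵘ (ι a) ℚᵘ.+ ℚ.toℚᵘ (ι b)        ≈⟨ ℚP.toℚᵘ-homo-+ (ι a) (ι b) ⟨
    ℚ.toℚᵘ (ι a ⊕ ι b)                    ∎)
    where open SetoidReasoning

ι-suc : ∀ a → ι (suc a) ≡ 1ℚ ⊕ ι a
ι-suc a = trans (ι-+ 1 a) (cong (λ q → q ⊕ ι a) ι-1)

ι-* : ∀ a b → ι (a * b) ≡ ι a ⊗ ι b
ι-* zero    b = trans ι-0 (sym (trans (cong (_⊗ ι b) ι-0) (ℚP.*-zeroˡ (ι b))))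
ι-* (suc a) b = begin
  ι (b + a * b)          ≡⟨ ι-+ b (a * b) ⟩
  ι b ⊕ ι (a * b)        ≡⟨ cong (ι b ⊕_) (ι-* a b) ⟩
  ι b ⊕ ι a ⊗ ι b        ≡⟨ solve 2 (λ a b → b :+ a :* b := (con 1ℚ :+ a) :* b) refl (ι a) (ι b) ⟩
  (1ℚ ⊕ ι a) ⊗ ι b       ≡⟨ cong (_⊗ ι b) (ι-suc a) ⟨
  ι (suc a) ⊗ ι b        ∎
  where open ≡-Reasoning

0≤ι : ∀ a → 0ℚ ≤ℚ ι a
0≤ι zero    = ℚP.≤-reflexive (sym ι-0)
0≤ι (suc a) = subst (0ℚ ≤ℚ_) (sym (ι-suc a)) (0≤⊕ (ℚP.<⇒≤ (ℚP.positive⁻¹ 1ℚ)) (0≤ι a))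

ι-mono : ∀ {a b} → a ≤ b → ι a ≤ℚ ι b
ι-mono {a} {b} a≤b = ≤ℚ-by (ι (b ∸ a)) (0≤ι (b ∸ a)) (trans (cong ι (sym (ℕP.m+[n∸m]≡n a≤b))) (ι-+ a (b ∸ a)))

1≤ι : ∀ {a} → 1 ≤ a → 1ℚ ≤ℚ ι a
1≤ι {a} 1≤a = subst (λ q → q ≤ℚ ι a) ι-1 (ι-mono 1≤a)

ι-cancel-≤ : ∀ {a b} → ι a ≤ℚ ι b → a ≤ b
ι-cancel-≤ {a} {b} le with a ℕP.≤? b
... | yes a≤b = a≤b
... | no  a≰b = ⊥-elim (ℚP.<-irrefl refl (ℚP.<-≤-trans (ℚP.<-≤-trans lt (ι-mono (ℕP.≰⇒> a≰b))) le))
  where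
  lt : ι b < ι (suc b)
  lt = subst₂ _<_ (ℚP.+-identityˡ (ι b)) (sym (ι-suc b)) (ℚP.+-monoˡ-< (ι b) (ℚP.positive⁻¹ 1ℚ))

Σℚ : ∀ {A : Set} → List A → (A → ℚ) → ℚ
Σℚ []       f = 0ℚ
Σℚ (x ∷ xs) f = f x ⊕ Σℚ xs f

module _ {A : Set} where

  Σ-cong : ∀ (xs : List A) {f g : A → ℚ} → (∀ x → f x ≡ g x) → Σℚ xs f ≡ Σℚ xs g
  Σ-cong []       f≗g = refl
  Σ-cong (x ∷ xs) f≗g = cong₂ _⊕_ (f≗g x) (Σ-cong xs f≗g)

  Σ-mono : ∀ (xs : List A) {f g : A → ℚ} → (∀ x → f x ≤ℚ g x) → Σℚ xs f ≤ℚ Σℚ xs g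
  Σ-mono []       f≤g = ℚP.≤-refl
  Σ-mono (x ∷ xs) f≤g = ℚP.+-mono-≤ (f≤g x) (Σ-mono xs f≤g)

  Σ-zero : ∀ (xs : List A) → Σℚ xs (λ _ → 0ℚ) ≡ 0ℚ
  Σ-zero []       = refl
  Σ-zero (x ∷ xs) = trans (ℚP.+-identityˡ _) (Σ-zero xs)

  Σ-nonneg : ∀ (xs : List A) {f : A → ℚ} → (∀ x → 0ℚ ≤ℚ f x) → 0ℚ ≤ℚ Σℚ xs f
  Σ-nonneg xs f≥0 = subst (_≤ℚ Σℚ xs _) (Σ-zero xs) (Σ-mono xs f≥0)

  Σ-⊕ : ∀ (xs : List A) (f g : A → ℚ) → Σℚ xs (λ x → f x ⊕ g x) ≡ Σℚ xs f ⊕ Σℚ xs g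
  Σ-⊕ []       f g = refl
  Σ-⊕ (x ∷ xs) f g = trans (cong (f x ⊕ g x ⊕_) (Σ-⊕ xs f g))
    (solve 4 (λ a b c d → a :+ b :+ (c :+ d) := a :+ c :+ (b :+ d)) refl (f x) (g x) (Σℚ xs f) (Σℚ xs g))

  Σ-⊗ : ∀ (xs : List A) c (f : A → ℚ) → Σℚ xs (λ x → c ⊗ f x) ≡ c ⊗ Σℚ xs f
  Σ-⊗ []       c f = sym (ℚP.*-zeroʳ c)
  Σ-⊗ (x ∷ xs) c f = trans (cong (c ⊗ f x ⊕_) (Σ-⊗ xs c f)) (sym (ℚP.*-distribˡ-+ c (f x) (Σℚ xs f)))

  Σ-⊖ : ∀ (xs : List A) (f g : A → ℚ) → Σℚ xs (λ x → f x ⊖ g x) ≡ Σℚ xs f ⊖ Σℚ xs g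
  Σ-⊖ []       f g = refl
  Σ-⊖ (x ∷ xs) f g = trans (cong (f x ⊖ g x ⊕_) (Σ-⊖ xs f g))
    (solve 4 (λ a b c d → a :- b :+ (c :- d) := a :+ c :- (b :+ d)) refl (f x) (g x) (Σℚ xs f) (Σℚ xs g))

  Σ-const : ∀ (xs : List A) c → Σℚ xs (λ _ → c) ≡ ι (length xs) ⊗ c
  Σ-const []       c = sym (trans (cong (_⊗ c) ι-0) (ℚP.*-zeroˡ c))
  Σ-const (x ∷ xs) c = trans (cong (c ⊕_) (Σ-const xs c)) (trans
    (solve 2 (λ c l → c :+ l :* c := (con 1ℚ :+ l) :* c) refl c (ι (length xs)))
    (cong (_⊗ c) (sym (ι-suc (length xs)))))

  Σ-∈≤ : ∀ {xs : List A} {f : A → ℚ} → (∀ x → 0ℚ ≤ℚ f x) → ∀ {x} → x ∈ xs → f x ≤ℚ Σℚ xs f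
  Σ-∈≤ {x ∷ xs} {f} f≥0 (here refl) = ≤ℚ-by (Σℚ xs f) (Σ-nonneg xs f≥0) refl
  Σ-∈≤ {y ∷ xs} {f} f≥0 (there x∈)  = ℚP.≤-trans (Σ-∈≤ f≥0 x∈)
    (≤ℚ-by (f y) (f≥0 y) (ℚP.+-comm (f y) (Σℚ xs f)))

  Σ-++ : ∀ (xs ys : List A) (f : A → ℚ) → Σℚ (xs ++ ys) f ≡ Σℚ xs f ⊕ Σℚ ys f
  Σ-++ []       ys f = sym (ℚP.+-identityˡ _)
  Σ-++ (x ∷ xs) ys f = trans (cong (f x ⊕_) (Σ-++ xs ys f)) (sym (ℚP.+-assoc (f x) _ _))

module _ {A B : Set} where

  Σ-swap : ∀ (xs : List A) (ys : List B) (f : A → B → ℚ) →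
           Σℚ xs (λ x → Σℚ ys (f x)) ≡ Σℚ ys (λ y → Σℚ xs (λ x → f x y))
  Σ-swap []       ys f = sym (Σ-zero ys)
  Σ-swap (x ∷ xs) ys f = trans (cong (Σℚ ys (f x) ⊕_) (Σ-swap xs ys f)) (sym (Σ-⊕ ys (f x) _))

  Σ-map : ∀ (xs : List A) (g : A → B) (f : B → ℚ) → Σℚ (map g xs) f ≡ Σℚ xs (f ∘ g)
  Σ-map []       g f = refl
  Σ-map (x ∷ xs) g f = cong (f (g x) ⊕_) (Σ-map xs g f)

  Σ-concatMap : ∀ (xs : List A) (g : A → List B) (f : B → ℚ) →
                Σℚ (concatMap g xs) f ≡ Σℚ xs (λ x → Σℚ (g x) f)
  Σ-concatMap []       g f = refl
  Σ-concatMap (x ∷ xs) g f = trans (Σ-++ (g x) (concatMap g xs) f) (cong (Σℚ (g x) f ⊕_) (Σ-concatMap xs g f))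

ind : Bool → ℚ
ind true  = 1ℚ
ind false = 0ℚ

0≤ind : ∀ b → 0ℚ ≤ℚ ind b
0≤ind true  = ℚP.<⇒≤ (ℚP.positive⁻¹ 1ℚ)
0≤ind false = ℚP.≤-refl

ind≤1 : ∀ b → ind b ≤ℚ 1ℚ
ind≤1 true  = ℚP.≤-refl
ind≤1 false = 0≤ind true

ind-∧ : ∀ a b → ind (a ∧ b) ≡ ind a ⊗ ind b
ind-∧ true  b = sym (ℚP.*-identityˡ (ind b))
ind-∧ false b = sym (ℚP.*-zeroˡ (ind b))

ind-∨ : ∀ a b → ind (a ∨ b) ≤ℚ ind a ⊕ ind b
ind-∨ true  b = ≤ℚ-by (ind b) (0≤ind b) refl
ind-∨ false b = ℚP.≤-reflexive (sym (ℚP.+-identityˡ (ind b)))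

cnt : ∀ {A : Set} → List A → (A → Bool) → ℕ
cnt []       P = 0
cnt (x ∷ xs) P = (if P x then 1 else 0) + cnt xs P

ι-cnt : ∀ {A : Set} (xs : List A) (P : A → Bool) → ι (cnt xs P) ≡ Σℚ xs (ind ∘ P)
ι-cnt []       P = ι-0
ι-cnt (x ∷ xs) P with P x
... | true  = trans (ι-suc (cnt xs P)) (cong (1ℚ ⊕_) (ι-cnt xs P))
... | false = trans (ι-cnt xs P) (sym (ℚP.+-identityˡ _))

cube : (n m : ℕ) → List (Vec (Fin n) m)
cube n zero    = [] ∷ []
cube n (suc m) = concatMap (λ a → map (a ∷_) (cube n m)) (allFin n)

Σ-cube : ∀ {n m} (f : Vec (Fin n) (suc m) → ℚ) →
         Σℚ (cube n (suc m)) f ≡ Σℚ (allFin n) (λ a → Σℚ (cube n m) (λ v → f (a ∷ v)))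
Σ-cube {n} {m} f = trans (Σ-concatMap (allFin n) (λ a → map (a ∷_) (cube n m)) f)
  (Σ-cong (allFin n) (λ a → Σ-map (cube n m) (a ∷_) f))

∈-cube : ∀ {n m} (v : Vec (Fin n) m) → v ∈ cube n m
∈-cube []      = here refl
∈-cube (a ∷ v) = ∈-concatMap⁺ _ (lose (∈-allFin a) (∈-map⁺ (a ∷_) (∈-cube v)))

length-cube : ∀ n m → length (cube n m) ≡ n ^ m
length-cube n zero    = refl
length-cube n (suc m) = go (allFin n) (ListP.length-tabulate {n = n} id)
  where
  go : ∀ {l} (as : List (Fin n)) → length as ≡ l → length (concatMap (λ a → map (a ∷_) (cube n m)) as) ≡ l * n ^ m
  go []       refl = refl
  go (a ∷ as) refl = trans (ListP.length-++ (map (a ∷_) (cube n m)))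
    (cong₂ _+_ (trans (ListP.length-map (a ∷_) (cube n m)) (length-cube n m)) (go as refl))

-- Overwriting forgets the old `i`-th entry, so every vector arises from exactly `n` pairs of `a`
-- and `v`.
Σ-average : ∀ {n m} (i : Fin m) (f : Vec (Fin n) m → ℚ) →
            Σℚ (allFin n) (λ a → Σℚ (cube n m) (λ v → f (v [ i ]≔ a))) ≡ ι n ⊗ Σℚ (cube n m) f
Σ-average {n} {suc m} zero f = begin
  Σℚ as (λ a → Σℚ (cube n (suc m)) (λ v → f (v [ zero ]≔ a)))    ≡⟨ Σ-cong as (λ a → Σ-cube (λ v → f (v [ zero ]≔ a))) ⟩
  Σℚ as (λ a → Σℚ as (λ _ → Σℚ (cube n m) (λ v → f (a ∷ v))))    ≡⟨ Σ-cong as (λ a → Σ-const as _) ⟩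
  Σℚ as (λ a → ι (length as) ⊗ Σℚ (cube n m) (λ v → f (a ∷ v)))  ≡⟨ Σ-⊗ as (ι (length as)) _ ⟩
  ι (length as) ⊗ Σℚ as (λ a → Σℚ (cube n m) (λ v → f (a ∷ v)))  ≡⟨ cong₂ (λ l s → ι l ⊗ s) (ListP.length-tabulate {n = n} id) (sym (Σ-cube f)) ⟩
  ι n ⊗ Σℚ (cube n (suc m)) f                                     ∎
  where open ≡-Reasoning
        as = allFin n
Σ-average {n} {suc m} (suc i) f = begin
  Σℚ as (λ a → Σℚ (cube n (suc m)) (λ v → f (v [ suc i ]≔ a)))               ≡⟨ Σ-cong as (λ a → Σ-cube (λ v → f (v [ suc i ]≔ a))) ⟩
  Σℚ as (λ a → Σℚ as (λ b → Σℚ (cube n m) (λ v → f (b ∷ (v [ i ]≔ a)))))     ≡⟨ Σ-swap as as _ ⟩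
  Σℚ as (λ b → Σℚ as (λ a → Σℚ (cube n m) (λ v → f (b ∷ (v [ i ]≔ a)))))     ≡⟨ Σ-cong as (λ b → Σ-average i (λ v → f (b ∷ v))) ⟩
  Σℚ as (λ b → ι n ⊗ Σℚ (cube n m) (λ v → f (b ∷ v)))                        ≡⟨ Σ-⊗ as (ι n) _ ⟩
  ι n ⊗ Σℚ as (λ b → Σℚ (cube n m) (λ v → f (b ∷ v)))                        ≡⟨ cong (ι n ⊗_) (Σ-cube f) ⟨
  ι n ⊗ Σℚ (cube n (suc m)) f                                                 ∎
  where open ≡-Reasoning
        as = allFin n

-- The default at 0 allows `ceₖ` to be written for keys without points; a key that is attained has
-- mass at least 1.
recip : ℚ → ℚ
recip q with q ℚP.≟ 0ℚ
... | yes _   = 0ℚ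
... | no  q≢0 = ℚ.1/_ q {{ℚ.≢-nonZero q≢0}}

recip-inverse : ∀ {q} → 1ℚ ≤ℚ q → recip q ⊗ q ≡ 1ℚ
recip-inverse {q} 1≤q with q ℚP.≟ 0ℚ
... | yes refl = ⊥-elim (ℚP.<-irrefl refl (ℚP.<-≤-trans (ℚP.positive⁻¹ 1ℚ) 1≤q))
... | no  q≢0  = ℚP.*-inverseˡ q {{ℚ.≢-nonZero q≢0}}

0≤recip : ∀ {q} → 1ℚ ≤ℚ q → 0ℚ ≤ℚ recip q
0≤recip {q} 1≤q = subst (0ℚ ≤ℚ_) eq (0≤⊗ (ℚP.≤-trans (0≤ind true) 1≤q) (0≤sq (recip q)))
  where
  eq : q ⊗ (recip q ⊗ recip q) ≡ recip q
  eq = trans (solve 2 (λ q r → q :* (r :* r) := r :* q :* r) refl q (recip q))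
             (trans (cong (λ s → s ⊗ recip q) (recip-inverse 1≤q)) (ℚP.*-identityˡ (recip q)))

-- Conditional expectation and energy

_Refines_ : ∀ {X K L : Set} → (X → K) → (X → L) → Set
k Refines l = ∀ x y → k x ≡ k y → l x ≡ l y

module CondExp {X K : Set} (_≟_ : DecidableEquality K) (xs : List X) (complete : ∀ x → x ∈ xs) where

  private
    S = Σℚ xs

  same : K → K → Bool
  same k l = does (k ≟ l)

  same-refl : ∀ k → same k k ≡ true
  same-refl k with k ≟ k
  ... | yes _ = refl
  ... | no ¬p = ⊥-elim (¬p refl)

  module _ (key : X → K) where

    mass : K → ℚ
    mass k = S (λ y → ind (same (key y) k))

    -- The average of `f` over a fibre of `key`; `ce` is the conditional expectation.
    ceₖ : (X → ℚ) → K → ℚ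
    ceₖ f k = recip (mass k) ⊗ S (λ y → ind (same (key y) k) ⊗ f y)

    ce : (X → ℚ) → X → ℚ
    ce f x = ceₖ f (key x)

    1≤mass : ∀ x → 1ℚ ≤ℚ mass (key x)
    1≤mass x = subst (λ b → ind b ≤ℚ mass (key x)) (same-refl (key x))
      (Σ-∈≤ (λ y → 0≤ind (same (key y) (key x))) (complete x))

    ce-nonneg : ∀ {f} → (∀ x → 0ℚ ≤ℚ f x) → ∀ x → 0ℚ ≤ℚ ce f x
    ce-nonneg f≥0 x = 0≤⊗ (0≤recip (1≤mass x)) (Σ-nonneg xs (λ y → 0≤⊗ (0≤ind (same (key y) (key x))) (f≥0 y)))

    -- The projection property. Expanded, the right side is a sum over pairs with equal keys, on
    -- which `Φ` and the mass may be read at either member; summing over the other member gives mass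
    -- times reciprocal.
    ce-orth : ∀ f {Φ : X → ℚ} → (∀ x y → key x ≡ key y → Φ x ≡ Φ y) →
              S (λ x → f x ⊗ Φ x) ≡ S (λ x → ce f x ⊗ Φ x)
    ce-orth f {Φ} inv = sym (begin
      S (λ x → ce f x ⊗ Φ x)                                     ≡⟨ Σ-cong xs expand ⟩
      S (λ x → S (λ y → G x y))                                  ≡⟨ Σ-swap xs xs G ⟩
      S (λ y → S (λ x → G x y))                                  ≡⟨ Σ-cong xs collapse ⟩
      S (λ y → f y ⊗ Φ y)                                        ∎)
      where
      open ≡-Reasoning
      r : X → ℚ
      r x = recip (mass (key x))
      G : X → X → ℚ
      G x y = r x ⊗ Φ x ⊗ (ind (same (key y) (key x)) ⊗ f y)
      expand : ∀ x → ce f x ⊗ Φ x ≡ S (λ y → G x y)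
      expand x = trans (solve 3 (λ a b c → a :* b :* c := a :* c :* b) refl (r x) (S (λ y → ind (same (key y) (key x)) ⊗ f y)) (Φ x))
                       (sym (Σ-⊗ xs (r x ⊗ Φ x) (λ y → ind (same (key y) (key x)) ⊗ f y)))
      move : ∀ x y → G x y ≡ r y ⊗ Φ y ⊗ f y ⊗ ind (same (key x) (key y))
      move x y with key y ≟ key x | key x ≟ key y
      ... | yes p | yes _ = trans (cong₂ (λ k φ → recip (mass k) ⊗ φ ⊗ (1ℚ ⊗ f y)) (sym p) (sym (inv y x p)))
                                  (solve 3 (λ a b c → a :* b :* (con 1ℚ :* c) := a :* b :* c :* con 1ℚ) refl (r y) (Φ y) (f y))
      ... | no _  | no _  = solve 6 (λ a b c d e h → a :* b :* (con 0ℚ :* c) := d :* e :* h :* con 0ℚ) refl (r x) (Φ x) (f y) (r y) (Φ y) (f y)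
      ... | yes p | no ¬q = ⊥-elim (¬q (sym p))
      ... | no ¬p | yes q = ⊥-elim (¬p (sym q))
      collapse : ∀ y → S (λ x → G x y) ≡ f y ⊗ Φ y
      collapse y = begin
        S (λ x → G x y)                                                  ≡⟨ Σ-cong xs (λ x → move x y) ⟩
        S (λ x → r y ⊗ Φ y ⊗ f y ⊗ ind (same (key x) (key y)))           ≡⟨ Σ-⊗ xs (r y ⊗ Φ y ⊗ f y) (λ x → ind (same (key x) (key y))) ⟩
        r y ⊗ Φ y ⊗ f y ⊗ mass (key y)                                   ≡⟨ solve 4 (λ a b c d → a :* b :* c :* d := (a :* d) :* (c :* b)) refl (r y) (Φ y) (f y) (mass (key y)) ⟩
        r y ⊗ mass (key y) ⊗ (f y ⊗ Φ y)                                 ≡⟨ cong (λ q → q ⊗ (f y ⊗ Φ y)) (recip-inverse (1≤mass y)) ⟩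
        1ℚ ⊗ (f y ⊗ Φ y)                                                 ≡⟨ ℚP.*-identityˡ (f y ⊗ Φ y) ⟩
        f y ⊗ Φ y                                                        ∎

  sq : ℚ → ℚ
  sq q = q ⊗ q

  energy : (X → K) → (X → ℚ) → ℚ
  energy key f = S (λ x → sq (ce key f x))

  -- Pythagoras for a projection `v` of `u`.
  Σ-sq-⊖ : ∀ (u v : X → ℚ) → S (λ x → u x ⊗ v x) ≡ S (λ x → sq (v x)) →
           S (λ x → sq (u x ⊖ v x)) ≡ S (λ x → sq (u x)) ⊖ S (λ x → sq (v x))
  Σ-sq-⊖ u v uv≡vv = begin
    S (λ x → sq (u x ⊖ v x))
      ≡⟨ Σ-cong xs (λ x → solve 2 (λ u v → (u :- v) :* (u :- v) := u :* u :+ v :* v :- (u :* v :+ u :* v)) refl (u x) (v x)) ⟩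
    S (λ x → sq (u x) ⊕ sq (v x) ⊖ (u x ⊗ v x ⊕ u x ⊗ v x))
      ≡⟨ Σ-⊖ xs (λ x → sq (u x) ⊕ sq (v x)) (λ x → u x ⊗ v x ⊕ u x ⊗ v x) ⟩
    S (λ x → sq (u x) ⊕ sq (v x)) ⊖ S (λ x → u x ⊗ v x ⊕ u x ⊗ v x)
      ≡⟨ cong₂ _⊖_ (Σ-⊕ xs (λ x → sq (u x)) (λ x → sq (v x))) (trans (Σ-⊕ xs (λ x → u x ⊗ v x) (λ x → u x ⊗ v x)) (cong₂ _⊕_ uv≡vv uv≡vv)) ⟩
    U ⊕ V ⊖ (V ⊕ V)
      ≡⟨ solve 2 (λ u v → u :+ v :- (v :+ v) := u :- v) refl U V ⟩
    U ⊖ V ∎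
    where
    open ≡-Reasoning
    U = S (λ x → sq (u x))
    V = S (λ x → sq (v x))

  -- The coarse expectation of `f` is also that of the fine one: `ce k' f` is a function of either
  -- key, so both inner products with it reduce to `f` by `ce-orth`.
  energy-increment : ∀ {k'' k' : X → K} f → k'' Refines k' →
    S (λ x → sq (ce k'' f x ⊖ ce k' f x)) ≡ energy k'' f ⊖ energy k' f
  energy-increment {k''} {k'} f ref = Σ-sq-⊖ (ce k'' f) (ce k' f)
    (trans (sym (ce-orth k'' f (λ x y e → cong (ceₖ k' f) (ref x y e))))
           (ce-orth k' f (λ x y e → cong (ceₖ k' f) e)))

  energy-mono : ∀ {k'' k' : X → K} f → k'' Refines k' → energy k' f ≤ℚ energy k'' f
  energy-mono {k''} {k'} f ref = ≤ℚ-by (energy k'' f ⊖ energy k' f)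
    (subst (0ℚ ≤ℚ_) (energy-increment {k''} {k'} f ref) (Σ-nonneg xs (λ x → 0≤sq (ce k'' f x ⊖ ce k' f x))))
    (solve 2 (λ a b → a := b :+ (a :- b)) refl (energy k'' f) (energy k' f))

  energy-≤ : ∀ (k : X → K) f → energy k f ≤ℚ S (λ x → sq (f x))
  energy-≤ k f = ≤ℚ-by (S (λ x → sq (f x)) ⊖ energy k f)
    (subst (0ℚ ≤ℚ_) (Σ-sq-⊖ f (ce k f) (ce-orth k f (λ x y e → cong (ceₖ k f) e))) (Σ-nonneg xs (λ x → 0≤sq (f x ⊖ ce k f x))))
    (solve 2 (λ a b → a := b :+ (a :- b)) refl (S (λ x → sq (f x))) (energy k f))

-- Sets of coordinates in binary order

-- A vector of Booleans is a set of coordinates, ordered by its binary value.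
code : ∀ {m} → Vec Bool m → ℕ
code []                = 0
code {suc m} (b ∷ h)   = (if b then 2 ^ m else 0) + code h

code< : ∀ {m} (h : Vec Bool m) → code h <ᴺ 2 ^ m
code< []              = s≤s z≤n
code< {suc m} (true  ∷ h) = subst (2 ^ m + code h <ᴺ_) (cong (2 ^ m +_) (sym (ℕP.+-identityʳ _))) (ℕP.+-monoʳ-< (2 ^ m) (code< h))
code< {suc m} (false ∷ h) = ℕP.<-≤-trans (code< h) (ℕP.m≤m+n (2 ^ m) _)

code-injective : ∀ {m} (h h' : Vec Bool m) → code h ≡ code h' → h ≡ h'
code-injective []          []           eq = refl
code-injective {suc m} (true  ∷ h) (true  ∷ h') eq = cong (true ∷_) (code-injective h h' (ℕP.+-cancelˡ-≡ (2 ^ m) _ _ eq))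
code-injective (false ∷ h) (false ∷ h') eq = cong (false ∷_) (code-injective h h' eq)
code-injective {suc m} (true  ∷ h) (false ∷ h') eq = ⊥-elim (ℕP.<-irrefl (sym eq) (ℕP.<-≤-trans (code< h') (ℕP.m≤m+n (2 ^ m) _)))
code-injective {suc m} (false ∷ h) (true  ∷ h') eq = ⊥-elim (ℕP.<-irrefl eq (ℕP.<-≤-trans (code< h) (ℕP.m≤m+n (2 ^ m) _)))

decode : ∀ m t → t <ᴺ 2 ^ m → ∃[ h ] code {m} h ≡ t
decode zero    zero    _    = [] , refl
decode zero    (suc t) (s≤s ())
decode (suc m) t       t< with t ℕP.<? 2 ^ m
... | yes t<' = let h , eq = decode m t t<' in false ∷ h , eq
... | no  t≮  = let h , eq = decode m (t ∸ 2 ^ m) lt in true ∷ h , trans (cong (2 ^ m +_) eq) (ℕP.m+[n∸m]≡n (ℕP.≮⇒≥ t≮))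
  where
  lt : t ∸ 2 ^ m <ᴺ 2 ^ m
  lt = ℕP.+-cancelˡ-< (2 ^ m) _ _ (subst₂ _<ᴺ_ (sym (ℕP.m+[n∸m]≡n (ℕP.≮⇒≥ t≮))) (cong (2 ^ m +_) (ℕP.+-identityʳ _)) t<)

-- Binary order extends inclusion, so a set is treated after all its proper subsets.
code-remove : ∀ {m} (h : Vec Bool m) i → lookup h i ≡ true → code (h [ i ]≔ false) <ᴺ code h
code-remove {suc m} (true ∷ h) zero    refl = ℕP.m<n+m (code h) (ℕP.m^n>0 2 m)
code-remove {suc m} (b ∷ h)    (suc i) eq   = ℕP.+-monoʳ-< (if b then 2 ^ m else 0) (code-remove h i eq)

-- Only the full set has the last code.
code-missing : ∀ {m} (h : Vec Bool m) i → lookup h i ≡ false → suc (code h) <ᴺ 2 ^ m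
code-missing {suc m} (false ∷ h) zero refl = ℕP.≤-trans (s≤s (code< h)) (ℕP.m<m+n (2 ^ m) (subst (1 ≤_) (sym (ℕP.+-identityʳ _)) (ℕP.m^n>0 2 m)))
code-missing {suc m} (true ∷ h) (suc i) eq = subst₂ _<ᴺ_ (ℕP.+-suc (2 ^ m) (code h)) (cong (2 ^ m +_) (sym (ℕP.+-identityʳ _))) (ℕP.+-monoʳ-< (2 ^ m) (code-missing h i eq))
code-missing {suc m} (false ∷ h) (suc i) eq = ℕP.<-≤-trans (code-missing h i eq) (ℕP.m≤m+n (2 ^ m) _)

missing : ∀ {m} (h : Vec Bool m) → suc (code h) <ᴺ 2 ^ m → ∃[ i ] lookup h i ≡ false
missing []          (s≤s ())
missing (false ∷ h) lt = zero , refl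
missing {suc m} (true  ∷ h) lt = let i , eq = missing h lt' in suc i , eq
  where
  lt' : suc (code h) <ᴺ 2 ^ m
  lt' = ℕP.+-cancelˡ-< (2 ^ m) _ _ (subst₂ _<ᴺ_ (sym (ℕP.+-suc (2 ^ m) (code h))) (cong (2 ^ m +_) (ℕP.+-identityʳ _)) lt)

remove-insert : ∀ {m} (h : Vec Bool m) i → lookup h i ≡ true → (h [ i ]≔ false) [ i ]≔ true ≡ h
remove-insert h i eq = trans (VecP.[]≔-idempotent h i) (trans (cong (h [ i ]≔_) (sym eq)) (VecP.[]≔-lookup h i))

coordSets : ∀ m → List (Vec Bool m)
coordSets zero    = [] ∷ []
coordSets (suc m) = map (false ∷_) (coordSets m) ++ map (true ∷_) (coordSets m)

∈-coordSets : ∀ {m} (h : Vec Bool m) → h ∈ coordSets m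
∈-coordSets []          = here refl
∈-coordSets (false ∷ h) = ∈-++⁺ˡ (∈-map⁺ (false ∷_) (∈-coordSets h))
∈-coordSets (true ∷ h)  = ∈-++⁺ʳ _ (∈-map⁺ (true ∷_) (∈-coordSets h))

-- Families of colourings, their keys and refinements

Cube : ℕ → ℕ → Set
Cube n m = Vec (Fin n) m

Indep : ∀ {n m} {A : Set} → Fin m → (Cube n m → A) → Set
Indep i f = ∀ x a → f (x [ i ]≔ a) ≡ f x

-- A colour of `h` is a function of the coordinates in `h`. It takes the whole vector, and `meas`
-- replaces the restriction to `h`.
record Family (n m : ℕ) : Set where
  field
    col  : Vec Bool m → Cube n m → ℕ
    meas : ∀ h i → lookup h i ≡ false → Indep i (col h)

open Family public

Bounded : ∀ {n m} → Family n m → ℕ → Set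
Bounded Q M = ∀ h x → col Q h x <ᴺ M

pair-injective : ∀ {M a b a' b'} → a <ᴺ M → a' <ᴺ M → a + M * b ≡ a' + M * b' → a ≡ a' × b ≡ b'
pair-injective {M@(suc _)} {a} {b} {a'} {b'} a< a'< eq = a≡ , ℕP.*-cancelˡ-≡ b b' M (ℕP.+-cancelˡ-≡ a _ _ (trans eq (cong (_+ M * b') (sym a≡))))
  where
  mod : ∀ {u v} → u <ᴺ M → (u + M * v) DM.% M ≡ u
  mod {u} {v} u< = trans (cong (λ w → (u + w) DM.% M) (ℕP.*-comm M v)) (trans (DM.[m+kn]%n≡m%n u v M) (DM.m<n⇒m%n≡m u<))
  a≡ : a ≡ a'
  a≡ = trans (sym (mod a<)) (trans (cong (DM._% M) eq) (mod a'<))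

pair< : ∀ {M a b} → a <ᴺ M → b <ᴺ M → a + M * b <ᴺ M * M
pair< {M} {a} {b} a< b< = begin-strict
  a + M * b  <⟨ ℕP.+-monoˡ-< (M * b) a< ⟩
  M + M * b  ≡⟨ ℕP.*-suc M b ⟨
  M * suc b  ≤⟨ ℕP.*-monoʳ-≤ M b< ⟩
  M * M      ∎
  where open ℕP.≤-Reasoning

M≤M*M : ∀ M → M ≤ M * M
M≤M*M zero    = z≤n
M≤M*M (suc M) = ℕP.m≤m*n (suc M) (suc M)

anyF : ∀ {m} → (Fin m → Bool) → Bool
anyF {m} P = any P (allFin m)

any-false : ∀ {A : Set} (P : A → Bool) xs → any P xs ≡ false → ∀ {x} → x ∈ xs → P x ≡ false
any-false P (x ∷ xs) eq (here refl) with P x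
... | false = refl
any-false P (x ∷ xs) eq (there y∈) with P x
... | false = any-false P xs eq y∈

any-false⁺ : ∀ {A : Set} (P : A → Bool) xs → (∀ x → P x ≡ false) → any P xs ≡ false
any-false⁺ P []       all = refl
any-false⁺ P (x ∷ xs) all rewrite all x = any-false⁺ P xs all

any-cong : ∀ {A : Set} {P P' : A → Bool} xs → (∀ x → P x ≡ P' x) → any P xs ≡ any P' xs
any-cong []       eq = refl
any-cong (x ∷ xs) eq = cong₂ _∨_ (eq x) (any-cong xs eq)

anyF-false : ∀ {m} (P : Fin m → Bool) → anyF P ≡ false → ∀ i → P i ≡ false
anyF-false {m} P eq i = any-false P (allFin m) eq (∈-allFin i)

anyF-false⁺ : ∀ {m} (P : Fin m → Bool) → (∀ i → P i ≡ false) → anyF P ≡ false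
anyF-false⁺ {m} P = any-false⁺ P (allFin m)

map-≡ : ∀ {A B : Set} {f g : A → B} {xs : List A} → map f xs ≡ map g xs → ∀ {x} → x ∈ xs → f x ≡ g x
map-≡ {xs = _ ∷ _} eq (here refl) = ListP.∷-injectiveˡ eq
map-≡ {xs = _ ∷ _} eq (there x∈)  = map-≡ (ListP.∷-injectiveʳ eq) x∈

keep : ∀ {P : Set} → Dec P → ℕ → ℕ
keep (yes _) c = c
keep (no _)  c = 0

module Keys (t : ℕ) {n m : ℕ} where

  -- Colours of later sets are erased rather than dropped, so that all keys are indexed by the same
  -- list of sets.
  below : Vec Bool m → ℕ → ℕ
  below h c = keep (code h ℕP.<? t) c

  -- The part of the key that is visible on the `i`-th facet; conditioning on it yields densities
  -- that do not depend on the `i`-th coordinate.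
  keyAt : Family n m → Fin m → Cube n m → List ℕ
  keyAt Q i x = map (λ h → if lookup h i then 0 else below h (col Q h x)) (coordSets m)

  key : Family n m → Cube n m → List ℕ
  key Q x = map (λ h → below h (col Q h x)) (coordSets m)

  below-≡ : ∀ h {c d} → below h c ≡ below h d → code h <ᴺ t → c ≡ d
  below-≡ h eq lt with code h ℕP.<? t
  ... | yes _  = eq
  ... | no ¬lt = ⊥-elim (¬lt lt)

  below-≡⁺ : ∀ h {c d} → (code h <ᴺ t → c ≡ d) → below h c ≡ below h d
  below-≡⁺ h eq with code h ℕP.<? t
  ... | yes lt = eq lt
  ... | no _   = refl

  key-≡ : ∀ Q x y → key Q x ≡ key Q y → ∀ h → code h <ᴺ t → col Q h x ≡ col Q h y
  key-≡ Q x y eq h = below-≡ h (map-≡ eq (∈-coordSets h))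

  key-≡⁺ : ∀ Q Q' x y → (∀ h → code h <ᴺ t → col Q h x ≡ col Q' h y) → key Q x ≡ key Q' y
  key-≡⁺ Q Q' x y eq = ListP.map-cong (λ h → below-≡⁺ h (eq h)) (coordSets m)

  keyAt-≡ : ∀ Q i x y → keyAt Q i x ≡ keyAt Q i y → ∀ h → lookup h i ≡ false → code h <ᴺ t → col Q h x ≡ col Q h y
  keyAt-≡ Q i x y eq h i∉h with lookup h i | map-≡ eq (∈-coordSets h)
  ... | false | e = below-≡ h e

  keyAt-≡⁺ : ∀ Q i x y → (∀ h → lookup h i ≡ false → code h <ᴺ t → col Q h x ≡ col Q h y) → keyAt Q i x ≡ keyAt Q i y
  keyAt-≡⁺ Q i x y eq = ListP.map-cong go (coordSets m)
    where
    go : ∀ h → (if lookup h i then 0 else below h (col Q h x)) ≡ (if lookup h i then 0 else below h (col Q h y))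
    go h with lookup h i in e
    ... | true  = refl
    ... | false = below-≡⁺ h (eq h e)

  keyAt-indep : ∀ Q i → Indep i (keyAt Q i)
  keyAt-indep Q i x a = keyAt-≡⁺ Q i _ _ (λ h i∉h _ → meas Q h i i∉h x a)

  key⇒keyAt : ∀ Q i x y → key Q x ≡ key Q y → keyAt Q i x ≡ keyAt Q i y
  key⇒keyAt Q i x y eq = keyAt-≡⁺ Q i x y (λ h _ lt → key-≡ Q x y eq h lt)

  -- By `fixed`, the colour of the set of code `t`, which is being counted, survives every
  -- refinement of the earlier sets.
  record _≽_ (Q' Q : Family n m) : Set where
    field
      finer : ∀ h → code h <ᴺ t → col Q' h Refines col Q h
      fixed : ∀ h → ¬ (code h <ᴺ t) → ∀ x → col Q' h x ≡ col Q h x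

  open _≽_ public

  ≽-refl : ∀ {Q} → Q ≽ Q
  ≽-refl = record { finer = λ h _ x y e → e ; fixed = λ h _ x → refl }

  ≽-trans : ∀ {Q Q' Q''} → Q'' ≽ Q' → Q' ≽ Q → Q'' ≽ Q
  ≽-trans p q = record { finer = λ h lt x y e → finer q h lt x y (finer p h lt x y e)
                       ; fixed = λ h ge x → trans (fixed p h ge x) (fixed q h ge x) }

  ≽-key : ∀ {Q Q'} → Q' ≽ Q → ∀ x y → key Q' x ≡ key Q' y → key Q x ≡ key Q y
  ≽-key {Q} {Q'} p x y eq = key-≡⁺ Q Q x y (λ h lt → finer p h lt x y (key-≡ Q' x y eq h lt))

  ≽-keyAt : ∀ {Q Q'} → Q' ≽ Q → ∀ i → keyAt Q' i Refines keyAt Q i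
  ≽-keyAt {Q} {Q'} p i x y eq = keyAt-≡⁺ Q i x y (λ h i∉h lt → finer p h lt x y (keyAt-≡ Q' i x y eq h i∉h lt))

  module _ (M : ℕ) (i : Fin m) (a : Fin n) (Q : Family n m) where

    private
      col′ : ∀ h → Bool → Dec (code h <ᴺ t) → Cube n m → ℕ
      col′ h true  _       x = col Q h x
      col′ h false (yes _) x = col Q h x + M * col Q (h [ i ]≔ true) (x [ i ]≔ a)
      col′ h false (no _)  x = col Q h x

    -- An earlier set `h` without `i` absorbs the colour that `h` with `i` added takes on the slice
    -- where the `i`-th coordinate is `a`. Colours are below `M`, so `u + M * v` codes the pair.
    refine : Family n m
    refine = record
      { col  = λ h x → col′ h (lookup h i) (code h ℕP.<? t) x
      ; meas = ms }
      where
      ms : ∀ h j → lookup h j ≡ false → Indep j (λ x → col′ h (lookup h i) (code h ℕP.<? t) x)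
      ms h j j∉h x b with lookup h i in i∉h | code h ℕP.<? t
      ... | true  | _     = meas Q h j j∉h x b
      ... | false | no _  = meas Q h j j∉h x b
      ... | false | yes _ = cong₂ (λ u v → u + M * v) (meas Q h j j∉h x b) upd
        where
        upd : col Q (h [ i ]≔ true) ((x [ j ]≔ b) [ i ]≔ a) ≡ col Q (h [ i ]≔ true) (x [ i ]≔ a)
        upd with i Data.Fin.≟ j
        ... | yes refl = cong (col Q (h [ i ]≔ true)) (VecP.[]≔-idempotent x i)
        ... | no  i≢j  = trans (cong (col Q (h [ i ]≔ true)) (VecP.[]≔-commutes x j i (i≢j ∘ sym)))
                               (meas Q (h [ i ]≔ true) j (trans (VecP.lookup∘update′ (i≢j ∘ sym) h true) j∉h) (x [ i ]≔ a) b)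

    refine-bounded : Bounded Q M → Bounded refine (M * M)
    refine-bounded Q< h x with lookup h i | code h ℕP.<? t
    ... | true  | _     = ℕP.<-≤-trans (Q< h x) (M≤M*M M)
    ... | false | no _  = ℕP.<-≤-trans (Q< h x) (M≤M*M M)
    ... | false | yes _ = pair< (Q< h x) (Q< _ _)

    refine-split : Bounded Q M → ∀ h → lookup h i ≡ false → code h <ᴺ t → ∀ x y → col refine h x ≡ col refine h y →
                   col Q h x ≡ col Q h y × col Q (h [ i ]≔ true) (x [ i ]≔ a) ≡ col Q (h [ i ]≔ true) (y [ i ]≔ a)
    refine-split Q< h i∉h lt x y eq with lookup h i | code h ℕP.<? t
    ... | false | yes _  = pair-injective (Q< h x) (Q< h y) eq
    ... | false | no ¬lt = ⊥-elim (¬lt lt)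

    refine-≽ : Bounded Q M → refine ≽ Q
    refine-≽ Q< = record { finer = fin ; fixed = fix }
      where
      fin : ∀ h → code h <ᴺ t → col refine h Refines col Q h
      fin h lt x y eq with lookup h i | code h ℕP.<? t
      ... | true  | _     = eq
      ... | false | no _  = eq
      ... | false | yes _ = proj₁ (pair-injective (Q< h x) (Q< h y) eq)
      fix : ∀ h → ¬ (code h <ᴺ t) → ∀ x → col refine h x ≡ col Q h x
      fix h ge x with lookup h i | code h ℕP.<? t
      ... | true  | _     = refl
      ... | false | no _  = refl
      ... | false | yes lt = ⊥-elim (ge lt)

    -- Fixing the i-th coordinate to a turns every colour of code < t, and every colour of code t
    -- whose set contains i, into a function of the refined colours of sets avoiding i.
    refine-slice : Bounded Q M → ∀ x y → keyAt refine i x ≡ keyAt refine i y →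
                   ∀ h → (code h <ᴺ t ⊎ (code h ≤ t × lookup h i ≡ true)) → col Q h (x [ i ]≔ a) ≡ col Q h (y [ i ]≔ a)
    refine-slice Q< x y eq h c with lookup h i in e
    ... | false = trans (meas Q h i e x a) (trans (go c) (sym (meas Q h i e y a)))
      where
      go : (code h <ᴺ t ⊎ (code h ≤ t × false ≡ true)) → col Q h x ≡ col Q h y
      go (inj₁ lt) = proj₁ (refine-split Q< h e lt x y (keyAt-≡ refine i x y eq h e lt))
    ... | true  = subst (λ h → col Q h (x [ i ]≔ a) ≡ col Q h (y [ i ]≔ a)) (remove-insert h i e)
                    (proj₂ (refine-split Q< h' e' lt x y (keyAt-≡ refine i x y eq h' e' lt)))
      where
      h' = h [ i ]≔ false
      e' : lookup h' i ≡ false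
      e' = VecP.lookup∘update i h false
      le : (code h <ᴺ t ⊎ (code h ≤ t × true ≡ true)) → code h ≤ t
      le (inj₁ lt)       = ℕP.<⇒≤ lt
      le (inj₂ (le , _)) = le
      lt : code h' <ᴺ t
      lt = ℕP.<-≤-trans (code-remove h i e) (le c)

-- Elementary inequalities and decidable tests

⊗-cancelˡ-≤ : ∀ {a b} c → 1ℚ ≤ℚ c → c ⊗ a ≤ℚ c ⊗ b → a ≤ℚ b
⊗-cancelˡ-≤ c 1≤c le = ℚP.*-cancelˡ-≤-pos c {{ℚ.positive (ℚP.<-≤-trans (ℚP.positive⁻¹ 1ℚ) 1≤c)}} le

2w≤w²+1 : ∀ w → w ⊕ w ≤ℚ w ⊗ w ⊕ 1ℚ
2w≤w²+1 w = ≤ℚ-by ((w ⊖ 1ℚ) ⊗ (w ⊖ 1ℚ)) (0≤sq (w ⊖ 1ℚ))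
  (solve 1 (λ w → w :* w :+ con 1ℚ := w :+ w :+ (w :- con 1ℚ) :* (w :- con 1ℚ)) refl w)

half : ∀ {a b} → a ⊕ a ≤ℚ b ⊕ b → a ≤ℚ b
half {a} {b} le = ⊗-cancelˡ-≤ (1ℚ ⊕ 1ℚ) (≤ℚ-by 1ℚ (0≤ind true) refl)
  (subst₂ _≤ℚ_ (dbl a) (dbl b) le)
  where
  dbl : ∀ a → a ⊕ a ≡ (1ℚ ⊕ 1ℚ) ⊗ a
  dbl = solve 1 (λ a → a :+ a := (con 1ℚ :+ con 1ℚ) :* a) refl

w²≤1⇒w≤1 : ∀ w → w ⊗ w ≤ℚ 1ℚ → w ≤ℚ 1ℚ
w²≤1⇒w≤1 w le = half (ℚP.≤-trans (2w≤w²+1 w) (ℚP.+-monoˡ-≤ 1ℚ le))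

-- Takes the place of the Cauchy-Schwarz inequality: linear errors are bounded by energy without
-- square roots.
w≤w²+1 : ∀ w → w ≤ℚ w ⊗ w ⊕ 1ℚ
w≤w²+1 w = half (ℚP.≤-trans (2w≤w²+1 w) (≤ℚ-by (w ⊗ w ⊕ 1ℚ) (0≤⊕ (0≤sq w) (0≤ind true)) refl))

abstract

  _<ℚᵇ_ : ℚ → ℚ → Bool
  a <ℚᵇ b = isYes (a ℚP.<? b)

  <ℚᵇ-true : ∀ {a b} → (a <ℚᵇ b) ≡ true → a < b
  <ℚᵇ-true {a} {b} eq = toWitness (a ℚP.<? b) eq
    where
    toWitness : ∀ {P : Set} (d : Dec P) → isYes d ≡ true → P
    toWitness (yes p) _ = p

  <ℚᵇ-false : ∀ {a b} → (a <ℚᵇ b) ≡ false → b ≤ℚ a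
  <ℚᵇ-false {a} {b} eq = ℚP.≮⇒≥ (toWitness (a ℚP.<? b) eq)
    where
    toWitness : ∀ {P : Set} (d : Dec P) → isYes d ≡ false → ¬ P
    toWitness (no ¬p) _ = ¬p

≡ᵇ-refl : ∀ k → (k ≡ᵇ k) ≡ true
≡ᵇ-refl zero    = refl
≡ᵇ-refl (suc k) = ≡ᵇ-refl k

≡ᵇ-sound : ∀ {k l} → (k ≡ᵇ l) ≡ true → k ≡ l
≡ᵇ-sound {k} {l} eq = ℕP.≡ᵇ⇒≡ k l (subst T (sym eq) tt)

∈-downFrom : ∀ {k M} → k <ᴺ M → k ∈ downFrom M
∈-downFrom {k} {suc M} (s≤s k≤M) with k ℕP.≟ M
... | yes refl = here refl
... | no  k≢M  = there (∈-downFrom (ℕP.≤∧≢⇒< k≤M k≢M))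

Σ-≡ᵇ-≤1 : ∀ k M → Σℚ (downFrom M) (λ c → ind (k ≡ᵇ c)) ≤ℚ 1ℚ
Σ-≡ᵇ-≤1 k zero    = 0≤ind true
Σ-≡ᵇ-≤1 k (suc M) with k ≡ᵇ M in eq
... | false = subst (_≤ℚ 1ℚ) (sym (ℚP.+-identityˡ _)) (Σ-≡ᵇ-≤1 k M)
... | true  = ℚP.≤-reflexive (trans (cong (1ℚ ⊕_) (go M (ℕP.≤-reflexive (sym (≡ᵇ-sound {k} {M} eq))))) refl)
  where
  go : ∀ L → L ≤ k → Σℚ (downFrom L) (λ c → ind (k ≡ᵇ c)) ≡ 0ℚ
  go zero    _   = refl
  go (suc L) L<k with k ≡ᵇ L in e
  ... | true  = ⊥-elim (ℕP.<-irrefl (sym (≡ᵇ-sound {k} {L} e)) L<k)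
  ... | false = trans (ℚP.+-identityˡ _) (go L (ℕP.<⇒≤ L<k))

ind-any : ∀ {A : Set} (P : A → Bool) xs → ind (any P xs) ≤ℚ Σℚ xs (ind ∘ P)
ind-any P []       = ℚP.≤-refl
ind-any P (x ∷ xs) = ℚP.≤-trans (ind-∨ (P x) (any P xs)) (ℚP.+-monoʳ-≤ (ind (P x)) (ind-any P xs))

ind-<ℚᵇ : ∀ a b → ind (a <ℚᵇ b) ⊗ a ≤ℚ ind (a <ℚᵇ b) ⊗ b
ind-<ℚᵇ a b with a <ℚᵇ b in eq
... | true  = ⊗-monoˡ-≤ (0≤ind true) (ℚP.<⇒≤ (<ℚᵇ-true eq))
... | false = ℚP.≤-reflexive (trans (ℚP.*-zeroˡ a) (sym (ℚP.*-zeroˡ b)))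

Σ-≤const : ∀ {A : Set} (xs : List A) {f : A → ℚ} c → (∀ x → f x ≤ℚ c) → Σℚ xs f ≤ℚ ι (length xs) ⊗ c
Σ-≤const xs c f≤c = ℚP.≤-trans (Σ-mono xs f≤c) (ℚP.≤-reflexive (Σ-const xs c))

-- Energy increment for one set of coordinates

colourTests : ℕ → List (ℕ × Bool)
colourTests M = cartesianProduct (downFrom M) (false ∷ true ∷ [])

module Energy {n m : ℕ} (t : ℕ) (g : Vec Bool m) (code-g : code g ≡ t) (M : ℕ)
              (G : Cube n m → ℕ) (G< : ∀ x → G x <ᴺ suc M) (G-meas : ∀ i → lookup g i ≡ false → Indep i G)
              (B : Fin m → Cube n m → Bool) (B-indep : ∀ i → Indep i (B i)) where

  open Keys t {n} {m} public

  X : Set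
  X = Cube n m

  xs : List X
  xs = cube n m

  N : ℚ
  N = ι (length xs)

  S : (X → ℚ) → ℚ
  S = Σℚ xs

  open CondExp (ListP.≡-dec ℕP._≟_) xs ∈-cube public

  -- For `i` in `g` the colour may vary with the `i`-th coordinate, and the test becomes constant.
  -- Colours range below `suc M`, so the default 0 is always among them.
  χ : Fin m → X → ℕ
  χ i x = if lookup g i then 0 else G x

  χ< : ∀ i x → χ i x <ᴺ suc M
  χ< i x with lookup g i
  ... | true  = s≤s z≤n
  ... | false = G< x

  χ-indep : ∀ i → Indep i (χ i)
  χ-indep i x a with lookup g i in e
  ... | true  = refl
  ... | false = G-meas i e x a

  Test : Set
  Test = Fin m × ℕ × Bool

  -- A colour class for `b = false`, its part inside the exceptional set `B i` for `b = true`. The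
  -- densities of both are needed to see how much of a colour `B i` destroys.
  fᵇ : Test → X → Bool
  fᵇ (i , c , b) x = (χ i x ≡ᵇ c) ∧ (not b ∨ B i x)

  f : Test → X → ℚ
  f τ x = ind (fᵇ τ x)

  f-indep : ∀ τ → Indep (proj₁ τ) (f τ)
  f-indep (i , c , b) x a = cong₂ (λ k β → ind ((k ≡ᵇ c) ∧ (not b ∨ β))) (χ-indep i x a) (B-indep i x a)

  tests : List Test
  tests = cartesianProduct (allFin m) (colourTests (suc M))

  L : ℕ
  L = length tests

  ∈-tests : ∀ {i c b} → c <ᴺ suc M → (i , c , b) ∈ tests
  ∈-tests {i} {c} {b} c< = ∈-cartesianProduct⁺ (∈-allFin i) (∈-cartesianProduct⁺ (∈-downFrom c<) (bool b))
    where
    bool : ∀ b → b ∈ (false ∷ true ∷ [])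
    bool false = here refl
    bool true  = there (here refl)

  P : Family n m → Test → X → ℚ
  P Q τ = ce (keyAt Q (proj₁ τ)) (f τ)

  P-indep : ∀ Q τ → Indep (proj₁ τ) (P Q τ)
  P-indep Q τ x a = cong (ceₖ (keyAt Q (proj₁ τ)) (f τ)) (keyAt-indep Q (proj₁ τ) x a)

  P-key : ∀ Q τ x y → key Q x ≡ key Q y → P Q τ x ≡ P Q τ y
  P-key Q τ x y eq = cong (ceₖ (keyAt Q (proj₁ τ)) (f τ)) (key⇒keyAt Q (proj₁ τ) x y eq)

  P-nonneg : ∀ Q τ x → 0ℚ ≤ℚ P Q τ x
  P-nonneg Q τ = ce-nonneg (keyAt Q (proj₁ τ)) (λ x → 0≤ind (fᵇ τ x))

  en : Family n m → Test → ℚ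
  en Q τ = energy (keyAt Q (proj₁ τ)) (f τ)

  𝓔 : Family n m → ℚ
  𝓔 Q = Σℚ tests (en Q)

  0≤𝓔 : ∀ Q → 0ℚ ≤ℚ 𝓔 Q
  0≤𝓔 Q = Σ-nonneg tests (λ τ → Σ-nonneg xs (λ x → 0≤sq (P Q τ x)))

  𝓔-≤ : ∀ Q → 𝓔 Q ≤ℚ ι L ⊗ N
  𝓔-≤ Q = Σ-≤const tests N (λ τ → ℚP.≤-trans (energy-≤ (keyAt Q (proj₁ τ)) (f τ))
    (ℚP.≤-trans (Σ-≤const xs 1ℚ (λ x → ind-sq (fᵇ τ x))) (ℚP.≤-reflexive (ℚP.*-identityʳ N))))
    where
    ind-sq : ∀ b → ind b ⊗ ind b ≤ℚ 1ℚ
    ind-sq true  = ℚP.≤-refl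
    ind-sq false = 0≤ind true

  increment : ∀ {Q Q'} → Q' ≽ Q → ∀ {τ} → τ ∈ tests → S (λ x → sq (P Q' τ x ⊖ P Q τ x)) ≤ℚ 𝓔 Q' ⊖ 𝓔 Q
  increment {Q} {Q'} r {τ} τ∈ = subst₂ _≤ℚ_ (sym (energy-increment (f τ) (≽-keyAt r (proj₁ τ)))) (Σ-⊖ tests (en Q') (en Q))
    (Σ-∈≤ {f = λ τ → en Q' τ ⊖ en Q τ} (λ τ → 0≤⊖ (energy-mono (f τ) (≽-keyAt r (proj₁ τ)))) τ∈)

  -- Stability under single refinements suffices: a slice of a function of the colours is measurable
  -- for one of them.
  Uniform : ℕ → ℕ → Family n m → Set
  Uniform M' H Q = ∀ i a → ι H ⊗ ι H ⊗ (𝓔 (refine M' i a Q) ⊖ 𝓔 Q) ≤ℚ N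

  module _ {M' H Q} (Q< : Bounded Q M') (unif : Uniform M' H Q) (1≤n : 1 ≤ n) where

    -- Averaging over the value a of the i-th coordinate, on which f and its conditional
    -- expectation do not depend, replaces Φ by functions measurable for the refinement.
    uniform-test : ∀ (σ : ℚ) → σ ⊗ σ ≡ 1ℚ → ∀ {i c b} → c <ᴺ suc M → (Φ : X → Bool) →
      (∀ a x y → keyAt (refine M' i a Q) i x ≡ keyAt (refine M' i a Q) i y → Φ (x [ i ]≔ a) ≡ Φ (y [ i ]≔ a)) →
      ι H ⊗ (σ ⊗ S (λ y → (f (i , c , b) y ⊖ P Q (i , c , b) y) ⊗ ind (Φ y))) ≤ℚ N ⊕ N
    uniform-test σ σ² {i} {c} {b} c< Φ inv = ⊗-cancelˡ-≤ (ι n) (1≤ι 1≤n) (begin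
      ι n ⊗ (ι H ⊗ (σ ⊗ S F))
        ≡⟨ solve 4 (λ n h s f → n :* (h :* (s :* f)) := h :* s :* (n :* f)) refl (ι n) (ι H) σ (S F) ⟩
      ι H ⊗ σ ⊗ (ι n ⊗ S F)
        ≡⟨ cong (ι H ⊗ σ ⊗_) (sym (Σ-average i F)) ⟩
      ι H ⊗ σ ⊗ Σℚ (allFin n) (λ a → S (λ y → F (y [ i ]≔ a)))
        ≡⟨ Σ-⊗ (allFin n) (ι H ⊗ σ) (λ a → S (λ y → F (y [ i ]≔ a))) ⟨
      Σℚ (allFin n) (λ a → ι H ⊗ σ ⊗ S (λ y → F (y [ i ]≔ a)))
        ≤⟨ Σ-≤const (allFin n) (N ⊕ N) slice ⟩
      ι (length (allFin n)) ⊗ (N ⊕ N)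
        ≡⟨ cong (λ l → ι l ⊗ (N ⊕ N)) (ListP.length-tabulate {n = n} id) ⟩
      ι n ⊗ (N ⊕ N) ∎)
      where
      open ℚP.≤-Reasoning
      τ : Test
      τ = i , c , b
      F : X → ℚ
      F y = (f τ y ⊖ P Q τ y) ⊗ ind (Φ y)
      slice : ∀ a → ι H ⊗ σ ⊗ S (λ y → F (y [ i ]≔ a)) ≤ℚ N ⊕ N
      slice a = begin
        ι H ⊗ σ ⊗ S (λ y → F (y [ i ]≔ a))
          ≡⟨ cong (ι H ⊗ σ ⊗_) (Σ-cong xs (λ y → cong (_⊗ φ y) (cong₂ _⊖_ (f-indep τ y a) (P-indep Q τ y a)))) ⟩
        ι H ⊗ σ ⊗ S (λ y → (f τ y ⊖ P Q τ y) ⊗ φ y)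
          ≡⟨ cong (ι H ⊗ σ ⊗_) swap ⟩
        ι H ⊗ σ ⊗ S (λ y → u y ⊗ φ y)
          ≡⟨ Σ-⊗ xs (ι H ⊗ σ) (λ y → u y ⊗ φ y) ⟨
        S (λ y → ι H ⊗ σ ⊗ (u y ⊗ φ y))
          ≤⟨ Σ-mono xs (λ y → pointwise (u y) (Φ (y [ i ]≔ a))) ⟩
        S (λ y → ι H ⊗ ι H ⊗ sq (u y) ⊕ 1ℚ)
          ≡⟨ trans (Σ-⊕ xs (λ y → ι H ⊗ ι H ⊗ sq (u y)) (λ _ → 1ℚ)) (cong₂ _⊕_ (Σ-⊗ xs (ι H ⊗ ι H) (λ y → sq (u y))) (trans (Σ-const xs 1ℚ) (ℚP.*-identityʳ N))) ⟩
        ι H ⊗ ι H ⊗ S (λ y → sq (u y)) ⊕ N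
          ≤⟨ ℚP.+-monoˡ-≤ N (⊗-monoˡ-≤ (0≤⊗ (0≤ι H) (0≤ι H)) (increment (refine-≽ M' i a Q Q<) (∈-tests c<))) ⟩
        ι H ⊗ ι H ⊗ (𝓔 Q'' ⊖ 𝓔 Q) ⊕ N
          ≤⟨ ℚP.+-monoˡ-≤ N (unif i a) ⟩
        N ⊕ N ∎
        where
        Q'' = refine M' i a Q
        φ : X → ℚ
        φ y = ind (Φ (y [ i ]≔ a))
        u : X → ℚ
        u y = P Q'' τ y ⊖ P Q τ y
        ⊖-Σ : ∀ (v w : X → ℚ) → S (λ y → (v y ⊖ w y) ⊗ φ y) ≡ S (λ y → v y ⊗ φ y) ⊖ S (λ y → w y ⊗ φ y)
        ⊖-Σ v w = trans (Σ-cong xs (λ y → solve 3 (λ v w p → (v :- w) :* p := v :* p :- w :* p) refl (v y) (w y) (φ y)))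
                        (Σ-⊖ xs (λ y → v y ⊗ φ y) (λ y → w y ⊗ φ y))
        swap : S (λ y → (f τ y ⊖ P Q τ y) ⊗ φ y) ≡ S (λ y → u y ⊗ φ y)
        swap = trans (⊖-Σ (f τ) (P Q τ)) (trans
          (cong (_⊖ S (λ y → P Q τ y ⊗ φ y)) (ce-orth (keyAt Q'' i) (f τ) (λ x y e → cong ind (inv a x y e))))
          (sym (⊖-Σ (P Q'' τ) (P Q τ))))
        -- The bound w ≤ w² + 1 at w = `H σ u`. The sign `σ` disappears in the square, so one proof
        -- gives the estimate from above and from below.
        pointwise : ∀ u b → ι H ⊗ σ ⊗ (u ⊗ ind b) ≤ℚ ι H ⊗ ι H ⊗ sq u ⊕ 1ℚ
        pointwise u true = subst₂ _≤ℚ_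
          (solve 3 (λ h s u → h :* s :* u := h :* s :* (u :* con 1ℚ)) refl (ι H) σ u)
          (trans (solve 3 (λ h s u → h :* s :* u :* (h :* s :* u) :+ con 1ℚ := (s :* s) :* (h :* h :* (u :* u)) :+ con 1ℚ) refl (ι H) σ u)
                 (cong (_⊕ 1ℚ) (trans (cong (_⊗ (ι H ⊗ ι H ⊗ sq u)) σ²) (ℚP.*-identityˡ (ι H ⊗ ι H ⊗ sq u)))))
          (w≤w²+1 (ι H ⊗ σ ⊗ u))
        pointwise u false = subst (_≤ℚ ι H ⊗ ι H ⊗ sq u ⊕ 1ℚ)
          (solve 3 (λ h s u → con 0ℚ := h :* s :* (u :* con 0ℚ)) refl (ι H) σ u)
          (0≤⊕ (0≤⊗ (0≤⊗ (0≤ι H) (0≤ι H)) (0≤sq u)) (0≤ind true))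

  -- Every refinement squares the number of colours.
  climb : ℕ → ℕ → ℕ
  climb zero    M' = M'
  climb (suc k) M' = climb k (M' * M')

  climb-≥ : ∀ k M' → M' ≤ climb k M'
  climb-≥ zero    M' = ℕP.≤-refl
  climb-≥ (suc k) M' = ℕP.≤-trans (M≤M*M M') (climb-≥ k (M' * M'))

  record Fine (H M' : ℕ) (Q : Family n m) : Set where
    field
      fam     : Family n m
      bound   : ℕ
      bound≤  : bound ≤ M'
      bounded : Bounded fam bound
      finer   : fam ≽ Q
      uniform : Uniform bound H fam

  private
    uniform? : ∀ M' H Q → Uniform M' H Q ⊎ ∃[ i ] ∃[ a ] (N < ι H ⊗ ι H ⊗ (𝓔 (refine M' i a Q) ⊖ 𝓔 Q))
    uniform? M' H Q with FinP.any? (λ i → FinP.any? (λ a → N ℚP.<? (ι H ⊗ ι H ⊗ (𝓔 (refine M' i a Q) ⊖ 𝓔 Q))))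
    ... | yes (i , a , lt) = inj₂ (i , a , lt)
    ... | no  none         = inj₁ (λ i a → ℚP.≮⇒≥ (λ lt → none (i , a , lt)))

  -- A failure of uniformity raises the energy by more than N / H², and the energy never exceeds L
  -- N. `room` says that at most `k` further failures are possible.
  fine : ∀ k H M' Q → Bounded Q M' → ι H ⊗ ι H ⊗ (ι L ⊗ N ⊖ 𝓔 Q) ≤ℚ ι k ⊗ N → Fine H (climb k M') Q
  fine k H M' Q Q< room with uniform? M' H Q
  ... | inj₁ u = record { fam = Q ; bound = M' ; bound≤ = climb-≥ k M' ; bounded = Q< ; finer = ≽-refl ; uniform = u }
  fine zero H M' Q Q< room | inj₂ (i , a , lt) = ⊥-elim (ℚP.<-irrefl refl (ℚP.<-≤-trans lt (begin
    ι H ⊗ ι H ⊗ (𝓔 (refine M' i a Q) ⊖ 𝓔 Q)  ≤⟨ ⊗-monoˡ-≤ (0≤⊗ (0≤ι H) (0≤ι H)) (ℚP.+-monoˡ-≤ (ℚ.- 𝓔 Q) (𝓔-≤ (refine M' i a Q))) ⟩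
    ι H ⊗ ι H ⊗ (ι L ⊗ N ⊖ 𝓔 Q)              ≤⟨ room ⟩
    ι 0 ⊗ N                                   ≡⟨ trans (cong (_⊗ N) ι-0) (ℚP.*-zeroˡ N) ⟩
    0ℚ                                        ≤⟨ 0≤ι (length xs) ⟩
    N                                         ∎)))
    where open ℚP.≤-Reasoning
  fine (suc k) H M' Q Q< room | inj₂ (i , a , lt) = record
    { fam = Fine.fam r ; bound = Fine.bound r ; bound≤ = Fine.bound≤ r ; bounded = Fine.bounded r
    ; finer = ≽-trans (Fine.finer r) (refine-≽ M' i a Q Q<) ; uniform = Fine.uniform r }
    where
    Q₁ = refine M' i a Q
    room₁ : ι H ⊗ ι H ⊗ (ι L ⊗ N ⊖ 𝓔 Q₁) ≤ℚ ι k ⊗ N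
    room₁ = ≤ℚ-by (ι (suc k) ⊗ N ⊖ ι H ⊗ ι H ⊗ (ι L ⊗ N ⊖ 𝓔 Q) ⊕ (ι H ⊗ ι H ⊗ (𝓔 Q₁ ⊖ 𝓔 Q) ⊖ N))
      (0≤⊕ (0≤⊖ room) (0≤⊖ (ℚP.<⇒≤ lt)))
      (trans (solve 6 (λ k n h l e e₁ → k :* n := h :* h :* (l :* n :- e₁) :+ ((con 1ℚ :+ k) :* n :- h :* h :* (l :* n :- e) :+ (h :* h :* (e₁ :- e) :- n)))
               refl (ι k) N (ι H) (ι L) (𝓔 Q) (𝓔 Q₁))
             (cong (λ s → ι H ⊗ ι H ⊗ (ι L ⊗ N ⊖ 𝓔 Q₁) ⊕ (s ⊗ N ⊖ ι H ⊗ ι H ⊗ (ι L ⊗ N ⊖ 𝓔 Q) ⊕ (ι H ⊗ ι H ⊗ (𝓔 Q₁ ⊖ 𝓔 Q) ⊖ N))) (sym (ι-suc k))))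
    r = fine k H (M' * M') Q₁ (refine-bounded M' i a Q Q<) room₁

-- Numerical core of the counting step

module _ (m t c s A N σ : ℚ) (1≤m : 1ℚ ≤ℚ m) (1≤t : 1ℚ ≤ℚ t) (1≤c : 1ℚ ≤ℚ c) (A≥0 : 0ℚ ≤ℚ A) (N≥0 : 0ℚ ≤ℚ N) where

  private
    0≤1 = 0≤ind true
    m≥0 = ℚP.≤-trans 0≤1 1≤m
    t≥0 = ℚP.≤-trans 0≤1 1≤t
    c≥0 = ℚP.≤-trans 0≤1 1≤c
    lit≥0 : ∀ k → 0ℚ ≤ℚ ℕ→ℚ k
    lit≥0 k = subst (0ℚ ≤ℚ_) (ι≡ℕ→ℚ k) (0≤ι k)
    1≤lit : ∀ k → 1ℚ ≤ℚ ℕ→ℚ (suc k)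
    1≤lit k = subst (1ℚ ≤ℚ_) (ι≡ℕ→ℚ (suc k)) (1≤ι (s≤s z≤n))
    1≤⊗ : ∀ {a b} → 1ℚ ≤ℚ a → 1ℚ ≤ℚ b → 1ℚ ≤ℚ a ⊗ b
    1≤⊗ 1≤a 1≤b = ⊗-mono-≤ (ℚP.≤-trans 0≤1 1≤a) 0≤1 1≤a 1≤b
    Ξ = ℕ→ℚ 16 ⊗ m ⊗ t
    H = ℕ→ℚ 40 ⊗ m ⊗ t ⊗ c

  -- `A` counts the points supplied by the induction hypothesis, `s` those that also have the right
  -- colour, `σ` bounds the part of the latter in exceptional sets. With Ξ = 16 m t, H = 40 m t c
  -- and N ≤ c A, the errors A / Ξ and 2 N / H are at most A / (16 m t) and A / (20 m t). So 71 A ≤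
  -- 80 t s and 160 t σ ≤ 80 t s + 27 A, which leaves 44 A ≤ 160 t (s - σ); and 160 / 44 is less
  -- than 8.
  counting-arithmetic : H ⊗ Ξ ⊗ A ≤ℚ t ⊗ (H ⊗ Ξ ⊗ s ⊕ (ℕ→ℚ 2 ⊗ Ξ ⊗ N ⊕ H ⊗ A)) →
    ℕ→ℚ 2 ⊗ H ⊗ Ξ ⊗ σ ≤ℚ H ⊗ Ξ ⊗ s ⊕ (ℕ→ℚ 3 ⊗ m ⊗ H ⊗ A ⊕ ℕ→ℚ 6 ⊗ m ⊗ Ξ ⊗ N) →
    N ≤ℚ c ⊗ A → N ≤ℚ ℕ→ℚ 8 ⊗ t ⊗ c ⊗ (s ⊖ σ)
  counting-arithmetic III sum N≤cA =
    ⊗-cancelˡ-≤ (ℕ→ℚ 160) (1≤lit 159) (ℚP.≤-trans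
      (≤ℚ-by (ℕ→ℚ 192 ⊗ N) (0≤⊗ (lit≥0 192) N≥0) (solve 1 (λ n → con (ℕ→ℚ 352) :* n := con (ℕ→ℚ 160) :* n :+ con (ℕ→ℚ 192) :* n) refl N))
      (ℚP.≤-trans (⊗-monoˡ-≤ (lit≥0 352) N≤cA) (ℚP.≤-trans
        (ℚP.≤-reflexive (solve 2 (λ c a → con (ℕ→ℚ 352) :* (c :* a) := con (ℕ→ℚ 8) :* c :* (con (ℕ→ℚ 44) :* a)) refl c A))
        (ℚP.≤-trans (⊗-monoˡ-≤ (0≤⊗ (lit≥0 8) c≥0) gap)
          (ℚP.≤-reflexive (solve 4 (λ t c s σ → con (ℕ→ℚ 8) :* c :* (con (ℕ→ℚ 160) :* t :* (s :- σ)) := con (ℕ→ℚ 160) :* (con (ℕ→ℚ 8) :* t :* c :* (s :- σ))) refl t c s σ))))))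
    where
    lower₁ : ℕ→ℚ 80 ⊗ m ⊗ c ⊗ A ≤ℚ ℕ→ℚ 80 ⊗ m ⊗ t ⊗ c ⊗ s ⊕ ℕ→ℚ 4 ⊗ N ⊕ ℕ→ℚ 5 ⊗ c ⊗ A
    lower₁ = ⊗-cancelˡ-≤ (ℕ→ℚ 8 ⊗ m ⊗ (t ⊗ t)) (1≤⊗ (1≤⊗ (1≤lit 7) 1≤m) (1≤⊗ 1≤t 1≤t)) (subst₂ _≤ℚ_
      (solve 4 (λ m t c a → con (ℕ→ℚ 40) :* m :* t :* c :* (con (ℕ→ℚ 16) :* m :* t) :* a := con (ℕ→ℚ 8) :* m :* (t :* t) :* (con (ℕ→ℚ 80) :* m :* c :* a)) refl m t c A)
      (solve 6 (λ m t c a s n → t :* (con (ℕ→ℚ 40) :* m :* t :* c :* (con (ℕ→ℚ 16) :* m :* t) :* s :+ (con (ℕ→ℚ 2) :* (con (ℕ→ℚ 16) :* m :* t) :* n :+ con (ℕ→ℚ 40) :* m :* t :* c :* a))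
        := con (ℕ→ℚ 8) :* m :* (t :* t) :* (con (ℕ→ℚ 80) :* m :* t :* c :* s :+ con (ℕ→ℚ 4) :* n :+ con (ℕ→ℚ 5) :* c :* a)) refl m t c A s N)
      III)
    lower₂ : ℕ→ℚ 71 ⊗ A ≤ℚ ℕ→ℚ 80 ⊗ t ⊗ s
    lower₂ = ⊗-cancelˡ-≤ (m ⊗ c) (1≤⊗ 1≤m 1≤c) (≤ℚ-by
      (ℕ→ℚ 80 ⊗ m ⊗ t ⊗ c ⊗ s ⊕ ℕ→ℚ 4 ⊗ N ⊕ ℕ→ℚ 5 ⊗ c ⊗ A ⊖ ℕ→ℚ 80 ⊗ m ⊗ c ⊗ A ⊕ (ℕ→ℚ 4 ⊗ (c ⊗ A ⊖ N) ⊕ ℕ→ℚ 9 ⊗ ((m ⊖ 1ℚ) ⊗ (c ⊗ A))))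
      (0≤⊕ (0≤⊖ lower₁) (0≤⊕ (0≤⊗ (lit≥0 4) (0≤⊖ N≤cA)) (0≤⊗ (lit≥0 9) (0≤⊗ (0≤⊖ 1≤m) (0≤⊗ c≥0 A≥0)))))
      (solve 6 (λ m t c a s n → m :* c :* (con (ℕ→ℚ 80) :* t :* s) := m :* c :* (con (ℕ→ℚ 71) :* a) :+
        (con (ℕ→ℚ 80) :* m :* t :* c :* s :+ con (ℕ→ℚ 4) :* n :+ con (ℕ→ℚ 5) :* c :* a :- con (ℕ→ℚ 80) :* m :* c :* a :+
          (con (ℕ→ℚ 4) :* (c :* a :- n) :+ con (ℕ→ℚ 9) :* ((m :- con 1ℚ) :* (c :* a))))) refl m t c A s N))
    upper : ℕ→ℚ 160 ⊗ t ⊗ σ ≤ℚ ℕ→ℚ 80 ⊗ t ⊗ s ⊕ ℕ→ℚ 27 ⊗ A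
    upper = ⊗-cancelˡ-≤ (ℕ→ℚ 8 ⊗ (m ⊗ m) ⊗ (t ⊗ c)) (1≤⊗ (1≤⊗ (1≤lit 7) (1≤⊗ 1≤m 1≤m)) (1≤⊗ 1≤t 1≤c)) (≤ℚ-by
      (H ⊗ Ξ ⊗ s ⊕ (ℕ→ℚ 3 ⊗ m ⊗ H ⊗ A ⊕ ℕ→ℚ 6 ⊗ m ⊗ Ξ ⊗ N) ⊖ ℕ→ℚ 2 ⊗ H ⊗ Ξ ⊗ σ ⊕ ℕ→ℚ 96 ⊗ (m ⊗ m) ⊗ t ⊗ (c ⊗ A ⊖ N))
      (0≤⊕ (0≤⊖ sum) (0≤⊗ (0≤⊗ (0≤⊗ (lit≥0 96) (0≤⊗ m≥0 m≥0)) t≥0) (0≤⊖ N≤cA)))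
      (solve 7 (λ m t c a s n σ → con (ℕ→ℚ 8) :* (m :* m) :* (t :* c) :* (con (ℕ→ℚ 80) :* t :* s :+ con (ℕ→ℚ 27) :* a) :=
        con (ℕ→ℚ 8) :* (m :* m) :* (t :* c) :* (con (ℕ→ℚ 160) :* t :* σ) :+
        (con (ℕ→ℚ 40) :* m :* t :* c :* (con (ℕ→ℚ 16) :* m :* t) :* s :+ (con (ℕ→ℚ 3) :* m :* (con (ℕ→ℚ 40) :* m :* t :* c) :* a :+ con (ℕ→ℚ 6) :* m :* (con (ℕ→ℚ 16) :* m :* t) :* n)
          :- con (ℕ→ℚ 2) :* (con (ℕ→ℚ 40) :* m :* t :* c) :* (con (ℕ→ℚ 16) :* m :* t) :* σ :+ con (ℕ→ℚ 96) :* (m :* m) :* t :* (c :* a :- n))) refl m t c A s N σ))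
    gap : ℕ→ℚ 44 ⊗ A ≤ℚ ℕ→ℚ 160 ⊗ t ⊗ (s ⊖ σ)
    gap = ≤ℚ-by (ℕ→ℚ 80 ⊗ t ⊗ s ⊕ ℕ→ℚ 27 ⊗ A ⊖ ℕ→ℚ 160 ⊗ t ⊗ σ ⊕ (ℕ→ℚ 80 ⊗ t ⊗ s ⊖ ℕ→ℚ 71 ⊗ A))
      (0≤⊕ (0≤⊖ upper) (0≤⊖ lower₂))
      (solve 4 (λ t a s σ → con (ℕ→ℚ 160) :* t :* (s :- σ) := con (ℕ→ℚ 44) :* a :+
        (con (ℕ→ℚ 80) :* t :* s :+ con (ℕ→ℚ 27) :* a :- con (ℕ→ℚ 160) :* t :* σ :+ (con (ℕ→ℚ 80) :* t :* s :- con (ℕ→ℚ 71) :* a))) refl t A s σ)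

Σ-≤const-∈ : ∀ {A : Set} (xs : List A) {f : A → ℚ} c → (∀ {x} → x ∈ xs → f x ≤ℚ c) → Σℚ xs f ≤ℚ ι (length xs) ⊗ c
Σ-≤const-∈ []       {f} c f≤c = ℚP.≤-reflexive (sym (trans (cong (_⊗ c) ι-0) (ℚP.*-zeroˡ c)))
Σ-≤const-∈ (x ∷ xs) {f} c f≤c = subst (f x ⊕ Σℚ xs f ≤ℚ_)
  (trans (solve 2 (λ c l → c :+ l :* c := (con 1ℚ :+ l) :* c) refl c (ι (length xs))) (cong (_⊗ c) (sym (ι-suc (length xs)))))
  (ℚP.+-mono-≤ (f≤c (here refl)) (Σ-≤const-∈ xs c (f≤c ∘ there)))

∧-true : ∀ {a b} → a ∧ b ≡ true → a ≡ true × b ≡ true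
∧-true {true} {true} _ = refl , refl

∨-false : ∀ {a b} → a ∨ b ≡ false → a ≡ false × b ≡ false
∨-false {false} {false} _ = refl , refl

not-true : ∀ {b} → not b ≡ true → b ≡ false
not-true {false} _ = refl

isYes-true : ∀ {P : Set} (d : Dec P) → isYes d ≡ true → P
isYes-true (yes p) _ = p

isYes-true⁺ : ∀ {P : Set} (d : Dec P) → P → isYes d ≡ true
isYes-true⁺ (yes _) _ = refl
isYes-true⁺ (no ¬p) p = ⊥-elim (¬p p)

isYes-cong : ∀ {P P' : Set} (d : Dec P) (d' : Dec P') → (P → P') → (P' → P) → isYes d ≡ isYes d'
isYes-cong (yes _) (yes _)  _ _ = refl
isYes-cong (no _)  (no _)   _ _ = refl
isYes-cong (yes p) (no ¬p') f _ = ⊥-elim (¬p' (f p))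
isYes-cong (no ¬p) (yes p') _ g = ⊥-elim (¬p (g p'))

-- The counting statement and its constants

abstract

  matches : ∀ {n m} → ℕ → Family n m → Cube n m → Cube n m → Bool
  matches t Q x y = isYes (ListP.≡-dec ℕP._≟_ (Keys.key t Q x) (Keys.key t Q y))

  matches-sound : ∀ {n m} t (Q : Family n m) x y → matches t Q x y ≡ true → Keys.key t Q x ≡ Keys.key t Q y
  matches-sound t Q x y = isYes-true (ListP.≡-dec ℕP._≟_ (Keys.key t Q x) (Keys.key t Q y))

  matches-complete : ∀ {n m} t (Q : Family n m) x y → Keys.key t Q x ≡ Keys.key t Q y → matches t Q x y ≡ true
  matches-complete t Q x y = isYes-true⁺ (ListP.≡-dec ℕP._≟_ (Keys.key t Q x) (Keys.key t Q y))

  matches-cong : ∀ {n m} t (Q : Family n m) x {y y'} → Keys.key t Q y ≡ Keys.key t Q y' → matches t Q x y ≡ matches t Q x y'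
  matches-cong t Q x {y} {y'} e = isYes-cong (ListP.≡-dec ℕP._≟_ (Keys.key t Q x) (Keys.key t Q y))
    (ListP.≡-dec ℕP._≟_ (Keys.key t Q x) (Keys.key t Q y')) (λ p → trans p e) (λ p → trans p (sym e))

  avoids : ∀ {n m} → (Fin m → Cube n m → Bool) → Cube n m → Bool
  avoids B y = not (anyF (λ i → B i y))

  avoids-sound : ∀ {n m} (B : Fin m → Cube n m → Bool) y → avoids B y ≡ true → ∀ i → B i y ≡ false
  avoids-sound B y e = anyF-false (λ i → B i y) (not-true e)

  avoids-cong : ∀ {n m} (B : Fin m → Cube n m → Bool) {y y'} → (∀ i → B i y ≡ B i y') → avoids B y ≡ avoids B y'
  avoids-cong {m = m} B e = cong not (any-cong (allFin m) e)

  avoids-union : ∀ {n m} (B : Fin m → Cube n m → Bool) y → 1ℚ ≤ℚ ind (avoids B y) ⊕ Σℚ (allFin m) (λ i → ind (B i y))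
  avoids-union {m = m} B y with anyF (λ i → B i y) in e
  ... | false = ≤ℚ-by (Σℚ (allFin m) (λ i → ind (B i y))) (Σ-nonneg (allFin m) (λ i → 0≤ind (B i y))) refl
  ... | true  = ℚP.≤-trans (subst (λ b → ind b ≤ℚ Σℚ (allFin m) (λ i → ind (B i y))) e (ind-any (λ i → B i y) (allFin m)))
                  (ℚP.≤-reflexive (sym (ℚP.+-identityˡ _)))

-- Atypical points are again covered by facet sets: few of them then meet a set with sparse fibres,
-- which is how the removal lemma finds a typical point.
Conclusion : ∀ {n m} → ℕ → ℕ → ℕ → Family n m → (Fin m → Cube n m → Bool) → Set
Conclusion {n} {m} t z ĉ Q B =
  Σ (Fin m → Cube n m → Bool) λ Bad → (∀ i → Indep i (Bad i)) × (∀ i → z * cnt (cube n m) (Bad i) ≤ length (cube n m)) ×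
    (∀ x → (∀ i → Bad i x ≡ false) →
      length (cube n m) ≤ ĉ * cnt (cube n m) (λ y → matches t Q x y ∧ avoids B y))

abstract

  -- Its reciprocal is the least density tolerated for a point's own colour. The `suc M` colours
  -- together make at most N / (4 (z + 1)) points thinner than that.
  thickness : ℕ → ℕ → ℕ
  thickness z M = 4 * suc z * suc M

  -- Its reciprocal bounds the gap between coarse and fine densities, that of `resolution` the scale
  -- of the error in `uniform-test`. The factors 16 and 40 are those of `counting-arithmetic`.
  sharpness : ℕ → ℕ → ℕ
  sharpness m t̂ = 16 * m * t̂

  resolution : ℕ → ℕ → ℕ → ℕ
  resolution m t̂ ĉ = 40 * m * t̂ * ĉ

  loss : ℕ → ℕ → ℕ
  loss t̂ ĉ = 8 * t̂ * ĉ

  -- The product of 2 m, the factor lost in `mixed-count`, and 4 (z + 1), the share of the cube left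
  -- to mixed points. The number of colours does not enter.
  tolerance : ℕ → ℕ → ℕ
  tolerance m z = 8 * m * suc z

  1≤thickness : ∀ z M → 1 ≤ thickness z M
  1≤thickness z M = s≤s z≤n

  ι-thickness : ∀ z M → ι (thickness z M) ≡ ℕ→ℚ 4 ⊗ ι (suc z) ⊗ ι (suc M)
  ι-thickness z M = trans (ι-* (4 * suc z) (suc M)) (cong (_⊗ ι (suc M)) (trans (ι-* 4 (suc z)) (cong (_⊗ ι (suc z)) (ι≡ℕ→ℚ 4))))

  ι-sharpness : ∀ m t̂ → ι (sharpness m t̂) ≡ ℕ→ℚ 16 ⊗ ι m ⊗ ι t̂
  ι-sharpness m t̂ = trans (ι-* (16 * m) t̂) (cong (_⊗ ι t̂) (trans (ι-* 16 m) (cong (_⊗ ι m) (ι≡ℕ→ℚ 16))))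

  ι-resolution : ∀ m t̂ ĉ → ι (resolution m t̂ ĉ) ≡ ℕ→ℚ 40 ⊗ ι m ⊗ ι t̂ ⊗ ι ĉ
  ι-resolution m t̂ ĉ = trans (ι-* (40 * m * t̂) ĉ) (cong (_⊗ ι ĉ) (trans (ι-* (40 * m) t̂) (cong (_⊗ ι t̂) (trans (ι-* 40 m) (cong (_⊗ ι m) (ι≡ℕ→ℚ 40))))))

  ι-loss : ∀ t̂ ĉ → ι (loss t̂ ĉ) ≡ ℕ→ℚ 8 ⊗ ι t̂ ⊗ ι ĉ
  ι-loss t̂ ĉ = trans (ι-* (8 * t̂) ĉ) (cong (_⊗ ι ĉ) (trans (ι-* 8 t̂) (cong (_⊗ ι t̂) (ι≡ℕ→ℚ 8))))

  ι-tolerance : ∀ m z → ι (tolerance m z) ≡ ℕ→ℚ 8 ⊗ ι m ⊗ ι (suc z)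
  ι-tolerance m z = trans (ι-* (8 * m) (suc z)) (cong (_⊗ ι (suc z)) (trans (ι-* 8 m) (cong (_⊗ ι m) (ι≡ℕ→ℚ 8))))

-- Counting one further colour

module Step {n m : ℕ} (t : ℕ) (g : Vec Bool m) (code-g : code g ≡ t) (i₀ : Fin m) (i₀∉g : lookup g i₀ ≡ false) (M : ℕ)
            (G : Cube n m → ℕ) (G< : ∀ x → G x <ᴺ suc M) (G-meas : ∀ i → lookup g i ≡ false → Indep i G)
            (B : Fin m → Cube n m → Bool) (B-indep : ∀ i → Indep i (B i)) (z : ℕ) where

  open Energy t g code-g M G G< G-meas B B-indep public

  t̂ Ξ : ℕ
  t̂ = thickness z M
  Ξ = sharpness m t̂

  module Coarse (Q : Family n m) where

    p q : Fin m → X → ℚ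
    p i x = P Q (i , χ i x , false) x
    q i x = P Q (i , χ i x , true) x

    -- At a thin point its own colour is rare given the earlier colours of the facet. At a mixed
    -- point more than 1 / (2 m) of that colour lies in `B i`; without mixed facets, all `m`
    -- exceptional sets together destroy about half of it.
    thin mixed : Fin m → X → Bool
    thin  i x = (ι t̂ ⊗ p i x) <ℚᵇ 1ℚ
    mixed i x = p i x <ℚᵇ (ι (2 * m) ⊗ q i x)

    p-indep : ∀ b i → Indep i (λ x → P Q (i , χ i x , b) x)
    p-indep b i x a = trans (cong (λ c → P Q (i , c , b) (x [ i ]≔ a)) (χ-indep i x a)) (P-indep Q (i , χ i x , b) x a)

    thin-indep : ∀ i → Indep i (thin i)
    thin-indep i x a = cong (λ u → (ι t̂ ⊗ u) <ℚᵇ 1ℚ) (p-indep false i x a)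

    mixed-indep : ∀ i → Indep i (mixed i)
    mixed-indep i x a = cong₂ (λ u v → u <ℚᵇ (ι (2 * m) ⊗ v)) (p-indep false i x a) (p-indep true i x a)

    private
      colours = downFrom (suc M)

      select : ∀ i x (h : ℕ → Bool) → ind (h (χ i x)) ≤ℚ Σℚ colours (λ c → f (i , c , false) x ⊗ ind (h c))
      select i x h = ℚP.≤-trans (ℚP.≤-reflexive here-term)
        (Σ-∈≤ {f = λ c → f (i , c , false) x ⊗ ind (h c)} (λ c → 0≤⊗ (0≤ind (fᵇ (i , c , false) x)) (0≤ind (h c))) (∈-downFrom (χ< i x)))
        where
        here-term : ind (h (χ i x)) ≡ f (i , χ i x , false) x ⊗ ind (h (χ i x))
        here-term rewrite ≡ᵇ-refl (χ i x) = sym (ℚP.*-identityˡ (ind (h (χ i x))))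

      -- The property is tested at the colour of the point itself. Summing over all colours, each
      -- weighted by its own indicator, allows the indicator to be replaced by its density, since
      -- `h c` is a function of the key.
      bySelect : ∀ i (h : ℕ → X → Bool) → (∀ c x y → keyAt Q i x ≡ keyAt Q i y → h c x ≡ h c y) →
        S (λ x → ind (h (χ i x) x)) ≤ℚ Σℚ colours (λ c → S (λ x → P Q (i , c , false) x ⊗ ind (h c x)))
      bySelect i h inv = ℚP.≤-trans (Σ-mono xs (λ x → select i x (λ c → h c x))) (ℚP.≤-reflexive
        (trans (Σ-swap xs colours (λ x c → f (i , c , false) x ⊗ ind (h c x)))
               (Σ-cong colours (λ c → ce-orth (keyAt Q i) (f (i , c , false)) (λ x y e → cong ind (inv c x y e))))))

      P-keyAt : ∀ i c b x y → keyAt Q i x ≡ keyAt Q i y → P Q (i , c , b) x ≡ P Q (i , c , b) y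
      P-keyAt i c b x y e = cong (ceₖ (keyAt Q i) (f (i , c , b))) e

    -- Each colour contributes at most N / t̂: where `h c` holds, its density is below 1 / t̂.
    thin-count : ∀ i → ι t̂ ⊗ S (ind ∘ thin i) ≤ℚ ι (suc M) ⊗ N
    thin-count i = begin
      ι t̂ ⊗ S (ind ∘ thin i)
        ≤⟨ ⊗-monoˡ-≤ (0≤ι t̂) (bySelect i h (λ c x y e → cong (λ u → (ι t̂ ⊗ u) <ℚᵇ 1ℚ) (P-keyAt i c false x y e))) ⟩
      ι t̂ ⊗ Σℚ colours (λ c → S (λ x → P Q (i , c , false) x ⊗ ind (h c x)))
        ≡⟨ Σ-⊗ colours (ι t̂) (λ c → S (λ x → P Q (i , c , false) x ⊗ ind (h c x))) ⟨
      Σℚ colours (λ c → ι t̂ ⊗ S (λ x → P Q (i , c , false) x ⊗ ind (h c x)))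
        ≤⟨ Σ-≤const colours N (λ c → ℚP.≤-trans (ℚP.≤-reflexive (sym (Σ-⊗ xs (ι t̂) (λ x → P Q (i , c , false) x ⊗ ind (h c x)))))
             (ℚP.≤-trans (Σ-≤const xs 1ℚ (λ x → bound (P Q (i , c , false) x))) (ℚP.≤-reflexive (ℚP.*-identityʳ N)))) ⟩
      ι (length colours) ⊗ N
        ≡⟨ cong (λ l → ι l ⊗ N) (ListP.length-downFrom (suc M)) ⟩
      ι (suc M) ⊗ N ∎
      where
      open ℚP.≤-Reasoning
      h : ℕ → X → Bool
      h c x = (ι t̂ ⊗ P Q (i , c , false) x) <ℚᵇ 1ℚ
      bound : ∀ u → ι t̂ ⊗ (u ⊗ ind ((ι t̂ ⊗ u) <ℚᵇ 1ℚ)) ≤ℚ 1ℚ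
      bound u = ℚP.≤-trans (ℚP.≤-reflexive (solve 3 (λ t u i → t :* (u :* i) := i :* (t :* u)) refl (ι t̂) u (ind ((ι t̂ ⊗ u) <ℚᵇ 1ℚ))))
        (ℚP.≤-trans (ind-<ℚᵇ (ι t̂ ⊗ u) 1ℚ) (ℚP.≤-trans (ℚP.≤-reflexive (ℚP.*-identityʳ _)) (ind≤1 ((ι t̂ ⊗ u) <ℚᵇ 1ℚ))))

    -- Where the test holds, the density of the colour is below 2 m times that of its part in `B i`;
    -- these parts are disjoint for different colours.
    mixed-count : ∀ i → S (ind ∘ mixed i) ≤ℚ ι (2 * m) ⊗ S (ind ∘ B i)
    mixed-count i = begin
      S (ind ∘ mixed i)
        ≤⟨ bySelect i h (λ c x y e → cong₂ (λ u v → u <ℚᵇ (ι (2 * m) ⊗ v)) (P-keyAt i c false x y e) (P-keyAt i c true x y e)) ⟩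
      Σℚ colours (λ c → S (λ x → P Q (i , c , false) x ⊗ ind (h c x)))
        ≤⟨ Σ-mono colours (λ c → Σ-mono xs (λ x → bound c x)) ⟩
      Σℚ colours (λ c → S (λ x → ι (2 * m) ⊗ (P Q (i , c , true) x ⊗ 1ℚ)))
        ≡⟨ Σ-cong colours (λ c → trans (Σ-⊗ xs (ι (2 * m)) (λ x → P Q (i , c , true) x ⊗ 1ℚ))
             (cong (ι (2 * m) ⊗_) (sym (ce-orth (keyAt Q i) (f (i , c , true)) (λ _ _ _ → refl))))) ⟩
      Σℚ colours (λ c → ι (2 * m) ⊗ S (λ x → f (i , c , true) x ⊗ 1ℚ))
        ≡⟨ Σ-⊗ colours (ι (2 * m)) (λ c → S (λ x → f (i , c , true) x ⊗ 1ℚ)) ⟩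
      ι (2 * m) ⊗ Σℚ colours (λ c → S (λ x → f (i , c , true) x ⊗ 1ℚ))
        ≡⟨ cong (ι (2 * m) ⊗_) (Σ-swap colours xs (λ c x → f (i , c , true) x ⊗ 1ℚ)) ⟩
      ι (2 * m) ⊗ S (λ x → Σℚ colours (λ c → f (i , c , true) x ⊗ 1ℚ))
        ≤⟨ ⊗-monoˡ-≤ (0≤ι (2 * m)) (Σ-mono xs total) ⟩
      ι (2 * m) ⊗ S (ind ∘ B i) ∎
      where
      open ℚP.≤-Reasoning
      h : ℕ → X → Bool
      h c x = P Q (i , c , false) x <ℚᵇ (ι (2 * m) ⊗ P Q (i , c , true) x)
      bound : ∀ c x → P Q (i , c , false) x ⊗ ind (h c x) ≤ℚ ι (2 * m) ⊗ (P Q (i , c , true) x ⊗ 1ℚ)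
      bound c x = ℚP.≤-trans (ℚP.≤-reflexive (ℚP.*-comm (P Q (i , c , false) x) (ind (h c x))))
        (ℚP.≤-trans (ind-<ℚᵇ (P Q (i , c , false) x) (ι (2 * m) ⊗ P Q (i , c , true) x))
          (ℚP.≤-trans (⊗-mono-≤ (0≤ind true) (0≤⊗ (0≤ι (2 * m)) (P-nonneg Q (i , c , true) x)) (ind≤1 (h c x)) ℚP.≤-refl)
            (ℚP.≤-reflexive (solve 2 (λ a b → con 1ℚ :* (a :* b) := a :* (b :* con 1ℚ)) refl (ι (2 * m)) (P Q (i , c , true) x)))))
      total : ∀ x → Σℚ colours (λ c → f (i , c , true) x ⊗ 1ℚ) ≤ℚ ind (B i x)
      total x = ℚP.≤-trans (ℚP.≤-reflexive (trans (Σ-cong colours (λ c → split (χ i x ≡ᵇ c)))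
                  (Σ-⊗ colours (ind (B i x)) (λ c → ind (χ i x ≡ᵇ c)))))
        (ℚP.≤-trans (⊗-monoˡ-≤ (0≤ind (B i x)) (Σ-≡ᵇ-≤1 (χ i x) (suc M))) (ℚP.≤-reflexive (ℚP.*-identityʳ (ind (B i x)))))
        where
        split : ∀ b → ind (b ∧ B i x) ⊗ 1ℚ ≡ ind (B i x) ⊗ ind b
        split true  = refl
        split false = trans (ℚP.*-zeroˡ 1ℚ) (sym (ℚP.*-zeroʳ (ind (B i x))))

  module Pair (Q Q' : Family n m) (r : Q' ≽ Q) where

    far : Test → X → Bool
    far τ y = 1ℚ <ℚᵇ (ι (Ξ * Ξ) ⊗ sq (P Q' τ y ⊖ P Q τ y))

    -- Some density on the facet differs by more than 1 / Ξ between `Q` and `Q'`. Being facet sets,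
    -- these can be given to the induction hypothesis as its exceptional sets.
    B′ : Fin m → X → Bool
    B′ i y = any (λ cb → far (i , cb) y) (colourTests (suc M))

    B′-indep : ∀ i → Indep i (B′ i)
    B′-indep i y a = any-cong (colourTests (suc M)) (λ cb →
      cong₂ (λ u v → 1ℚ <ℚᵇ (ι (Ξ * Ξ) ⊗ sq (u ⊖ v))) (P-indep Q' (i , cb) y a) (P-indep Q (i , cb) y a))

    B′-key : ∀ i y y' → key Q' y ≡ key Q' y' → B′ i y ≡ B′ i y'
    B′-key i y y' e = any-cong (colourTests (suc M)) (λ cb →
      cong₂ (λ u v → 1ℚ <ℚᵇ (ι (Ξ * Ξ) ⊗ sq (u ⊖ v))) (P-key Q' (i , cb) y y' e) (P-key Q (i , cb) y y' (≽-key r y y' e)))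

    -- Markov's inequality for the squared difference, whose sum is an energy increment.
    B′-count : ∀ i → S (ind ∘ B′ i) ≤ℚ ι (length (colourTests (suc M))) ⊗ (ι (Ξ * Ξ) ⊗ (𝓔 Q' ⊖ 𝓔 Q))
    B′-count i = begin
      S (ind ∘ B′ i)
        ≤⟨ Σ-mono xs (λ y → ind-any (λ cb → far (i , cb) y) cbs) ⟩
      S (λ y → Σℚ cbs (λ cb → ind (far (i , cb) y)))
        ≡⟨ Σ-swap xs cbs (λ y cb → ind (far (i , cb) y)) ⟩
      Σℚ cbs (λ cb → S (λ y → ind (far (i , cb) y)))
        ≤⟨ Σ-≤const-∈ cbs (ι (Ξ * Ξ) ⊗ (𝓔 Q' ⊖ 𝓔 Q)) each ⟩
      ι (length cbs) ⊗ (ι (Ξ * Ξ) ⊗ (𝓔 Q' ⊖ 𝓔 Q)) ∎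
      where
      open ℚP.≤-Reasoning
      cbs = colourTests (suc M)
      markov : ∀ w → 0ℚ ≤ℚ w → ind (1ℚ <ℚᵇ w) ≤ℚ w
      markov w w≥0 = ℚP.≤-trans (ℚP.≤-reflexive (sym (ℚP.*-identityʳ _))) (ℚP.≤-trans (ind-<ℚᵇ 1ℚ w)
        (ℚP.≤-trans (⊗-mono-≤ (0≤ind true) w≥0 (ind≤1 (1ℚ <ℚᵇ w)) ℚP.≤-refl) (ℚP.≤-reflexive (ℚP.*-identityˡ w))))
      each : ∀ {cb} → cb ∈ cbs → S (λ y → ind (far (i , cb) y)) ≤ℚ ι (Ξ * Ξ) ⊗ (𝓔 Q' ⊖ 𝓔 Q)
      each {cb} cb∈ = ℚP.≤-trans (Σ-mono xs (λ y → markov _ (0≤⊗ (0≤ι (Ξ * Ξ)) (0≤sq (P Q' (i , cb) y ⊖ P Q (i , cb) y)))))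
        (ℚP.≤-trans (ℚP.≤-reflexive (Σ-⊗ xs (ι (Ξ * Ξ)) (λ y → sq (P Q' (i , cb) y ⊖ P Q (i , cb) y))))
          (⊗-monoˡ-≤ (0≤ι (Ξ * Ξ)) (increment r (∈-cartesianProduct⁺ (∈-allFin i) cb∈))))

    near : ∀ {i c b} → c <ᴺ suc M → ∀ y → B′ i y ≡ false → ι Ξ ⊗ ι Ξ ⊗ sq (P Q' (i , c , b) y ⊖ P Q (i , c , b) y) ≤ℚ 1ℚ
    near {i} {c} {b} c< y ¬far = subst (λ k → k ⊗ sq (P Q' (i , c , b) y ⊖ P Q (i , c , b) y) ≤ℚ 1ℚ) (ι-* Ξ Ξ)
      (<ℚᵇ-false (any-false (λ cb → far (i , cb) y) (colourTests (suc M)) ¬far (∈-cartesianProduct⁺ (∈-downFrom c<) (bool b))))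
      where
      bool : ∀ b → b ∈ (false ∷ true ∷ [])
      bool false = here refl
      bool true  = there (here refl)

  module Counting (Q Q' : Family n m) (r : Q' ≽ Q) (Q'g : ∀ x → col Q' g x ≡ G x)
                  (M₁ : ℕ) (Q'< : Bounded Q' M₁) (ĉ : ℕ) (unif : Uniform M₁ (resolution m t̂ ĉ) Q')
                  (x : X) (¬thin : ∀ i → Coarse.thin Q i x ≡ false) (¬mixed : ∀ i → Coarse.mixed Q i x ≡ false) where

    open Pair Q Q' r

    H : ℕ
    H = resolution m t̂ ĉ

    A Ψ : X → Bool
    A y = matches t Q x y ∧ avoids B′ y
    Ψ y = A y ∧ (G y ≡ᵇ G x)

    -- The condition on the colour `G` sits in the test when `i` is not in `g`. Otherwise `G` may
    -- depend on the `i`-th coordinate and must sit here, where a slice of it is measurable for the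
    -- refinement. In both cases test times `Φ` is `Ψ`, or its part in `B i`.
    Φ : Fin m → X → Bool
    Φ i y = A y ∧ (if lookup g i then (G y ≡ᵇ G x) else true)

    private
      1≤n : 1 ≤ n
      1≤n = pos (lookup x i₀)
        where
        pos : ∀ {k} → Fin k → 1 ≤ k
        pos zero    = s≤s z≤n
        pos (suc _) = s≤s z≤n

    Φ-inv : ∀ i a y y' → keyAt (refine M₁ i a Q') i y ≡ keyAt (refine M₁ i a Q') i y' → Φ i (y [ i ]≔ a) ≡ Φ i (y' [ i ]≔ a)
    Φ-inv i a y y' e = cong₂ _∧_ (cong₂ _∧_ sameMatch (avoids-cong B′ (λ j → B′-key j ŷ ŷ' fineKey))) sameG
      where
      ŷ  = y [ i ]≔ a
      ŷ' = y' [ i ]≔ a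
      slice : ∀ h → (code h <ᴺ t ⊎ (code h ≤ t × lookup h i ≡ true)) → col Q' h ŷ ≡ col Q' h ŷ'
      slice = refine-slice M₁ i a Q' Q'< y y' e
      fineKey : key Q' ŷ ≡ key Q' ŷ'
      fineKey = key-≡⁺ Q' Q' ŷ ŷ' (λ h lt → slice h (inj₁ lt))
      coarseKey : key Q ŷ ≡ key Q ŷ'
      coarseKey = ≽-key r ŷ ŷ' fineKey
      sameMatch : matches t Q x ŷ ≡ matches t Q x ŷ'
      sameMatch = matches-cong t Q x coarseKey
      sameG : (if lookup g i then (G ŷ ≡ᵇ G x) else true) ≡ (if lookup g i then (G ŷ' ≡ᵇ G x) else true)
      sameG with lookup g i in e'
      ... | false = refl
      -- `G` has code exactly `t`, so only the second alternative of `refine-slice` reaches it,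
      -- thanks to `i` in `g`.
      ... | true  = cong (_≡ᵇ G x) (trans (sym (Q'g ŷ)) (trans (slice g (inj₂ (ℕP.≤-reflexive code-g , e'))) (Q'g ŷ')))

    fΦ : ∀ i b y → f (i , χ i x , b) y ⊗ ind (Φ i y) ≡ ind (Ψ y ∧ (not b ∨ B i y))
    fΦ i b y with lookup g i
    ... | true  = split₁ (A y) (G y ≡ᵇ G x) (not b ∨ B i y)
      where
      split₁ : ∀ a e β → ind β ⊗ ind (a ∧ e) ≡ ind ((a ∧ e) ∧ β)
      split₁ a e β = trans (ℚP.*-comm (ind β) (ind (a ∧ e))) (sym (ind-∧ (a ∧ e) β))
    ... | false = split₂ (A y) (G y ≡ᵇ G x) (not b ∨ B i y)
      where
      split₂ : ∀ a e β → ind (e ∧ β) ⊗ ind (a ∧ true) ≡ ind ((a ∧ e) ∧ β)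
      split₂ true  e β = ℚP.*-identityʳ (ind (e ∧ β))
      split₂ false e β = ℚP.*-zeroʳ (ind (e ∧ β))

    a : Fin m → ℚ
    a i = S (ind ∘ Φ i)

    s : ℚ
    s = S (ind ∘ Ψ)

    sB : Fin m → ℚ
    sB i = S (λ y → ind (Ψ y ∧ B i y))

    Aℚ : ℚ
    Aℚ = S (ind ∘ A)

    a≤A : ∀ i → a i ≤ℚ Aℚ
    a≤A i = Σ-mono xs (λ y → ∧-≤ (A y) _)
      where
      ∧-≤ : ∀ a b → ind (a ∧ b) ≤ℚ ind a
      ∧-≤ true  b = ind≤1 b
      ∧-≤ false b = ℚP.≤-refl

    0≤a : ∀ i → 0ℚ ≤ℚ a i
    0≤a i = Σ-nonneg xs (λ y → 0≤ind (Φ i y))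

    -- Two errors add up: test against fine density, controlled by uniformity, and fine against
    -- coarse density, at most 1 / Ξ at each point since `B′` is avoided. The coarse density is
    -- constant on the points that match `x`.
    approx : ∀ σ → σ ⊗ σ ≡ 1ℚ → ∀ i b → ι H ⊗ ι Ξ ⊗ (σ ⊗ (S (λ y → f (i , χ i x , b) y ⊗ ind (Φ i y)) ⊖ P Q (i , χ i x , b) x ⊗ a i))
             ≤ℚ ι Ξ ⊗ (N ⊕ N) ⊕ ι H ⊗ a i
    approx σ σ² i b = begin
      ι H ⊗ ι Ξ ⊗ (σ ⊗ (S (λ y → f τ y ⊗ φ y) ⊖ P₀ ⊗ a i))
        ≡⟨ cong (λ w → ι H ⊗ ι Ξ ⊗ (σ ⊗ w)) decompose ⟩
      ι H ⊗ ι Ξ ⊗ (σ ⊗ (S (λ y → (f τ y ⊖ P Q' τ y) ⊗ φ y) ⊕ S (λ y → (P Q' τ y ⊖ P₀) ⊗ φ y)))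
        ≡⟨ solve 5 (λ h ξ σ u v → h :* ξ :* (σ :* (u :+ v)) := ξ :* (h :* (σ :* u)) :+ h :* (ξ :* σ :* v)) refl (ι H) (ι Ξ) σ (S (λ y → (f τ y ⊖ P Q' τ y) ⊗ φ y)) (S (λ y → (P Q' τ y ⊖ P₀) ⊗ φ y)) ⟩
      ι Ξ ⊗ (ι H ⊗ (σ ⊗ S (λ y → (f τ y ⊖ P Q' τ y) ⊗ φ y))) ⊕ ι H ⊗ (ι Ξ ⊗ σ ⊗ S (λ y → (P Q' τ y ⊖ P₀) ⊗ φ y))
        ≤⟨ ℚP.+-mono-≤ (⊗-monoˡ-≤ (0≤ι Ξ) (uniform-test {H = H} Q'< unif 1≤n σ σ² {b = b} (χ< i x) (Φ i) (Φ-inv i))) (⊗-monoˡ-≤ (0≤ι H) close) ⟩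
      ι Ξ ⊗ (N ⊕ N) ⊕ ι H ⊗ a i ∎
      where
      open ℚP.≤-Reasoning
      τ : Test
      τ = i , χ i x , b
      P₀ = P Q τ x
      φ : X → ℚ
      φ y = ind (Φ i y)
      decompose : S (λ y → f τ y ⊗ φ y) ⊖ P₀ ⊗ a i ≡ S (λ y → (f τ y ⊖ P Q' τ y) ⊗ φ y) ⊕ S (λ y → (P Q' τ y ⊖ P₀) ⊗ φ y)
      decompose = sym (trans (sym (Σ-⊕ xs (λ y → (f τ y ⊖ P Q' τ y) ⊗ φ y) (λ y → (P Q' τ y ⊖ P₀) ⊗ φ y)))
        (trans (Σ-cong xs (λ y → solve 4 (λ f p p₀ φ → (f :- p) :* φ :+ (p :- p₀) :* φ := f :* φ :- p₀ :* φ) refl (f τ y) (P Q' τ y) P₀ (φ y)))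
          (trans (Σ-⊖ xs (λ y → f τ y ⊗ φ y) (λ y → P₀ ⊗ φ y)) (cong (S (λ y → f τ y ⊗ φ y) ⊖_) (Σ-⊗ xs P₀ φ)))))
      close : ι Ξ ⊗ σ ⊗ S (λ y → (P Q' τ y ⊖ P₀) ⊗ φ y) ≤ℚ a i
      close = ℚP.≤-trans (ℚP.≤-reflexive (sym (Σ-⊗ xs (ι Ξ ⊗ σ) (λ y → (P Q' τ y ⊖ P₀) ⊗ φ y)))) (Σ-mono xs each)
        where
        each : ∀ y → ι Ξ ⊗ σ ⊗ ((P Q' τ y ⊖ P₀) ⊗ φ y) ≤ℚ φ y
        each y with A y in Ay
        ... | false = ℚP.≤-reflexive (solve 3 (λ ξ σ u → ξ :* σ :* (u :* con 0ℚ) := con 0ℚ) refl (ι Ξ) σ (P Q' τ y ⊖ P₀))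
        ... | true with (if lookup g i then (G y ≡ᵇ G x) else true)
        ...   | false = ℚP.≤-reflexive (solve 3 (λ ξ σ u → ξ :* σ :* (u :* con 0ℚ) := con 0ℚ) refl (ι Ξ) σ (P Q' τ y ⊖ P₀))
        ...   | true  = subst (_≤ℚ 1ℚ) (solve 3 (λ ξ σ u → ξ :* σ :* u := ξ :* σ :* (u :* con 1ℚ)) refl (ι Ξ) σ (P Q' τ y ⊖ P₀))
          (w²≤1⇒w≤1 (ι Ξ ⊗ σ ⊗ (P Q' τ y ⊖ P₀)) (subst (_≤ℚ 1ℚ) sq-eq
            (near {i} {χ i x} {b} (χ< i x) y (avoids-sound B′ y (proj₂ (∧-true Ay)) i))))
          where
          P₀≡ : P Q τ y ≡ P₀
          P₀≡ = P-key Q τ y x (sym (matches-sound t Q x y (proj₁ (∧-true Ay))))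
          sq-eq : ι Ξ ⊗ ι Ξ ⊗ sq (P Q' τ y ⊖ P Q τ y) ≡ ι Ξ ⊗ σ ⊗ (P Q' τ y ⊖ P₀) ⊗ (ι Ξ ⊗ σ ⊗ (P Q' τ y ⊖ P₀))
          sq-eq = trans (cong (λ w → ι Ξ ⊗ ι Ξ ⊗ sq (P Q' τ y ⊖ w)) P₀≡)
            (trans (sym (ℚP.*-identityˡ (ι Ξ ⊗ ι Ξ ⊗ sq (P Q' τ y ⊖ P₀)))) (trans (cong (_⊗ (ι Ξ ⊗ ι Ξ ⊗ sq (P Q' τ y ⊖ P₀))) (sym σ²))
              (solve 3 (λ ξ σ u → σ :* σ :* (ξ :* ξ :* (u :* u)) := ξ :* σ :* u :* (ξ :* σ :* u)) refl (ι Ξ) σ (P Q' τ y ⊖ P₀))))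

    private
      p q : Fin m → ℚ
      p i = Coarse.p Q i x
      q i = Coarse.q Q i x

      HΞ≥0 : 0ℚ ≤ℚ ι H ⊗ ι Ξ
      HΞ≥0 = 0≤⊗ (0≤ι H) (0≤ι Ξ)

      fΦ-s : ∀ i → S (λ y → f (i , χ i x , false) y ⊗ ind (Φ i y)) ≡ s
      fΦ-s i = Σ-cong xs (λ y → trans (fΦ i false y) (cong ind (∧-identityʳ (Ψ y))))

      fΦ-sB : ∀ i → S (λ y → f (i , χ i x , true) y ⊗ ind (Φ i y)) ≡ sB i
      fΦ-sB i = Σ-cong xs (λ y → fΦ i true y)

      lower : ∀ i → ι H ⊗ ι Ξ ⊗ (p i ⊗ a i) ≤ℚ ι H ⊗ ι Ξ ⊗ s ⊕ (ι Ξ ⊗ (N ⊕ N) ⊕ ι H ⊗ a i)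
      lower i = ≤ℚ-by (ι Ξ ⊗ (N ⊕ N) ⊕ ι H ⊗ a i ⊖ ι H ⊗ ι Ξ ⊗ ((ℚ.- 1ℚ) ⊗ (s ⊖ p i ⊗ a i)))
        (0≤⊖ (subst (λ w → ι H ⊗ ι Ξ ⊗ ((ℚ.- 1ℚ) ⊗ (w ⊖ p i ⊗ a i)) ≤ℚ ι Ξ ⊗ (N ⊕ N) ⊕ ι H ⊗ a i) (fΦ-s i) (approx (ℚ.- 1ℚ) refl i false)))
        (solve 6 (λ h ξ s n a p → h :* ξ :* s :+ (ξ :* (n :+ n) :+ h :* a) := h :* ξ :* (p :* a) :+ (ξ :* (n :+ n) :+ h :* a :- h :* ξ :* (con (ℚ.- 1ℚ) :* (s :- p :* a)))) refl (ι H) (ι Ξ) s N (a i) (p i))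

      upper : ∀ i → ι H ⊗ ι Ξ ⊗ sB i ≤ℚ ι H ⊗ ι Ξ ⊗ (q i ⊗ a i) ⊕ (ι Ξ ⊗ (N ⊕ N) ⊕ ι H ⊗ a i)
      upper i = ≤ℚ-by (ι Ξ ⊗ (N ⊕ N) ⊕ ι H ⊗ a i ⊖ ι H ⊗ ι Ξ ⊗ (1ℚ ⊗ (sB i ⊖ q i ⊗ a i)))
        (0≤⊖ (subst (λ w → ι H ⊗ ι Ξ ⊗ (1ℚ ⊗ (w ⊖ q i ⊗ a i)) ≤ℚ ι Ξ ⊗ (N ⊕ N) ⊕ ι H ⊗ a i) (fΦ-sB i) (approx 1ℚ refl i true)))
        (solve 6 (λ h ξ s n a q → h :* ξ :* (q :* a) :+ (ξ :* (n :+ n) :+ h :* a) := h :* ξ :* s :+ (ξ :* (n :+ n) :+ h :* a :- h :* ξ :* (con 1ℚ :* (s :- q :* a)))) refl (ι H) (ι Ξ) (sB i) N (a i) (q i))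

      2ℚ = ℕ→ℚ 2

      ι2m : ι (2 * m) ≡ 2ℚ ⊗ ι m
      ι2m = trans (ι-* 2 m) (cong (_⊗ ι m) (ι≡ℕ→ℚ 2))

      1≤m : 1ℚ ≤ℚ ι m
      1≤m = 1≤ι (pos i₀)
        where
        pos : ∀ {k} → Fin k → 1 ≤ k
        pos zero    = s≤s z≤n
        pos (suc _) = s≤s z≤n

      A≥0 : 0ℚ ≤ℚ Aℚ
      A≥0 = Σ-nonneg xs (λ y → 0≤ind (A y))

      N≥0 : 0ℚ ≤ℚ N
      N≥0 = 0≤ι (length xs)

      mixedBound : ∀ i → 2ℚ ⊗ ι m ⊗ q i ≤ℚ p i
      mixedBound i = subst (λ w → w ⊗ q i ≤ℚ p i) ι2m (<ℚᵇ-false (¬mixed i))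

      -- Up to errors, 2 m `sB i` is 2 m `q i` `a i`, at most `p i` `a i`, which is `s` again.
      perFacet : ∀ i → 2ℚ ⊗ ι m ⊗ (ι H ⊗ ι Ξ) ⊗ sB i ≤ℚ ι H ⊗ ι Ξ ⊗ s ⊕ (ℕ→ℚ 3 ⊗ ι m ⊗ ι H ⊗ Aℚ ⊕ ℕ→ℚ 6 ⊗ ι m ⊗ ι Ξ ⊗ N)
      perFacet i = ≤ℚ-by
        (2ℚ ⊗ ι m ⊗ (ι H ⊗ ι Ξ ⊗ (q i ⊗ a i) ⊕ (ι Ξ ⊗ (N ⊕ N) ⊕ ι H ⊗ a i) ⊖ ι H ⊗ ι Ξ ⊗ sB i)
         ⊕ ((ι H ⊗ ι Ξ ⊗ a i) ⊗ (p i ⊖ 2ℚ ⊗ ι m ⊗ q i)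
         ⊕ ((ι H ⊗ ι Ξ ⊗ s ⊕ (ι Ξ ⊗ (N ⊕ N) ⊕ ι H ⊗ a i) ⊖ ι H ⊗ ι Ξ ⊗ (p i ⊗ a i))
         ⊕ ((2ℚ ⊗ ι m ⊕ 1ℚ) ⊗ ι H ⊗ (Aℚ ⊖ a i) ⊕ (ι m ⊖ 1ℚ) ⊗ (ι H ⊗ Aℚ ⊕ 2ℚ ⊗ ι Ξ ⊗ N)))))
        (0≤⊕ (0≤⊗ (0≤⊗ 0≤2 m≥0) (0≤⊖ (upper i)))
          (0≤⊕ (0≤⊗ (0≤⊗ HΞ≥0 (0≤a i)) (0≤⊖ (mixedBound i)))
            (0≤⊕ (0≤⊖ (lower i)) (0≤⊕ (0≤⊗ (0≤⊗ (0≤⊕ (0≤⊗ 0≤2 m≥0) 0≤1) (0≤ι H)) (0≤⊖ (a≤A i)))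
              (0≤⊗ (0≤⊖ 1≤m) (0≤⊕ (0≤⊗ (0≤ι H) A≥0) (0≤⊗ (0≤⊗ 0≤2 (0≤ι Ξ)) N≥0)))))))
        (solve 10 (λ m h ξ s n a A p q sB →
          h :* ξ :* s :+ (con (ℕ→ℚ 3) :* m :* h :* A :+ con (ℕ→ℚ 6) :* m :* ξ :* n) :=
          con 2ℚ :* m :* (h :* ξ) :* sB :+
          (con 2ℚ :* m :* (h :* ξ :* (q :* a) :+ (ξ :* (n :+ n) :+ h :* a) :- h :* ξ :* sB)
           :+ ((h :* ξ :* a) :* (p :- con 2ℚ :* m :* q)
           :+ ((h :* ξ :* s :+ (ξ :* (n :+ n) :+ h :* a) :- h :* ξ :* (p :* a))
           :+ ((con 2ℚ :* m :+ con 1ℚ) :* h :* (A :- a) :+ (m :- con 1ℚ) :* (h :* A :+ con 2ℚ :* ξ :* n))))))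
          refl (ι m) (ι H) (ι Ξ) s N (a i) Aℚ (p i) (q i) (sB i))
        where
        0≤1 = 0≤ind true
        0≤2 : 0ℚ ≤ℚ 2ℚ
        0≤2 = subst (0ℚ ≤ℚ_) (ι≡ℕ→ℚ 2) (0≤ι 2)
        m≥0 = 0≤ι m

    σ : ℚ
    σ = Σℚ (allFin m) sB

    private
      facetSum : 2ℚ ⊗ ι H ⊗ ι Ξ ⊗ σ ≤ℚ ι H ⊗ ι Ξ ⊗ s ⊕ (ℕ→ℚ 3 ⊗ ι m ⊗ ι H ⊗ Aℚ ⊕ ℕ→ℚ 6 ⊗ ι m ⊗ ι Ξ ⊗ N)
      facetSum = ⊗-cancelˡ-≤ (ι m) 1≤m (begin
        ι m ⊗ (2ℚ ⊗ ι H ⊗ ι Ξ ⊗ σ)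
          ≡⟨ solve 4 (λ m h ξ σ → m :* (con 2ℚ :* h :* ξ :* σ) := con 2ℚ :* m :* (h :* ξ) :* σ) refl (ι m) (ι H) (ι Ξ) σ ⟩
        2ℚ ⊗ ι m ⊗ (ι H ⊗ ι Ξ) ⊗ σ
          ≡⟨ Σ-⊗ (allFin m) (2ℚ ⊗ ι m ⊗ (ι H ⊗ ι Ξ)) sB ⟨
        Σℚ (allFin m) (λ i → 2ℚ ⊗ ι m ⊗ (ι H ⊗ ι Ξ) ⊗ sB i)
          ≤⟨ Σ-≤const (allFin m) R perFacet ⟩
        ι (length (allFin m)) ⊗ R
          ≡⟨ cong (λ l → ι l ⊗ R) (ListP.length-tabulate {n = m} id) ⟩
        ι m ⊗ R ∎)
        where
        open ℚP.≤-Reasoning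
        R = ι H ⊗ ι Ξ ⊗ s ⊕ (ℕ→ℚ 3 ⊗ ι m ⊗ ι H ⊗ Aℚ ⊕ ℕ→ℚ 6 ⊗ ι m ⊗ ι Ξ ⊗ N)

      a-i₀ : a i₀ ≡ Aℚ
      a-i₀ = Σ-cong xs (λ y → trans (cong (λ b → ind (A y ∧ (if b then (G y ≡ᵇ G x) else true))) i₀∉g) (cong ind (∧-identityʳ (A y))))

      -- The coordinate `i₀` outside `g` makes `Φ i₀` equal to `A`; as `x` is not thin there, at
      -- least about 1 / t̂ of `A` has the colour of `x`.
      massBound : ι H ⊗ ι Ξ ⊗ Aℚ ≤ℚ ι t̂ ⊗ (ι H ⊗ ι Ξ ⊗ s ⊕ (2ℚ ⊗ ι Ξ ⊗ N ⊕ ι H ⊗ Aℚ))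
      massBound = ≤ℚ-by
        (ι t̂ ⊗ (ι H ⊗ ι Ξ ⊗ s ⊕ (ι Ξ ⊗ (N ⊕ N) ⊕ ι H ⊗ Aℚ) ⊖ ι H ⊗ ι Ξ ⊗ (p i₀ ⊗ Aℚ)) ⊕ (ι H ⊗ ι Ξ ⊗ Aℚ) ⊗ (ι t̂ ⊗ p i₀ ⊖ 1ℚ))
        (0≤⊕ (0≤⊗ (0≤ι t̂) (0≤⊖ (subst (λ w → ι H ⊗ ι Ξ ⊗ (p i₀ ⊗ w) ≤ℚ ι H ⊗ ι Ξ ⊗ s ⊕ (ι Ξ ⊗ (N ⊕ N) ⊕ ι H ⊗ w)) a-i₀ (lower i₀))))
             (0≤⊗ (0≤⊗ HΞ≥0 A≥0) (0≤⊖ (<ℚᵇ-false (¬thin i₀)))))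
        (solve 7 (λ t h ξ s n a p → t :* (h :* ξ :* s :+ (con 2ℚ :* ξ :* n :+ h :* a)) :=
          h :* ξ :* a :+ (t :* (h :* ξ :* s :+ (ξ :* (n :+ n) :+ h :* a) :- h :* ξ :* (p :* a)) :+ (h :* ξ :* a) :* (t :* p :- con 1ℚ)))
          refl (ι t̂) (ι H) (ι Ξ) s N Aℚ (p i₀))

      1≤N : 1 ≤ length xs
      1≤N = nonempty (∈-cube x)
        where
        nonempty : ∀ {ys : List X} → x ∈ ys → 1 ≤ length ys
        nonempty (here _)  = s≤s z≤n
        nonempty (there _) = s≤s z≤n

    target : X → Bool
    target y = Ψ y ∧ avoids B y

    target-sound : ∀ y → target y ≡ true → key Q x ≡ key Q y × G x ≡ G y × avoids B y ≡ true
    target-sound y e =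
      let eΨ , eB = ∧-true {Ψ y} {avoids B y} e
          eA , eG = ∧-true {A y} {G y ≡ᵇ G x} eΨ
      in matches-sound t Q x y (proj₁ (∧-true {matches t Q x y} {avoids B′ y} eA)) , sym (≡ᵇ-sound {G y} {G x} eG) , eB

    count : length xs ≤ ĉ * cnt xs A → length xs ≤ loss t̂ ĉ * cnt xs target
    count N≤ĉA = ι-cancel-≤ (ℚP.≤-trans
      (counting-arithmetic (ι m) (ι t̂) (ι ĉ) s Aℚ N σ 1≤m (1≤ι (1≤thickness z M)) (1≤ι (1≤ĉ ĉ N≤ĉA)) A≥0 N≥0
        (subst₂ (λ h ξ → h ⊗ ξ ⊗ Aℚ ≤ℚ ι t̂ ⊗ (h ⊗ ξ ⊗ s ⊕ (2ℚ ⊗ ξ ⊗ N ⊕ h ⊗ Aℚ))) ιH ιΞ massBound)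
        (subst₂ (λ h ξ → 2ℚ ⊗ h ⊗ ξ ⊗ σ ≤ℚ h ⊗ ξ ⊗ s ⊕ (ℕ→ℚ 3 ⊗ ι m ⊗ h ⊗ Aℚ ⊕ ℕ→ℚ 6 ⊗ ι m ⊗ ξ ⊗ N)) ιH ιΞ facetSum)
        (subst (N ≤ℚ_) (trans (ι-* ĉ (cnt xs A)) (cong (ι ĉ ⊗_) (ι-cnt xs A))) (ι-mono N≤ĉA)))
      (ℚP.≤-trans (⊗-monoˡ-≤ (0≤⊗ (0≤⊗ (subst (0ℚ ≤ℚ_) (ι≡ℕ→ℚ 8) (0≤ι 8)) (0≤ι t̂)) (0≤ι ĉ)) s-σ≤)
        (ℚP.≤-reflexive (sym (trans (ι-* (loss t̂ ĉ) (cnt xs target)) (cong₂ _⊗_ (ι-loss t̂ ĉ) (ι-cnt xs target)))))))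
      where
      1≤ĉ : ∀ ĉ → length xs ≤ ĉ * cnt xs A → 1 ≤ ĉ
      1≤ĉ zero    le = ℕP.≤-trans 1≤N le
      1≤ĉ (suc _) _  = s≤s z≤n
      ιΞ : ι Ξ ≡ ℕ→ℚ 16 ⊗ ι m ⊗ ι t̂
      ιΞ = ι-sharpness m t̂
      ιH : ι H ≡ ℕ→ℚ 40 ⊗ ι m ⊗ ι t̂ ⊗ ι ĉ
      ιH = ι-resolution m t̂ ĉ
      split : ∀ y → ind (Ψ y) ≤ℚ ind (target y) ⊕ Σℚ (allFin m) (λ i → ind (Ψ y ∧ B i y))
      split y with Ψ y
      ... | false = 0≤⊕ {0ℚ} ℚP.≤-refl (Σ-nonneg (allFin m) (λ _ → ℚP.≤-refl))
      ... | true  = avoids-union B y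
      s-σ≤ : s ⊖ σ ≤ℚ S (ind ∘ target)
      s-σ≤ = ≤ℚ-by (S (ind ∘ target) ⊕ σ ⊖ s)
        (0≤⊖ (ℚP.≤-trans (Σ-mono xs split) (ℚP.≤-reflexive (trans (Σ-⊕ xs (ind ∘ target) (λ y → Σℚ (allFin m) (λ i → ind (Ψ y ∧ B i y))))
          (cong (S (ind ∘ target) ⊕_) (Σ-swap xs (allFin m) (λ y i → ind (Ψ y ∧ B i y))))))))
        (solve 3 (λ a b c → a := c :- b :+ (a :+ b :- c)) refl (S (ind ∘ target)) σ s)

-- Induction over the sets of coordinates

-- `ê` comes before `M`: in the inductive step the energy gap that makes `B′` small must be fixed
-- before the coarse family, whose number of colours depends on that gap, is found.
LStar : ℕ → ℕ → Set
LStar m t = ∀ z → ∃[ ê ] (∀ M → ∃[ ĉ ] (∀ {n} (Q : Family n m) → Bounded Q M →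
  (B : Fin m → Cube n m → Bool) → (∀ i → Indep i (B i)) →
  (∀ i → ê * cnt (cube n m) (B i) ≤ length (cube n m)) → Conclusion t z ĉ Q B))

cnt-mono : ∀ {A : Set} (xs : List A) {P P' : A → Bool} → (∀ x → P x ≡ true → P' x ≡ true) → cnt xs P ≤ cnt xs P'
cnt-mono []       imp = z≤n
cnt-mono (x ∷ xs) {P} {P'} imp with P x in e | P' x in e'
... | false | false = cnt-mono xs imp
... | false | true  = ℕP.≤-trans (cnt-mono xs imp) (ℕP.n≤1+n _)
... | true  | true  = s≤s (cnt-mono xs imp)
... | true  | false with () ← trans (sym e') (imp x e)

Conclusion-mono : ∀ {n m} t z ĉ ĉ' (Q : Family n m) B → ĉ ≤ ĉ' → Conclusion t z ĉ Q B → Conclusion t z ĉ' Q B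
Conclusion-mono t z ĉ ĉ' Q B le (Bad , ind , small , big) = Bad , ind , small , λ x good → ℕP.≤-trans (big x good) (ℕP.*-monoˡ-≤ _ le)

module Induct {m : ℕ} (t : ℕ) (g : Vec Bool m) (code-g : code g ≡ t) (i₀ : Fin m) (i₀∉g : lookup g i₀ ≡ false)
              (ih : LStar m t) (z M : ℕ) where

  -- Calling the hypothesis with 2 (z + 1) leaves the other half of the permitted bad points to the
  -- thin and the mixed ones, a quarter each.
  ê′ : ℕ
  ê′ = proj₁ (ih (2 * suc z))

  ĉ′ : ℕ → ℕ
  ĉ′ M' = proj₁ (proj₂ (ih (2 * suc z)) M')

  t̂ Ξ Lᵗ : ℕ
  t̂ = thickness z M
  Ξ = sharpness m t̂
  Lᵗ = length (cartesianProduct (allFin m) (colourTests (suc M)))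

  H : ℕ → ℕ
  H M' = resolution m t̂ (ĉ′ M')

  -- A copy of `climb` that is stated before `n` and the family are given, because the final
  -- constant must not depend on them.
  climb′ : ℕ → ℕ → ℕ
  climb′ zero    M' = M'
  climb′ (suc k) M' = climb′ k (M' * M')

  next : ℕ → ℕ
  next M' = climb′ (H M' * H M' * Lᵗ) M'

  -- The stage at which the energy stops growing is not known beforehand; the sum dominates the loss
  -- of each stage.
  ĉs : ℕ → ℕ → ℕ
  ĉs zero    M' = loss t̂ (ĉ′ M')
  ĉs (suc k) M' = loss t̂ (ĉ′ M') + ĉs k (next M')

  -- An energy gain of at most N / α makes every `B′ i` smaller than N / ê′. No number of coarse
  -- colours enters.
  α : ℕ
  α = ê′ * (length (colourTests (suc M)) * (Ξ * Ξ))

  module _ {n : ℕ} (Q₀ : Family n m) (Q₀< : Bounded Q₀ (suc M)) (B : Fin m → Cube n m → Bool) (B-indep : ∀ i → Indep i (B i))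
           (B-small : ∀ i → tolerance m z * cnt (cube n m) (B i) ≤ length (cube n m)) where

    open Step t g code-g i₀ i₀∉g M (col Q₀ g) (Q₀< g) (λ i → meas Q₀ g i) B B-indep z hiding (t̂; Ξ)

    climb≡ : ∀ k M' → climb k M' ≡ climb′ k M'
    climb≡ zero    M' = refl
    climb≡ (suc k) M' = climb≡ k (M' * M')

    g-fixed : ∀ {Q} → Q ≽ Q₀ → ∀ x → col Q g x ≡ col Q₀ g x
    g-fixed r = fixed r g (λ lt → ℕP.<-irrefl code-g lt)

    stage : ∀ M' Q → Bounded Q M' → Q ≽ Q₀ → (F : Fine (H M') (next M') Q) →
            ι α ⊗ (𝓔 (Fine.fam F) ⊖ 𝓔 Q) ≤ℚ N → Conclusion (suc t) z (loss t̂ (ĉ′ M')) Q₀ B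
    stage M' Q Q< r₀ F small = Bad , Bad-indep , Bad-small , big
      where
      Q' = Fine.fam F
      r = Fine.finer F
      open Pair Q Q' r
      open Coarse Q
      inner : Conclusion t (2 * suc z) (ĉ′ M') Q B′
      inner = proj₂ (proj₂ (ih (2 * suc z)) M') Q Q< B′ B′-indep λ i → ι-cancel-≤ (begin
        ι (ê′ * cnt xs (B′ i))
          ≡⟨ trans (ι-* ê′ (cnt xs (B′ i))) (cong (ι ê′ ⊗_) (ι-cnt xs (B′ i))) ⟩
        ι ê′ ⊗ S (ind ∘ B′ i)
          ≤⟨ ⊗-monoˡ-≤ (0≤ι ê′) (B′-count i) ⟩
        ι ê′ ⊗ (ι cbs ⊗ (ι (Ξ * Ξ) ⊗ (𝓔 Q' ⊖ 𝓔 Q)))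
          ≡⟨ solve 4 (λ a b c d → a :* (b :* (c :* d)) := a :* (b :* c) :* d) refl (ι ê′) (ι cbs) (ι (Ξ * Ξ)) (𝓔 Q' ⊖ 𝓔 Q) ⟩
        ι ê′ ⊗ (ι cbs ⊗ ι (Ξ * Ξ)) ⊗ (𝓔 Q' ⊖ 𝓔 Q)
          ≡⟨ cong (_⊗ (𝓔 Q' ⊖ 𝓔 Q)) (trans (ι-* ê′ (cbs * (Ξ * Ξ))) (cong (ι ê′ ⊗_) (ι-* cbs (Ξ * Ξ)))) ⟨
        ι α ⊗ (𝓔 Q' ⊖ 𝓔 Q)
          ≤⟨ small ⟩
        N ∎)
        where
        open ℚP.≤-Reasoning
        cbs = length (colourTests (suc M))
      Bad′ = proj₁ inner
      Bad : Fin m → X → Bool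
      Bad i x = Bad′ i x ∨ (thin i x ∨ mixed i x)
      Bad-indep : ∀ i → Indep i (Bad i)
      Bad-indep i x a = cong₂ _∨_ (proj₁ (proj₂ inner) i x a) (cong₂ _∨_ (thin-indep i x a) (mixed-indep i x a))
      zz = ι (suc z)
      zz≥0 = 0≤ι (suc z)
      lit : ∀ k → 0ℚ ≤ℚ ℕ→ℚ k
      lit k = subst (0ℚ ≤ℚ_) (ι≡ℕ→ℚ k) (0≤ι k)
      part₁ : ∀ i → ℕ→ℚ 2 ⊗ zz ⊗ S (ind ∘ Bad′ i) ≤ℚ N
      part₁ i = subst (_≤ℚ N) (trans (ι-* (2 * suc z) (cnt xs (Bad′ i))) (cong₂ _⊗_ (trans (ι-* 2 (suc z)) (cong (_⊗ zz) (ι≡ℕ→ℚ 2))) (ι-cnt xs (Bad′ i))))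
        (ι-mono (proj₁ (proj₂ (proj₂ inner)) i))
      part₂ : ∀ i → ℕ→ℚ 4 ⊗ zz ⊗ S (ind ∘ thin i) ≤ℚ N
      part₂ i = ⊗-cancelˡ-≤ (ι (suc M)) (1≤ι (s≤s z≤n)) (subst (_≤ℚ ι (suc M) ⊗ N)
        (trans (cong (_⊗ S (ind ∘ thin i)) (ι-thickness z M))
               (solve 4 (λ f z m s → f :* z :* m :* s := m :* (f :* z :* s)) refl (ℕ→ℚ 4) zz (ι (suc M)) (S (ind ∘ thin i))))
        (thin-count i))
      part₃ : ∀ i → ℕ→ℚ 4 ⊗ zz ⊗ S (ind ∘ mixed i) ≤ℚ N
      part₃ i = ℚP.≤-trans (⊗-monoˡ-≤ (0≤⊗ (lit 4) zz≥0) (mixed-count i)) (subst (_≤ℚ N) eq (ι-mono (B-small i)))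
        where
        eq : ι (tolerance m z * cnt xs (B i)) ≡ ℕ→ℚ 4 ⊗ zz ⊗ (ι (2 * m) ⊗ S (ind ∘ B i))
        eq = trans (trans (ι-* (tolerance m z) (cnt xs (B i))) (cong₂ _⊗_ (ι-tolerance m z) (ι-cnt xs (B i))))
          (trans (solve 3 (λ m z b → con (ℕ→ℚ 8) :* m :* z :* b := con (ℕ→ℚ 4) :* z :* (con (ℕ→ℚ 2) :* m :* b)) refl (ι m) zz (S (ind ∘ B i)))
            (cong (λ w → ℕ→ℚ 4 ⊗ zz ⊗ (w ⊗ S (ind ∘ B i))) (sym (trans (ι-* 2 m) (cong (_⊗ ι m) (ι≡ℕ→ℚ 2))))))
      Bad-small : ∀ i → z * cnt xs (Bad i) ≤ length xs
      Bad-small i = ℕP.≤-trans (ℕP.*-monoˡ-≤ (cnt xs (Bad i)) (ℕP.n≤1+n z)) (ι-cancel-≤ (ℚP.≤-trans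
        (ℚP.≤-reflexive (trans (ι-* (suc z) (cnt xs (Bad i))) (cong (zz ⊗_) (ι-cnt xs (Bad i)))))
        (ℚP.≤-trans (⊗-monoˡ-≤ zz≥0 union) total)))
        where
        b₁ = S (ind ∘ Bad′ i)
        b₂ = S (ind ∘ thin i)
        b₃ = S (ind ∘ mixed i)
        union : S (ind ∘ Bad i) ≤ℚ b₁ ⊕ (b₂ ⊕ b₃)
        union = ℚP.≤-trans (Σ-mono xs (λ x → ℚP.≤-trans (ind-∨ (Bad′ i x) (thin i x ∨ mixed i x)) (ℚP.+-monoʳ-≤ (ind (Bad′ i x)) (ind-∨ (thin i x) (mixed i x)))))
          (ℚP.≤-reflexive (trans (Σ-⊕ xs (ind ∘ Bad′ i) (λ x → ind (thin i x) ⊕ ind (mixed i x))) (cong (b₁ ⊕_) (Σ-⊕ xs (ind ∘ thin i) (ind ∘ mixed i)))))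
        total : zz ⊗ (b₁ ⊕ (b₂ ⊕ b₃)) ≤ℚ N
        total = ⊗-cancelˡ-≤ (ℕ→ℚ 4) (subst (1ℚ ≤ℚ_) (ι≡ℕ→ℚ 4) (1≤ι (s≤s z≤n))) (≤ℚ-by
          (ℕ→ℚ 2 ⊗ (N ⊖ ℕ→ℚ 2 ⊗ zz ⊗ b₁) ⊕ ((N ⊖ ℕ→ℚ 4 ⊗ zz ⊗ b₂) ⊕ (N ⊖ ℕ→ℚ 4 ⊗ zz ⊗ b₃)))
          (0≤⊕ (0≤⊗ (lit 2) (0≤⊖ (part₁ i))) (0≤⊕ (0≤⊖ (part₂ i)) (0≤⊖ (part₃ i))))
          (solve 5 (λ z a b c n → con (ℕ→ℚ 4) :* n := con (ℕ→ℚ 4) :* (z :* (a :+ (b :+ c))) :+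
            (con (ℕ→ℚ 2) :* (n :- con (ℕ→ℚ 2) :* z :* a) :+ ((n :- con (ℕ→ℚ 4) :* z :* b) :+ (n :- con (ℕ→ℚ 4) :* z :* c)))) refl zz b₁ b₂ b₃ N))
      big : ∀ x → (∀ i → Bad i x ≡ false) → length xs ≤ loss t̂ (ĉ′ M') * cnt xs (λ y → matches (suc t) Q₀ x y ∧ avoids B y)
      big x good = ℕP.≤-trans (count (proj₂ (proj₂ (proj₂ inner)) x (λ i → proj₁ (∨-false (good i)))))
        (ℕP.*-monoʳ-≤ (loss t̂ (ĉ′ M')) (cnt-mono xs {target} {λ y → matches (suc t) Q₀ x y ∧ avoids B y} lift))
        where
        open Counting Q Q' r (g-fixed (≽-trans r r₀)) (Fine.bound F) (Fine.bounded F) (ĉ′ M') (Fine.uniform F) x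
               (λ i → proj₁ (∨-false (proj₂ (∨-false {Bad′ i x} (good i))))) (λ i → proj₂ (∨-false {thin i x} (proj₂ (∨-false {Bad′ i x} (good i)))))
          using (count; target; target-sound)
        lift : ∀ y → target y ≡ true → matches (suc t) Q₀ x y ∧ avoids B y ≡ true
        lift y e = cong₂ _∧_ (matches-complete (suc t) Q₀ x y (Keys.key-≡⁺ (suc t) Q₀ Q₀ x y agree)) (proj₂ (proj₂ sound))
          where
          sound : key Q x ≡ key Q y × col Q₀ g x ≡ col Q₀ g y × avoids B y ≡ true
          sound = target-sound y e
          agree : ∀ h → code h <ᴺ suc t → col Q₀ h x ≡ col Q₀ h y
          agree h (s≤s h≤t) = [ (λ lt → key-≡ Q₀ x y (≽-key r₀ x y (proj₁ sound)) h lt)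
                              , (λ h≡t → subst (λ h → col Q₀ h x ≡ col Q₀ h y) (sym (code-injective h g (trans h≡t (sym code-g)))) (proj₁ (proj₂ sound))) ]′
                              (ℕP.m≤n⇒m<n∨m≡n h≤t)

    -- Either coarse and fine family have nearly equal energy and `stage` applies, or the fine
    -- family becomes the next coarse one at a gain of N / α. The latter happens at most α L times.
    outer : ∀ k M' Q → Bounded Q M' → Q ≽ Q₀ → ι α ⊗ (ι L ⊗ N ⊖ 𝓔 Q) ≤ℚ ι k ⊗ N → Conclusion (suc t) z (ĉs k M') Q₀ B
    outer k M' Q Q< r₀ room = go k room
      where
      F : Fine (H M') (next M') Q
      F = subst (λ b → Fine (H M') b Q) (climb≡ (H M' * H M' * Lᵗ) M') (fine (H M' * H M' * Lᵗ) (H M') M' Q Q< start)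
        where
        start : ι (H M') ⊗ ι (H M') ⊗ (ι L ⊗ N ⊖ 𝓔 Q) ≤ℚ ι (H M' * H M' * Lᵗ) ⊗ N
        start = ≤ℚ-by (ι (H M') ⊗ ι (H M') ⊗ 𝓔 Q) (0≤⊗ (0≤⊗ (0≤ι (H M')) (0≤ι (H M'))) (0≤𝓔 Q))
          (trans (cong (_⊗ N) (trans (ι-* (H M' * H M') Lᵗ) (cong (_⊗ ι Lᵗ) (ι-* (H M') (H M')))))
            (solve 4 (λ h l n e → h :* h :* l :* n := h :* h :* (l :* n :- e) :+ h :* h :* e) refl (ι (H M')) (ι L) N (𝓔 Q)))
      Q' = Fine.fam F
      go : ∀ k → ι α ⊗ (ι L ⊗ N ⊖ 𝓔 Q) ≤ℚ ι k ⊗ N → Conclusion (suc t) z (ĉs k M') Q₀ B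
      go zero room = stage M' Q Q< r₀ F (ℚP.≤-trans (⊗-monoˡ-≤ (0≤ι α) (ℚP.+-monoˡ-≤ (ℚ.- 𝓔 Q) (𝓔-≤ Q')))
        (ℚP.≤-trans room (ℚP.≤-trans (ℚP.≤-reflexive (trans (cong (_⊗ N) ι-0) (ℚP.*-zeroˡ N))) (0≤ι (length xs)))))
      go (suc k) room = [ (λ small → Conclusion-mono (suc t) z (loss t̂ (ĉ′ M')) (ĉs (suc k) M') Q₀ B (ℕP.m≤m+n _ _) (stage M' Q Q< r₀ F small)) , (λ large → Conclusion-mono (suc t) z (ĉs k (next M')) (ĉs (suc k) M') Q₀ B (ℕP.m≤n+m _ _) (outer k (next M') Q'
              (λ h x → ℕP.<-≤-trans (Fine.bounded F h x) (Fine.bound≤ F)) (≽-trans (Fine.finer F) r₀)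
              (≤ℚ-by (ι (suc k) ⊗ N ⊖ ι α ⊗ (ι L ⊗ N ⊖ 𝓔 Q) ⊕ (ι α ⊗ (𝓔 Q' ⊖ 𝓔 Q) ⊖ N))
                (0≤⊕ (0≤⊖ room) (0≤⊖ large))
                (trans (solve 6 (λ k n a l e e' → k :* n := a :* (l :* n :- e') :+ ((con 1ℚ :+ k) :* n :- a :* (l :* n :- e) :+ (a :* (e' :- e) :- n))) refl (ι k) N (ι α) (ι L) (𝓔 Q) (𝓔 Q'))
                  (cong (λ s → ι α ⊗ (ι L ⊗ N ⊖ 𝓔 Q') ⊕ (s ⊗ N ⊖ ι α ⊗ (ι L ⊗ N ⊖ 𝓔 Q) ⊕ (ι α ⊗ (𝓔 Q' ⊖ 𝓔 Q) ⊖ N))) (sym (ι-suc k))))))) ]′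
        (ℚP.≤-total (ι α ⊗ (𝓔 Q' ⊖ 𝓔 Q)) N)

    conclusion : Conclusion (suc t) z (ĉs (α * Lᵗ) (suc M)) Q₀ B
    conclusion = outer (α * Lᵗ) (suc M) Q₀ Q₀< ≽-refl (≤ℚ-by (ι α ⊗ 𝓔 Q₀) (0≤⊗ (0≤ι α) (0≤𝓔 Q₀))
      (trans (cong (_⊗ N) (ι-* α Lᵗ)) (solve 4 (λ a l n e → a :* l :* n := a :* (l :* n :- e) :+ a :* e) refl (ι α) (ι L) N (𝓔 Q₀))))

LStar-suc : ∀ {m} t → suc t <ᴺ 2 ^ m → LStar m t → LStar m (suc t)
LStar-suc {m} t t< ih z with decode m t (ℕP.<-trans (ℕP.n<1+n t) t<)
... | g , refl with missing g t<
... | i₀ , i₀∉g = tolerance m z , λ M → let open Induct (code g) g refl i₀ i₀∉g ih z M in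
      ĉs (α * Lᵗ) (suc M) , λ Q Q< B B-indep B-small → conclusion Q (λ h x → ℕP.<-trans (Q< h x) (ℕP.n<1+n M)) B B-indep B-small

-- There are no colours to match, and `m` exceptional sets of at most N / (2 m) points leave half of
-- the cube.
LStar-zero : ∀ {m} → LStar m 0
LStar-zero {m} z = 2 * m , λ M → 2 , λ {n} Q Q< B B-indep B-small →
  (λ _ _ → false) , (λ _ _ _ → refl) ,
  (λ i → ℕP.≤-trans (ℕP.≤-reflexive (trans (cong (z *_) (cnt-false (cube n m))) (ℕP.*-zeroʳ z))) z≤n) ,
  λ x _ → enough {n} Q B B-small x
  where
  cnt-false : ∀ {A : Set} (xs : List A) → cnt xs (λ _ → false) ≡ 0
  cnt-false []       = refl
  cnt-false (x ∷ xs) = cnt-false xs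
  module _ {n} (Q : Family n m) (B : Fin m → Cube n m → Bool) (small : ∀ i → 2 * m * cnt (cube n m) (B i) ≤ length (cube n m)) (x : Cube n m) where
    open ℚP.≤-Reasoning
    xs = cube n m
    N = ι (length xs)
    S = Σℚ xs
    τ : Cube n m → Bool
    τ y = matches 0 Q x y ∧ avoids B y
    σ : ℚ
    σ = Σℚ (allFin m) (λ i → S (ind ∘ B i))
    split : ∀ y → 1ℚ ≤ℚ ind (τ y) ⊕ Σℚ (allFin m) (λ i → ind (B i y))
    split y = subst (λ b → 1ℚ ≤ℚ ind (b ∧ avoids B y) ⊕ Σℚ (allFin m) (λ i → ind (B i y)))
      (sym (matches-complete 0 Q x y (Keys.key-≡⁺ 0 Q Q x y (λ h ())))) (avoids-union B y)
    total : N ≤ℚ S (ind ∘ τ) ⊕ σ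
    total = begin
      N                                                              ≡⟨ trans (Σ-const xs 1ℚ) (ℚP.*-identityʳ N) ⟨
      S (λ _ → 1ℚ)                                                   ≤⟨ Σ-mono xs split ⟩
      S (λ y → ind (τ y) ⊕ Σℚ (allFin m) (λ i → ind (B i y)))         ≡⟨ Σ-⊕ xs (ind ∘ τ) (λ y → Σℚ (allFin m) (λ i → ind (B i y))) ⟩
      S (ind ∘ τ) ⊕ S (λ y → Σℚ (allFin m) (λ i → ind (B i y)))       ≡⟨ cong (S (ind ∘ τ) ⊕_) (Σ-swap xs (allFin m) (λ y i → ind (B i y))) ⟩
      S (ind ∘ τ) ⊕ σ                                                ∎
    few : ι 2 ⊗ ι m ⊗ σ ≤ℚ ι m ⊗ N
    few = begin
      ι 2 ⊗ ι m ⊗ σ                                                  ≡⟨ Σ-⊗ (allFin m) (ι 2 ⊗ ι m) (λ i → S (ind ∘ B i)) ⟨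
      Σℚ (allFin m) (λ i → ι 2 ⊗ ι m ⊗ S (ind ∘ B i))                ≤⟨ Σ-≤const (allFin m) N (λ i → subst (_≤ℚ N) (trans (ι-* (2 * m) (cnt xs (B i))) (cong₂ _⊗_ (ι-* 2 m) (ι-cnt xs (B i)))) (ι-mono (small i))) ⟩
      ι (length (allFin m)) ⊗ N                                      ≡⟨ cong (λ l → ι l ⊗ N) (ListP.length-tabulate {n = m} id) ⟩
      ι m ⊗ N                                                        ∎
    enough : length xs ≤ 2 * cnt xs τ
    enough = ι-cancel-≤ (subst (N ≤ℚ_) (sym (trans (ι-* 2 (cnt xs τ)) (cong₂ _⊗_ (ι≡ℕ→ℚ 2) (ι-cnt xs τ)))) (by-m m refl))
      where
      -- for m = 0 the sum over the coordinates is empty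
      by-m : ∀ k → k ≡ m → N ≤ℚ ℕ→ℚ 2 ⊗ S (ind ∘ τ)
      by-m zero refl = ≤ℚ-by (S (ind ∘ τ) ⊕ (S (ind ∘ τ) ⊕ 0ℚ ⊖ N)) (0≤⊕ (Σ-nonneg xs (λ y → 0≤ind (τ y))) (0≤⊖ total))
        (solve 2 (λ s n → con (ℕ→ℚ 2) :* s := n :+ (s :+ (s :+ con 0ℚ :- n))) refl (S (ind ∘ τ)) N)
      by-m (suc k) refl = ≤ℚ-by (ℕ→ℚ 2 ⊗ (S (ind ∘ τ) ⊕ σ ⊖ N) ⊕ (N ⊖ ℕ→ℚ 2 ⊗ σ))
        (0≤⊕ (0≤⊗ (subst (0ℚ ≤ℚ_) (ι≡ℕ→ℚ 2) (0≤ι 2)) (0≤⊖ total)) (0≤⊖ (⊗-cancelˡ-≤ (ι m) (1≤ι (s≤s z≤n))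
          (subst (_≤ℚ ι m ⊗ N) (trans (cong (λ w → w ⊗ ι m ⊗ σ) (ι≡ℕ→ℚ 2)) (solve 2 (λ m σ → con (ℕ→ℚ 2) :* m :* σ := m :* (con (ℕ→ℚ 2) :* σ)) refl (ι m) σ)) few))))
        (solve 3 (λ s σ n → con (ℕ→ℚ 2) :* s := n :+ (con (ℕ→ℚ 2) :* (s :+ σ :- n) :+ (n :- con (ℕ→ℚ 2) :* σ))) refl (S (ind ∘ τ)) σ N)

LStar-below : ∀ {m} t → t <ᴺ 2 ^ m → LStar m t
LStar-below zero    _  = LStar-zero
LStar-below (suc t) t< = LStar-suc t t< (LStar-below t (ℕP.<-trans (ℕP.n<1+n t) t<))

-- The simplex removal lemma

allF : ∀ {m} → (Fin m → Bool) → Bool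
allF P = not (anyF (not ∘ P))

not-false : ∀ {b} → not b ≡ false → b ≡ true
not-false {true} _ = refl

allF-true : ∀ {m} (P : Fin m → Bool) → allF P ≡ true → ∀ i → P i ≡ true
allF-true P e i = not-false (anyF-false (not ∘ P) (not-true e) i)

allF-true⁺ : ∀ {m} (P : Fin m → Bool) → (∀ i → P i ≡ true) → allF P ≡ true
allF-true⁺ P e = cong not (anyF-false⁺ (not ∘ P) (λ i → cong not (e i)))

any-true⁺ : ∀ {A : Set} (P : A → Bool) xs {x} → x ∈ xs → P x ≡ true → any P xs ≡ true
any-true⁺ P (x ∷ xs) (here refl) e rewrite e = refl
any-true⁺ P (y ∷ xs) (there x∈)  e with P y
... | true  = refl
... | false = any-true⁺ P xs x∈ e

any-true : ∀ {A : Set} (P : A → Bool) xs → any P xs ≡ true → ∃[ x ] (x ∈ xs × P x ≡ true)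
any-true P (x ∷ xs) e with P x in eq
... | true  = x , here refl , eq
... | false = let y , y∈ , e' = any-true P xs e in y , there y∈ , e'

anyF-true⁺ : ∀ {m} (P : Fin m → Bool) i → P i ≡ true → anyF P ≡ true
anyF-true⁺ {m} P i = any-true⁺ P (allFin m) (∈-allFin i)

anyF-true : ∀ {m} (P : Fin m → Bool) → anyF P ≡ true → ∃[ i ] P i ≡ true
anyF-true {m} P e = let i , _ , e' = any-true P (allFin m) e in i , e'

cnt-witness : ∀ {A : Set} (xs : List A) (P : A → Bool) → 1 ≤ cnt xs P → ∃[ x ] P x ≡ true
cnt-witness (x ∷ xs) P 1≤ with P x in e
... | true  = x , e
... | false = cnt-witness xs P 1≤

shadow : ∀ {n m} → (Cube n m → Bool) → Cube n m → Bool
shadow T y = allF (λ i → anyF (λ a → T (y [ i ]≔ a)))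

-- The members of `T` are facet-disjoint simplices.
Thin : ∀ {n m} → (Cube n m → Bool) → Set
Thin {n} {m} T = ∀ (i : Fin m) y a b → T (y [ i ]≔ a) ≡ true → T (y [ i ]≔ b) ≡ true → a ≡ b

module _ {n m : ℕ} where

  private
    xs = cube n m
    S = Σℚ xs

  fibre-count : ∀ (i : Fin m) (T B : Cube n m → Bool) (D : ℕ) → Indep i B →
    (∀ y → cnt (allFin n) (λ a → T (y [ i ]≔ a)) ≤ D) →
    n * cnt xs (λ y → B y ∧ T y) ≤ D * cnt xs B
  fibre-count i T B D B-indep fibre = ι-cancel-≤ (begin
    ι (n * cnt xs (λ y → B y ∧ T y))
      ≡⟨ trans (ι-* n _) (cong (ι n ⊗_) (ι-cnt xs (λ y → B y ∧ T y))) ⟩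
    ι n ⊗ S (λ y → ind (B y ∧ T y))
      ≡⟨ Σ-average i (λ y → ind (B y ∧ T y)) ⟨
    Σℚ (allFin n) (λ a → S (λ y → ind (B (y [ i ]≔ a) ∧ T (y [ i ]≔ a))))
      ≡⟨ Σ-swap (allFin n) xs (λ a y → ind (B (y [ i ]≔ a) ∧ T (y [ i ]≔ a))) ⟩
    S (λ y → Σℚ (allFin n) (λ a → ind (B (y [ i ]≔ a) ∧ T (y [ i ]≔ a))))
      ≤⟨ Σ-mono xs each ⟩
    S (λ y → ι D ⊗ ind (B y))
      ≡⟨ Σ-⊗ xs (ι D) (ind ∘ B) ⟩
    ι D ⊗ S (ind ∘ B)
      ≡⟨ trans (ι-* D (cnt xs B)) (cong (ι D ⊗_) (ι-cnt xs B)) ⟨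
    ι (D * cnt xs B) ∎)
    where
    open ℚP.≤-Reasoning
    each : ∀ y → Σℚ (allFin n) (λ a → ind (B (y [ i ]≔ a) ∧ T (y [ i ]≔ a))) ≤ℚ ι D ⊗ ind (B y)
    each y = begin
      Σℚ (allFin n) (λ a → ind (B (y [ i ]≔ a) ∧ T (y [ i ]≔ a)))
        ≡⟨ Σ-cong (allFin n) (λ a → trans (cong (λ b → ind (b ∧ T (y [ i ]≔ a))) (B-indep y a)) (ind-∧ (B y) (T (y [ i ]≔ a)))) ⟩
      Σℚ (allFin n) (λ a → ind (B y) ⊗ ind (T (y [ i ]≔ a)))
        ≡⟨ trans (Σ-⊗ (allFin n) (ind (B y)) (λ a → ind (T (y [ i ]≔ a)))) (cong (ind (B y) ⊗_) (sym (ι-cnt (allFin n) (λ a → T (y [ i ]≔ a))))) ⟩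
      ind (B y) ⊗ ι (cnt (allFin n) (λ a → T (y [ i ]≔ a)))
        ≤⟨ ⊗-monoˡ-≤ (0≤ind (B y)) (ι-mono (fibre y)) ⟩
      ind (B y) ⊗ ι D
        ≡⟨ ℚP.*-comm (ind (B y)) (ι D) ⟩
      ι D ⊗ ind (B y) ∎

cnt-≤1 : ∀ {A : Set} (xs : List A) → AllPairs.AllPairs _≢_ xs → (P : A → Bool) → (∀ x y → P x ≡ true → P y ≡ true → x ≡ y) → cnt xs P ≤ 1
cnt-≤1 []       _          P uniq = z≤n
cnt-≤1 (x ∷ xs) (x∉ AllPairs.∷ u) P uniq with P x in e
... | false = cnt-≤1 xs u P uniq
... | true  = s≤s (ℕP.≤-reflexive (none xs x∉))
  where
  none : ∀ ys → All.All (x ≢_) ys → cnt ys P ≡ 0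
  none []       _               = refl
  none (y ∷ ys) (x≢y All.∷ x∉′) with P y in e'
  ... | true  = ⊥-elim (x≢y (uniq x y e e'))
  ... | false = none ys x∉′

module Removal (k D n : ℕ) (T : Cube n (suc k) → Bool) (thin : Thin T) (dense : n ^ k ≤ D * cnt (cube n (suc k)) T) (1≤n : 1 ≤ n) where

  private
    m = suc k
    xs = cube n m
    S = Σℚ xs

  E : Fin m → Cube n m → Bool
  E i y = anyF (λ a → T (y [ i ]≔ a))

  E-indep : ∀ i → Indep i (E i)
  E-indep i y b = any-cong (allFin n) (λ a → cong T (VecP.[]≔-idempotent y i))

  facet : Fin m → Vec Bool m
  facet i = replicate m true [ i ]≔ false

  facet-∉ : ∀ i → lookup (facet i) i ≡ false
  facet-∉ i = VecP.lookup∘update i (replicate m true) false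

  facet-∉⁻ : ∀ i j → lookup (facet i) j ≡ false → j ≡ i
  facet-∉⁻ i j e with j Data.Fin.≟ i
  ... | yes j≡i = j≡i
  ... | no  j≢i with () ← trans (sym e) (trans (VecP.lookup∘update′ j≢i (replicate m true) false) (VecP.lookup-replicate j true))

  private
    isFacet : Vec Bool m → Fin m → Bool
    isFacet h i = isYes (VecP.≡-dec Data.Bool._≟_ h (facet i))

    -- Only the sets with one coordinate missing carry information, namely whether the facet extends
    -- to a member of `T`. For all other sets the condition is vacuous.
    colour : Vec Bool m → Cube n m → Bool
    colour h x = allF (λ i → not (isFacet h i) ∨ E i x)

  Q : Family n m
  Q = record { col = λ h x → if colour h x then 1 else 0 ; meas = λ h j j∉h x a → cong (λ b → if b then 1 else 0) (cong not (any-cong (allFin m) (step h j j∉h x a))) }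
    where
    step : ∀ h j → lookup h j ≡ false → ∀ x a i → not (not (isFacet h i) ∨ E i (x [ j ]≔ a)) ≡ not (not (isFacet h i) ∨ E i x)
    step h j j∉h x a i with VecP.≡-dec Data.Bool._≟_ h (facet i)
    ... | no _ = refl
    ... | yes refl with facet-∉⁻ i j j∉h
    ...   | refl = cong not (E-indep i x a)

  Q< : Bounded Q 2
  Q< h x with colour h x
  ... | true  = s≤s (s≤s z≤n)
  ... | false = s≤s z≤n

  col-facet : ∀ i x → E i x ≡ true → col Q (facet i) x ≡ 1
  col-facet i x e = cong (λ b → if b then 1 else 0) (allF-true⁺ (λ j → not (isFacet (facet i) j) ∨ E j x) step)
    where
    step : ∀ j → not (isFacet (facet i) j) ∨ E j x ≡ true
    step j with VecP.≡-dec Data.Bool._≟_ (facet i) (facet j)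
    ... | no _  = refl
    ... | yes p = subst (λ j → E j x ≡ true) (sym (facet-∉⁻ i j (subst (λ h → lookup h j ≡ false) (sym p) (facet-∉ j)))) e

  facet-col : ∀ i x → col Q (facet i) x ≡ 1 → E i x ≡ true
  facet-col i x e = from (allF-true (λ j → not (isFacet (facet i) j) ∨ E j x) (one (colour (facet i) x) e) i)
    where
    one : ∀ b → (if b then 1 else 0) ≡ 1 → b ≡ true
    one true _ = refl
    from : not (isFacet (facet i) i) ∨ E i x ≡ true → E i x ≡ true
    from = subst (λ b → not b ∨ E i x ≡ true → E i x ≡ true) (sym (isYes-true⁺ (VecP.≡-dec Data.Bool._≟_ (facet i) (facet i)) refl)) id

  -- The code of the full set, hence above the codes of all facets.
  top : ℕ
  top = 2 ^ m ∸ 1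

  facet-below : ∀ i → code (facet i) <ᴺ top
  facet-below i = ℕP.∸-monoˡ-≤ 1 (code-missing (facet i) i (facet-∉ i))

  top< : top <ᴺ 2 ^ m
  top< = ℕP.∸-monoʳ-< {2 ^ m} {1} {0} (s≤s z≤n) (ℕP.m^n>0 2 m)

  -- A thin `T` has at most n^k / z members in a bad facet set, hence at most D |T| / z. The `m` bad
  -- sets together miss a member of `T` as soon as z exceeds m D.
  z : ℕ
  z = suc (m * D)

  private
    regular = proj₂ (LStar-below {m} top top< z) 2

  conclusion : Conclusion top z (proj₁ regular) Q (λ _ _ → false)
  conclusion = proj₂ regular Q Q< (λ _ _ → false) (λ _ _ _ → refl) (λ i → ℕP.≤-trans (ℕP.≤-reflexive (trans (cong (proj₁ (LStar-below {m} top top< z) *_) (cnt-false xs)) (ℕP.*-zeroʳ (proj₁ (LStar-below {m} top top< z))))) z≤n)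
    where
    cnt-false : ∀ {A : Set} (xs : List A) → cnt xs (λ _ → false) ≡ 0
    cnt-false []       = refl
    cnt-false (x ∷ xs) = cnt-false xs

  Bad : Fin m → Cube n m → Bool
  Bad = proj₁ conclusion

  bad-few : ∀ i → z * cnt xs (λ y → Bad i y ∧ T y) ≤ n ^ k
  bad-few i = ℕP.*-cancelˡ-≤ n {{ℕ.>-nonZero 1≤n}} (begin
    n * (z * cnt xs (λ y → Bad i y ∧ T y))   ≡⟨ trans (sym (ℕP.*-assoc n z _)) (trans (cong (_* cnt xs (λ y → Bad i y ∧ T y)) (ℕP.*-comm n z)) (ℕP.*-assoc z n _)) ⟩
    z * (n * cnt xs (λ y → Bad i y ∧ T y))   ≤⟨ ℕP.*-monoʳ-≤ z (fibre-count i T (Bad i) 1 (proj₁ (proj₂ conclusion) i) (λ y → cnt-≤1 (allFin n) (UniqueP.allFin⁺ n) (λ a → T (y [ i ]≔ a)) (thin i y))) ⟩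
    z * (1 * cnt xs (Bad i))                 ≡⟨ cong (z *_) (ℕP.*-identityˡ _) ⟩
    z * cnt xs (Bad i)                       ≤⟨ proj₁ (proj₂ (proj₂ conclusion)) i ⟩
    length xs                                ≡⟨ length-cube n m ⟩
    n * n ^ k                                ∎)
    where open ℕP.≤-Reasoning

  survivor : ∃[ x ] (T x ≡ true × (∀ i → Bad i x ≡ false))
  survivor = let x , e = cnt-witness xs P 1≤P
                 eT , eB = ∧-true {T x} {not (anyF (λ i → Bad i x))} e
             in x , eT , anyF-false (λ i → Bad i x) (not-true eB)
    where
    P : Cube n m → Bool
    P y = T y ∧ not (anyF (λ i → Bad i y))
    split : ∀ y → ind (T y) ≤ℚ ind (P y) ⊕ Σℚ (allFin m) (λ i → ind (Bad i y ∧ T y))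
    split y with T y
    ... | false = 0≤⊕ {0ℚ} ℚP.≤-refl (Σ-nonneg (allFin m) (λ i → 0≤ind (Bad i y ∧ false)))
    ... | true  with anyF (λ i → Bad i y) in e
    ...   | false = ≤ℚ-by (Σℚ (allFin m) (λ i → ind (Bad i y ∧ true))) (Σ-nonneg (allFin m) (λ i → 0≤ind (Bad i y ∧ true))) refl
    ...   | true  = ℚP.≤-trans (subst (λ b → ind b ≤ℚ Σℚ (allFin m) (λ i → ind (Bad i y))) e (ind-any (λ i → Bad i y) (allFin m)))
                      (ℚP.≤-reflexive (trans (Σ-cong (allFin m) (λ i → cong ind (sym (∧-identityʳ (Bad i y))))) (sym (ℚP.+-identityˡ _))))
    σ : ℚ
    σ = Σℚ (allFin m) (λ i → ι (cnt xs (λ y → Bad i y ∧ T y)))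
    few : ι z ⊗ σ ≤ℚ ι (m * D * cnt xs T)
    few = begin
      ι z ⊗ σ                                                            ≡⟨ Σ-⊗ (allFin m) (ι z) (λ i → ι (cnt xs (λ y → Bad i y ∧ T y))) ⟨
      Σℚ (allFin m) (λ i → ι z ⊗ ι (cnt xs (λ y → Bad i y ∧ T y)))       ≤⟨ Σ-≤const (allFin m) (ι (D * cnt xs T)) (λ i → ℚP.≤-trans (ℚP.≤-reflexive (sym (ι-* z _))) (ι-mono (ℕP.≤-trans (bad-few i) dense))) ⟩
      ι (length (allFin m)) ⊗ ι (D * cnt xs T)                           ≡⟨ trans (cong (λ l → ι l ⊗ ι (D * cnt xs T)) (ListP.length-tabulate {n = m} id)) (trans (sym (ι-* m (D * cnt xs T))) (cong ι (sym (ℕP.*-assoc m D (cnt xs T))))) ⟩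
      ι (m * D * cnt xs T)                                               ∎
      where open ℚP.≤-Reasoning
    total : ι (cnt xs T) ≤ℚ ι (cnt xs P) ⊕ σ
    total = begin
      ι (cnt xs T)                                                                 ≡⟨ ι-cnt xs T ⟩
      S (ind ∘ T)                                                                  ≤⟨ Σ-mono xs split ⟩
      S (λ y → ind (P y) ⊕ Σℚ (allFin m) (λ i → ind (Bad i y ∧ T y)))               ≡⟨ Σ-⊕ xs (ind ∘ P) (λ y → Σℚ (allFin m) (λ i → ind (Bad i y ∧ T y))) ⟩
      S (ind ∘ P) ⊕ S (λ y → Σℚ (allFin m) (λ i → ind (Bad i y ∧ T y)))             ≡⟨ cong₂ _⊕_ (sym (ι-cnt xs P)) (trans (Σ-swap xs (allFin m) (λ y i → ind (Bad i y ∧ T y))) (Σ-cong (allFin m) (λ i → sym (ι-cnt xs (λ y → Bad i y ∧ T y))))) ⟩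
      ι (cnt xs P) ⊕ σ                                                             ∎
      where open ℚP.≤-Reasoning
    main : z * cnt xs T ≤ z * cnt xs P + m * D * cnt xs T
    main = ι-cancel-≤ (subst₂ _≤ℚ_ (sym (ι-* z (cnt xs T))) (sym (trans (ι-+ (z * cnt xs P) (m * D * cnt xs T)) (cong (_⊕ ι (m * D * cnt xs T)) (ι-* z (cnt xs P)))))
      (ℚP.≤-trans (⊗-monoˡ-≤ (0≤ι z) total) (ℚP.≤-trans (ℚP.≤-reflexive (ℚP.*-distribˡ-+ (ι z) (ι (cnt xs P)) σ)) (ℚP.+-monoʳ-≤ (ι z ⊗ ι (cnt xs P)) few))))
    1≤T : 1 ≤ cnt xs T
    1≤T = pos (cnt xs T) dense
      where
      pos : ∀ c → n ^ k ≤ D * c → 1 ≤ c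
      pos (suc _) _  = s≤s z≤n
      pos zero    le = ℕP.≤-trans (ℕP.m^n>0 n {{ℕ.>-nonZero 1≤n}} k) (ℕP.≤-trans le (ℕP.≤-reflexive (ℕP.*-zeroʳ D)))
    1≤P : 1 ≤ cnt xs P
    1≤P = pos (cnt xs P) main
      where
      pos : ∀ c → z * cnt xs T ≤ z * c + m * D * cnt xs T → 1 ≤ c
      pos (suc _) _  = s≤s z≤n
      pos zero    le = ℕP.≤-trans 1≤T (ℕP.+-cancelʳ-≤ (m * D * cnt xs T) (cnt xs T) 0 (ℕP.≤-trans le (ℕP.≤-reflexive (cong (_+ m * D * cnt xs T) (ℕP.*-zeroʳ z)))))

  -- All facets of the survivor extend to a member of `T`, namely itself; a point with the same
  -- facet colours therefore lies in the shadow.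
  many : n ^ m ≤ proj₁ regular * cnt xs (shadow T)
  many = let x , Tx , good = survivor in
    ℕP.≤-trans (ℕP.≤-reflexive (sym (length-cube n m))) (ℕP.≤-trans (proj₂ (proj₂ (proj₂ conclusion)) x good)
      (ℕP.*-monoʳ-≤ (proj₁ regular) (cnt-mono xs {λ y → matches top Q x y ∧ avoids (λ _ _ → false) y} {shadow T} (lift x Tx))))
    where
    lift : ∀ x → T x ≡ true → ∀ y → matches top Q x y ∧ avoids (λ _ _ → false) y ≡ true → shadow T y ≡ true
    lift x Tx y e = allF-true⁺ (λ i → E i y) (λ i → facet-col i y
      (trans (sym (Keys.key-≡ top Q x y (matches-sound top Q x y (proj₁ (∧-true e))) (facet i) (facet-below i)))
             (col-facet i x (anyF-true⁺ (λ a → T (x [ i ]≔ a)) (lookup x i) (trans (cong T (VecP.[]≔-lookup x i)) Tx)))))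

abstract

  removal : ∀ k D → ∃[ D' ] (∀ {n} (T : Cube n (suc k) → Bool) → Thin T → n ^ k ≤ D * cnt (cube n (suc k)) T →
            n ^ suc k ≤ D' * cnt (cube n (suc k)) (shadow T))
  removal k D = proj₁ (proj₂ (LStar-below {suc k} (2 ^ suc k ∸ 1) (ℕP.∸-monoʳ-< {2 ^ suc k} {1} {0} (s≤s z≤n) (ℕP.m^n>0 2 (suc k))) (suc (suc k * D))) 2) , λ
    { {zero}  T thin dense → z≤n
    ; {suc n} T thin dense → Removal.many k D (suc n) T thin dense (s≤s z≤n) }

-- Counting and greedy selection in lists

T⇒≡ : ∀ {b} → T b → b ≡ true
T⇒≡ {true} _ = refl

≡⇒T : ∀ {b} → b ≡ true → T b
≡⇒T refl = tt

module _ {A : Set} where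

  length-filterᵇ : ∀ (P : A → Bool) xs → length (filterᵇ P xs) ≡ cnt xs P
  length-filterᵇ P []       = refl
  length-filterᵇ P (x ∷ xs) with P x
  ... | true  = cong suc (length-filterᵇ P xs)
  ... | false = length-filterᵇ P xs

  ∈-filterᵇ⁻ : ∀ (P : A → Bool) {xs x} → x ∈ filterᵇ P xs → x ∈ xs × P x ≡ true
  ∈-filterᵇ⁻ P {xs} x∈ = let x∈xs , t = ∈-filter⁻ (T? ∘ P) {xs = xs} x∈ in x∈xs , T⇒≡ t

  ∈-filterᵇ⁺ : ∀ (P : A → Bool) {xs x} → x ∈ xs → P x ≡ true → x ∈ filterᵇ P xs
  ∈-filterᵇ⁺ P x∈ e = ∈-filter⁺ (T? ∘ P) x∈ (≡⇒T e)

  cnt-≤length : ∀ (xs : List A) P → cnt xs P ≤ length xs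
  cnt-≤length []       P = z≤n
  cnt-≤length (x ∷ xs) P with P x
  ... | true  = s≤s (cnt-≤length xs P)
  ... | false = ℕP.m≤n⇒m≤1+n (cnt-≤length xs P)

  cnt-true : ∀ (xs : List A) → cnt xs (λ _ → true) ≡ length xs
  cnt-true []       = refl
  cnt-true (x ∷ xs) = cong suc (cnt-true xs)

  cnt-false : ∀ (xs : List A) → cnt xs (λ _ → false) ≡ 0
  cnt-false []       = refl
  cnt-false (x ∷ xs) = cnt-false xs

  cnt-cong : ∀ (xs : List A) {P P' : A → Bool} → (∀ x → P x ≡ P' x) → cnt xs P ≡ cnt xs P'
  cnt-cong []       e = refl
  cnt-cong (x ∷ xs) e = cong₂ (λ b c → (if b then 1 else 0) + c) (e x) (cnt-cong xs e)

  cnt-++ : ∀ (xs ys : List A) P → cnt (xs ++ ys) P ≡ cnt xs P + cnt ys P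
  cnt-++ []       ys P = refl
  cnt-++ (x ∷ xs) ys P = trans (cong ((if P x then 1 else 0) +_) (cnt-++ xs ys P)) (sym (ℕP.+-assoc (if P x then 1 else 0) _ _))

  cnt-split : ∀ (xs : List A) (P Q : A → Bool) → cnt xs P ≡ cnt xs (λ x → P x ∧ Q x) + cnt xs (λ x → P x ∧ not (Q x))
  cnt-split []       P Q = refl
  cnt-split (x ∷ xs) P Q with P x | Q x
  ... | false | _     = cnt-split xs P Q
  ... | true  | true  = cong suc (cnt-split xs P Q)
  ... | true  | false = trans (cong suc (cnt-split xs P Q)) (sym (ℕP.+-suc _ _))

  cnt-pos : ∀ {xs : List A} {x} (P : A → Bool) → x ∈ xs → P x ≡ true → 1 ≤ cnt xs P
  cnt-pos {xs = x ∷ xs} P (here refl) e rewrite e = s≤s z≤n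
  cnt-pos {xs = y ∷ xs} P (there x∈)  e = ℕP.≤-trans (cnt-pos P x∈ e) (ℕP.m≤n+m _ (if P y then 1 else 0))

  cnt-mono-∈ : ∀ (xs : List A) {P P' : A → Bool} → (∀ {x} → x ∈ xs → P x ≡ true → P' x ≡ true) → cnt xs P ≤ cnt xs P'
  cnt-mono-∈ []       imp = z≤n
  cnt-mono-∈ (x ∷ xs) {P} {P'} imp with P x in e | P' x in e'
  ... | false | false = cnt-mono-∈ xs (imp ∘ there)
  ... | false | true  = ℕP.m≤n⇒m≤1+n (cnt-mono-∈ xs (imp ∘ there))
  ... | true  | true  = s≤s (cnt-mono-∈ xs (imp ∘ there))
  ... | true  | false with () ← trans (sym e') (imp (here refl) e)

  cnt-filterᵇ : ∀ (xs : List A) P Q → cnt (filterᵇ P xs) Q ≡ cnt xs (λ x → P x ∧ Q x)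
  cnt-filterᵇ []       P Q = refl
  cnt-filterᵇ (x ∷ xs) P Q with P x
  ... | true  = cong ((if Q x then 1 else 0) +_) (cnt-filterᵇ xs P Q)
  ... | false = cnt-filterᵇ xs P Q

  cnt-take : ∀ r (xs : List A) P → cnt (take r xs) P ≤ cnt xs P
  cnt-take zero    xs       P = z≤n
  cnt-take (suc r) []       P = z≤n
  cnt-take (suc r) (x ∷ xs) P = ℕP.+-monoʳ-≤ (if P x then 1 else 0) (cnt-take r xs P)

  AllPairs-∈ : ∀ {R : A → A → Set} {xs} → AllPairs R xs → ∀ {x y} → x ∈ xs → y ∈ xs → x ≡ y ⊎ (R x y ⊎ R y x)
  AllPairs-∈ (r ∷ rs) (here refl) (here refl) = inj₁ refl
  AllPairs-∈ (r ∷ rs) (here refl) (there y∈)  = inj₂ (inj₁ (All.lookup r y∈))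
  AllPairs-∈ (r ∷ rs) (there x∈)  (here refl) = inj₂ (inj₂ (All.lookup r x∈))
  AllPairs-∈ (r ∷ rs) (there x∈)  (there y∈)  = AllPairs-∈ rs x∈ y∈

  private
    remove : ∀ {x : A} {ys} → x ∈ ys → List A
    remove {ys = y ∷ ys} (here _)   = ys
    remove {ys = y ∷ ys} (there x∈) = y ∷ remove x∈

    length-remove : ∀ {x : A} {ys} (x∈ : x ∈ ys) → length ys ≡ suc (length (remove x∈))
    length-remove (here _)   = refl
    length-remove (there x∈) = cong suc (length-remove x∈)

    ∈-remove : ∀ {x z : A} {ys} (x∈ : x ∈ ys) → z ∈ ys → x ≢ z → z ∈ remove x∈
    ∈-remove (here refl) (here refl) x≢z = ⊥-elim (x≢z refl)
    ∈-remove (here _)    (there z∈)  x≢z = z∈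
    ∈-remove (there x∈)  (here refl) x≢z = here refl
    ∈-remove (there x∈)  (there z∈)  x≢z = there (∈-remove x∈ z∈ x≢z)

  unique-length-≤ : ∀ {xs ys : List A} → Unique xs → (∀ {x} → x ∈ xs → x ∈ ys) → length xs ≤ length ys
  unique-length-≤ {[]}     u sub = z≤n
  unique-length-≤ {x ∷ xs} (x∉ ∷ u) sub = subst (suc (length xs) ≤_) (sym (length-remove (sub (here refl))))
    (s≤s (unique-length-≤ u (λ z∈ → ∈-remove (sub (here refl)) (sub (there z∈)) (All.lookup x∉ z∈))))

  -- Greedy choice: a selected entry discards the at most `C` entries in conflict with it.
  -- Reflexivity counts the entry itself among them.
  independent-sublist : (conf : A → A → Bool) (C : ℕ) → ∀ fuel (L : List A) → length L ≤ fuel →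
           (∀ {x} → x ∈ L → conf x x ≡ true) → (∀ {x} → x ∈ L → cnt L (conf x) ≤ C) →
           ∃[ L' ] ((∀ {x} → x ∈ L' → x ∈ L) × AllPairs (λ x y → conf x y ≡ false) L' × length L ≤ C * length L')
  independent-sublist conf C fuel       []      le rfl few = [] , id , [] , z≤n
  independent-sublist conf C (suc fuel) (x ∷ L) (s≤s le) rfl few =
    x ∷ L' , sub , All.tabulate (λ y∈ → not-true (proj₂ (∈-filterᵇ⁻ (not ∘ conf x) {L} (proj₁ (proj₂ rec) y∈)))) ∷ proj₁ (proj₂ (proj₂ rec)) , bound
    where
    L₁ = filterᵇ (not ∘ conf x) L
    len₁ : length L₁ ≡ cnt L (not ∘ conf x)
    len₁ = length-filterᵇ (not ∘ conf x) L
    few₁ : ∀ {y} → y ∈ L₁ → cnt L₁ (conf y) ≤ C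
    few₁ {y} y∈ = ℕP.≤-trans (ℕP.≤-reflexive (cnt-filterᵇ L (not ∘ conf x) (conf y)))
      (ℕP.≤-trans (cnt-mono L {λ z → not (conf x z) ∧ conf y z} {conf y} (λ z e → proj₂ (∧-true {not (conf x z)} e)))
        (ℕP.≤-trans (ℕP.m≤n+m _ (if conf y x then 1 else 0)) (few (there (proj₁ (∈-filterᵇ⁻ (not ∘ conf x) y∈))))))
    rec = independent-sublist conf C fuel L₁ (ℕP.≤-trans (ℕP.≤-trans (ℕP.≤-reflexive len₁) (cnt-≤length L _)) le)
            (λ y∈ → rfl (there (proj₁ (∈-filterᵇ⁻ (not ∘ conf x) y∈)))) few₁
    L' = proj₁ rec
    sub : ∀ {y} → y ∈ x ∷ L' → y ∈ x ∷ L
    sub (here refl) = here refl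
    sub (there y∈)  = there (proj₁ (∈-filterᵇ⁻ (not ∘ conf x) (proj₁ (proj₂ rec) y∈)))
    bound : suc (length L) ≤ C * suc (length L')
    bound = begin
      suc (length L)                                       ≡⟨ cong suc (trans (sym (cnt-true L)) (cnt-split L (λ _ → true) (conf x))) ⟩
      suc (cnt L (conf x)) + cnt L (not ∘ conf x)          ≤⟨ ℕP.+-mono-≤ (subst (_≤ C) (cong (λ b → (if b then 1 else 0) + cnt L (conf x)) (rfl (here refl))) (few (here refl))) (ℕP.≤-reflexive (sym len₁)) ⟩
      C + length L₁                                        ≤⟨ ℕP.+-monoʳ-≤ C (proj₂ (proj₂ (proj₂ rec))) ⟩
      C + C * length L'                                    ≡⟨ ℕP.*-suc C (length L') ⟨
      C * suc (length L')                                  ∎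
      where open ℕP.≤-Reasoning

module _ {A B : Set} where

  cnt-map : ∀ (xs : List A) (f : A → B) P → cnt (map f xs) P ≡ cnt xs (P ∘ f)
  cnt-map []       f P = refl
  cnt-map (x ∷ xs) f P = cong ((if P (f x) then 1 else 0) +_) (cnt-map xs f P)

  cnt-any : ∀ (xs : List A) (ys : List B) (P : B → A → Bool) C → (∀ {y} → y ∈ ys → cnt xs (P y) ≤ C) →
            cnt xs (λ x → any (λ y → P y x) ys) ≤ length ys * C
  cnt-any xs []       P C few = ℕP.≤-reflexive (cnt-false xs)
  cnt-any xs (y ∷ ys) P C few = ℕP.≤-trans (cnt-∨ xs (P y) (λ x → any (λ y → P y x) ys)) (ℕP.+-mono-≤ (few (here refl)) (cnt-any xs ys P C (few ∘ there)))
    where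
    cnt-∨ : ∀ (xs : List A) P Q → cnt xs (λ x → P x ∨ Q x) ≤ cnt xs P + cnt xs Q
    cnt-∨ []       P Q = z≤n
    cnt-∨ (x ∷ xs) P Q with P x | Q x
    ... | true  | true  = s≤s (ℕP.≤-trans (cnt-∨ xs P Q) (ℕP.+-monoʳ-≤ (cnt xs P) (ℕP.n≤1+n _)))
    ... | true  | false = s≤s (cnt-∨ xs P Q)
    ... | false | true  = ℕP.≤-trans (s≤s (cnt-∨ xs P Q)) (ℕP.≤-reflexive (sym (ℕP.+-suc _ _)))
    ... | false | false = cnt-∨ xs P Q

  consIf : ∀ {b'} b → b' ≡ b → (b' ≡ true → B) → List B → List B
  consIf true  e g L = g e ∷ L
  consIf false e g L = L

  collect : (xs : List A) (P : A → Bool) → (∀ x → P x ≡ true → B) → List B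
  collect []       P f = []
  collect (x ∷ xs) P f = consIf (P x) refl (f x) (collect xs P f)

  length-collect : ∀ xs P f → length (collect xs P f) ≡ cnt xs P
  length-collect []       P f = refl
  length-collect (x ∷ xs) P f = trans (len (P x) refl) (cong ((if P x then 1 else 0) +_) (length-collect xs P f))
    where
    len : ∀ b e → length (consIf b e (f x) (collect xs P f)) ≡ (if b then 1 else 0) + length (collect xs P f)
    len true  e = refl
    len false e = refl

  All-collect : ∀ {Q : B → Set} {R : A → Set} xs P f → All R xs → (∀ {x} e → R x → Q (f x e)) → All Q (collect xs P f)
  All-collect []       P f _        q = []
  All-collect {Q} (x ∷ xs) P f (r ∷ rs) q = go (P x) refl
    where
    go : ∀ b e → All Q (consIf b e (f x) (collect xs P f))
    go true  e = q e r ∷ All-collect xs P f rs q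
    go false e = All-collect xs P f rs q

  AllPairs-collect : ∀ {R : A → A → Set} {Q : B → B → Set} xs P f → AllPairs R xs →
    (∀ x y e e' → R x y → Q (f x e) (f y e')) → AllPairs Q (collect xs P f)
  AllPairs-collect []       P f _        q = []
  AllPairs-collect {R} {Q} (x ∷ xs) P f (r ∷ rs) q = go (P x) refl
    where
    go : ∀ b e → AllPairs Q (consIf b e (f x) (collect xs P f))
    go true  e = All-collect {R = R x} xs P f r (λ {y} e' → q x y e e') ∷ AllPairs-collect xs P f rs q
    go false e = AllPairs-collect xs P f rs q

cube-unique : ∀ n m → Unique (cube n m)
cube-unique n zero    = [] ∷ []
cube-unique n (suc m) = UniqueP.concat⁺ (AllP.map⁺ (All.universal (λ a → UniqueP.map⁺ VecP.∷-injectiveʳ (cube-unique n m)) (allFin n)))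
  (AllPairsP.map⁺ (AllPairs.map disjoint (UniqueP.allFin⁺ n)))
  where
  disjoint : ∀ {a b} → a ≢ b → ∀ {v} → ¬ (v ∈ map (a ∷_) (cube n m) × v ∈ map (b ∷_) (cube n m))
  disjoint a≢b (v∈a , v∈b) with ∈-map⁻ _ v∈a | ∈-map⁻ _ v∈b
  ... | _ , _ , refl | _ , _ , e = a≢b (VecP.∷-injectiveˡ e)

-- Configurations in 3-graphs

module _ {n : ℕ} where

  Win : ℕ → ℕ → ThreeGraph n → Set
  Win e d H = ∃[ S ] (S ⊆ edges H × length S ≡ e × ∣ ⋃ S ∣ ≤ e + d)

  sublist? : ∀ {A : Set} (xs : List A) {P : List A → Set} → (∀ S → Dec (P S)) → Dec (∃[ S ] (S ⊆ xs × P S))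
  sublist? []       P? with P? []
  ... | yes p = yes ([] , [] , p)
  ... | no ¬p = no λ { ([] , [] , p) → ¬p p }
  sublist? (x ∷ xs) P? with sublist? xs P? | sublist? xs (λ S → P? (x ∷ S))
  ... | yes (S , s , p) | _               = yes (S , x ∷ʳ s , p)
  ... | no _            | yes (S , s , p) = yes (x ∷ S , refl ∷ s , p)
  ... | no ¬p           | no ¬q           = no λ { (S , _ ∷ʳ s , p) → ¬p (S , s , p) ; (_ ∷ S , refl ∷ s , p) → ¬q (S , s , p) }

  win? : ∀ e d H → Dec (Win e d H)
  win? e d H = sublist? (edges H) (λ S → (length S ℕP.≟ e) ×-dec (∣ ⋃ S ∣ ℕP.≤? (e + d)))

  ∈-⋃ : ∀ {x : Fin n} (S : List (Subset n)) → x ∈ˢ ⋃ S → ∃[ E ] (E ∈ S × x ∈ˢ E)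
  ∈-⋃ []      x∈ = ⊥-elim (SubsetP.∉⊥ x∈)
  ∈-⋃ (E ∷ S) x∈ with SubsetP.x∈p∪q⁻ E (⋃ S) x∈
  ... | inj₁ x∈E = E , here refl , x∈E
  ... | inj₂ x∈S = let F , F∈ , x∈F = ∈-⋃ S x∈S in F , there F∈ , x∈F

  ∣p∪q∣≤ : ∀ {n} (p q : Subset n) → ∣ p ∪ q ∣ ≤ ∣ p ∣ + ∣ q ∣
  ∣p∪q∣≤ []          []          = z≤n
  ∣p∪q∣≤ (true ∷ p)  (true ∷ q)  = s≤s (ℕP.≤-trans (∣p∪q∣≤ p q) (ℕP.+-monoʳ-≤ ∣ p ∣ (ℕP.n≤1+n _)))
  ∣p∪q∣≤ (true ∷ p)  (false ∷ q) = s≤s (∣p∪q∣≤ p q)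
  ∣p∪q∣≤ (false ∷ p) (true ∷ q)  = ℕP.≤-trans (s≤s (∣p∪q∣≤ p q)) (ℕP.≤-reflexive (sym (ℕP.+-suc _ _)))
  ∣p∪q∣≤ (false ∷ p) (false ∷ q) = ∣p∪q∣≤ p q

  card-≤ : ∀ (vs : List (Fin n)) (p : Subset n) → (∀ {x} → x ∈ˢ p → x ∈ vs) → ∣ p ∣ ≤ length vs
  card-≤ vs p sub = ℕP.≤-trans (SubsetP.p⊆q⇒∣p∣≤∣q∣ (λ x∈ → cover vs (sub x∈))) (size vs)
    where
    cover : ∀ vs {x} → x ∈ vs → x ∈ˢ ⋃ (map ⁅_⁆ vs)
    cover (v ∷ vs) (here refl) = SubsetP.x∈p∪q⁺ (inj₁ (SubsetP.x∈⁅x⁆ v))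
    cover (v ∷ vs) (there x∈)  = SubsetP.x∈p∪q⁺ (inj₂ (cover vs x∈))
    size : ∀ vs → ∣ ⋃ (map ⁅_⁆ vs) ∣ ≤ length vs
    size []       = ℕP.≤-reflexive (SubsetP.∣⊥∣≡0 n)
    size (v ∷ vs) = ℕP.≤-trans (∣p∪q∣≤ ⁅ v ⁆ (⋃ (map ⁅_⁆ vs))) (ℕP.+-mono-≤ (ℕP.≤-reflexive (SubsetP.∣⁅x⁆∣≡1 v)) (size vs))

  -- The edges may be listed in any order: the sublist is recovered by filtering `edges H`, and
  -- uniqueness on both sides shows that its length is unchanged.
  win-intro : ∀ {e d} (H : ThreeGraph n) (es : List (Subset n)) (vs : List (Fin n)) → Unique es → All (_∈ edges H) es →
              length es ≡ e → (∀ {E x} → E ∈ es → x ∈ˢ E → x ∈ vs) → length vs ≤ e + d → Win e d H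
  win-intro {e} {d} H es vs u es∈ len cov small =
    S , SublistP.filter-⊆ inEs (edges H) , trans (ℕP.≤-antisym le ge) len ,
    ℕP.≤-trans (card-≤ vs (⋃ S) (λ x∈ → let E , E∈ , x∈E = ∈-⋃ S x∈ in cov (proj₂ (∈-filter⁻ inEs {xs = edges H} E∈)) x∈E)) small
    where
    _≟ˢ_ : DecidableEquality (Subset n)
    _≟ˢ_ = VecP.≡-dec Data.Bool._≟_
    inEs : ∀ E → Dec (E ∈ es)
    inEs E = Any.any? (E ≟ˢ_) es
    S = filter inEs (edges H)
    le : length S ≤ length es
    le = unique-length-≤ (UniqueP.filter⁺ inEs (distinct H)) (λ E∈ → proj₂ (∈-filter⁻ inEs {xs = edges H} E∈))
    ge : length es ≤ length S
    ge = unique-length-≤ u (λ E∈ → ∈-filter⁺ inEs (All.lookup es∈ E∈) E∈)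

-- Patterns, excess and admissibility

module _ {V : Set} where

  verts : V × V × V → List V
  verts (u , v , w) = u ∷ v ∷ w ∷ []

  inside : (V → Bool) → V × V × V → Bool
  inside K (u , v , w) = K u ∧ (K v ∧ K w)

  inside-∈ : ∀ (K : V → Bool) ed → inside K ed ≡ true → ∀ {v} → v ∈ verts ed → K v ≡ true
  inside-∈ K (u , v , w) e (here refl)                 = proj₁ (∧-true e)
  inside-∈ K (u , v , w) e (there (here refl))         = proj₁ (∧-true (proj₂ (∧-true {K u} e)))
  inside-∈ K (u , v , w) e (there (there (here refl))) = proj₂ (∧-true {K v} (proj₂ (∧-true {K u} e)))

  inside-∈⁺ : ∀ (K : V → Bool) ed → (∀ {v} → v ∈ verts ed → K v ≡ true) → inside K ed ≡ true
  inside-∈⁺ K (u , v , w) all = cong₂ _∧_ (all (here refl)) (cong₂ _∧_ (all (there (here refl))) (all (there (there (here refl)))))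

  outside-∈ : ∀ (K : V → Bool) ed → inside K ed ≡ false → ∃[ v ] (v ∈ verts ed × K v ≡ false)
  outside-∈ K (u , v , w) e with K u in eu | K v in ev | K w in ew
  ... | false | _     | _     = u , here refl , eu
  ... | true  | false | _     = v , there (here refl) , ev
  ... | true  | true  | false = w , there (there (here refl)) , ew

  img : ∀ {n} → (V → Fin n) → V × V × V → Subset n
  img φ (u , v , w) = ⁅ φ u ⁆ ∪ (⁅ φ v ⁆ ∪ ⁅ φ w ⁆)

  ∈-img⁻ : ∀ {n} (φ : V → Fin n) ed {x} → x ∈ˢ img φ ed → ∃[ v ] (v ∈ verts ed × x ≡ φ v)
  ∈-img⁻ φ (u , v , w) x∈ with SubsetP.x∈p∪q⁻ ⁅ φ u ⁆ _ x∈
  ... | inj₁ x∈u = u , here refl , SubsetP.x∈⁅y⁆⇒x≡y (φ u) x∈u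
  ... | inj₂ x∈vw with SubsetP.x∈p∪q⁻ ⁅ φ v ⁆ _ x∈vw
  ...   | inj₁ x∈v = v , there (here refl) , SubsetP.x∈⁅y⁆⇒x≡y (φ v) x∈v
  ...   | inj₂ x∈w = w , there (there (here refl)) , SubsetP.x∈⁅y⁆⇒x≡y (φ w) x∈w

  ∈-img⁺ : ∀ {n} (φ : V → Fin n) ed {v} → v ∈ verts ed → φ v ∈ˢ img φ ed
  ∈-img⁺ φ (u , v , w) (here refl)                 = SubsetP.x∈p∪q⁺ (inj₁ (SubsetP.x∈⁅x⁆ _))
  ∈-img⁺ φ (u , v , w) (there (here refl))         = SubsetP.x∈p∪q⁺ (inj₂ (SubsetP.x∈p∪q⁺ (inj₁ (SubsetP.x∈⁅x⁆ _))))
  ∈-img⁺ φ (u , v , w) (there (there (here refl))) = SubsetP.x∈p∪q⁺ (inj₂ (SubsetP.x∈p∪q⁺ (inj₂ (SubsetP.x∈⁅x⁆ _))))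

  -- Triples are ordered and their images are not, so mere inequality of triples would not separate
  -- the images.
  Differ : V × V × V → V × V × V → Set
  Differ ed ed' = ∃[ v ] (v ∈ verts ed × ¬ (v ∈ verts ed'))

  Inj : ∀ {n} → (V → Fin n) → Set
  Inj φ = ∀ u v → φ u ≡ φ v → u ≡ v

  img-differ : ∀ {n} {φ : V → Fin n} → Inj φ → ∀ {ed ed'} → Differ ed ed' → img φ ed ≢ img φ ed'
  img-differ {φ = φ} inj {ed} {ed'} (v , v∈ , v∉) eq with ∈-img⁻ φ ed' (subst (φ v ∈ˢ_) eq (∈-img⁺ φ ed v∈))
  ... | u , u∈ , e = v∉ (subst (_∈ verts ed') (sym (inj v u e)) u∈)

record Pattern : Set₁ where
  infix 4 _≟R_
  field
    dim     : ℕ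
    Rest    : Set
    _≟R_    : DecidableEquality Rest
    rests   : List Rest
    ∈-rests : ∀ ρ → ρ ∈ rests

  Vtx : Set
  Vtx = Fin (suc dim) ⊎ Rest

  field
    E : List (Vtx × Vtx × Vtx)

  _≟V_ : DecidableEquality Vtx
  _≟V_ = SumP.≡-dec Data.Fin._≟_ _≟R_

  vs : List Vtx
  vs = map inj₁ (allFin (suc dim)) ++ map inj₂ rests

  ∈-vs : ∀ v → v ∈ vs
  ∈-vs (inj₁ i) = ∈-++⁺ˡ (∈-map⁺ inj₁ (∈-allFin i))
  ∈-vs (inj₂ ρ) = ∈-++⁺ʳ (map inj₁ (allFin (suc dim))) (∈-map⁺ inj₂ (∈-rests ρ))

  cntV cntE cntW : (Vtx → Bool) → ℕ
  cntV K = cnt vs K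
  cntE K = cnt E (inside K)
  cntW K = cnt (allFin (suc dim)) (K ∘ inj₁)

  -- `dim` is the excess of the whole pattern. Completing a copy from any `K` above `U` therefore
  -- adds no more vertices than edges.
  Rank : (Vtx → Bool) → Set
  Rank U = ∀ K → (∀ v → U v ≡ true → K v ≡ true) → cntE K + dim ≤ cntV K

-- g bounds the excess of every initial segment of the edge list
record Admissible (P : Pattern) (g : ℕ) : Set where
  open Pattern P
  field
    size   : length vs ≡ length E + dim
    sub    : ∀ K → cntE K ≤ cntV K
    cover  : ∀ r → r ≤ length E → ∃[ C ] (All (λ ed → inside C ed ≡ true) (take r E) × cntV C ≤ r + g)
    differ : AllPairs Differ E

-- Sunflowers of copies

-- `v` vertices, `q` petals, `r` vertices outside the kernel; the two factors `v` count the pairs of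
-- vertices at which two maps can collide.
flowerBound : ℕ → ℕ → ℕ → ℕ
flowerBound v q zero    = 1
flowerBound v q (suc r) = q * (v * (v * flowerBound v q r))

abstract

  copyBound : Pattern → ℕ → ℕ
  copyBound P e = flowerBound (length (Pattern.vs P)) (suc e) (length (Pattern.vs P))

  copyBound-≡ : ∀ P e → copyBound P e ≡ flowerBound (length (Pattern.vs P)) (suc e) (length (Pattern.vs P))
  copyBound-≡ P e = refl

module Copies (P : Pattern) {n : ℕ} (H : ThreeGraph n) where

  open Pattern P public

  Map : Set
  Map = Vtx → Fin n

  Copy : Map → Set
  Copy φ = Inj φ × All (λ ed → img φ ed ∈ edges H) E

  Distinct : Map → Map → Set
  Distinct φ ψ = ∃[ v ] φ v ≢ ψ v

  Disjoint : (Vtx → Bool) → Map → Map → Set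
  Disjoint K φ ψ = ∀ u v → K u ≡ false → φ u ≢ ψ v × ψ u ≢ φ v

  Agree : (Vtx → Bool) → List Map → Set
  Agree K L = ∀ {φ ψ} → φ ∈ L → ψ ∈ L → ∀ v → K v ≡ true → φ v ≡ ψ v

  _≗?_at_ : Map → Fin n → Vtx → Bool
  φ ≗? a at v = isYes (φ v Data.Fin.≟ a)

  sunBound : ℕ → ℕ → ℕ
  sunBound = flowerBound (length vs)

  record Sunflower (q : ℕ) (K : Vtx → Bool) (L : List Map) : Set where
    field
      kernel   : Vtx → Bool
      petals   : List Map
      kernel⊇  : ∀ v → K v ≡ true → kernel v ≡ true
      petals⊆  : ∀ {φ} → φ ∈ petals → φ ∈ L
      agree    : Agree kernel petals
      disjoint : AllPairs (Disjoint kernel) petals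
      proper   : ∃[ v ] kernel v ≡ false
      enough   : q ≤ length petals

  1≤sunBound : ∀ q r → 1 ≤ q → 1 ≤ sunBound q r
  1≤sunBound q zero    1≤q = s≤s z≤n
  1≤sunBound q (suc r) 1≤q = ℕP.*-mono-≤ 1≤q (ℕP.*-mono-≤ {1} {length vs} (s≤s z≤n) (ℕP.*-mono-≤ {1} {length vs} (s≤s z≤n) (1≤sunBound q r 1≤q)))

  private
    add : (Vtx → Bool) → Vtx → Vtx → Bool
    add K v u = K u ∨ isYes (u ≟V v)

    two-disagree : ∀ {K} L → 1 <ᴺ length L → AllPairs Distinct L → Agree K L → ∃[ v ] K v ≡ false
    two-disagree (φ ∷ []) (s≤s ())
    two-disagree (φ ∷ ψ ∷ L) lt (((v , ne) ∷ _) ∷ _) ag = v , helper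
      where
      helper : _ ≡ false
      helper = ¬-not (λ e → ne (ag (here refl) (there (here refl)) v e))

  -- If many maps send one vertex outside `K` to the same point, that vertex joins the kernel.
  -- Otherwise each map collides with few others, and a greedy choice gives disjoint petals.
  sunflower : ∀ q r K L → 1 ≤ q → cntV (not ∘ K) ≤ r → Agree K L → AllPairs Distinct L → All Inj L →
              sunBound q r <ᴺ length L → Sunflower q K L
  sunflower q r K L 1≤q rem ag dis inj lt with Any.any? (λ v → Any.any? (λ a → popular? v a) (allFin n)) vs
    where
    popular? : ∀ v a → Dec (K v ≡ false × sunBound q (r ∸ 1) <ᴺ cnt L (λ φ → φ ≗? a at v))
    popular? v a = (K v Data.Bool.≟ false) ×-dec (sunBound q (r ∸ 1) ℕP.<? cnt L (λ φ → φ ≗? a at v))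
  -- No vertex is left outside the kernel, yet two distinct maps must differ at one.
  sunflower q zero K L 1≤q rem ag dis inj lt | _ =
    let v , Kv = two-disagree L lt dis ag
    in ⊥-elim (ℕP.<-irrefl refl (ℕP.≤-trans (cnt-pos (not ∘ K) (∈-vs v) (cong not Kv)) rem))
  sunflower q (suc r) K L 1≤q rem ag dis inj lt | yes pop with Any.satisfied pop
  ... | v , pop' with Any.satisfied pop'
  ... | a , Kv , many = record
        { kernel = Sunflower.kernel S ; petals = Sunflower.petals S
        ; kernel⊇ = λ u Ku → Sunflower.kernel⊇ S u (cong (_∨ isYes (u ≟V v)) Ku)
        ; petals⊆ = λ φ∈ → proj₁ (∈-filterᵇ⁻ (λ φ → φ ≗? a at v) (Sunflower.petals⊆ S φ∈))
        ; agree = Sunflower.agree S ; disjoint = Sunflower.disjoint S ; proper = Sunflower.proper S ; enough = Sunflower.enough S }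
    where
    L₁ = filterᵇ (λ φ → φ ≗? a at v) L
    ag₁ : Agree (add K v) L₁
    ag₁ {φ} {ψ} φ∈ ψ∈ u e with ∈-filterᵇ⁻ (λ φ → φ ≗? a at v) {L} φ∈ | ∈-filterᵇ⁻ (λ φ → φ ≗? a at v) {L} ψ∈
    ... | φ∈L , φv | ψ∈L , ψv with K u in Ku
    ...   | true  = ag φ∈L ψ∈L u Ku
    ...   | false with u ≟V v
    ...     | yes refl = trans (isYes-true (φ v Data.Fin.≟ a) φv) (sym (isYes-true (ψ v Data.Fin.≟ a) ψv))
    rem₁ : cntV (not ∘ add K v) ≤ r
    rem₁ = ℕP.≤-pred (ℕP.≤-trans (ℕP.≤-trans (ℕP.≤-reflexive (ℕP.+-comm 1 _)) (ℕP.≤-trans (ℕP.+-mono-≤ (cnt-mono vs {not ∘ add K v} {λ u → not (K u) ∧ not (isYes (u ≟V v))} drop) (cnt-pos (λ u → not (K u) ∧ isYes (u ≟V v)) (∈-vs v) at-v))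
      (ℕP.≤-reflexive (trans (ℕP.+-comm (cntV (λ u → not (K u) ∧ not (isYes (u ≟V v)))) (cntV (λ u → not (K u) ∧ isYes (u ≟V v)))) (sym (cnt-split vs (not ∘ K) (λ u → isYes (u ≟V v)))))))) rem)
      where
      drop : ∀ u → not (add K v u) ≡ true → not (K u) ∧ not (isYes (u ≟V v)) ≡ true
      drop u e with K u
      ... | false = e
      at-v : not (K v) ∧ isYes (v ≟V v) ≡ true
      at-v = cong₂ _∧_ (cong not Kv) (isYes-true⁺ (v ≟V v) refl)
    S = sunflower q r (add K v) L₁ 1≤q rem₁ ag₁ (AllPairsP.filter⁺ (λ φ → T? (φ ≗? a at v)) dis) (AllP.filter⁺ (λ φ → T? (φ ≗? a at v)) inj)
          (subst (sunBound q r <ᴺ_) (sym (length-filterᵇ (λ φ → φ ≗? a at v) L)) many)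
  sunflower q (suc r) K L 1≤q rem ag dis inj lt | no none = record
    { kernel = K ; petals = L' ; kernel⊇ = λ _ e → e ; petals⊆ = L'⊆
    ; agree = λ φ∈ ψ∈ → ag (L'⊆ φ∈) (L'⊆ ψ∈)
    ; disjoint = disj L' L'⊆ (proj₁ (proj₂ (proj₂ gr)))
    ; proper = nonempty
    ; enough = ℕP.<⇒≤ (ℕP.*-cancelˡ-< C q (length L') (ℕP.<-≤-trans (subst (_<ᴺ length L) (ℕP.*-comm q C) lt) (proj₂ (proj₂ (proj₂ gr))))) }
    where
    B = sunBound q r
    C = length vs * (length vs * B)
    conf : Map → Map → Bool
    conf φ ψ = any (λ u → not (K u) ∧ any (λ v → ψ ≗? φ v at u) vs) vs
    few : ∀ {φ} → φ ∈ L → cnt L (conf φ) ≤ C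
    few {φ} φ∈ = cnt-any L vs (λ u ψ → not (K u) ∧ any (λ v → ψ ≗? φ v at u) vs) (length vs * B) (λ {u} u∈ → perU u u∈)
      where
      perU : ∀ u → u ∈ vs → cnt L (λ ψ → not (K u) ∧ any (λ v → ψ ≗? φ v at u) vs) ≤ length vs * B
      perU u u∈ with K u in Ku
      ... | true  = ℕP.≤-trans (ℕP.≤-reflexive (cnt-false L)) z≤n
      ... | false = cnt-any L vs (λ v ψ → ψ ≗? φ v at u) B (λ {v} _ → ℕP.≮⇒≥ (λ big → none (lose u∈ (lose (∈-allFin (φ v)) (Ku , big)))))
    nonempty : ∃[ v ] K v ≡ false
    nonempty = two-disagree L (ℕP.≤-<-trans (1≤sunBound q (suc r) 1≤q) lt) dis ag
    rfl : ∀ {φ} → φ ∈ L → conf φ φ ≡ true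
    rfl {φ} φ∈ = let v , Kv = nonempty in any-true⁺ _ vs (∈-vs v)
      (cong₂ _∧_ (cong not Kv) (any-true⁺ _ vs (∈-vs v) (isYes-true⁺ (φ v Data.Fin.≟ φ v) refl)))
    gr = independent-sublist conf C (length L) L ℕP.≤-refl rfl few
    L' = proj₁ gr
    L'⊆ : ∀ {φ} → φ ∈ L' → φ ∈ L
    L'⊆ = proj₁ (proj₂ gr)
    free : ∀ {φ ψ} → conf φ ψ ≡ false → ∀ u v → K u ≡ false → ψ u ≢ φ v
    free {φ} {ψ} c u v Ku e with () ← trans (sym c) (any-true⁺ _ vs (∈-vs u)
      (cong₂ _∧_ (cong not Ku) (any-true⁺ _ vs (∈-vs v) (isYes-true⁺ (ψ u Data.Fin.≟ φ v) e))))
    disj : ∀ L' → (∀ {φ} → φ ∈ L' → φ ∈ L) → AllPairs (λ φ ψ → conf φ ψ ≡ false) L' → AllPairs (Disjoint K) L'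
    disj []       s _        = []
    disj (φ ∷ L') s (c ∷ cs) = All.tabulate (λ {ψ} ψ∈ u v Ku → (λ e → other ψ ψ∈ u v Ku e) , free (All.lookup c ψ∈) u v Ku) ∷ disj L' (s ∘ there) cs
      where
      other : ∀ ψ → ψ ∈ L' → ∀ u v → K u ≡ false → φ u ≢ ψ v
      other ψ ψ∈ u v Ku e with K v in Kv
      ... | false = free (All.lookup c ψ∈) v u Kv (sym e)
      -- On the kernel both maps agree, so `φ` would take the same value at `u` and at `v`.
      ... | true with All.lookup inj (s (here refl)) u v (trans e (ag (s (there ψ∈)) (s (here refl)) v Kv))
      ...   | refl with () ← trans (sym Ku) Kv

prefix-count : ∀ {A : Set} (xs : List A) P r → r ≤ cnt xs P → ∃[ r' ] (r' ≤ length xs × cnt (take r' xs) P ≡ r)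
prefix-count xs       P zero    le = 0 , z≤n , refl
prefix-count (x ∷ xs) P (suc r) le with P x in e
... | true  = let r' , r'≤ , eq = prefix-count xs P r (ℕP.≤-pred le) in suc r' , s≤s r'≤ , trans (cong (λ b → (if b then 1 else 0) + cnt (take r' xs) P) e) (cong suc eq)
... | false = let r' , r'≤ , eq = prefix-count xs P (suc r) le in suc r' , s≤s r'≤ , trans (cong (λ b → (if b then 1 else 0) + cnt (take r' xs) P) e) eq

∈-take : ∀ {A : Set} r {xs : List A} {x} → x ∈ take r xs → x ∈ xs
∈-take (suc r) {x ∷ xs} (here refl) = here refl
∈-take (suc r) {x ∷ xs} (there x∈)  = there (∈-take r x∈)

-- Boundedly many copies over a set of full rank

module Bounding (P : Pattern) (g : ℕ) (adm : Admissible P g) {n : ℕ} (H : ThreeGraph n) (e d : ℕ) (d≥ : Pattern.dim P + g ≤ d)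
                (noWin : ¬ Win e d H) where

  open Copies P H public
  open Admissible adm

  private
    edgesOf : Map → List (Vtx × Vtx × Vtx) → List (Subset n)
    edgesOf φ = map (img φ)

    edgesOf-unique : ∀ {φ eds} → Inj φ → AllPairs Differ eds → Unique (edgesOf φ eds)
    edgesOf-unique inj df = AllPairsP.map⁺ (AllPairs.map (img-differ inj) df)

    edgesOf-∈ : ∀ {φ eds} → All (λ ed → img φ ed ∈ edges H) eds → All (_∈ edges H) (edgesOf φ eds)
    edgesOf-∈ = AllP.map⁺

    vertsOf : Map → (Vtx → Bool) → List (Fin n)
    vertsOf φ C = map φ (filterᵇ C vs)

    length-vertsOf : ∀ φ C → length (vertsOf φ C) ≡ cntV C
    length-vertsOf φ C = trans (ListP.length-map φ (filterᵇ C vs)) (length-filterᵇ C vs)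

    ∈-vertsOf : ∀ φ C {v} → C v ≡ true → φ v ∈ vertsOf φ C
    ∈-vertsOf φ C {v} Cv = ∈-map⁺ φ (∈-filterᵇ⁺ C (∈-vs v) Cv)

  copy-short : ∀ {φ} → Copy φ → e ≤ length E → ⊥
  copy-short {φ} (inj , H∈) e≤ with cover e e≤
  ... | C , ins , small = noWin (win-intro H (edgesOf φ (take e E)) (vertsOf φ C)
        (edgesOf-unique inj (AllPairsP.take⁺ e differ)) (edgesOf-∈ (AllP.take⁺ e H∈))
        (trans (ListP.length-map (img φ) (take e E)) (trans (ListP.length-take e E) (ℕP.m≤n⇒m⊓n≡m e≤)))
        covered (ℕP.≤-trans (ℕP.≤-reflexive (length-vertsOf φ C)) (ℕP.≤-trans small (ℕP.+-monoʳ-≤ e (ℕP.≤-trans (ℕP.m≤n+m g dim) d≥)))))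
    where
    covered : ∀ {F x} → F ∈ edgesOf φ (take e E) → x ∈ˢ F → x ∈ vertsOf φ C
    covered F∈ x∈ with ∈-map⁻ (img φ) F∈
    ... | ed , ed∈ , refl with ∈-img⁻ φ ed x∈
    ...   | v , v∈ , refl = ∈-vertsOf φ C (inside-∈ C ed (All.lookup ins ed∈) v∈)

  module Flower (K : Vtx → Bool) (rank : cntE K + dim ≤ cntV K) (proper : ∃[ v ] K v ≡ false) where

    private
      out : Vtx × Vtx × Vtx → Bool
      out ed = not (inside K ed)

      s : ℕ
      s = cnt E out

      E-split : length E ≡ cntE K + s
      E-split = trans (sym (cnt-true E)) (cnt-split E (λ _ → true) (inside K))

      V-split : length vs ≡ cntV K + cntV (not ∘ K)
      V-split = trans (sym (cnt-true vs)) (cnt-split vs (λ _ → true) K)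

      -- The kernel has excess at least `dim` and the whole pattern exactly `dim`, so a petal brings
      -- no more new vertices than new edges.
      petal-size : cntV (not ∘ K) ≤ s
      petal-size = ℕP.+-cancelˡ-≤ (cntE K + dim) _ _ (begin
        cntE K + dim + cntV (not ∘ K)  ≤⟨ ℕP.+-monoˡ-≤ _ rank ⟩
        cntV K + cntV (not ∘ K)        ≡⟨ sym V-split ⟩
        length vs                      ≡⟨ size ⟩
        length E + dim                 ≡⟨ cong (_+ dim) E-split ⟩
        cntE K + s + dim               ≡⟨ trans (ℕP.+-assoc (cntE K) s dim) (trans (cong (cntE K +_) (ℕP.+-comm s dim)) (sym (ℕP.+-assoc (cntE K) dim s))) ⟩
        cntE K + dim + s               ∎)
        where open ℕP.≤-Reasoning

      1≤s : 1 ≤ s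
      1≤s = let v , Kv = proper in ℕP.≤-trans (cnt-pos (not ∘ K) (∈-vs v) (cong not Kv)) petal-size

    record Growth (φs : List Map) (r : ℕ) : Set where
      field
        es      : List (Subset n)
        new     : List (Fin n)
        es-len  : length es ≡ r
        es-uniq : Unique es
        es-H    : All (_∈ edges H) es
        es-from : ∀ {F} → F ∈ es → ∃[ φ ] ∃[ ed ] (φ ∈ φs × inside K ed ≡ false × F ≡ img φ ed)
        es-cov  : ∀ {F x} → F ∈ es → x ∈ˢ F → (∃[ φ ] ∃[ v ] (φ ∈ φs × K v ≡ true × x ≡ φ v)) ⊎ x ∈ new
        new-len : length new ≤ r + g

    open Growth

    private
      piece : ∀ φ → Copy φ → ∀ eds C → AllPairs Differ eds → All (λ ed → img φ ed ∈ edges H) eds →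
              (∀ {ed} → ed ∈ eds → inside C ed ≡ true) → ∀ r → cnt eds out ≡ r → ∀ φs → φ ∈ φs →
              let es = edgesOf φ (filterᵇ out eds) ; new = vertsOf φ (λ v → C v ∧ not (K v)) in
              length es ≡ r × Unique es × All (_∈ edges H) es ×
              (∀ {F} → F ∈ es → ∃[ φ ] ∃[ ed ] (φ ∈ φs × inside K ed ≡ false × F ≡ img φ ed)) ×
              (∀ {F x} → F ∈ es → x ∈ˢ F → (∃[ φ ] ∃[ v ] (φ ∈ φs × K v ≡ true × x ≡ φ v)) ⊎ x ∈ new)
      piece φ (inj , _) eds C df H∈ ins r len φs φ∈ =
        trans (ListP.length-map (img φ) (filterᵇ out eds)) (trans (length-filterᵇ out eds) len) ,
        edgesOf-unique inj (AllPairsP.filter⁺ (T? ∘ out) df) ,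
        edgesOf-∈ (AllP.filter⁺ (T? ∘ out) H∈) , from , cov
        where
        from : ∀ {F} → F ∈ edgesOf φ (filterᵇ out eds) → ∃[ φ ] ∃[ ed ] (φ ∈ φs × inside K ed ≡ false × F ≡ img φ ed)
        from F∈ with ∈-map⁻ (img φ) F∈
        ... | ed , ed∈ , eq = φ , ed , φ∈ , not-true (proj₂ (∈-filterᵇ⁻ out {eds} ed∈)) , eq
        cov : ∀ {F x} → F ∈ edgesOf φ (filterᵇ out eds) → x ∈ˢ F → (∃[ φ ] ∃[ v ] (φ ∈ φs × K v ≡ true × x ≡ φ v)) ⊎ x ∈ vertsOf φ (λ v → C v ∧ not (K v))
        cov F∈ x∈ with ∈-map⁻ (img φ) F∈
        ... | ed , ed∈ , refl with ∈-img⁻ φ ed x∈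
        ...   | v , v∈ , refl with K v in Kv
        ...     | true  = inj₁ (φ , v , φ∈ , Kv , refl)
        ...     | false = inj₂ (∈-vertsOf φ (λ v → C v ∧ not (K v)) (cong₂ _∧_ (inside-∈ C ed (ins (proj₁ (∈-filterᵇ⁻ out {eds} ed∈))) v∈) (cong not Kv)))

    -- Complete petals pay for themselves by `petal-size`. The last one is cut at a prefix of its
    -- edge list with exactly `r` new edges: `cover` charges `g`, and by `sub` the kernel edges in
    -- the prefix are paid for by kernel vertices.
    grow : ∀ φs r → AllPairs (Disjoint K) φs → All Copy φs → r ≤ length φs → Growth φs r
    grow []       zero dj cp le = record { es = [] ; new = [] ; es-len = refl ; es-uniq = [] ; es-H = [] ; es-from = λ () ; es-cov = λ () ; new-len = z≤n }
    grow (φ ∷ φs) r (dφ ∷ dj) (cφ ∷ cp) le with r ℕP.≤? s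
    ... | yes r≤s with prefix-count E out r r≤s
    ...   | r* , r*≤ , len with cover r* r*≤
    ...     | C , ins , small =
      let len' , u , h , fr , cv = piece φ cφ (take r* E) C (AllPairsP.take⁺ r* differ) (AllP.take⁺ r* (proj₂ cφ)) (All.lookup ins) r len (φ ∷ φs) (here refl)
      in record { es = _ ; new = _ ; es-len = len' ; es-uniq = u ; es-H = h ; es-from = fr ; es-cov = cv
                ; new-len = ℕP.≤-trans (ℕP.≤-reflexive (length-vertsOf φ (λ v → C v ∧ not (K v)))) bound }
      where
      kE = cnt (take r* E) (inside K)
      kE≤ : kE ≤ cntV (λ v → C v ∧ K v)
      kE≤ = ℕP.≤-trans (cnt-mono-∈ (take r* E) {inside K} {inside (λ v → C v ∧ K v)} (λ {ed} ed∈ e → inside-∈⁺ _ ed (λ v∈ → cong₂ _∧_ (inside-∈ C ed (All.lookup ins ed∈) v∈) (inside-∈ K ed e v∈))))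
        (ℕP.≤-trans (cnt-take r* E _) (sub (λ v → C v ∧ K v)))
      r*-split : r* ≡ kE + r
      r*-split = trans (sym (trans (ListP.length-take r* E) (ℕP.m≤n⇒m⊓n≡m r*≤))) (trans (sym (cnt-true (take r* E))) (trans (cnt-split (take r* E) (λ _ → true) (inside K)) (cong (kE +_) len)))
      bound : cntV (λ v → C v ∧ not (K v)) ≤ r + g
      bound = ℕP.+-cancelˡ-≤ kE _ _ (begin
        kE + cntV (λ v → C v ∧ not (K v))                    ≤⟨ ℕP.+-monoˡ-≤ _ kE≤ ⟩
        cntV (λ v → C v ∧ K v) + cntV (λ v → C v ∧ not (K v)) ≡⟨ cnt-split vs C K ⟨
        cntV C                                               ≤⟨ small ⟩
        r* + g                                               ≡⟨ trans (cong (_+ g) r*-split) (ℕP.+-assoc kE r g) ⟩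
        kE + (r + g)                                         ∎)
        where open ℕP.≤-Reasoning
    grow (φ ∷ φs) r (dφ ∷ dj) (cφ ∷ cp) le | no r≰s = record
      { es = es₁ ++ es G ; new = new₁ ++ new G
      ; es-len = trans (ListP.length-++ es₁) (trans (cong₂ _+_ (proj₁ p) (es-len G)) (ℕP.m+[n∸m]≡n (ℕP.<⇒≤ (ℕP.≰⇒> r≰s))))
      ; es-uniq = UniqueP.++⁺ (proj₁ (proj₂ p)) (es-uniq G) apart
      ; es-H = AllP.++⁺ (proj₁ (proj₂ (proj₂ p))) (es-H G)
      ; es-from = λ F∈ → [ proj₁ (proj₂ (proj₂ (proj₂ p))) , (λ F∈ → let ψ , ed , ψ∈ , o , eq = es-from G F∈ in ψ , ed , there ψ∈ , o , eq) ]′ (∈-++⁻ es₁ F∈)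
      ; es-cov = λ F∈ x∈ → [ (λ F∈ → [ inj₁ , inj₂ ∘ ∈-++⁺ˡ ]′ (proj₂ (proj₂ (proj₂ (proj₂ p))) F∈ x∈))
                           , (λ F∈ → [ (λ { (ψ , v , ψ∈ , Kv , eq) → inj₁ (ψ , v , there ψ∈ , Kv , eq) }) , inj₂ ∘ ∈-++⁺ʳ new₁ ]′ (es-cov G F∈ x∈)) ]′ (∈-++⁻ es₁ F∈)
      ; new-len = ℕP.≤-trans (ℕP.≤-reflexive (ListP.length-++ new₁)) (ℕP.≤-trans (ℕP.+-mono-≤ (ℕP.≤-trans (ℕP.≤-reflexive (length-vertsOf φ (λ v → true ∧ not (K v)))) petal-size) (new-len G))
          (ℕP.≤-reflexive (trans (sym (ℕP.+-assoc s (r ∸ s) g)) (cong (_+ g) (ℕP.m+[n∸m]≡n (ℕP.<⇒≤ (ℕP.≰⇒> r≰s))))))) }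
      where
      p = piece φ cφ E (λ _ → true) differ (proj₂ cφ) (λ _ → refl) s refl (φ ∷ φs) (here refl)
      es₁ = edgesOf φ (filterᵇ out E)
      new₁ = vertsOf φ (λ v → true ∧ not (K v))
      -- Each petal has at least one new edge, so `r` petals suffice for `r` edges.
      G = grow φs (r ∸ s) dj cp (ℕP.≤-trans (ℕP.∸-monoʳ-≤ r 1≤s) (ℕP.≤-trans (ℕP.∸-monoˡ-≤ 1 le) ℕP.≤-refl))
      apart : ∀ {F} → ¬ (F ∈ es₁ × F ∈ es G)
      apart (F∈₁ , F∈₂) with ∈-map⁻ (img φ) F∈₁ | es-from G F∈₂
      ... | ed , ed∈ , refl | ψ , ed' , ψ∈ , o , eq with outside-∈ K ed (not-true (proj₂ (∈-filterᵇ⁻ out {E} ed∈)))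
      ...   | v , v∈ , Kv with ∈-img⁻ ψ ed' (subst (φ v ∈ˢ_) eq (∈-img⁺ φ ed v∈))
      ...     | u , _ , φv≡ψu = proj₁ (All.lookup dφ ψ∈ v u Kv) φv≡ψu

    -- One complete copy brings excess `dim` and already contains the image of the kernel; the
    -- remaining edges come from the other petals at a further cost of `g`.
    flower-win : ∀ φ φs → Agree K (φ ∷ φs) → AllPairs (Disjoint K) (φ ∷ φs) → All Copy (φ ∷ φs) → e ≤ length φs → ⊥
    flower-win φ φs ag (dφ ∷ dj) (cφ ∷ cp) e≤ with e ℕP.≤? length E
    ... | yes short = copy-short cφ short
    ... | no  long  = noWin (win-intro H (es₀ ++ es G) (vertsOf φ (λ _ → true) ++ new G)
          (UniqueP.++⁺ (edgesOf-unique (proj₁ cφ) differ) (es-uniq G) apart)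
          (AllP.++⁺ (edgesOf-∈ (proj₂ cφ)) (es-H G))
          (trans (ListP.length-++ es₀) (trans (cong₂ _+_ (ListP.length-map (img φ) E) (es-len G)) E+r))
          covered small)
      where
      r = e ∸ length E
      E+r : length E + r ≡ e
      E+r = ℕP.m+[n∸m]≡n (ℕP.<⇒≤ (ℕP.≰⇒> long))
      G = grow φs r dj cp (ℕP.≤-trans (ℕP.m∸n≤m e (length E)) e≤)
      es₀ = edgesOf φ E
      apart : ∀ {F} → ¬ (F ∈ es₀ × F ∈ es G)
      apart (F∈₁ , F∈₂) with ∈-map⁻ (img φ) F∈₁ | es-from G F∈₂
      ... | ed , ed∈ , refl | ψ , ed' , ψ∈ , o , eq with outside-∈ K ed' o
      ...   | v , v∈ , Kv with ∈-img⁻ φ ed (subst (ψ v ∈ˢ_) (sym eq) (∈-img⁺ ψ ed' v∈))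
      ...     | u , _ , ψv≡φu = proj₂ (All.lookup dφ ψ∈ v u Kv) ψv≡φu
      covered : ∀ {F x} → F ∈ es₀ ++ es G → x ∈ˢ F → x ∈ vertsOf φ (λ _ → true) ++ new G
      covered F∈ x∈ with ∈-++⁻ es₀ F∈
      ... | inj₁ F∈₀ with ∈-map⁻ (img φ) F∈₀
      ...   | ed , _ , refl with ∈-img⁻ φ ed x∈
      ...     | v , _ , refl = ∈-++⁺ˡ (∈-vertsOf φ (λ _ → true) refl)
      covered F∈ x∈ | inj₂ F∈G with es-cov G F∈G x∈
      ... | inj₁ (ψ , v , ψ∈ , Kv , refl) = ∈-++⁺ˡ (subst (_∈ vertsOf φ (λ _ → true)) (ag (here refl) (there ψ∈) v Kv) (∈-vertsOf φ (λ _ → true) refl))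
      ... | inj₂ x∈new = ∈-++⁺ʳ _ x∈new
      small : length (vertsOf φ (λ _ → true) ++ new G) ≤ e + d
      small = begin
        length (vertsOf φ (λ _ → true) ++ new G)     ≡⟨ ListP.length-++ (vertsOf φ (λ _ → true)) ⟩
        length (vertsOf φ (λ _ → true)) + length (new G) ≤⟨ ℕP.+-mono-≤ (ℕP.≤-reflexive (trans (length-vertsOf φ (λ _ → true)) (trans (cnt-true vs) size))) (new-len G) ⟩
        length E + dim + (r + g)                     ≡⟨ ℕP.+-assoc (length E) dim (r + g) ⟩
        length E + (dim + (r + g))                   ≡⟨ cong (length E +_) (trans (sym (ℕP.+-assoc dim r g)) (trans (cong (_+ g) (ℕP.+-comm dim r)) (ℕP.+-assoc r dim g))) ⟩
        length E + (r + (dim + g))                   ≡⟨ ℕP.+-assoc (length E) r (dim + g) ⟨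
        length E + r + (dim + g)                     ≤⟨ ℕP.+-mono-≤ (ℕP.≤-reflexive E+r) d≥ ⟩
        e + d                                        ∎
        where open ℕP.≤-Reasoning

  bounded : ∀ U → Rank U → ∀ L → AllPairs Distinct L → All Copy L → Agree U L → length L ≤ copyBound P e
  bounded U rank L dis cp ag = subst (length L ≤_) (sym (copyBound-≡ P e)) (ℕP.≮⇒≥ λ lt →
    contra (sunflower (suc e) (length vs) U L (s≤s z≤n) (cnt-≤length vs _) ag dis (All.map proj₁ cp) lt))
    where
    contra : Sunflower (suc e) U L → ⊥
    contra S = go (Sunflower.petals S) (Sunflower.petals⊆ S) (Sunflower.agree S) (Sunflower.disjoint S) (Sunflower.enough S)
      where
      K = Sunflower.kernel S
      go : ∀ ps → (∀ {φ} → φ ∈ ps → φ ∈ L) → Agree K ps → AllPairs (Disjoint K) ps → suc e ≤ length ps → ⊥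
      go (φ ∷ φs) sub ag' dj (s≤s le) = Flower.flower-win K (rank K (Sunflower.kernel⊇ S)) (Sunflower.proper S) φ φs ag' dj (All.tabulate (λ φ∈ → All.lookup cp (sub φ∈))) le

∨-true : ∀ {a b} → a ∨ b ≡ true → a ≡ true ⊎ b ≡ true
∨-true {true}  _ = inj₁ refl
∨-true {false} e = inj₂ e

isYes-false⁺ : ∀ {A : Set} (d : Dec A) → ¬ A → isYes d ≡ false
isYes-false⁺ (yes a) ¬a = ⊥-elim (¬a a)
isYes-false⁺ (no _)  _  = refl

-- Simplices whose facets carry copies

module _ (P : Pattern) where

  open Pattern P

  facetRoots : Fin (suc dim) → Vtx → Bool
  facetRoots i (inj₁ l) = not (isYes (l Data.Fin.≟ i))
  facetRoots i (inj₂ _) = false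

  pairRoots : Fin (suc dim) → Fin (suc dim) → Vtx → Vtx → Bool
  pairRoots i j v u = isYes (u ≟V v) ∨ (facetRoots i u ∧ facetRoots j u)

  quads : List (Fin (suc dim) × Fin (suc dim) × Vtx × Vtx)
  quads = cartesianProduct (allFin (suc dim)) (cartesianProduct (allFin (suc dim)) (cartesianProduct vs vs))

  simplexBound : ℕ → ℕ → ℕ
  simplexBound e D = proj₁ (removal dim (D * (suc dim * copyBound P e)))

  -- Degenerate simplices are of order n^dim; from this `n` on they are at most half of the n^(dim +
  -- 1) / D₂ simplices found.
  simplexThreshold : ℕ → ℕ → ℕ
  simplexThreshold e D = suc (2 * simplexBound e D * (length quads * copyBound P e))

  -- The vertices that the copies on the `i`-th and the `j`-th facet are expected to have in common.
  Closure : Set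
  Closure = Fin (suc dim) → Fin (suc dim) → Vtx → Bool

  -- `rankFacet` bounds the copies on a facet of roots; `rankPair` bounds the copies that meet the
  -- copy on another facet in a vertex outside the closure.
  record Generic (cl : Closure) : Set where
    field
      rankFacet : ∀ i → Rank (facetRoots i)
      rankPair  : ∀ i j → i ≢ j → ∀ v → cl i j v ≡ false → Rank (pairRoots i j v)

module Simplices (P : Pattern) (g : ℕ) (adm : Admissible P g) (cl : Closure P) (gen : Generic P cl)
                 {n : ℕ} (H : ThreeGraph n) (e d : ℕ) (d≥ : Pattern.dim P + g ≤ d) (noWin : ¬ Win e d H)
                 (Φ : List (Pattern.Vtx P → Fin n)) (cp : All (Copies.Copy P H) Φ) (dis : AllPairs (Copies.Distinct P H) Φ)
                 (D : ℕ) (dense : n ^ Pattern.dim P ≤ D * length Φ) where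

  open Bounding P g adm H e d d≥ noWin public
  open Generic gen

  private
    m : ℕ
    m = suc dim

    C : ℕ
    C = copyBound P e

  abstract

    agreeOff : Fin m → (Fin m → Fin n) → Map → Bool
    agreeOff i a ψ = allF (λ l → isYes (l Data.Fin.≟ i) ∨ isYes (ψ (inj₁ l) Data.Fin.≟ a l))

    agreeOff-sound : ∀ i a ψ → agreeOff i a ψ ≡ true → ∀ l → l ≢ i → ψ (inj₁ l) ≡ a l
    agreeOff-sound i a ψ e l l≢i with ∨-true (allF-true (λ l → isYes (l Data.Fin.≟ i) ∨ isYes (ψ (inj₁ l) Data.Fin.≟ a l)) e l)
    ... | inj₁ l≡i = ⊥-elim (l≢i (isYes-true (l Data.Fin.≟ i) l≡i))
    ... | inj₂ eq  = isYes-true (ψ (inj₁ l) Data.Fin.≟ a l) eq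

    agreeOff-complete : ∀ i a ψ → (∀ l → l ≢ i → ψ (inj₁ l) ≡ a l) → agreeOff i a ψ ≡ true
    agreeOff-complete i a ψ eq = allF-true⁺ _ step
      where
      step : ∀ (l : Fin (suc dim)) → isYes (l Data.Fin.≟ i) ∨ isYes (ψ (inj₁ l) Data.Fin.≟ a l) ≡ true
      step l with l Data.Fin.≟ i
      ... | yes _  = refl
      ... | no l≢i = isYes-true⁺ (ψ (inj₁ l) Data.Fin.≟ a l) (eq l l≢i)

  private
    roots : Map → Fin m → Fin n
    roots φ l = φ (inj₁ l)

    conf : Map → Map → Bool
    conf φ ψ = any (λ i → agreeOff i (roots φ) ψ) (allFin m)

    conf-refl : ∀ φ → conf φ φ ≡ true
    conf-refl φ = any-true⁺ (λ i → agreeOff i (roots φ) φ) (allFin m) (∈-allFin zero) (agreeOff-complete zero (roots φ) φ (λ _ _ → refl))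

    conf-few : ∀ {φ} → φ ∈ Φ → cnt Φ (conf φ) ≤ m * C
    conf-few {φ} _ = subst (λ k → cnt Φ (conf φ) ≤ k * C) (ListP.length-tabulate {n = m} id)
      (cnt-any Φ (allFin m) (λ i ψ → agreeOff i (roots φ) ψ) C (λ {i} _ → ℕP.≤-trans (ℕP.≤-reflexive (sym (length-filterᵇ (agreeOff i (roots φ)) Φ)))
        (bounded (facetRoots P i) (rankFacet i) (filterᵇ (agreeOff i (roots φ)) Φ) (AllPairsP.filter⁺ (T? ∘ agreeOff i (roots φ)) dis) (AllP.filter⁺ (T? ∘ agreeOff i (roots φ)) cp) (ag i))))
      where
      ag : ∀ i → Agree (facetRoots P i) (filterᵇ (agreeOff i (roots φ)) Φ)
      ag i {ψ} {ψ'} ψ∈ ψ'∈ (inj₁ l) Ul = trans (one ψ ψ∈) (sym (one ψ' ψ'∈))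
        where
        l≢i : l ≢ i
        l≢i l≡i with () ← trans (sym Ul) (cong not (isYes-true⁺ (l Data.Fin.≟ i) l≡i))
        one : ∀ ψ → ψ ∈ filterᵇ (agreeOff i (roots φ)) Φ → ψ (inj₁ l) ≡ φ (inj₁ l)
        one ψ ψ∈ = agreeOff-sound i (roots φ) ψ (proj₂ (∈-filterᵇ⁻ (agreeOff i (roots φ)) {Φ} ψ∈)) l l≢i

    abstract
      -- By `rankFacet` few copies share a facet of roots. Thinning costs the factor m C, after
      -- which any `dim` roots determine the copy.
      selected : ∃[ L ] ((∀ {φ} → φ ∈ L → φ ∈ Φ) × AllPairs (λ φ ψ → conf φ ψ ≡ false) L × length Φ ≤ m * C * length L)
      selected = independent-sublist conf (m * C) (length Φ) Φ ℕP.≤-refl (λ {φ} _ → conf-refl φ) conf-few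

  Φ′ : List Map
  Φ′ = proj₁ selected

  Φ′⊆ : ∀ {φ} → φ ∈ Φ′ → φ ∈ Φ
  Φ′⊆ = proj₁ (proj₂ selected)

  Φ′-copy : ∀ {φ} → φ ∈ Φ′ → Copy φ
  Φ′-copy φ∈ = All.lookup cp (Φ′⊆ φ∈)

  determined : ∀ {φ ψ} → φ ∈ Φ′ → ψ ∈ Φ′ → ∀ i → (∀ l → l ≢ i → φ (inj₁ l) ≡ ψ (inj₁ l)) → φ ≡ ψ
  determined {φ} {ψ} φ∈ ψ∈ i eq with AllPairs-∈ (proj₁ (proj₂ (proj₂ selected))) φ∈ ψ∈
  ... | inj₁ φ≡ψ       = φ≡ψ
  ... | inj₂ (inj₁ c) with () ← trans (sym c) (any-true⁺ (λ i → agreeOff i (roots φ) ψ) (allFin m) (∈-allFin i) (agreeOff-complete i (roots φ) ψ (λ l l≢i → sym (eq l l≢i))))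
  ... | inj₂ (inj₂ c) with () ← trans (sym c) (any-true⁺ (λ i → agreeOff i (roots ψ) φ) (allFin m) (∈-allFin i) (agreeOff-complete i (roots ψ) φ eq))

  private
    rootVec : Map → Cube n m
    rootVec φ = Vec.tabulate (roots φ)

    _≟C_ : DecidableEquality (Cube n m)
    _≟C_ = VecP.≡-dec Data.Fin._≟_

    xs = cube n m

    T′ : Cube n m → Bool
    T′ y = any (λ φ → isYes (rootVec φ ≟C y)) Φ′

    T-witness : ∀ y → T′ y ≡ true → ∃[ φ ] (φ ∈ Φ′ × ∀ l → φ (inj₁ l) ≡ lookup y l)
    T-witness y e with any-true (λ φ → isYes (rootVec φ ≟C y)) Φ′ e
    ... | φ , φ∈ , eq = φ , φ∈ , λ l → trans (sym (VecP.lookup∘tabulate (roots φ) l)) (cong (λ v → lookup v l) (isYes-true (rootVec φ ≟C y) eq))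

    T-thin : Thin T′
    T-thin i y a b ea eb =
      let φ , φ∈ , φ≡ = T-witness (y [ i ]≔ a) ea
          ψ , ψ∈ , ψ≡ = T-witness (y [ i ]≔ b) eb
          φ≡ψ = determined φ∈ ψ∈ i (λ l l≢i → trans (φ≡ l) (trans (VecP.lookup∘update′ l≢i y a) (trans (sym (VecP.lookup∘update′ l≢i y b)) (sym (ψ≡ l)))))
      in trans (sym (VecP.lookup∘update i y a)) (trans (sym (φ≡ i)) (trans (cong (λ χ → χ (inj₁ i)) φ≡ψ) (trans (ψ≡ i) (VecP.lookup∘update i y b))))

    T-dense : length Φ′ ≤ cnt xs T′
    T-dense = subst₂ _≤_ (ListP.length-map rootVec Φ′) (length-filterᵇ T′ xs) (unique-length-≤
      (AllPairsP.map⁺ (AllPairs.map (λ {φ} {ψ} → apart φ ψ) (proj₁ (proj₂ (proj₂ selected)))))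
      (λ {y} y∈ → let φ , φ∈ , eq = ∈-map⁻ rootVec y∈ in ∈-filterᵇ⁺ T′ (∈-cube y) (any-true⁺ (λ φ → isYes (rootVec φ ≟C y)) Φ′ φ∈ (isYes-true⁺ (rootVec φ ≟C y) (sym eq)))))
      where
      apart : ∀ φ ψ → conf φ ψ ≡ false → rootVec φ ≢ rootVec ψ
      apart φ ψ c eq with () ← trans (sym c) (any-true⁺ (λ i → agreeOff i (roots φ) ψ) (allFin m) (∈-allFin zero) (agreeOff-complete zero (roots φ) ψ
        (λ l _ → trans (sym (VecP.lookup∘tabulate (roots ψ) l)) (trans (cong (λ v → lookup v l) (sym eq)) (VecP.lookup∘tabulate (roots φ) l)))))

    D₂ = simplexBound P e D

    shadow-dense : n ^ m ≤ D₂ * cnt xs (shadow T′)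
    shadow-dense = proj₂ (removal dim (D * (m * C))) T′ T-thin (begin
      n ^ dim                        ≤⟨ dense ⟩
      D * length Φ                   ≤⟨ ℕP.*-monoʳ-≤ D (proj₂ (proj₂ (proj₂ selected))) ⟩
      D * (m * C * length Φ′)        ≡⟨ ℕP.*-assoc D (m * C) (length Φ′) ⟨
      D * (m * C) * length Φ′        ≤⟨ ℕP.*-monoʳ-≤ (D * (m * C)) T-dense ⟩
      D * (m * C) * cnt xs T′        ∎)
      where open ℕP.≤-Reasoning

    picks : Fin m → Cube n m → List Map
    picks i y = filterᵇ (agreeOff i (lookup y)) Φ′

    conflict : Fin m × Fin m × Vtx × Vtx → Cube n m → Bool
    conflict (i , j , u , v) y = not (isYes (i Data.Fin.≟ j)) ∧ (not (cl i j v) ∧ any (λ φ → any (λ ψ → isYes (φ u Data.Fin.≟ ψ v)) (picks j y)) (picks i y))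

    -- Without the `i`-th coordinate the copy `φ` on the `i`-th facet is already determined, hence
    -- so is the collision point. Then `rankPair` leaves few choices for `ψ`, and `ψ` reveals the
    -- `i`-th coordinate as one of its roots.
    fibre : ∀ q y → cnt (allFin n) (λ a → conflict q (y [ proj₁ q ]≔ a)) ≤ C
    fibre (i , j , u , v) y with i Data.Fin.≟ j | cl i j v in clv
    ... | yes _  | _     = ℕP.≤-trans (ℕP.≤-reflexive (cnt-false (allFin n))) z≤n
    ... | no _   | true  = ℕP.≤-trans (ℕP.≤-reflexive (cnt-false (allFin n))) z≤n
    ... | no i≢j | false = go (picks i y) refl
      where
      Q : Fin n → Bool
      Q a = any (λ φ → any (λ ψ → isYes (φ u Data.Fin.≟ ψ v)) (picks j (y [ i ]≔ a))) (picks i (y [ i ]≔ a))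
      shift : ∀ a φ → φ ∈ picks i (y [ i ]≔ a) → φ ∈ picks i y
      shift a φ φ∈ = let φ∈′ , eq = ∈-filterᵇ⁻ (agreeOff i (lookup (y [ i ]≔ a))) {Φ′} φ∈ in
        ∈-filterᵇ⁺ (agreeOff i (lookup y)) φ∈′ (agreeOff-complete i (lookup y) φ (λ l l≢i → trans (agreeOff-sound i (lookup (y [ i ]≔ a)) φ eq l l≢i) (VecP.lookup∘update′ l≢i y a)))
      go : ∀ L → picks i y ≡ L → cnt (allFin n) Q ≤ C
      go [] eq = ℕP.≤-trans (cnt-mono (allFin n) {Q} {λ _ → false} none) (ℕP.≤-trans (ℕP.≤-reflexive (cnt-false (allFin n))) z≤n)
        where
        none : ∀ a → Q a ≡ true → false ≡ true
        none a e with any-true (λ φ → any (λ ψ → isYes (φ u Data.Fin.≟ ψ v)) (picks j (y [ i ]≔ a))) (picks i (y [ i ]≔ a)) e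
        ... | φ , φ∈ , _ with subst (φ ∈_) eq (shift a φ φ∈)
        ...   | ()
      go (φ₀ ∷ _) eq = ℕP.≤-trans (subst₂ _≤_ (length-filterᵇ Q (allFin n)) (ListP.length-map (λ ψ → ψ (inj₁ i)) L)
          (unique-length-≤ (UniqueP.filter⁺ (T? ∘ Q) (UniqueP.allFin⁺ n)) (λ {a} a∈ → inL a (proj₂ (∈-filterᵇ⁻ Q {allFin n} a∈)))))
          (bounded (pairRoots P i j v) (rankPair i j i≢j v clv) L (AllPairsP.filter⁺ (T? ∘ test) dis) (AllP.filter⁺ (T? ∘ test) cp) ag)
        where
        test : Map → Bool
        test ψ = isYes (ψ v Data.Fin.≟ φ₀ u) ∧ allF (λ l → (isYes (l Data.Fin.≟ i) ∨ isYes (l Data.Fin.≟ j)) ∨ isYes (ψ (inj₁ l) Data.Fin.≟ lookup y l))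
        L = filterᵇ test Φ
        φ₀∈ : φ₀ ∈ picks i y
        φ₀∈ = subst (φ₀ ∈_) (sym eq) (here refl)
        inL : ∀ a → Q a ≡ true → a ∈ map (λ ψ → ψ (inj₁ i)) L
        inL a e with any-true (λ φ → any (λ ψ → isYes (φ u Data.Fin.≟ ψ v)) (picks j (y [ i ]≔ a))) (picks i (y [ i ]≔ a)) e
        ... | φ , φ∈ , e' with any-true (λ ψ → isYes (φ u Data.Fin.≟ ψ v)) (picks j (y [ i ]≔ a)) e'
        ...   | ψ , ψ∈ , e'' = subst (_∈ map (λ ψ → ψ (inj₁ i)) L) (trans (ψ-off i i≢j) (VecP.lookup∘update i y a))
                  (∈-map⁺ (λ ψ → ψ (inj₁ i)) (∈-filterᵇ⁺ test (Φ′⊆ (proj₁ ψ∈′)) tst))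
          where
          ψ∈′ = ∈-filterᵇ⁻ (agreeOff j (lookup (y [ i ]≔ a))) {Φ′} ψ∈
          ψ-off : ∀ l → l ≢ j → ψ (inj₁ l) ≡ lookup (y [ i ]≔ a) l
          ψ-off = agreeOff-sound j (lookup (y [ i ]≔ a)) ψ (proj₂ ψ∈′)
          φ≡φ₀ : φ ≡ φ₀
          φ≡φ₀ = let φ∈₁ , eq₁ = ∈-filterᵇ⁻ (agreeOff i (lookup y)) {Φ′} (shift a φ φ∈)
                     φ∈₂ , eq₂ = ∈-filterᵇ⁻ (agreeOff i (lookup y)) {Φ′} φ₀∈
                 in determined φ∈₁ φ∈₂ i (λ l l≢i → trans (agreeOff-sound i (lookup y) φ eq₁ l l≢i) (sym (agreeOff-sound i (lookup y) φ₀ eq₂ l l≢i)))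
          tst : test ψ ≡ true
          tst = cong₂ _∧_ (isYes-true⁺ (ψ v Data.Fin.≟ φ₀ u) (trans (sym (isYes-true (φ u Data.Fin.≟ ψ v) e'')) (cong (λ χ → χ u) φ≡φ₀))) (allF-true⁺ _ per)
            where
            per : ∀ l → (isYes (l Data.Fin.≟ i) ∨ isYes (l Data.Fin.≟ j)) ∨ isYes (ψ (inj₁ l) Data.Fin.≟ lookup y l) ≡ true
            per l with l Data.Fin.≟ i | l Data.Fin.≟ j
            ... | yes _  | _      = refl
            ... | no _   | yes _  = refl
            ... | no l≢i | no l≢j = isYes-true⁺ (ψ (inj₁ l) Data.Fin.≟ lookup y l) (trans (ψ-off l l≢j) (VecP.lookup∘update′ l≢i y a))
        ag : Agree (pairRoots P i j v) L
        ag {ψ} {ψ'} ψ∈ ψ'∈ w Uw = trans (val ψ (tested ψ ψ∈) w Uw) (sym (val ψ' (tested ψ' ψ'∈) w Uw))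
          where
          tested : ∀ ψ → ψ ∈ L → test ψ ≡ true
          tested ψ ψ∈ = proj₂ (∈-filterᵇ⁻ test {Φ} ψ∈)
          at : Vtx → Fin n
          at (inj₁ l) = if isYes (inj₁ l ≟V v) then φ₀ u else lookup y l
          at (inj₂ ρ) = φ₀ u
          val : ∀ ψ → test ψ ≡ true → ∀ w → pairRoots P i j v w ≡ true → ψ w ≡ at w
          val ψ t (inj₁ l) Uw with inj₁ l ≟V v
          ... | yes refl = isYes-true (ψ v Data.Fin.≟ φ₀ u) (proj₁ (∧-true t))
          ... | no _ with l Data.Fin.≟ i | l Data.Fin.≟ j | allF-true (λ l → (isYes (l Data.Fin.≟ i) ∨ isYes (l Data.Fin.≟ j)) ∨ isYes (ψ (inj₁ l) Data.Fin.≟ lookup y l)) (proj₂ (∧-true {isYes (ψ v Data.Fin.≟ φ₀ u)} t)) l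
          ...   | no _   | no _  | r = isYes-true (ψ (inj₁ l) Data.Fin.≟ lookup y l) r
          val ψ t (inj₂ ρ) Uw with inj₂ ρ ≟V v
          ... | yes refl = isYes-true (ψ v Data.Fin.≟ φ₀ u) (proj₁ (∧-true t))

    good : Cube n m → Bool
    good y = shadow T′ y ∧ not (any (λ q → conflict q y) (quads P))

    conflict-few : 1 ≤ n → ∀ q → cnt xs (conflict q) ≤ C * n ^ dim
    conflict-few 1≤n q@(i , _) = ℕP.*-cancelˡ-≤ n {{ℕ.>-nonZero 1≤n}} (begin
      n * cnt xs (conflict q)          ≤⟨ fibre-count i (conflict q) (λ _ → true) C (λ _ _ → refl) (fibre q) ⟩
      C * cnt xs (λ _ → true)          ≡⟨ cong (C *_) (trans (cnt-true xs) (length-cube n m)) ⟩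
      C * (n * n ^ dim)                ≡⟨ trans (sym (ℕP.*-assoc C n _)) (trans (cong (_* n ^ dim) (ℕP.*-comm C n)) (ℕP.*-assoc n C _)) ⟩
      n * (C * n ^ dim)                ∎)
      where open ℕP.≤-Reasoning

  good-dense : simplexThreshold P e D ≤ n → n ^ m ≤ 2 * D₂ * cnt xs good
  good-dense n≥ = ℕP.+-cancelʳ-≤ (n ^ m) _ _ (begin
    n ^ m + n ^ m                                            ≡⟨ cong (n ^ m +_) (ℕP.+-identityʳ _) ⟨
    2 * n ^ m                                                ≤⟨ ℕP.*-monoʳ-≤ 2 shadow-dense ⟩
    2 * (D₂ * cnt xs (shadow T′))                            ≡⟨ ℕP.*-assoc 2 D₂ _ ⟨
    2 * D₂ * cnt xs (shadow T′)                              ≤⟨ ℕP.*-monoʳ-≤ (2 * D₂) split ⟩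
    2 * D₂ * (cnt xs good + Z * n ^ dim)                     ≡⟨ ℕP.*-distribˡ-+ (2 * D₂) (cnt xs good) (Z * n ^ dim) ⟩
    2 * D₂ * cnt xs good + 2 * D₂ * (Z * n ^ dim)            ≡⟨ cong (2 * D₂ * cnt xs good +_) (sym (ℕP.*-assoc (2 * D₂) Z (n ^ dim))) ⟩
    2 * D₂ * cnt xs good + 2 * D₂ * Z * n ^ dim              ≤⟨ ℕP.+-monoʳ-≤ (2 * D₂ * cnt xs good) (ℕP.*-monoˡ-≤ (n ^ dim) (ℕP.<⇒≤ n≥)) ⟩
    2 * D₂ * cnt xs good + n ^ m                             ∎)
    where
    open ℕP.≤-Reasoning
    Z = length (quads P) * C
    split : cnt xs (shadow T′) ≤ cnt xs good + Z * n ^ dim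
    split = begin
      cnt xs (shadow T′)
        ≡⟨ cnt-split xs (shadow T′) (λ y → any (λ q → conflict q y) (quads P)) ⟩
      cnt xs (λ y → shadow T′ y ∧ any (λ q → conflict q y) (quads P)) + cnt xs good
        ≤⟨ ℕP.+-monoˡ-≤ (cnt xs good) (cnt-mono xs {λ y → shadow T′ y ∧ any (λ q → conflict q y) (quads P)} {λ y → any (λ q → conflict q y) (quads P)} (λ y e → proj₂ (∧-true {shadow T′ y} e))) ⟩
      cnt xs (λ y → any (λ q → conflict q y) (quads P)) + cnt xs good
        ≤⟨ ℕP.+-monoˡ-≤ (cnt xs good) (cnt-any xs (quads P) conflict (C * n ^ dim) (λ {q} _ → conflict-few (ℕP.≤-trans (s≤s z≤n) n≥) q)) ⟩
      length (quads P) * (C * n ^ dim) + cnt xs good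
        ≡⟨ trans (ℕP.+-comm _ (cnt xs good)) (cong (cnt xs good +_) (sym (ℕP.*-assoc (length (quads P)) C (n ^ dim)))) ⟩
      cnt xs good + Z * n ^ dim ∎

  record Simplex : Set where
    field
      pt     : Cube n m
      facet  : Fin m → Map
      facet∈ : ∀ i → facet i ∈ Φ′
      onFacet : ∀ i l → l ≢ i → facet i (inj₁ l) ≡ lookup pt l
      free   : ∀ i j → i ≢ j → ∀ u v → cl i j v ≡ false → facet i u ≢ facet j v

  open Simplex public

  private
    simplex : ∀ y → good y ≡ true → Simplex
    simplex y e = record
      { pt = y ; facet = λ i → proj₁ (pick i) ; facet∈ = λ i → proj₁ (proj₂ (pick i)) ; onFacet = λ i l → proj₂ (proj₂ (pick i)) l
      ; free = λ i j i≢j u v clv eq → clash i j i≢j u v clv eq }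
      where
      sh = proj₁ (∧-true {shadow T′ y} e)
      pick : ∀ i → ∃[ φ ] (φ ∈ Φ′ × ∀ l → l ≢ i → φ (inj₁ l) ≡ lookup y l)
      pick i = let a , ea = anyF-true (λ a → T′ (y [ i ]≔ a)) (allF-true (λ i → anyF (λ a → T′ (y [ i ]≔ a))) sh i)
                   φ , φ∈ , φ≡ = T-witness (y [ i ]≔ a) ea
               in φ , φ∈ , λ l l≢i → trans (φ≡ l) (VecP.lookup∘update′ l≢i y a)
      picked : ∀ i → proj₁ (pick i) ∈ picks i y
      picked i = ∈-filterᵇ⁺ (agreeOff i (lookup y)) (proj₁ (proj₂ (pick i))) (agreeOff-complete i (lookup y) (proj₁ (pick i)) (proj₂ (proj₂ (pick i))))
      clash : ∀ i j → i ≢ j → ∀ u v → cl i j v ≡ false → proj₁ (pick i) u ≢ proj₁ (pick j) v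
      clash i j i≢j u v clv eq with () ← trans (sym (any-false (λ q → conflict q y) (quads P) (not-true (proj₂ (∧-true {shadow T′ y} e)))
          (∈-cartesianProduct⁺ (∈-allFin i) (∈-cartesianProduct⁺ (∈-allFin j) (∈-cartesianProduct⁺ (∈-vs u) (∈-vs v))))))
        (cong₂ _∧_ (cong not (isYes-false⁺ (i Data.Fin.≟ j) i≢j)) (cong₂ _∧_ (cong not clv)
          (any-true⁺ _ (picks i y) (picked i) (any-true⁺ _ (picks j y) (picked j) (isYes-true⁺ (proj₁ (pick i) u Data.Fin.≟ proj₁ (pick j) v) eq)))))

  simplices : List Simplex
  simplices = collect xs good simplex

  simplices-dense : simplexThreshold P e D ≤ n → n ^ m ≤ 2 * simplexBound P e D * length simplices
  simplices-dense n≥ = subst (λ l → n ^ m ≤ 2 * D₂ * l) (sym (length-collect xs good simplex)) (good-dense n≥)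

  simplices-distinct : AllPairs (λ s s' → pt s ≢ pt s') simplices
  simplices-distinct = AllPairs-collect xs good simplex (cube-unique n m) (λ x y e e' ne → ne)

-- Assembling copies of the next pattern

mapEdge : ∀ {V V' : Set} → (V → V') → V × V × V → V' × V' × V'
mapEdge f (u , v , w) = f u , f v , f w

all-V : ∀ {d r} {Q : Fin d ⊎ Fin r → Set} → (∀ v → Dec (Q v)) → Dec (∀ v → Q v)
all-V Q? with FinP.all? (Q? ∘ inj₁) | FinP.all? (Q? ∘ inj₂)
... | yes p | yes q = yes λ { (inj₁ i) → p i ; (inj₂ j) → q j }
... | no ¬p | _     = no λ f → ¬p (f ∘ inj₁)
... | yes _ | no ¬q = no λ f → ¬q (f ∘ inj₂)

-- By `merge` and `separate` the copies of `P` are glued along the closure and nowhere else.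
record Assembly (P P' : Pattern) (cl : Closure P) : Set where
  open Pattern
  field
    ι°       : Fin (suc (dim P)) → Vtx P → Vtx P'
    locate   : ∀ u → ∃[ i ] ∃[ v ] ι° i v ≡ u
    merge    : ∀ i j v → cl i j v ≡ true → ι° j v ≡ ι° i v
    separate : ∀ i j u v → ι° i u ≡ ι° j v → u ≡ v × (i ≡ j ⊎ cl i j u ≡ true)
    edge     : ∀ {ed'} → ed' ∈ E P' → ∃[ i ] ∃[ ed ] (ed ∈ E P × ed' ≡ mapEdge (ι° i) ed)
    dim-suc  : dim P' ≡ suc (dim P)

img-mapEdge : ∀ {V V' : Set} {n} (f : V → V') (φ : V' → Fin n) (ψ : V → Fin n) → (∀ v → φ (f v) ≡ ψ v) → ∀ ed → img φ (mapEdge f ed) ≡ img ψ ed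
img-mapEdge f φ ψ eq (u , v , w) = cong₂ _∪_ (cong ⁅_⁆ (eq u)) (cong₂ _∪_ (cong ⁅_⁆ (eq v)) (cong ⁅_⁆ (eq w)))

lookup-≢ : ∀ {n m} (x y : Cube n m) → x ≢ y → ∃[ l ] lookup x l ≢ lookup y l
lookup-≢ []      []      x≢y = ⊥-elim (x≢y refl)
lookup-≢ (a ∷ x) (b ∷ y) x≢y with a Data.Fin.≟ b
... | no  a≢b  = zero , a≢b
... | yes refl = let l , ne = lookup-≢ x y (λ e → x≢y (cong (a ∷_) e)) in suc l , ne

other : ∀ {k} (l : Fin (suc (suc k))) → ∃[ i ] l ≢ i
other zero    = suc zero , λ ()
other (suc l) = zero , λ ()

-- `Good` remembers the origin of the copies: the passage from `F₃` to `F₄` uses it to recover that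
-- the copies of `F₃` consist of selected edges.
record Level (P : Pattern) {n : ℕ} (H : ThreeGraph n) (D : ℕ) (Good : (Pattern.Vtx P → Fin n) → Set) : Set where
  field
    copies   : List (Pattern.Vtx P → Fin n)
    isCopy   : All (Copies.Copy P H) copies
    distinct : AllPairs (Copies.Distinct P H) copies
    good     : ∀ {φ} → φ ∈ copies → Good φ
    dense    : n ^ Pattern.dim P ≤ D * length copies

module Ascend (P P' : Pattern) (g : ℕ) (adm : Admissible P g) (cl : Closure P) (gen : Generic P cl) (asm : Assembly P P' cl)
              {n : ℕ} (H : ThreeGraph n) (e d : ℕ) (d≥ : Pattern.dim P + g ≤ d) (noWin : ¬ Win e d H)
              {Good : (Pattern.Vtx P → Fin n) → Set} (D : ℕ) (lvl : Level P H D Good) where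

  open Simplices P g adm cl gen H e d d≥ noWin (Level.copies lvl) (Level.isCopy lvl) (Level.distinct lvl) D (Level.dense lvl) public
  open Assembly asm
  private module P′ = Copies P' H

  module _ (another : ∀ (l : Fin (suc dim)) → ∃[ i ] l ≢ i) (share : ∀ s i j v → cl i j v ≡ true → facet s i v ≡ facet s j v) where

    assemble : Simplex → P′.Map
    assemble s u = facet s (proj₁ (locate u)) (proj₁ (proj₂ (locate u)))

    -- `locate` may return another representative of the vertex. By `separate` it is then in the
    -- closure, where the facets agree.
    assemble-ι : ∀ s i v → assemble s (ι° i v) ≡ facet s i v
    assemble-ι s i v with locate (ι° i v)
    ... | j , w , eq with separate j i w v eq
    ...   | refl , inj₁ refl = refl
    ...   | refl , inj₂ c    = share s j i w c

    assemble-copy : ∀ s → P′.Copy (assemble s)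
    assemble-copy s = inj , All.tabulate edges∈
      where
      inj : Inj (assemble s)
      inj u v eq = trans (sym eu) (trans (go i j a b eq) ev)
        where
        i = proj₁ (locate u)
        a = proj₁ (proj₂ (locate u))
        eu = proj₂ (proj₂ (locate u))
        j = proj₁ (locate v)
        b = proj₁ (proj₂ (locate v))
        ev = proj₂ (proj₂ (locate v))
        go : ∀ i j a b → facet s i a ≡ facet s j b → ι° i a ≡ ι° j b
        go i j a b eq with i Data.Fin.≟ j
        ... | yes refl = cong (ι° i) (proj₁ (Φ′-copy (facet∈ s i)) a b eq)
        ... | no i≢j with cl i j b in c
        ...   | false = ⊥-elim (free s i j i≢j a b c eq)
        ...   | true  = trans (cong (ι° i) (proj₁ (Φ′-copy (facet∈ s i)) a b (trans eq (sym (share s i j b c))))) (sym (merge i j b c))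
      edges∈ : ∀ {ed'} → ed' ∈ P′.E → img (assemble s) ed' ∈ edges H
      edges∈ ed'∈ with edge ed'∈
      ... | i , ed , ed∈ , refl = subst (_∈ edges H) (sym (img-mapEdge (ι° i) (assemble s) (facet s i) (assemble-ι s i) ed))
                                    (All.lookup (proj₂ (Φ′-copy (facet∈ s i))) ed∈)

    -- A coordinate where the points differ is a root of the copy on any facet other than the
    -- opposite one.
    assemble-distinct : ∀ s s' → pt s ≢ pt s' → P′.Distinct (assemble s) (assemble s')
    assemble-distinct s s' ne with lookup-≢ (pt s) (pt s') ne
    ... | l , ne' with another l
    ...   | i , l≢i = ι° i (inj₁ l) , λ eq → ne' (trans (sym (onFacet s i l l≢i)) (trans (sym (assemble-ι s i (inj₁ l))) (trans eq (trans (assemble-ι s' i (inj₁ l)) (onFacet s' i l l≢i)))))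

    ascend : simplexThreshold P e D ≤ n → Level P' H (2 * simplexBound P e D) (λ φ → ∃[ s ] ∀ i v → φ (ι° i v) ≡ facet s i v)
    ascend n≥ = record
      { copies   = map assemble simplices
      ; isCopy   = AllP.map⁺ (All.universal assemble-copy simplices)
      ; distinct = AllPairsP.map⁺ (AllPairs.map (λ {s} {s'} → assemble-distinct s s') simplices-distinct)
      ; good     = λ φ∈ → let s , _ , eq = ∈-map⁻ assemble φ∈ in s , λ i v → trans (cong (λ φ → φ (ι° i v)) eq) (assemble-ι s i v)
      ; dense    = subst₂ (λ k l → n ^ k ≤ 2 * simplexBound P e D * l) (sym dim-suc) (sym (ListP.length-map assemble simplices)) (simplices-dense n≥) }

-- Deciding properties of small patterns

allBits : ∀ m → (Vec Bool m → Bool) → Bool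
allBits zero    f = f []
allBits (suc m) f = allBits m (λ b → f (false ∷ b)) ∧ allBits m (λ b → f (true ∷ b))

allBits-sound : ∀ m f → allBits m f ≡ true → ∀ b → f b ≡ true
allBits-sound zero    f e []          = e
allBits-sound (suc m) f e (false ∷ b) = allBits-sound m _ (proj₁ (∧-true e)) b
allBits-sound (suc m) f e (true ∷ b)  = allBits-sound m _ (proj₂ (∧-true {allBits m (λ b → f (false ∷ b))} e)) b

finPattern : (d r : ℕ) → List ((Fin (suc d) ⊎ Fin r) × (Fin (suc d) ⊎ Fin r) × (Fin (suc d) ⊎ Fin r)) → Pattern
finPattern d r E = record { dim = d ; Rest = Fin r ; _≟R_ = Data.Fin._≟_ ; rests = allFin r ; ∈-rests = ∈-allFin ; E = E }

≤ᵇ-sound : ∀ {a b} → (a ℕ.≤ᵇ b) ≡ true → a ≤ b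
≤ᵇ-sound {a} {b} e = ℕP.≤ᵇ⇒≤ a b (≡⇒T e)

module Bits (d r : ℕ) (E′ : List ((Fin (suc d) ⊎ Fin r) × (Fin (suc d) ⊎ Fin r) × (Fin (suc d) ⊎ Fin r))) where

  open Pattern (finPattern d r E′)

  private
    fromBits : Vec Bool (suc d) → Vec Bool r → Vtx → Bool
    fromBits b c (inj₁ l) = lookup b l
    fromBits b c (inj₂ ρ) = lookup c ρ

  -- Vertex sets run through bit vectors, so that a property of all sets holds by evaluation.
  -- Soundness requires the property to respect pointwise equality.
  ∀K : ((Vtx → Bool) → Bool) → Bool
  ∀K f = allBits (suc d) (λ b → allBits r (λ c → f (fromBits b c)))

  ∀K-sound : ∀ f → (∀ {K K'} → (∀ v → K v ≡ K' v) → f K ≡ f K') → ∀K f ≡ true → ∀ K → f K ≡ true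
  ∀K-sound f cg e K = trans (cg same) (allBits-sound r (λ c → f (fromBits b c)) (allBits-sound (suc d) (λ b → allBits r (λ c → f (fromBits b c))) e b) c)
    where
    b = Vec.tabulate (K ∘ inj₁)
    c = Vec.tabulate (K ∘ inj₂)
    same : ∀ v → K v ≡ fromBits b c v
    same (inj₁ l) = sym (VecP.lookup∘tabulate (K ∘ inj₁) l)
    same (inj₂ ρ) = sym (VecP.lookup∘tabulate (K ∘ inj₂) ρ)

  inside-cong : ∀ {K K' : Vtx → Bool} → (∀ v → K v ≡ K' v) → ∀ ed → inside K ed ≡ inside K' ed
  inside-cong eq (u , v , w) = cong₂ _∧_ (eq u) (cong₂ _∧_ (eq v) (eq w))

  rankTest : (Vtx → Bool) → (Vtx → Bool) → Bool
  rankTest U K = any (λ v → U v ∧ not (K v)) vs ∨ ((cntE K + d) ℕ.≤ᵇ cntV K)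

  rank : ∀ U → ∀K (rankTest U) ≡ true → Rank U
  rank U e K U⊆K with ∨-true {any (λ v → U v ∧ not (K v)) vs} (∀K-sound (rankTest U) cg e K)
    where
    cg : ∀ {K K'} → (∀ v → K v ≡ K' v) → rankTest U K ≡ rankTest U K'
    cg eq = cong₂ _∨_ (any-cong vs (λ v → cong (λ b → U v ∧ not b) (eq v))) (cong₂ (λ a b → (a + d) ℕ.≤ᵇ b) (cnt-cong E (inside-cong eq)) (cnt-cong vs eq))
  ... | inj₂ le = ≤ᵇ-sound le
  ... | inj₁ bad with any-true (λ v → U v ∧ not (K v)) vs bad
  ...   | v , _ , e' with () ← trans (sym (not-true (proj₂ (∧-true {U v} e')))) (U⊆K v (proj₁ (∧-true e')))

  balanceTest : (Vtx → Bool) → Bool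
  balanceTest K = (cntE K + d ⊓ (cntW K + 1 ⊓ cntE K)) ℕ.≤ᵇ cntV K

  balance : ∀K balanceTest ≡ true → ∀ K → cntE K + d ⊓ (cntW K + 1 ⊓ cntE K) ≤ cntV K
  balance e K = ≤ᵇ-sound (∀K-sound balanceTest cg e K)
    where
    cg : ∀ {K K'} → (∀ v → K v ≡ K' v) → balanceTest K ≡ balanceTest K'
    cg eq = cong₂ ℕ._≤ᵇ_ (cong₂ (λ a w → a + d ⊓ (w + 1 ⊓ a)) (cnt-cong E (inside-cong eq)) (cnt-cong (allFin (suc d)) (eq ∘ inj₁))) (cnt-cong vs eq)

  subTest : (Vtx → Bool) → Bool
  subTest K = cntE K ℕ.≤ᵇ cntV K

  subset : ∀K subTest ≡ true → ∀ K → cntE K ≤ cntV K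
  subset e K = ≤ᵇ-sound (∀K-sound subTest (λ eq → cong₂ ℕ._≤ᵇ_ (cnt-cong E (inside-cong eq)) (cnt-cong vs eq)) e K)

  rankPairTest : Closure (finPattern d r E′) → Bool
  rankPairTest cl = allF (λ i → allF (λ j → not (any (λ v → not (isYes (i Data.Fin.≟ j) ∨ (cl i j v ∨ ∀K (rankTest (pairRoots (finPattern d r E′) i j v))))) vs)))

  generic : ∀ cl → allF (λ i → ∀K (rankTest (facetRoots (finPattern d r E′) i))) ≡ true → rankPairTest cl ≡ true → Generic (finPattern d r E′) cl
  generic cl e₁ e₂ = record
    { rankFacet = λ i → rank _ (allF-true (λ i → ∀K (rankTest (facetRoots (finPattern d r E′) i))) e₁ i)
    ; rankPair  = λ i j i≢j v clv → rank _ (pick i j i≢j v clv) }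
    where
    pick : ∀ i j → i ≢ j → ∀ v → cl i j v ≡ false → ∀K (rankTest (pairRoots (finPattern d r E′) i j v)) ≡ true
    pick i j i≢j v clv with ∨-true (not-false (any-false (λ v → not (isYes (i Data.Fin.≟ j) ∨ (cl i j v ∨ ∀K (rankTest (pairRoots (finPattern d r E′) i j v))))) vs
      (not-true (allF-true (λ j → not (any (λ v → not (isYes (i Data.Fin.≟ j) ∨ (cl i j v ∨ ∀K (rankTest (pairRoots (finPattern d r E′) i j v))))) vs)) (allF-true _ e₂ i) j)) (∈-vs v)))
    ... | inj₁ i≡j = ⊥-elim (i≢j (isYes-true (i Data.Fin.≟ j) i≡j))
    ... | inj₂ e with ∨-true {cl i j v} e
    ...   | inj₁ c with () ← trans (sym c) clv
    ...   | inj₂ ok = ok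

-- The patterns F₂, F₃ and F₄

rootClosure : ∀ P → Closure P
rootClosure P i j v = facetRoots P i v ∧ facetRoots P j v

pattern r0 = inj₁ zero
pattern r1 = inj₁ (suc zero)
pattern r2 = inj₁ (suc (suc zero))
pattern r3 = inj₁ (suc (suc (suc zero)))
pattern r4 = inj₁ (suc (suc (suc (suc zero))))
pattern s0 = inj₂ zero
pattern s1 = inj₂ (suc zero)
pattern s2 = inj₂ (suc (suc zero))
pattern s3 = inj₂ (suc (suc (suc zero)))
pattern s4 = inj₂ (suc (suc (suc (suc zero))))
pattern s5 = inj₂ (suc (suc (suc (suc (suc zero)))))
pattern s6 = inj₂ (suc (suc (suc (suc (suc (suc zero))))))
pattern s7 = inj₂ (suc (suc (suc (suc (suc (suc (suc zero)))))))

E₂ : List ((Fin 3 ⊎ Fin 0) × (Fin 3 ⊎ Fin 0) × (Fin 3 ⊎ Fin 0))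
E₂ = (r0 , r1 , r2) ∷ []

-- The triangle is `r0`, `r1`, `s0`; the `i`-th edge replaces its `i`-th vertex by `r2`, `r3` or
-- `s1`.
E₃ : List ((Fin 4 ⊎ Fin 2) × (Fin 4 ⊎ Fin 2) × (Fin 4 ⊎ Fin 2))
E₃ = (r2 , r1 , s0) ∷ (r0 , r3 , s0) ∷ (r0 , r1 , s1) ∷ []

F₂ F₃ : Pattern
F₂ = finPattern 2 0 E₂
F₃ = finPattern 3 2 E₃

-- Two roots of the (6,3)-configuration in a common edge determine its third vertex.
closure₃ : Closure F₃
closure₃ i j s0 = (isYes (i Data.Fin.≟ zero) ∧ isYes (j Data.Fin.≟ suc (suc (suc zero)))) ∨ ((isYes (j Data.Fin.≟ zero) ∧ isYes (i Data.Fin.≟ suc (suc (suc zero))))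
  ∨ ((isYes (i Data.Fin.≟ suc zero) ∧ isYes (j Data.Fin.≟ suc (suc zero))) ∨ (isYes (j Data.Fin.≟ suc zero) ∧ isYes (i Data.Fin.≟ suc (suc zero)))))
closure₃ i j s1 = (isYes (i Data.Fin.≟ suc (suc zero)) ∧ isYes (j Data.Fin.≟ suc (suc (suc zero)))) ∨ (isYes (j Data.Fin.≟ suc (suc zero)) ∧ isYes (i Data.Fin.≟ suc (suc (suc zero))))
closure₃ i j v@(inj₁ _) = rootClosure F₃ i j v

generic₂ : Generic F₂ (rootClosure F₂)
generic₂ = Bits.generic 2 0 E₂ (rootClosure F₂) refl refl

generic₃ : Generic F₃ closure₃
generic₃ = Bits.generic 3 2 E₃ closure₃ refl refl

-- The tetrahedron is `s0`, `s1`, `s2`, `s3`, with off-facet roots `s6`, `s7`, `r3`, `r4`. The roots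
-- `r0`, `r1`, `r2` are the images of `s1` in the four copies of `F₃`, two of which coincide.
E₄ : List ((Fin 5 ⊎ Fin 8) × (Fin 5 ⊎ Fin 8) × (Fin 5 ⊎ Fin 8))
E₄ = (s2 , s1 , s4) ∷ (s0 , r4 , s4) ∷ (s0 , s1 , r0) ∷ (r3 , s1 , s5) ∷ (s0 , s3 , s5) ∷
     (s2 , s7 , s5) ∷ (s0 , s7 , r1) ∷ (s6 , s3 , s4) ∷ (s6 , s1 , r2) ∷ []

F₄ : Pattern
F₄ = finPattern 4 8 E₄

-- Excess up to `dim` is forced by roots alone, with one extra unit once an edge is present. This
-- yields the ranks of facets and pairs and is inherited by `Next`. An edge of `F₃` with two roots
-- violates it, hence the separate treatment of that pattern.
Balanced : Pattern → Set
Balanced P = ∀ K → cntE K + dim ⊓ (cntW K + 1 ⊓ cntE K) ≤ cntV K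
  where open Pattern P

balanced₄ : Balanced F₄
balanced₄ = Bits.balance 4 8 E₄ refl

admissible₂ : Admissible F₂ 3
admissible₂ = record
  { size = refl ; sub = Bits.subset 2 0 E₂ refl
  ; cover = λ r _ → (λ _ → true) , All.tabulate (λ _ → refl) , ℕP.m≤n+m 3 r ; differ = [] ∷ [] }

differ? : ∀ {d r} (ed ed' : (Fin d ⊎ Fin r) × (Fin d ⊎ Fin r) × (Fin d ⊎ Fin r)) → Dec (Differ ed ed')
differ? ed ed' with Any.any? (λ v → ¬? (Any.any? (v ≟_) (verts ed'))) (verts ed)
  where _≟_ = SumP.≡-dec Data.Fin._≟_ Data.Fin._≟_
... | yes p = let v , v∈ , v∉ = find p in yes (v , v∈ , v∉)
... | no ¬p = no λ { (v , v∈ , v∉) → ¬p (lose v∈ v∉) }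

admissible₃ : Admissible F₃ 6
admissible₃ = record
  { size = refl ; sub = Bits.subset 3 2 E₃ refl
  ; cover = λ r _ → (λ _ → true) , All.tabulate (λ _ → refl) , ℕP.m≤n+m 6 r
  ; differ = from-yes (AllPairs.allPairs? differ? E₃) }

assembly₂ : Assembly F₂ F₃ (rootClosure F₂)
assembly₂ = record
  { ι° = ι₂ ; locate = loc
  ; merge = λ i j v → from-yes (FinP.all? λ i → FinP.all? λ j → all-V λ v → ((rootClosure F₂ i j v) Data.Bool.≟ true) →-dec (ι₂ j v ≟₃ ι₂ i v)) i j v
  ; separate = λ i j u v → from-yes (FinP.all? λ i → FinP.all? λ j → all-V λ u → all-V λ v → (ι₂ i u ≟₃ ι₂ j v) →-dec ((u ≟₂ v) ×-dec ((i Data.Fin.≟ j) ⊎-dec (rootClosure F₂ i j u Data.Bool.≟ true)))) i j u v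
  ; edge = λ { (here refl) → zero , _ , here refl , refl ; (there (here refl)) → suc zero , _ , here refl , refl ; (there (there (here refl))) → suc (suc zero) , _ , here refl , refl }
  ; dim-suc = refl }
  where
  _≟₂_ = Pattern._≟V_ F₂
  _≟₃_ = Pattern._≟V_ F₃
  ι₂ : Fin 3 → Fin 3 ⊎ Fin 0 → Fin 4 ⊎ Fin 2
  ι₂ zero             r0 = r2
  ι₂ zero             r1 = r1
  ι₂ zero             r2 = s0
  ι₂ (suc zero)       r0 = r0
  ι₂ (suc zero)       r1 = r3
  ι₂ (suc zero)       r2 = s0
  ι₂ (suc (suc zero)) r0 = r0
  ι₂ (suc (suc zero)) r1 = r1
  ι₂ (suc (suc zero)) r2 = s1
  loc : ∀ u → ∃[ i ] ∃[ v ] ι₂ i v ≡ u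
  loc r0 = suc zero , r0 , refl
  loc r1 = zero , r1 , refl
  loc r2 = zero , r0 , refl
  loc r3 = suc zero , r1 , refl
  loc s0 = zero , r2 , refl
  loc s1 = suc (suc zero) , r2 , refl

private
  pattern f0 = zero
  pattern f1 = suc zero
  pattern f2 = suc (suc zero)
  pattern f3 = suc (suc (suc zero))

assembly₃ : Assembly F₃ F₄ closure₃
assembly₃ = record
  { ι° = ι₃ ; locate = loc
  ; merge = λ i j v → from-yes (FinP.all? λ i → FinP.all? λ j → all-V λ v → (closure₃ i j v Data.Bool.≟ true) →-dec (ι₃ j v ≟₄ ι₃ i v)) i j v
  ; separate = λ i j u v → from-yes (FinP.all? λ i → FinP.all? λ j → all-V λ u → all-V λ v → (ι₃ i u ≟₄ ι₃ j v) →-dec ((u ≟₃ v) ×-dec ((i Data.Fin.≟ j) ⊎-dec (closure₃ i j u Data.Bool.≟ true)))) i j u v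
  ; edge = λ ed∈ → All.lookup edge₃ ed∈
  ; dim-suc = refl }
  where
  _≟₃_ = Pattern._≟V_ F₃
  _≟₄_ = Pattern._≟V_ F₄
  ι₃ : Fin 4 → Fin 4 ⊎ Fin 2 → Fin 5 ⊎ Fin 8
  ι₃ f0 r0 = s6
  ι₃ f0 r1 = s1
  ι₃ f0 r2 = s2
  ι₃ f0 r3 = s3
  ι₃ f0 s0 = s4
  ι₃ f0 s1 = r2
  ι₃ f1 r0 = s0
  ι₃ f1 r1 = s7
  ι₃ f1 r2 = s2
  ι₃ f1 r3 = s3
  ι₃ f1 s0 = s5
  ι₃ f1 s1 = r1
  ι₃ f2 r0 = s0
  ι₃ f2 r1 = s1
  ι₃ f2 r2 = r3
  ι₃ f2 r3 = s3
  ι₃ f2 s0 = s5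
  ι₃ f2 s1 = r0
  ι₃ f3 r0 = s0
  ι₃ f3 r1 = s1
  ι₃ f3 r2 = s2
  ι₃ f3 r3 = r4
  ι₃ f3 s0 = s4
  ι₃ f3 s1 = r0
  loc : ∀ u → ∃[ i ] ∃[ v ] ι₃ i v ≡ u
  loc r0 = f3 , s1 , refl
  loc r1 = f1 , s1 , refl
  loc r2 = f0 , s1 , refl
  loc r3 = f2 , r2 , refl
  loc r4 = f3 , r3 , refl
  loc s0 = f1 , r0 , refl
  loc s1 = f0 , r1 , refl
  loc s2 = f0 , r2 , refl
  loc s3 = f0 , r3 , refl
  loc s4 = f0 , s0 , refl
  loc s5 = f1 , s0 , refl
  loc s6 = f0 , r0 , refl
  loc s7 = f1 , r1 , refl
  e0 : (r2 , r1 , s0) ∈ E₃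
  e0 = here refl
  e1 : (r0 , r3 , s0) ∈ E₃
  e1 = there (here refl)
  e2 : (r0 , r1 , s1) ∈ E₃
  e2 = there (there (here refl))
  edge₃ : All (λ ed' → ∃[ i ] ∃[ ed ] (ed ∈ E₃ × ed' ≡ mapEdge (ι₃ i) ed)) E₄
  edge₃ = (f3 , _ , e0 , refl) ∷ (f3 , _ , e1 , refl) ∷ (f3 , _ , e2 , refl) ∷ (f2 , _ , e0 , refl) ∷ (f2 , _ , e1 , refl) ∷
          (f1 , _ , e0 , refl) ∷ (f1 , _ , e2 , refl) ∷ (f0 , _ , e1 , refl) ∷ (f0 , _ , e2 , refl) ∷ []

-- From edges to copies of F₄

rootClosure-sound : ∀ P i j l → rootClosure P i j (inj₁ l) ≡ true → l ≢ i × l ≢ j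
rootClosure-sound P i j l e = differ-from i (proj₁ (∧-true e)) , differ-from j (proj₂ (∧-true {facetRoots P i (inj₁ l)} e))
  where
  differ-from : ∀ i → facetRoots P i (inj₁ l) ≡ true → l ≢ i
  differ-from i e' l≡i with () ← trans (sym e') (cong not (isYes-true⁺ (l Data.Fin.≟ i) l≡i))

bound₂ bound₃ : ℕ → ℕ → ℕ
bound₂ e D = 2 * simplexBound F₂ e D
bound₃ e D = 2 * simplexBound F₃ e (bound₂ e D)

module Base {n : ℕ} (H : ThreeGraph n) (e d : ℕ) (9≤d : 9 ≤ d) (noWin : ¬ Win e d H)
            (D : ℕ) {Good : (Pattern.Vtx F₂ → Fin n) → Set} (lvl₂ : Level F₂ H D Good) where

  private
    module A₂ = Ascend F₂ F₃ 3 admissible₂ (rootClosure F₂) generic₂ assembly₂ H e d (ℕP.≤-trans (s≤s (s≤s (s≤s (s≤s (s≤s z≤n))))) 9≤d) noWin D lvl₂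

    share₂ : ∀ s i j v → rootClosure F₂ i j v ≡ true → A₂.facet s i v ≡ A₂.facet s j v
    share₂ s i j (inj₁ l) c = let l≢i , l≢j = rootClosure-sound F₂ i j l c in trans (A₂.onFacet s i l l≢i) (sym (A₂.onFacet s j l l≢j))

    Sub : (Pattern.Vtx F₃ → Fin n) → Set
    Sub φ = ∃[ s ] ∀ i v → φ (Assembly.ι° assembly₂ i v) ≡ A₂.facet s i v

    module Second (lvl₃ : Level F₃ H (bound₂ e D) Sub) where

      module A₃ = Ascend F₃ F₄ 6 admissible₃ closure₃ generic₃ assembly₃ H e d 9≤d noWin (bound₂ e D) lvl₃

      sub : ∀ s i → Sub (A₃.facet s i)
      sub s i = Level.good lvl₃ (A₃.Φ′⊆ (A₃.facet∈ s i))

      -- The `q`-th edges of both copies belong to the thinned list of edges, in which the first two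
      -- roots determine the edge.
      viaEdge : ∀ s i j q → let ι° = Assembly.ι° assembly₂ q ; φ = A₃.facet s i ; ψ = A₃.facet s j in
                φ (ι° r0) ≡ ψ (ι° r0) → φ (ι° r1) ≡ ψ (ι° r1) → φ (ι° r2) ≡ ψ (ι° r2)
      viaEdge s i j q e₀ e₁ = trans (sφ q r2) (trans (cong (λ χ → χ r2) same) (sym (sψ q r2)))
        where
        sφ = proj₂ (sub s i)
        sψ = proj₂ (sub s j)
        u  = proj₁ (sub s i)
        u' = proj₁ (sub s j)
        roots-agree : ∀ l → l ≢ f2 → A₂.facet u q (inj₁ l) ≡ A₂.facet u' q (inj₁ l)
        roots-agree f0 _ = trans (sym (sφ q r0)) (trans e₀ (sψ q r0))
        roots-agree f1 _ = trans (sym (sφ q r1)) (trans e₁ (sψ q r1))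
        roots-agree f2 ne = ⊥-elim (ne refl)
        same : A₂.facet u q ≡ A₂.facet u' q
        same = A₂.determined (A₂.facet∈ u q) (A₂.facet∈ u' q) f2 roots-agree

      onBoth : ∀ s i j l → l ≢ i → l ≢ j → A₃.facet s i (inj₁ l) ≡ A₃.facet s j (inj₁ l)
      onBoth s i j l l≢i l≢j = trans (A₃.onFacet s i l l≢i) (sym (A₃.onFacet s j l l≢j))

      share₃ : ∀ s i j v → closure₃ i j v ≡ true → A₃.facet s i v ≡ A₃.facet s j v
      share₃ s i j (inj₁ l) c = let l≢i , l≢j = rootClosure-sound F₃ i j l c in onBoth s i j l l≢i l≢j
      share₃ s f0 f3 s0 c = viaEdge s f0 f3 f0 (onBoth s f0 f3 f2 (λ ()) (λ ())) (onBoth s f0 f3 f1 (λ ()) (λ ()))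
      share₃ s f3 f0 s0 c = viaEdge s f3 f0 f0 (onBoth s f3 f0 f2 (λ ()) (λ ())) (onBoth s f3 f0 f1 (λ ()) (λ ()))
      share₃ s f1 f2 s0 c = viaEdge s f1 f2 f1 (onBoth s f1 f2 f0 (λ ()) (λ ())) (onBoth s f1 f2 f3 (λ ()) (λ ()))
      share₃ s f2 f1 s0 c = viaEdge s f2 f1 f1 (onBoth s f2 f1 f0 (λ ()) (λ ())) (onBoth s f2 f1 f3 (λ ()) (λ ()))
      share₃ s f2 f3 s1 c = viaEdge s f2 f3 f2 (onBoth s f2 f3 f0 (λ ()) (λ ())) (onBoth s f2 f3 f1 (λ ()) (λ ()))
      share₃ s f3 f2 s1 c = viaEdge s f3 f2 f2 (onBoth s f3 f2 f0 (λ ()) (λ ())) (onBoth s f3 f2 f1 (λ ()) (λ ()))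
      share₃ s f0 f0 s0 ()
      share₃ s f0 f1 s0 ()
      share₃ s f0 f2 s0 ()
      share₃ s f1 f0 s0 ()
      share₃ s f1 f1 s0 ()
      share₃ s f1 f3 s0 ()
      share₃ s f2 f0 s0 ()
      share₃ s f2 f2 s0 ()
      share₃ s f2 f3 s0 ()
      share₃ s f3 f1 s0 ()
      share₃ s f3 f2 s0 ()
      share₃ s f3 f3 s0 ()
      share₃ s f0 f0 s1 ()
      share₃ s f0 f1 s1 ()
      share₃ s f0 f2 s1 ()
      share₃ s f0 f3 s1 ()
      share₃ s f1 f0 s1 ()
      share₃ s f1 f1 s1 ()
      share₃ s f1 f2 s1 ()
      share₃ s f1 f3 s1 ()
      share₃ s f2 f0 s1 ()
      share₃ s f2 f1 s1 ()
      share₃ s f2 f2 s1 ()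
      share₃ s f3 f0 s1 ()
      share₃ s f3 f1 s1 ()
      share₃ s f3 f3 s1 ()

      ⊤-good : ∀ {G} → Level F₄ H (bound₃ e D) G → Level F₄ H (bound₃ e D) (λ _ → ⊤)
      ⊤-good l = record { copies = Level.copies l ; isCopy = Level.isCopy l ; distinct = Level.distinct l ; good = λ _ → tt ; dense = Level.dense l }

      level₄ : simplexThreshold F₃ e (bound₂ e D) ≤ n → Level F₄ H (bound₃ e D) (λ _ → ⊤)
      level₄ n≥ = ⊤-good (A₃.ascend other share₃ n≥)

  level₄ : simplexThreshold F₂ e D ≤ n → simplexThreshold F₃ e (bound₂ e D) ≤ n → Level F₄ H (bound₃ e D) (λ _ → ⊤)
  level₄ n≥₂ n≥₃ = Second.level₄ (A₂.ascend other share₂ n≥₂) n≥₃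

-- Sums over the facets

∨-introˡ : ∀ {a b} → a ≡ true → a ∨ b ≡ true
∨-introˡ refl = refl

bit : Bool → ℕ
bit b = if b then 1 else 0

bit≤1 : ∀ b → bit b ≤ 1
bit≤1 true  = s≤s z≤n
bit≤1 false = z≤n

sumF : ∀ m → (Fin m → ℕ) → ℕ
sumF zero    f = 0
sumF (suc m) f = f zero + sumF m (f ∘ suc)

sumF-cong : ∀ m {f g : Fin m → ℕ} → (∀ i → f i ≡ g i) → sumF m f ≡ sumF m g
sumF-cong zero    e = refl
sumF-cong (suc m) e = cong₂ _+_ (e zero) (sumF-cong m (e ∘ suc))

sumF-mono : ∀ m {f g : Fin m → ℕ} → (∀ i → f i ≤ g i) → sumF m f ≤ sumF m g
sumF-mono zero    e = z≤n
sumF-mono (suc m) e = ℕP.+-mono-≤ (e zero) (sumF-mono m (e ∘ suc))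

sumF-+ : ∀ m (f g : Fin m → ℕ) → sumF m (λ i → f i + g i) ≡ sumF m f + sumF m g
sumF-+ zero    f g = refl
sumF-+ (suc m) f g = trans (cong (f zero + g zero +_) (sumF-+ m (f ∘ suc) (g ∘ suc)))
  (solveℕ 4 (λ a b c d → a ⊞ b ⊞ (c ⊞ d) ≜ a ⊞ c ⊞ (b ⊞ d)) refl (f zero) (g zero) (sumF m (f ∘ suc)) (sumF m (g ∘ suc)))
  where open +-*-Solver

sumF-bits : ∀ m (b : Fin m → Bool) → sumF m (bit ∘ b) ≤ m
sumF-bits zero    b = z≤n
sumF-bits (suc m) b = ℕP.+-mono-≤ (bit≤1 (b zero)) (sumF-bits m (b ∘ suc))

sumF-not : ∀ m (b : Fin m → Bool) → sumF m (bit ∘ b) + sumF m (bit ∘ not ∘ b) ≡ m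
sumF-not zero    b = refl
sumF-not (suc m) b = trans (solveℕ 4 (λ a b c d → a ⊞ c ⊞ (b ⊞ d) ≜ a ⊞ b ⊞ (c ⊞ d)) refl (bit (b zero)) (bit (not (b zero))) (sumF m (bit ∘ b ∘ suc)) (sumF m (bit ∘ not ∘ b ∘ suc)))
  (cong₂ _+_ (one (b zero)) (sumF-not m (b ∘ suc)))
  where
  one : ∀ b → bit b + bit (not b) ≡ 1
  one true  = refl
  one false = refl

sumF-term : ∀ m (f : Fin m → ℕ) i → f i ≤ sumF m f
sumF-term (suc m) f zero    = ℕP.m≤m+n _ _
sumF-term (suc m) f (suc i) = ℕP.≤-trans (sumF-term m (f ∘ suc) i) (ℕP.m≤n+m _ _)

sumF-min1 : ∀ m (f : Fin m → ℕ) → 1 ⊓ sumF m f ≤ sumF m (λ i → 1 ⊓ f i)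
sumF-min1 zero    f = z≤n
sumF-min1 (suc m) f with f zero
... | zero  = sumF-min1 m (f ∘ suc)
... | suc _ = s≤s z≤n


choose : ∀ {A B : Set} → Dec A → B → B → B
choose (yes _) x y = x
choose (no _)  x y = y

sumF-update : ∀ m (f : Fin m → ℕ) i x → sumF m (λ l → choose (l Data.Fin.≟ i) x (f l)) + f i ≡ sumF m f + x
sumF-update (suc m) f zero x = begin
  x + sumF m (λ l → choose (suc l Data.Fin.≟ zero) x (f (suc l))) + f zero  ≡⟨ cong (λ s → x + s + f zero) (sumF-cong m (λ l → refl)) ⟩
  x + sumF m (f ∘ suc) + f zero                                             ≡⟨ solveℕ 3 (λ a b c → a ⊞ b ⊞ c ≜ c ⊞ b ⊞ a) refl x (sumF m (f ∘ suc)) (f zero) ⟩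
  f zero + sumF m (f ∘ suc) + x                                             ∎
  where
  open ≡-Reasoning
sumF-update (suc m) f (suc i) x = begin
  f zero + sumF m (λ l → choose (suc l Data.Fin.≟ suc i) x (f (suc l))) + f (suc i)  ≡⟨ cong (λ s → f zero + s + f (suc i)) (sumF-cong m same) ⟩
  f zero + sumF m (λ l → choose (l Data.Fin.≟ i) x (f (suc l))) + f (suc i)          ≡⟨ trans (ℕP.+-assoc (f zero) _ _) (cong (f zero +_) (sumF-update m (f ∘ suc) i x)) ⟩
  f zero + (sumF m (f ∘ suc) + x)                                                    ≡⟨ ℕP.+-assoc (f zero) _ x ⟨
  f zero + sumF m (f ∘ suc) + x                                                      ∎
  where
  open ≡-Reasoning
  same : ∀ l → choose (suc l Data.Fin.≟ suc i) x (f (suc l)) ≡ choose (l Data.Fin.≟ i) x (f (suc l))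
  same l with l Data.Fin.≟ i
  ... | yes refl = refl
  ... | no _     = refl

cnt-tabulate : ∀ {A : Set} m (f : Fin m → A) P → cnt (tabulate f) P ≡ sumF m (bit ∘ P ∘ f)
cnt-tabulate zero    f P = refl
cnt-tabulate (suc m) f P = cong (bit (P (f zero)) +_) (cnt-tabulate m (f ∘ suc) P)

cnt-concatMap : ∀ {A B : Set} m (f : Fin m → A) (h : A → List B) P → cnt (concatMap h (tabulate f)) P ≡ sumF m (λ i → cnt (h (f i)) P)
cnt-concatMap zero    f h P = refl
cnt-concatMap (suc m) f h P = trans (cnt-++ (h (f zero)) _ P) (cong (cnt (h (f zero)) P +_) (cnt-concatMap m (f ∘ suc) h P))

-- Balanced patterns of higher dimension

record Raw (j : ℕ) : Set₁ where
  infix 4 _≟R_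
  field
    Rest    : Set
    _≟R_    : DecidableEquality Rest
    rests   : List Rest
    ∈-rests : ∀ ρ → ρ ∈ rests
    E       : List ((Fin (4 + j) ⊎ Rest) × (Fin (4 + j) ⊎ Rest) × (Fin (4 + j) ⊎ Rest))

toPattern : ∀ {j} → Raw j → Pattern
toPattern {j} R = record { dim = 3 + j ; Rest = Rest ; _≟R_ = _≟R_ ; rests = rests ; ∈-rests = ∈-rests ; E = E }
  where open Raw R

-- `coverR` charges only vertices that are not roots; `admissible` adds all roots once. `inner`
-- serves to tell apart edges of different copies.
record Props {j : ℕ} (R : Raw j) (h : ℕ) : Set where
  open Raw R
  field
    size     : suc (length rests) ≡ length E
    balanced : Balanced (toPattern R)
    coverR   : ∀ r → r ≤ length E → ∃[ C ] ((∀ {ed ρ} → ed ∈ take r E → inj₂ ρ ∈ verts ed → C ρ ≡ true) × cnt rests C ≤ r + h)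
    differ   : AllPairs Differ E
    inner    : ∀ {ed} → ed ∈ E → ∃[ ρ ] inj₂ ρ ∈ verts ed

module _ {j h : ℕ} {R : Raw j} (props : Props R h) where

  open Props props
  private P = toPattern R
  open Pattern P

  cntV-split : ∀ K → cntV K ≡ cntW K + cnt rests (K ∘ inj₂)
  cntV-split K = trans (cnt-++ (map inj₁ (allFin (suc dim))) (map inj₂ rests) K) (cong₂ _+_ (cnt-map (allFin (suc dim)) inj₁ K) (cnt-map rests inj₂ K))

  admissible : Admissible P (4 + j + h)
  admissible = record
    { size = trans (ListP.length-++ (map inj₁ (allFin (suc dim)))) (trans (cong₂ _+_ (trans (ListP.length-map inj₁ (allFin (suc dim))) (ListP.length-tabulate {n = suc dim} id)) (ListP.length-map inj₂ rests))
               (trans (cong suc (ℕP.+-comm dim (length rests))) (cong (_+ dim) size)))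
    ; sub = λ K → ℕP.≤-trans (ℕP.m≤m+n _ _) (balanced K)
    ; cover = cov
    ; differ = differ }
    where
    cov : ∀ r → r ≤ length E → ∃[ C ] (All (λ ed → inside C ed ≡ true) (take r E) × cntV C ≤ r + (4 + j + h))
    cov r r≤ = let C , ins , small = coverR r r≤ in
      full C , All.tabulate (λ {ed} ed∈ → inside-∈⁺ (full C) ed (λ { {inj₁ _} _ → refl ; {inj₂ ρ} v∈ → ins ed∈ v∈ })) , (begin
        cntV (full C)                      ≡⟨ cntV-split (full C) ⟩
        cntW (full C) + cnt rests C        ≤⟨ ℕP.+-mono-≤ (ℕP.≤-reflexive (trans (cnt-true (allFin (suc dim))) (ListP.length-tabulate {n = suc dim} id))) small ⟩
        4 + j + (r + h)                    ≡⟨ solveℕ 3 (λ a r h → a ⊞ (r ⊞ h) ≜ r ⊞ (a ⊞ h)) refl (4 + j) r h ⟩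
        r + (4 + j + h)                    ∎)
      where
      open ℕP.≤-Reasoning
      full : (Rest → Bool) → Vtx → Bool
      full C (inj₁ _) = true
      full C (inj₂ ρ) = C ρ

  private
    rank-bound : ∀ K w → w ≤ cntW K + 1 ⊓ cntE K → dim ≤ w → cntE K + dim ≤ cntV K
    rank-bound K w w≤ dim≤w = ℕP.≤-trans (ℕP.+-monoʳ-≤ (cntE K) (ℕP.≤-reflexive (sym (ℕP.m≤n⇒m⊓n≡m (ℕP.≤-trans dim≤w w≤))))) (balanced K)

    single : ∀ i → cnt (allFin (suc dim)) (λ l → isYes (l Data.Fin.≟ i)) ≤ 1
    single i = cnt-≤1 (allFin (suc dim)) (UniqueP.allFin⁺ (suc dim)) _ (λ x y ex ey → trans (isYes-true (x Data.Fin.≟ i) ex) (sym (isYes-true (y Data.Fin.≟ i) ey)))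

    len : length (allFin (suc dim)) ≡ suc dim
    len = ListP.length-tabulate {n = suc dim} id

    facet-count : ∀ i → dim ≤ cnt (allFin (suc dim)) (λ l → not (isYes (l Data.Fin.≟ i)))
    facet-count i = ℕP.≤-pred (ℕP.≤-trans (ℕP.≤-reflexive (trans (sym len) (trans (sym (cnt-true (allFin (suc dim)))) (cnt-split (allFin (suc dim)) (λ _ → true) (λ l → isYes (l Data.Fin.≟ i)))))) (ℕP.+-monoˡ-≤ _ (single i)))

    pair-count : ∀ i j → dim ≤ suc (cnt (allFin (suc dim)) (λ l → not (isYes (l Data.Fin.≟ i)) ∧ not (isYes (l Data.Fin.≟ j))))
    pair-count i j = ℕP.≤-trans (facet-count i) (ℕP.≤-trans (ℕP.≤-reflexive (cnt-split (allFin (suc dim)) (λ l → not (isYes (l Data.Fin.≟ i))) (λ l → isYes (l Data.Fin.≟ j))))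
      (ℕP.+-monoˡ-≤ _ (ℕP.≤-trans (cnt-mono (allFin (suc dim)) {λ l → not (isYes (l Data.Fin.≟ i)) ∧ isYes (l Data.Fin.≟ j)} {λ l → isYes (l Data.Fin.≟ j)} (λ l e → proj₂ (∧-true {not (isYes (l Data.Fin.≟ i))} e))) (single j))))

  -- For a pair of facets, the common roots are `dim - 1`. If `v` is a root outside the closure it
  -- completes one of the two facets; otherwise the missing unit is the bonus for an edge, or `v`
  -- itself when there is no edge.
  generic : Generic P (rootClosure P)
  generic = record { rankFacet = λ i K U⊆K → facetRank i K (λ l → U⊆K (inj₁ l)) ; rankPair = pairRank }
    where
    facetRank : ∀ i K → (∀ l → not (isYes (l Data.Fin.≟ i)) ≡ true → K (inj₁ l) ≡ true) → cntE K + dim ≤ cntV K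
    facetRank i K U⊆K = rank-bound K (cntW K) (ℕP.m≤m+n _ _) (ℕP.≤-trans (facet-count i) (cnt-mono (allFin (suc dim)) U⊆K))
    pairRank : ∀ i j → i ≢ j → ∀ v → rootClosure P i j v ≡ false → Rank (pairRoots P i j v)
    pairRank i j i≢j (inj₁ l) cl K U⊆K with l Data.Fin.≟ i
    ... | yes refl = facetRank j K upto
      where
      upto : ∀ l' → not (isYes (l' Data.Fin.≟ j)) ≡ true → K (inj₁ l') ≡ true
      upto l' l'≢j with l' Data.Fin.≟ l
      ... | yes refl = U⊆K (inj₁ l') (∨-introˡ (isYes-true⁺ (_≟V_ (inj₁ l') (inj₁ l')) refl))
      ... | no l'≢l  = U⊆K (inj₁ l') (trans (cong₂ _∨_ (isYes-false⁺ (_≟V_ (inj₁ l') (inj₁ l)) (λ { refl → l'≢l refl })) (cong₂ _∧_ (cong not (isYes-false⁺ (l' Data.Fin.≟ l) l'≢l)) l'≢j)) refl)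
    ... | no l≢i with l Data.Fin.≟ j
    ...   | yes refl = facetRank i K upto
      where
      upto : ∀ l' → not (isYes (l' Data.Fin.≟ i)) ≡ true → K (inj₁ l') ≡ true
      upto l' l'≢i with l' Data.Fin.≟ l
      ... | yes refl = U⊆K (inj₁ l') (∨-introˡ (isYes-true⁺ (_≟V_ (inj₁ l') (inj₁ l')) refl))
      ... | no l'≢l  = U⊆K (inj₁ l') (trans (cong₂ _∨_ (isYes-false⁺ (_≟V_ (inj₁ l') (inj₁ l)) (λ { refl → l'≢l refl })) (cong₂ _∧_ l'≢i (cong not (isYes-false⁺ (l' Data.Fin.≟ l) l'≢l)))) refl)
    pairRank i j i≢j (inj₂ ρ) cl K U⊆K = go (cntE K) refl
      where
      w≥ : dim ≤ suc (cntW K)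
      w≥ = ℕP.≤-trans (pair-count i j) (s≤s (cnt-mono (allFin (suc dim)) {λ l → not (isYes (l Data.Fin.≟ i)) ∧ not (isYes (l Data.Fin.≟ j))} {K ∘ inj₁} (λ l e → U⊆K (inj₁ l) (trans (cong₂ _∨_ (isYes-false⁺ (_≟V_ (inj₁ l) (inj₂ ρ)) (λ ())) e) refl))))
      Kρ : K (inj₂ ρ) ≡ true
      Kρ = U⊆K (inj₂ ρ) (cong (_∨ false) (isYes-true⁺ (_≟V_ (inj₂ ρ) (inj₂ ρ)) refl))
      go : ∀ c → cntE K ≡ c → cntE K + dim ≤ cntV K
      go zero    eq = ℕP.≤-trans (ℕP.≤-reflexive (cong (_+ dim) eq)) (ℕP.≤-trans w≥ (ℕP.≤-trans (ℕP.≤-trans (ℕP.≤-reflexive (ℕP.+-comm 1 (cntW K))) (ℕP.+-monoʳ-≤ (cntW K) (cnt-pos (K ∘ inj₂) (∈-rests ρ) Kρ))) (ℕP.≤-reflexive (sym (cntV-split K)))))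
      go (suc c) eq = rank-bound K (suc (cntW K)) (ℕP.≤-trans (ℕP.≤-reflexive (ℕP.+-comm 1 (cntW K))) (ℕP.+-monoʳ-≤ (cntW K) (ℕP.≤-reflexive (sym (cong (1 ⊓_) eq))))) w≥

-- Inheritance of balance

module BalanceStep (k : ℕ) (b a : Fin (suc k) → Bool) (w eE R : Fin (suc k) → ℕ)
  (w-eq : ∀ i → w i + bit (b i) ≡ sumF (suc k) (bit ∘ b) + bit (a i))
  (ih : ∀ i → eE i + k ⊓ (w i + 1 ⊓ eE i) ≤ w i + R i) where

  private
    m = suc k
    s = sumF m (bit ∘ b)
    A = sumF m (bit ∘ a)
    open ℕP.≤-Reasoning

    w≤k⇒ : ∀ i → w i ≤ k → eE i ≤ R i
    w≤k⇒ i w≤k = ℕP.+-cancelˡ-≤ (w i) _ _ (begin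
      w i + eE i                      ≡⟨ ℕP.+-comm (w i) (eE i) ⟩
      eE i + w i                      ≤⟨ ℕP.+-monoʳ-≤ (eE i) (ℕP.⊓-glb w≤k (ℕP.m≤m+n _ _)) ⟩
      eE i + k ⊓ (w i + 1 ⊓ eE i)     ≤⟨ ih i ⟩
      w i + R i                       ∎)

    w≤ : ∀ i → w i ≤ s + bit (a i)
    w≤ i = ℕP.≤-trans (ℕP.m≤m+n (w i) (bit (b i))) (ℕP.≤-reflexive (w-eq i))

    k≤w⇒ : ∀ i → w i ≡ k + bit (a i) → eE i ≤ bit (a i) + R i
    k≤w⇒ i eq = ℕP.+-cancelˡ-≤ k _ _ (begin
      k + eE i                        ≡⟨ ℕP.+-comm k (eE i) ⟩
      eE i + k                        ≡⟨ cong (eE i +_) (ℕP.m≤n⇒m⊓n≡m (ℕP.≤-trans (ℕP.≤-trans (ℕP.m≤m+n k (bit (a i))) (ℕP.≤-reflexive (sym eq))) (ℕP.m≤m+n _ _))) ⟨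
      eE i + k ⊓ (w i + 1 ⊓ eE i)     ≤⟨ ih i ⟩
      w i + R i                       ≡⟨ trans (cong (_+ R i) eq) (ℕP.+-assoc k _ _) ⟩
      k + (bit (a i) + R i)           ∎)

  totalE totalR : ℕ
  totalE = sumF m eE
  totalR = sumF m R

  -- `s` counts the simplex vertices in the set, `A` the off-facet roots. Every copy has fewer than
  -- `k` roots in the set, so nothing is truncated, and each copy with an edge keeps its bonus.
  sparse : s + 2 ≤ k → ∀ W → W ≤ s + A → totalE + suc k ⊓ (W + 1 ⊓ totalE) ≤ s + (A + totalR)
  sparse s+2≤k W W≤ = begin
    totalE + suc k ⊓ (W + 1 ⊓ totalE)            ≤⟨ ℕP.+-monoʳ-≤ totalE (ℕP.m⊓n≤n (suc k) _) ⟩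
    totalE + (W + 1 ⊓ totalE)                    ≤⟨ ℕP.+-monoʳ-≤ totalE (ℕP.+-mono-≤ W≤ (sumF-min1 m eE)) ⟩
    totalE + (s + A + sumF m (λ i → 1 ⊓ eE i))   ≡⟨ solveℕ 4 (λ e s a u → e ⊞ (s ⊞ a ⊞ u) ≜ s ⊞ (a ⊞ (e ⊞ u))) refl totalE s A (sumF m (λ i → 1 ⊓ eE i)) ⟩
    s + (A + (totalE + sumF m (λ i → 1 ⊓ eE i))) ≡⟨ cong (λ x → s + (A + x)) (sumF-+ m eE (λ i → 1 ⊓ eE i)) ⟨
    s + (A + sumF m (λ i → eE i + 1 ⊓ eE i))     ≤⟨ ℕP.+-monoʳ-≤ s (ℕP.+-monoʳ-≤ A (sumF-mono m each)) ⟩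
    s + (A + totalR)                             ∎
    where
    each : ∀ i → eE i + 1 ⊓ eE i ≤ R i
    each i = ℕP.+-cancelˡ-≤ (w i) _ _ (begin
      w i + (eE i + 1 ⊓ eE i)         ≡⟨ solveℕ 3 (λ w e u → w ⊞ (e ⊞ u) ≜ e ⊞ (w ⊞ u)) refl (w i) (eE i) (1 ⊓ eE i) ⟩
      eE i + (w i + 1 ⊓ eE i)         ≡⟨ cong (eE i +_) (ℕP.m≥n⇒m⊓n≡n small) ⟨
      eE i + k ⊓ (w i + 1 ⊓ eE i)     ≤⟨ ih i ⟩
      w i + R i                       ∎)
      where
      small : w i + 1 ⊓ eE i ≤ k
      small = begin
        w i + 1 ⊓ eE i                ≤⟨ ℕP.+-mono-≤ (ℕP.≤-trans (w≤ i) (ℕP.+-monoʳ-≤ s (bit≤1 (a i)))) (ℕP.m⊓n≤m 1 (eE i)) ⟩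
        s + 1 + 1                     ≡⟨ ℕP.+-assoc s 1 1 ⟩
        s + 2                         ≤⟨ s+2≤k ⟩
        k                             ∎

  private
    conclude : ∀ W X → suc W ≤ X → totalE + X ≤ s + A + totalR → totalE + suc k ⊓ (W + 1 ⊓ totalE) ≤ s + (A + totalR)
    conclude W X W<X le = begin
      totalE + suc k ⊓ (W + 1 ⊓ totalE)    ≤⟨ ℕP.+-monoʳ-≤ totalE (ℕP.≤-trans (ℕP.m⊓n≤n (suc k) _) (ℕP.+-monoʳ-≤ W (ℕP.m⊓n≤m 1 totalE))) ⟩
      totalE + (W + 1)                     ≡⟨ cong (totalE +_) (ℕP.+-comm W 1) ⟩
      totalE + suc W                       ≤⟨ ℕP.+-monoʳ-≤ totalE W<X ⟩
      totalE + X                           ≤⟨ le ⟩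
      s + A + totalR                       ≡⟨ ℕP.+-assoc s A totalR ⟩
      s + (A + totalR)                     ∎

  -- Truncation at `k` may cost the bonus of every copy; a simplex vertex that is not a root of the
  -- new pattern makes up for it.
  nearlyFull : s + 1 ≡ k → ∀ W → suc W ≤ s + A → totalE + suc k ⊓ (W + 1 ⊓ totalE) ≤ s + (A + totalR)
  nearlyFull s+1≡k W W< = conclude W (s + A) W< (begin
    totalE + (s + A)   ≡⟨ ℕP.+-comm totalE (s + A) ⟩
    s + A + totalE     ≤⟨ ℕP.+-monoʳ-≤ (s + A) (sumF-mono m (λ i → w≤k⇒ i (ℕP.≤-trans (w≤ i) (ℕP.≤-trans (ℕP.+-monoʳ-≤ s (bit≤1 (a i))) (ℕP.≤-reflexive s+1≡k))))) ⟩
    s + A + totalR     ∎)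

  -- Besides the bonus, the copy opposite the missing vertex may lose its off-facet root; the second
  -- unit in the hypothesis on `W` pays for it.
  oneMissing : s ≡ k → ∀ W → suc (suc W) ≤ s + A → totalE + suc k ⊓ (W + 1 ⊓ totalE) ≤ s + (A + totalR)
  oneMissing s≡k W W< = conclude W (s + Mn) (ℕP.≤-pred (ℕP.≤-trans W< (ℕP.≤-trans (ℕP.+-monoʳ-≤ s A≤) (ℕP.≤-reflexive (trans (cong (s +_) (ℕP.+-comm Mn 1)) (ℕP.+-suc s Mn)))))) (begin
      totalE + (s + Mn)                            ≡⟨ solveℕ 3 (λ e s n → e ⊞ (s ⊞ n) ≜ s ⊞ (e ⊞ n)) refl totalE s Mn ⟩
      s + (totalE + Mn)                            ≡⟨ cong (s +_) (sumF-+ m eE (λ i → bit (a i ∧ b i))) ⟨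
      s + sumF m (λ i → eE i + bit (a i ∧ b i))    ≤⟨ ℕP.+-monoʳ-≤ s (sumF-mono m each) ⟩
      s + sumF m (λ i → bit (a i) + R i)           ≡⟨ cong (s +_) (sumF-+ m (bit ∘ a) R) ⟩
      s + (A + totalR)                             ≡⟨ ℕP.+-assoc s A totalR ⟨
      s + A + totalR                               ∎)
    where
    Mn = sumF m (λ i → bit (a i ∧ b i))
    A≤ : A ≤ Mn + 1
    A≤ = begin
      A                                                     ≤⟨ sumF-mono m (λ i → split (a i) (b i)) ⟩
      sumF m (λ i → bit (a i ∧ b i) + bit (not (b i)))      ≡⟨ sumF-+ m (λ i → bit (a i ∧ b i)) (bit ∘ not ∘ b) ⟩
      Mn + sumF m (bit ∘ not ∘ b)                           ≡⟨ cong (Mn +_) (ℕP.+-cancelˡ-≡ s _ _ (trans (sumF-not m b) (trans (cong suc (sym s≡k)) (ℕP.+-comm 1 s)))) ⟩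
      Mn + 1                                                ∎
      where
      split : ∀ a b → bit a ≤ bit (a ∧ b) + bit (not b)
      split true  true  = s≤s z≤n
      split true  false = s≤s z≤n
      split false b     = z≤n
    each : ∀ i → eE i + bit (a i ∧ b i) ≤ bit (a i) + R i
    each i with b i in bi | w-eq i
    ... | false | eq = ℕP.≤-trans (ℕP.≤-reflexive (trans (cong (λ c → eE i + bit c) (∧-false (a i))) (ℕP.+-identityʳ (eE i)))) (k≤w⇒ i (trans (sym (ℕP.+-identityʳ (w i))) (trans eq (cong (_+ bit (a i)) s≡k))))
      where
      ∧-false : ∀ a → a ∧ false ≡ false
      ∧-false true  = refl
      ∧-false false = refl
    ... | true  | eq = ℕP.≤-trans (ℕP.≤-reflexive (trans (cong (λ c → eE i + bit c) (∧-identityʳ (a i))) (ℕP.+-comm (eE i) (bit (a i))))) (ℕP.+-monoʳ-≤ (bit (a i)) (w≤k⇒ i wk))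
      where
      wk : w i ≤ k
      wk = ℕP.≤-pred (begin
        suc (w i)         ≡⟨ ℕP.+-comm 1 (w i) ⟩
        w i + 1           ≡⟨ eq ⟩
        s + bit (a i)     ≤⟨ ℕP.+-monoʳ-≤ s (bit≤1 (a i)) ⟩
        s + 1             ≡⟨ trans (cong (_+ 1) s≡k) (ℕP.+-comm k 1) ⟩
        suc k             ∎)

  -- Every copy may lose its off-facet root, but the k + 1 simplex vertices alone reach the
  -- truncation.
  full : s ≡ suc k → ∀ W → totalE + suc k ⊓ (W + 1 ⊓ totalE) ≤ s + (A + totalR)
  full s≡ W = begin
    totalE + suc k ⊓ (W + 1 ⊓ totalE)     ≤⟨ ℕP.+-monoʳ-≤ totalE (ℕP.m⊓n≤m (suc k) _) ⟩
    totalE + suc k                        ≡⟨ trans (ℕP.+-comm totalE (suc k)) (cong (_+ totalE) (sym s≡)) ⟩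
    s + totalE                            ≤⟨ ℕP.+-monoʳ-≤ s (ℕP.≤-trans (sumF-mono m each) (ℕP.≤-reflexive (sumF-+ m (bit ∘ a) R))) ⟩
    s + (A + totalR)                      ∎
    where
    none : sumF m (bit ∘ not ∘ b) ≡ 0
    none = ℕP.+-cancelˡ-≡ s _ _ (trans (sumF-not m b) (trans (sym s≡) (sym (ℕP.+-identityʳ s))))
    allIn : ∀ i → b i ≡ true
    allIn i with b i in bi | ℕP.≤-trans (sumF-term m (bit ∘ not ∘ b) i) (ℕP.≤-reflexive none)
    ... | true  | _  = refl
    each : ∀ i → eE i ≤ bit (a i) + R i
    each i = k≤w⇒ i (ℕP.suc-injective (begin-equality
      suc (w i)           ≡⟨ ℕP.+-comm 1 (w i) ⟩
      w i + 1             ≡⟨ cong (λ c → w i + bit c) (allIn i) ⟨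
      w i + bit (b i)     ≡⟨ w-eq i ⟩
      s + bit (a i)       ≡⟨ cong (_+ bit (a i)) s≡ ⟩
      suc (k + bit (a i)) ∎))

  -- W counts the roots of the new pattern: at most k-2 of them are vertices of the simplex
  balance-step : ∀ W → W ≤ s + A → suc (suc W) ≤ k + A → totalE + suc k ⊓ (W + 1 ⊓ totalE) ≤ s + (A + totalR)
  balance-step W W≤ W+2≤ with s + 2 ℕP.≤? k
  ... | yes le = sparse le W W≤
  ... | no  gt with s ℕP.≟ k
  ...   | yes s≡k = oneMissing s≡k W (ℕP.≤-trans W+2≤ (ℕP.≤-reflexive (cong (_+ A) (sym s≡k))))
  ...   | no  s≢k with s ℕP.≤? k
  ...     | yes s≤k = nearlyFull s+1≡k W (ℕP.≤-pred (ℕP.≤-trans W+2≤ (ℕP.≤-reflexive (trans (cong (_+ A) (sym s+1≡k)) (trans (cong (_+ A) (ℕP.+-comm s 1)) refl)))))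
    where
    s+1≡k : s + 1 ≡ k
    s+1≡k = ℕP.≤-antisym (ℕP.≤-trans (ℕP.≤-reflexive (ℕP.+-comm s 1)) (ℕP.≤∧≢⇒< s≤k s≢k)) (ℕP.≤-pred (ℕP.≤-trans (ℕP.≰⇒> gt) (ℕP.≤-reflexive (ℕP.+-suc s 1))))
  ...     | no  s≰k = full (ℕP.≤-antisym (sumF-bits m b) (ℕP.≰⇒> s≰k)) W

∈-take-++ : ∀ {A : Set} r (xs ys : List A) {x} → x ∈ take r (xs ++ ys) → x ∈ take r xs ⊎ x ∈ take (r ∸ length xs) ys
∈-take-++ r       []       ys x∈          = inj₂ x∈
∈-take-++ (suc r) (z ∷ xs) ys (here refl) = inj₁ (here refl)
∈-take-++ (suc r) (z ∷ xs) ys (there x∈) with ∈-take-++ r xs ys x∈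
... | inj₁ p = inj₁ (there p)
... | inj₂ p = inj₂ p

-- A prefix of a concatenation consists of complete blocks and at most one partial block, and only
-- the partial one pays the surplus `c₀`.
take-concat : ∀ {A B : Set} (e c₀ : ℕ) (c : ℕ → ℕ) → c 0 ≡ 0 → c e ≤ e → (∀ x → c x ≤ x + c₀) →
  ∀ m (f : Fin m → B) (h : B → List A) → (∀ y → length (h y) ≡ e) → ∀ r →
  ∃[ ρ ] ((∀ {x} → x ∈ take r (concatMap h (tabulate f)) → ∃[ i ] x ∈ take (ρ i) (h (f i))) × (∀ i → ρ i ≤ e) × sumF m (c ∘ ρ) ≤ r + c₀)
take-concat e c₀ c c0 ce cx zero    f h len r = (λ ()) , (λ x∈ → ⊥-elim (none r x∈)) , (λ ()) , z≤n
  where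
  none : ∀ {A : Set} r {x : A} → x ∈ take r [] → ⊥
  none zero    ()
  none (suc r) ()
take-concat {A} {B} e c₀ c c0 ce cx (suc m) f h len r with e ℕP.≤? r
... | yes e≤r = ρ , cov , ρ≤ , bound
  where
  rec = take-concat e c₀ c c0 ce cx m (f ∘ suc) h len (r ∸ e)
  ρ : Fin (suc m) → ℕ
  ρ zero    = e
  ρ (suc i) = proj₁ rec i
  ρ≤ : ∀ i → ρ i ≤ e
  ρ≤ zero    = ℕP.≤-refl
  ρ≤ (suc i) = proj₁ (proj₂ (proj₂ rec)) i
  cov : ∀ {x} → x ∈ take r (h (f zero) ++ concatMap h (tabulate (f ∘ suc))) → ∃[ i ] x ∈ take (ρ i) (h (f i))
  cov {x} x∈ with ∈-take-++ r (h (f zero)) _ x∈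
  ... | inj₁ p = zero , subst (x ∈_) (sym (ListP.take-all e (h (f zero)) (ℕP.≤-reflexive (len (f zero))))) (∈-take r p)
  ... | inj₂ p = let i , q = proj₁ (proj₂ rec) (subst (λ l → x ∈ take (r ∸ l) (concatMap h (tabulate (f ∘ suc)))) (len (f zero)) p) in suc i , q
  bound : c e + sumF m (c ∘ proj₁ rec) ≤ r + c₀
  bound = ℕP.≤-trans (ℕP.+-mono-≤ ce (proj₂ (proj₂ (proj₂ rec)))) (ℕP.≤-reflexive (trans (sym (ℕP.+-assoc e (r ∸ e) c₀)) (cong (_+ c₀) (ℕP.m+[n∸m]≡n e≤r))))
... | no e≰r = ρ , cov , ρ≤ , bound
  where
  r<e = ℕP.≰⇒> e≰r
  ρ : Fin (suc m) → ℕ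
  ρ zero    = r
  ρ (suc i) = 0
  ρ≤ : ∀ i → ρ i ≤ e
  ρ≤ zero    = ℕP.<⇒≤ r<e
  ρ≤ (suc i) = z≤n
  cov : ∀ {x} → x ∈ take r (h (f zero) ++ concatMap h (tabulate (f ∘ suc))) → ∃[ i ] x ∈ take (ρ i) (h (f i))
  cov {x} x∈ with ∈-take-++ r (h (f zero)) _ x∈
  ... | inj₁ p = zero , p
  ... | inj₂ p with () ← subst (λ l → x ∈ take l (concatMap h (tabulate (f ∘ suc)))) (trans (cong (r ∸_) (len (f zero))) (ℕP.m≤n⇒m∸n≡0 (ℕP.<⇒≤ r<e))) p
  bound : c r + sumF m (λ _ → c 0) ≤ r + c₀
  bound = ℕP.≤-trans (ℕP.≤-reflexive (trans (cong (c r +_) (zeros m)) (ℕP.+-identityʳ (c r)))) (cx r)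
    where
    zeros : ∀ m → sumF m (λ _ → c 0) ≡ 0
    zeros zero    = refl
    zeros (suc m) = cong₂ _+_ c0 (zeros m)

verts-mapEdge : ∀ {V V' : Set} (f : V → V') ed → verts (mapEdge f ed) ≡ map f (verts ed)
verts-mapEdge f (u , v , w) = refl

-- Construction of the next pattern

module Next {j : ℕ} (R : Raw j) where

  open Raw R

  private
    m : ℕ
    m = 4 + j

    V : Set
    V = Fin m ⊎ Rest

  -- Three simplex vertices, all off-facet roots but four, and the inner vertices of the copies. The
  -- new roots thus include j + 1 simplex vertices, which is k - 2 for k = 3 + j, as `balance-step`
  -- demands.
  Rest′ : Set
  Rest′ = Fin 3 ⊎ (Fin j ⊎ (Fin m × Rest))

  private
    V′ : Set
    V′ = Fin (5 + j) ⊎ Rest′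

  -- nodeP l is the l-th vertex of the simplex, nodeC i the root of the i-th facet off the simplex
  nodeP nodeC : Fin m → V′
  nodeP zero                = inj₂ (inj₁ zero)
  nodeP (suc zero)          = inj₂ (inj₁ (suc zero))
  nodeP (suc (suc zero))    = inj₂ (inj₁ (suc (suc zero)))
  nodeP (suc (suc (suc x))) = inj₁ (suc (suc (suc (suc x))))
  nodeC zero                      = inj₁ zero
  nodeC (suc zero)                = inj₁ (suc zero)
  nodeC (suc (suc zero))          = inj₁ (suc (suc zero))
  nodeC (suc (suc (suc zero)))    = inj₁ (suc (suc (suc zero)))
  nodeC (suc (suc (suc (suc x)))) = inj₂ (inj₂ (inj₁ x))

  inn : Fin m → Rest → V′
  inn i ρ = inj₂ (inj₂ (inj₂ (i , ρ)))

  ι° : Fin m → V → V′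
  ι° i (inj₁ l) = choose (l Data.Fin.≟ i) (nodeC i) (nodeP l)
  ι° i (inj₂ ρ) = inn i ρ

  edgesIn : Fin m → List (V′ × V′ × V′)
  edgesIn i = map (mapEdge (ι° i)) E

  E′ : List (V′ × V′ × V′)
  E′ = concatMap edgesIn (allFin m)

  private
    restIn : Fin m → Rest → Rest′
    restIn i ρ = inj₂ (inj₂ (i , ρ))

    restsOf : Fin m → List Rest′
    restsOf i = map (restIn i) rests

    tail : List Rest′
    tail = concatMap restsOf (allFin m)

    rests₂ : List Rest′
    rests₂ = map (inj₂ ∘ inj₁) (allFin j) ++ tail

  rests′ : List Rest′
  rests′ = map inj₁ (allFin 3) ++ rests₂

  next : Raw (suc j)
  next = record
    { Rest = Rest′ ; _≟R_ = SumP.≡-dec Data.Fin._≟_ (SumP.≡-dec Data.Fin._≟_ (ProductP.≡-dec Data.Fin._≟_ _≟R_))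
    ; rests = rests′ ; ∈-rests = mem ; E = E′ }
    where
    mem : ∀ ρ → ρ ∈ rests′
    mem (inj₁ x)               = ∈-++⁺ˡ (∈-map⁺ inj₁ (∈-allFin x))
    mem (inj₂ (inj₁ x))        = ∈-++⁺ʳ (map inj₁ (allFin 3)) (∈-++⁺ˡ (∈-map⁺ (inj₂ ∘ inj₁) (∈-allFin x)))
    mem (inj₂ (inj₂ (i , ρ)))  = ∈-++⁺ʳ (map inj₁ (allFin 3)) (∈-++⁺ʳ (map (inj₂ ∘ inj₁) (allFin j)) (∈-concatMap⁺ restsOf (lose (∈-allFin i) (∈-map⁺ (restIn i) (∈-rests ρ)))))

  private
    Node : Set
    Node = Fin m ⊎ (Fin m ⊎ (Fin m × Rest))

    -- Undoes the relabelling into roots and rest; afterwards simplex vertices, off-facet roots and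
    -- inner vertices are told apart by their constructors.
    θ : V′ → Node
    θ (inj₁ zero)                          = inj₂ (inj₁ zero)
    θ (inj₁ (suc zero))                    = inj₂ (inj₁ (suc zero))
    θ (inj₁ (suc (suc zero)))              = inj₂ (inj₁ (suc (suc zero)))
    θ (inj₁ (suc (suc (suc zero))))        = inj₂ (inj₁ (suc (suc (suc zero))))
    θ (inj₁ (suc (suc (suc (suc x)))))     = inj₁ (suc (suc (suc x)))
    θ (inj₂ (inj₁ zero))                   = inj₁ zero
    θ (inj₂ (inj₁ (suc zero)))             = inj₁ (suc zero)
    θ (inj₂ (inj₁ (suc (suc zero))))       = inj₁ (suc (suc zero))
    θ (inj₂ (inj₂ (inj₁ x)))               = inj₂ (inj₁ (suc (suc (suc (suc x)))))
    θ (inj₂ (inj₂ (inj₂ p)))               = inj₂ (inj₂ p)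

    θ-P : ∀ l → θ (nodeP l) ≡ inj₁ l
    θ-P zero                = refl
    θ-P (suc zero)          = refl
    θ-P (suc (suc zero))    = refl
    θ-P (suc (suc (suc x))) = refl

    θ-C : ∀ i → θ (nodeC i) ≡ inj₂ (inj₁ i)
    θ-C zero                      = refl
    θ-C (suc zero)                = refl
    θ-C (suc (suc zero))          = refl
    θ-C (suc (suc (suc zero)))    = refl
    θ-C (suc (suc (suc (suc x)))) = refl

    ι-diag : ∀ i → ι° i (inj₁ i) ≡ nodeC i
    ι-diag i with i Data.Fin.≟ i
    ... | yes _  = refl
    ... | no i≢i = ⊥-elim (i≢i refl)

    ι-off : ∀ i l → l ≢ i → ι° i (inj₁ l) ≡ nodeP l
    ι-off i l l≢i with l Data.Fin.≟ i
    ... | yes l≡i = ⊥-elim (l≢i l≡i)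
    ... | no _    = refl

  separate : ∀ i j u v → ι° i u ≡ ι° j v → u ≡ v × (i ≡ j ⊎ rootClosure (toPattern R) i j u ≡ true)
  separate i j (inj₁ l) (inj₁ l') eq with l Data.Fin.≟ i | l' Data.Fin.≟ j
  ... | yes refl | yes refl with trans (sym (θ-C i)) (trans (cong θ eq) (θ-C j))
  ...   | refl = refl , inj₁ refl
  separate i j (inj₁ l) (inj₁ l') eq | yes refl | no _ with () ← trans (sym (θ-C i)) (trans (cong θ eq) (θ-P l'))
  separate i j (inj₁ l) (inj₁ l') eq | no _ | yes refl with () ← trans (sym (θ-P l)) (trans (cong θ eq) (θ-C j))
  separate i j (inj₁ l) (inj₁ l') eq | no l≢i | no l'≢j with trans (sym (θ-P l)) (trans (cong θ eq) (θ-P l'))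
  ...   | refl = refl , inj₂ (cong not (isYes-false⁺ (l Data.Fin.≟ j) l'≢j))
  separate i j (inj₁ l) (inj₂ ρ) eq with l Data.Fin.≟ i
  ... | yes refl with () ← trans (sym (θ-C i)) (cong θ eq)
  ... | no _     with () ← trans (sym (θ-P l)) (cong θ eq)
  separate i j (inj₂ ρ) (inj₁ l) eq with l Data.Fin.≟ j
  ... | yes refl with () ← trans (cong θ eq) (θ-C j)
  ... | no _     with () ← trans (cong θ eq) (θ-P l)
  separate i j (inj₂ ρ) (inj₂ ρ') refl = refl , inj₁ refl

  ι-injective : ∀ i u v → ι° i u ≡ ι° i v → u ≡ v
  ι-injective i u v eq = proj₁ (separate i i u v eq)

  assembly : Assembly (toPattern R) (toPattern next) (rootClosure (toPattern R))
  assembly = record { ι° = ι° ; locate = loc ; merge = mer ; separate = separate ; edge = edg ; dim-suc = refl }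
    where
    loc : ∀ u → ∃[ i ] ∃[ v ] ι° i v ≡ u
    loc (inj₁ zero)                          = zero , inj₁ zero , ι-diag zero
    loc (inj₁ (suc zero))                    = suc zero , inj₁ (suc zero) , ι-diag (suc zero)
    loc (inj₁ (suc (suc zero)))              = suc (suc zero) , inj₁ (suc (suc zero)) , ι-diag (suc (suc zero))
    loc (inj₁ (suc (suc (suc zero))))        = suc (suc (suc zero)) , inj₁ (suc (suc (suc zero))) , ι-diag (suc (suc (suc zero)))
    loc (inj₁ (suc (suc (suc (suc x)))))     = zero , inj₁ (suc (suc (suc x))) , refl
    loc (inj₂ (inj₁ zero))                   = suc zero , inj₁ zero , refl
    loc (inj₂ (inj₁ (suc zero)))             = zero , inj₁ (suc zero) , refl
    loc (inj₂ (inj₁ (suc (suc zero))))       = zero , inj₁ (suc (suc zero)) , refl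
    loc (inj₂ (inj₂ (inj₁ x)))               = suc (suc (suc (suc x))) , inj₁ (suc (suc (suc (suc x)))) , ι-diag (suc (suc (suc (suc x))))
    loc (inj₂ (inj₂ (inj₂ (i , ρ))))         = i , inj₂ ρ , refl
    mer : ∀ i j v → rootClosure (toPattern R) i j v ≡ true → ι° j v ≡ ι° i v
    mer i j (inj₁ l) c = let l≢i , l≢j = rootClosure-sound (toPattern R) i j l c in trans (ι-off j l l≢j) (sym (ι-off i l l≢i))
    edg : ∀ {ed'} → ed' ∈ E′ → ∃[ i ] ∃[ ed ] (ed ∈ E × ed' ≡ mapEdge (ι° i) ed)
    edg ed'∈ = let i , _ , p = find (∈-concatMap⁻ edgesIn {xs = allFin m} ed'∈)
                   ed , ed∈ , eq = ∈-map⁻ (mapEdge (ι° i)) p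
               in i , ed , ed∈ , eq

  share : ∀ {n} (pt : Cube n m) (facet : Fin m → V → Fin n) → (∀ i l → l ≢ i → facet i (inj₁ l) ≡ lookup pt l) →
          ∀ i j v → rootClosure (toPattern R) i j v ≡ true → facet i v ≡ facet j v
  share pt facet on i j (inj₁ l) c = let l≢i , l≢j = rootClosure-sound (toPattern R) i j l c in trans (on i l l≢i) (sym (on j l l≢j))

  module _ {h : ℕ} (props : Props R h) where

    open Props props

    private
      P P′ : Pattern
      P = toPattern R
      P′ = toPattern next

    balanced′ : Balanced P′
    balanced′ K = subst₂ (λ eE v → eE + (4 + j) ⊓ (W + 1 ⊓ eE) ≤ v) (sym cntE-eq) (sym cntV-eq) (balance-step W W≤ W+2≤)
      where
      b a : Fin m → Bool
      b l = K (nodeP l)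
      a i = K (nodeC i)
      w eE Rr : Fin m → ℕ
      w i = Pattern.cntW P (K ∘ ι° i)
      eE i = Pattern.cntE P (K ∘ ι° i)
      Rr i = cnt rests (K ∘ inn i)
      w-eq : ∀ i → w i + bit (b i) ≡ sumF m (bit ∘ b) + bit (a i)
      w-eq i = trans (cong (_+ bit (b i)) (trans (cnt-tabulate m id ((K ∘ ι° i) ∘ inj₁)) (sumF-cong m per))) (sumF-update m (bit ∘ b) i (bit (a i)))
        where
        per : ∀ l → bit (K (ι° i (inj₁ l))) ≡ choose (l Data.Fin.≟ i) (bit (a i)) (bit (b l))
        per l with l Data.Fin.≟ i
        ... | yes _ = refl
        ... | no _  = refl
      ih : ∀ i → eE i + (3 + j) ⊓ (w i + 1 ⊓ eE i) ≤ w i + Rr i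
      ih i = ℕP.≤-trans (balanced (K ∘ ι° i)) (ℕP.≤-reflexive (cntV-split props (K ∘ ι° i)))
      open BalanceStep (3 + j) b a w eE Rr w-eq ih
      W : ℕ
      W = Pattern.cntW P′ K
      σb σc a₀ a₁ a₂ a₃ b₀ b₁ b₂ : ℕ
      σb = sumF (suc j) (λ x → bit (b (suc (suc (suc x)))))
      σc = sumF j (λ x → bit (a (suc (suc (suc (suc x))))))
      a₀ = bit (a zero)
      a₁ = bit (a (suc zero))
      a₂ = bit (a (suc (suc zero)))
      a₃ = bit (a (suc (suc (suc zero))))
      b₀ = bit (b zero)
      b₁ = bit (b (suc zero))
      b₂ = bit (b (suc (suc zero)))
      W-eq : W ≡ a₀ + (a₁ + (a₂ + (a₃ + σb)))
      W-eq = cnt-tabulate (5 + j) id (K ∘ inj₁)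
      W≤ : W ≤ sumF m (bit ∘ b) + sumF m (bit ∘ a)
      W≤ = ℕP.≤-trans (ℕP.m≤m+n W (b₀ + b₁ + b₂ + σc)) (ℕP.≤-reflexive (trans (cong (_+ (b₀ + b₁ + b₂ + σc)) W-eq)
        (solveℕ 9 (λ a₀ a₁ a₂ a₃ sb b₀ b₁ b₂ sc → a₀ ⊞ (a₁ ⊞ (a₂ ⊞ (a₃ ⊞ sb))) ⊞ (b₀ ⊞ b₁ ⊞ b₂ ⊞ sc) ≜ b₀ ⊞ (b₁ ⊞ (b₂ ⊞ sb)) ⊞ (a₀ ⊞ (a₁ ⊞ (a₂ ⊞ (a₃ ⊞ sc))))) refl a₀ a₁ a₂ a₃ σb b₀ b₁ b₂ σc)))
      W+2≤ : suc (suc W) ≤ 3 + j + sumF m (bit ∘ a)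
      W+2≤ = ℕP.≤-trans (s≤s (s≤s (ℕP.≤-trans (ℕP.≤-reflexive W-eq) (ℕP.+-monoʳ-≤ a₀ (ℕP.+-monoʳ-≤ a₁ (ℕP.+-monoʳ-≤ a₂ (ℕP.+-monoʳ-≤ a₃ (ℕP.≤-trans (sumF-bits (suc j) (λ x → b (suc (suc (suc x))))) (ℕP.m≤m+n (suc j) σc)))))))))
        (ℕP.≤-reflexive (solveℕ 6 (λ j a₀ a₁ a₂ a₃ sc → num 2 ⊞ (a₀ ⊞ (a₁ ⊞ (a₂ ⊞ (a₃ ⊞ (num 1 ⊞ j ⊞ sc))))) ≜ num 3 ⊞ j ⊞ (a₀ ⊞ (a₁ ⊞ (a₂ ⊞ (a₃ ⊞ sc))))) refl j a₀ a₁ a₂ a₃ σc))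
      cntE-eq : Pattern.cntE P′ K ≡ totalE
      cntE-eq = trans (cnt-concatMap m id edgesIn (inside K)) (sumF-cong m (λ i → cnt-map E (mapEdge (ι° i)) (inside K)))
      rests-eq : cnt rests′ (K ∘ inj₂) ≡ b₀ + (b₁ + (b₂ + 0)) + (σc + totalR)
      rests-eq = trans (cnt-++ (map inj₁ (allFin 3)) rests₂ (K ∘ inj₂)) (cong₂ _+_ refl
        (trans (cnt-++ (map (inj₂ ∘ inj₁) (allFin j)) tail (K ∘ inj₂)) (cong₂ _+_ (trans (cnt-map (allFin j) (inj₂ ∘ inj₁) (K ∘ inj₂)) (cnt-tabulate j id (K ∘ inj₂ ∘ inj₂ ∘ inj₁)))
          (trans (cnt-concatMap m id restsOf (K ∘ inj₂)) (sumF-cong m (λ i → cnt-map rests (restIn i) (K ∘ inj₂)))))))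
      cntV-eq : Pattern.cntV P′ K ≡ sumF m (bit ∘ b) + (sumF m (bit ∘ a) + totalR)
      cntV-eq = trans (trans (cnt-++ (map inj₁ (allFin (5 + j))) (map inj₂ rests′) K) (cong₂ _+_ (trans (cnt-map (allFin (5 + j)) inj₁ K) W-eq) (trans (cnt-map rests′ inj₂ K) rests-eq)))
        (solveℕ 10 (λ a₀ a₁ a₂ a₃ sb b₀ b₁ b₂ sc r → a₀ ⊞ (a₁ ⊞ (a₂ ⊞ (a₃ ⊞ sb))) ⊞ (b₀ ⊞ (b₁ ⊞ (b₂ ⊞ num 0)) ⊞ (sc ⊞ r)) ≜ b₀ ⊞ (b₁ ⊞ (b₂ ⊞ sb)) ⊞ (a₀ ⊞ (a₁ ⊞ (a₂ ⊞ (a₃ ⊞ sc))) ⊞ r)) refl a₀ a₁ a₂ a₃ σb b₀ b₁ b₂ σc totalR)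

    private
      sumF-const : ∀ m c → sumF m (λ _ → c) ≡ m * c
      sumF-const zero    c = refl
      sumF-const (suc m) c = cong (c +_) (sumF-const m c)

      length-E′ : length E′ ≡ m * length E
      length-E′ = trans (sym (cnt-true E′)) (trans (cnt-concatMap m id edgesIn (λ _ → true))
        (trans (sumF-cong m (λ i → trans (cnt-true (map (mapEdge (ι° i)) E)) (ListP.length-map (mapEdge (ι° i)) E))) (sumF-const m (length E))))

      size′ : suc (length rests′) ≡ length E′
      size′ = trans (cong (λ k → suc (3 + k)) len₂) (trans (sym (trans (cong (m *_) (sym size)) (ℕP.*-suc m (length rests)))) (sym length-E′))
        where
        len₂ : length rests₂ ≡ j + m * length rests
        len₂ = trans (ListP.length-++ (map (inj₂ ∘ inj₁) (allFin j))) (cong₂ _+_ (trans (ListP.length-map (inj₂ ∘ inj₁) (allFin j)) (ListP.length-tabulate {n = j} id))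
          (trans (sym (cnt-true tail)) (trans (cnt-concatMap m id restsOf (λ _ → true))
            (trans (sumF-cong m (λ i → trans (cnt-true (map (restIn i) rests)) (ListP.length-map (restIn i) rests))) (sumF-const m (length rests))))))

      inner′ : ∀ {ed'} → ed' ∈ E′ → ∃[ ρ ] inj₂ ρ ∈ verts ed'
      inner′ ed'∈ with Assembly.edge assembly ed'∈
      ... | i , ed , ed∈ , refl = let ρ , ρ∈ = inner ed∈ in inj₂ (inj₂ (i , ρ)) , subst (inn i ρ ∈_) (sym (verts-mapEdge (ι° i) ed)) (∈-map⁺ (ι° i) ρ∈)

      -- Across copies, a vertex given by `inner` belongs to a single copy.
      differ′ : AllPairs Differ E′
      differ′ = AllPairsP.concat⁺ (AllP.map⁺ (All.universal within (allFin m))) (AllPairsP.map⁺ (AllPairs.map across (UniqueP.allFin⁺ m)))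
        where
        within : ∀ i → AllPairs Differ (map (mapEdge (ι° i)) E)
        within i = AllPairsP.map⁺ (AllPairs.map lift differ)
          where
          lift : ∀ {ed ed'} → Differ ed ed' → Differ (mapEdge (ι° i) ed) (mapEdge (ι° i) ed')
          lift {ed} {ed'} (v , v∈ , v∉) = ι° i v , subst (ι° i v ∈_) (sym (verts-mapEdge (ι° i) ed)) (∈-map⁺ (ι° i) v∈) ,
            λ p → let u , u∈ , eq = ∈-map⁻ (ι° i) {xs = verts ed'} (subst (ι° i v ∈_) (verts-mapEdge (ι° i) ed') p) in v∉ (subst (_∈ verts ed') (sym (ι-injective i v u eq)) u∈)
        across : ∀ {i i'} → i ≢ i' → All (λ ed → All (Differ ed) (map (mapEdge (ι° i')) E)) (map (mapEdge (ι° i)) E)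
        across {i} {i'} i≢i' = AllP.map⁺ (All.tabulate (λ {ed} ed∈ → AllP.map⁺ (All.tabulate (λ {ed'} ed'∈ → one ed∈ ed'∈))))
          where
          one : ∀ {ed ed'} → ed ∈ E → ed' ∈ E → Differ (mapEdge (ι° i) ed) (mapEdge (ι° i') ed')
          one {ed} {ed'} ed∈ ed'∈ = let ρ , ρ∈ = inner ed∈ in
            inn i ρ , subst (inn i ρ ∈_) (sym (verts-mapEdge (ι° i) ed)) (∈-map⁺ (ι° i) ρ∈) ,
            λ p → let u , u∈ , eq = ∈-map⁻ (ι° i') {xs = verts ed'} (subst (inn i ρ ∈_) (verts-mapEdge (ι° i') ed') p)
                      q = separate i i' (inj₂ ρ) u eq
                  in [ i≢i' , (λ ()) ]′ (proj₂ q)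

      e : ℕ
      e = length E

      used : ℕ → Bool
      used zero    = false
      used (suc _) = true

      part : ∀ x → x ≤ e → Rest → Bool
      part zero    _ ρ = false
      part (suc x) le ρ = choose (suc x ℕP.≟ e) true (proj₁ (coverR (suc x) le) ρ)

      -- By `size`, the inner vertices of a complete copy together with its off-facet root number
      -- exactly `e`. A partial copy pays its slack `h` and one for that root.
      cost : ℕ → ℕ
      cost zero    = 0
      cost (suc x) = choose (suc x ℕP.≟ e) e (suc x + (1 + h))

      cost-e : cost e ≤ e
      cost-e = go e refl
        where
        go : ∀ x → x ≡ e → cost x ≤ e
        go zero    _  = z≤n
        go (suc x) eq with suc x ℕP.≟ e
        ... | yes _ = ℕP.≤-refl
        ... | no ¬p = ⊥-elim (¬p eq)

      cost-≤ : ∀ x → cost x ≤ x + (1 + h)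
      cost-≤ zero    = z≤n
      cost-≤ (suc x) with suc x ℕP.≟ e
      ... | yes p = ℕP.≤-trans (ℕP.≤-reflexive (sym p)) (ℕP.m≤m+n (suc x) (1 + h))
      ... | no _  = ℕP.≤-refl

      part-cost : ∀ x le → bit (used x) + cnt rests (part x le) ≤ cost x
      part-cost zero    le = ℕP.≤-reflexive (cnt-false rests)
      part-cost (suc x) le with suc x ℕP.≟ e
      ... | yes p = ℕP.≤-reflexive (trans (cong suc (cnt-true rests)) size)
      ... | no _  = ℕP.≤-trans (s≤s (proj₂ (proj₂ (coverR (suc x) le)))) (ℕP.≤-reflexive (sym (ℕP.+-suc (suc x) h)))

      part-sound : ∀ x le {ed ρ} → ed ∈ take x E → inj₂ ρ ∈ verts ed → part x le ρ ≡ true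
      part-sound (suc x) le ed∈ ρ∈ with suc x ℕP.≟ e
      ... | yes _ = refl
      ... | no _  = proj₁ (proj₂ (coverR (suc x) le)) ed∈ ρ∈

      used-sound : ∀ x {ed} → ed ∈ take x E → used x ≡ true
      used-sound (suc x) _ = refl

      -- Of the increase by 4, three units are the simplex vertices in the rest and one is the
      -- off-facet root of the partial copy.
      coverR′ : ∀ r → r ≤ length E′ → ∃[ C ] ((∀ {ed ρ} → ed ∈ take r E′ → inj₂ ρ ∈ verts ed → C ρ ≡ true) × cnt rests′ C ≤ r + (4 + h))
      coverR′ r _ = C , sound , small
        where
        tc = take-concat e (1 + h) cost refl cost-e cost-≤ m id edgesIn (λ i → ListP.length-map (mapEdge (ι° i)) E) r
        ρs = proj₁ tc
        ρs≤ = proj₁ (proj₂ (proj₂ tc))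
        C : Rest′ → Bool
        C (inj₁ _)               = true
        C (inj₂ (inj₁ x))        = used (ρs (suc (suc (suc (suc x)))))
        C (inj₂ (inj₂ (i , ρ)))  = part (ρs i) (ρs≤ i) ρ
        sound : ∀ {ed ρ} → ed ∈ take r E′ → inj₂ ρ ∈ verts ed → C ρ ≡ true
        sound {ed'} {ρ} ed'∈ ρ∈ with proj₁ (proj₂ tc) ed'∈
        ... | i , p with ∈-map⁻ (mapEdge (ι° i)) (subst (ed' ∈_) (ListP.take-map {f = mapEdge (ι° i)} (ρs i) E) p)
        ...   | ed , ed∈ , refl with ∈-map⁻ (ι° i) {xs = verts ed} (subst (inj₂ ρ ∈_) (verts-mapEdge (ι° i) ed) ρ∈)
        ...     | inj₂ ρ₀ , v∈ , refl = part-sound (ρs i) (ρs≤ i) ed∈ v∈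
        ...     | inj₁ l , v∈ , eq with l Data.Fin.≟ i
        ...       | yes refl = atC i eq (used-sound (ρs i) ed∈)
          where
          atC : ∀ i → inj₂ ρ ≡ nodeC i → used (ρs i) ≡ true → C ρ ≡ true
          atC (suc (suc (suc (suc x)))) refl u = u
          atC zero ()
          atC (suc zero) ()
          atC (suc (suc zero)) ()
          atC (suc (suc (suc zero))) ()
        ...       | no _ = atP l eq
          where
          atP : ∀ l → inj₂ ρ ≡ nodeP l → C ρ ≡ true
          atP zero             refl = refl
          atP (suc zero)       refl = refl
          atP (suc (suc zero)) refl = refl
          atP (suc (suc (suc x))) ()
        open ℕP.≤-Reasoning
        Us : Fin m → ℕ
        Us i = bit (used (ρs i))
        Ps : Fin m → ℕ
        Ps i = cnt rests (part (ρs i) (ρs≤ i))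
        σu = sumF j (λ x → Us (suc (suc (suc (suc x)))))
        small : cnt rests′ C ≤ r + (4 + h)
        small = begin
          cnt rests′ C
            ≡⟨ trans (cnt-++ (map inj₁ (allFin 3)) rests₂ C) (cong (3 +_) (trans (cnt-++ (map (inj₂ ∘ inj₁) (allFin j)) tail C) (cong₂ _+_ (trans (cnt-map (allFin j) (inj₂ ∘ inj₁) C) (cnt-tabulate j id (C ∘ inj₂ ∘ inj₁)))
                 (trans (cnt-concatMap m id restsOf C) (sumF-cong m (λ i → cnt-map rests (restIn i) C)))))) ⟩
          3 + (σu + sumF m Ps)
            ≤⟨ ℕP.+-monoʳ-≤ 3 (ℕP.+-monoˡ-≤ (sumF m Ps) (ℕP.≤-trans (ℕP.m≤n+m σu (Us (suc (suc (suc zero))))) (ℕP.≤-trans (ℕP.m≤n+m _ (Us (suc (suc zero)))) (ℕP.≤-trans (ℕP.m≤n+m _ (Us (suc zero))) (ℕP.m≤n+m _ (Us zero)))))) ⟩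
          3 + (sumF m Us + sumF m Ps)
            ≡⟨ cong (3 +_) (sumF-+ m Us Ps) ⟨
          3 + sumF m (λ i → Us i + Ps i)
            ≤⟨ ℕP.+-monoʳ-≤ 3 (ℕP.≤-trans (sumF-mono m (λ i → part-cost (ρs i) (ρs≤ i))) (proj₂ (proj₂ (proj₂ tc)))) ⟩
          3 + (r + (1 + h))
            ≡⟨ solveℕ 2 (λ r h → num 3 ⊞ (r ⊞ (num 1 ⊞ h)) ≜ r ⊞ (num 4 ⊞ h)) refl r h ⟩
          r + (4 + h) ∎

    next-props : Props next (4 + h)
    next-props = record { size = size′ ; balanced = balanced′ ; coverR = coverR′ ; differ = differ′ ; inner = inner′ }

    next-length : length E′ ≡ (4 + j) * length E
    next-length = length-E′

-- The chain of patterns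

raw₄ : Raw 1
raw₄ = record { Rest = Fin 8 ; _≟R_ = Data.Fin._≟_ ; rests = allFin 8 ; ∈-rests = ∈-allFin ; E = E₄ }

props₄ : Props raw₄ 8
props₄ = record
  { size = refl ; balanced = balanced₄
  ; coverR = λ r _ → (λ _ → true) , (λ _ _ → refl) , ℕP.m≤n+m 8 r
  ; differ = from-yes (AllPairs.allPairs? differ? E₄)
  ; inner = All.lookup inners }
  where
  Inner : (Fin 5 ⊎ Fin 8) × (Fin 5 ⊎ Fin 8) × (Fin 5 ⊎ Fin 8) → Set
  Inner ed = ∃[ ρ ] inj₂ ρ ∈ verts ed
  first : ∀ {ρ v w} → Inner (inj₂ ρ , v , w)
  first = _ , here refl
  second : ∀ {u ρ w} → Inner (u , inj₂ ρ , w)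
  second = _ , there (here refl)
  inners : All Inner E₄
  inners = first ∷ first ∷ first ∷ second ∷ first ∷ first ∷ first ∷ first ∷ first ∷ []

raw : ∀ t → Raw (suc t)
raw zero    = raw₄
raw (suc t) = Next.next (raw t)

slack : ℕ → ℕ
slack zero    = 8
slack (suc t) = 4 + slack t

props : ∀ t → Props (raw t) (slack t)
props zero    = props₄
props (suc t) = Next.next-props (raw t) (props t)

F : ℕ → Pattern
F t = toPattern (raw t)

edgeCount : ℕ → ℕ
edgeCount zero    = 9
edgeCount (suc t) = (5 + t) * edgeCount t

length-E : ∀ t → length (Pattern.E (F t)) ≡ edgeCount t
length-E zero    = refl
length-E (suc t) = trans (Next.next-length (raw t) (props t)) (cong ((5 + t) *_) (length-E t))

-- With k = 4 + t this is 6 (k - 1). The terms needed are `k` for the dimension, k + 1 for the roots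
-- and 4 k - 8 for the slack, one less than this in total.
excess : ℕ → ℕ
excess t = 6 * (3 + t)

excess-≥ : ∀ t → Pattern.dim (F t) + (4 + suc t + slack t) ≤ excess t
excess-≥ t = subst (λ s → 3 + suc t + (4 + suc t + s) ≤ excess t) (sym (slack≡ t))
  (ℕP.≤-trans (ℕP.n≤1+n _) (ℕP.≤-reflexive (solveℕ 1 (λ t → num 1 ⊞ (num 3 ⊞ (num 1 ⊞ t) ⊞ (num 4 ⊞ (num 1 ⊞ t) ⊞ (num 8 ⊞ num 4 ⊠ t))) ≜ num 6 ⊠ (num 3 ⊞ t)) refl t)))
  where
  slack≡ : ∀ t → slack t ≡ 8 + 4 * t
  slack≡ zero    = refl
  slack≡ (suc t) = trans (cong (4 +_) (slack≡ t)) (solveℕ 1 (λ t → num 4 ⊞ (num 8 ⊞ num 4 ⊠ t) ≜ num 8 ⊞ num 4 ⊠ (num 1 ⊞ t)) refl t)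

excess-mono : ∀ t → excess t ≤ excess (suc t)
excess-mono t = ℕP.*-monoʳ-≤ 6 (ℕP.n≤1+n (3 + t))

levelBound levelThreshold : ℕ → ℕ → ℕ → ℕ
levelBound e D zero    = bound₃ e D
levelBound e D (suc t) = 2 * simplexBound (F t) e (levelBound e D t)
levelThreshold e D zero    = simplexThreshold F₂ e D + simplexThreshold F₃ e (bound₂ e D)
levelThreshold e D (suc t) = levelThreshold e D t + simplexThreshold (F t) e (levelBound e D t)

module Chain {n : ℕ} (H : ThreeGraph n) (e d : ℕ) (noWin : ¬ Win e d H) (D : ℕ) {Good : (Pattern.Vtx F₂ → Fin n) → Set} (lvl₂ : Level F₂ H D Good) where

  level : ∀ t → excess t ≤ d → levelThreshold e D t ≤ n → Level (F t) H (levelBound e D t) (λ _ → ⊤)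
  level zero    d≥ n≥ = Base.level₄ H e d (ℕP.≤-trans (ℕP.m≤n+m 9 9) d≥) noWin D lvl₂ (ℕP.≤-trans (ℕP.m≤m+n (simplexThreshold F₂ e D) (simplexThreshold F₃ e (bound₂ e D))) n≥) (ℕP.≤-trans (ℕP.m≤n+m (simplexThreshold F₃ e (bound₂ e D)) (simplexThreshold F₂ e D)) n≥)
  level (suc t) d≥ n≥ = forget (A.ascend other (λ s → Next.share (raw t) (A.pt s) (A.facet s) (A.onFacet s)) (ℕP.≤-trans (ℕP.m≤n+m (simplexThreshold (F t) e (levelBound e D t)) (levelThreshold e D t)) n≥))
    where
    d≥′ : excess t ≤ d
    d≥′ = ℕP.≤-trans (excess-mono t) d≥
    module A = Ascend (F t) (F (suc t)) (4 + suc t + slack t) (admissible (props t)) (rootClosure (F t)) (generic (props t)) (Next.assembly (raw t))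
                 H e d (ℕP.≤-trans (excess-≥ t) d≥′) noWin (levelBound e D t) (level t d≥′ (ℕP.≤-trans (ℕP.m≤m+n (levelThreshold e D t) (simplexThreshold (F t) e (levelBound e D t))) n≥))
    forget : ∀ {G} → Level (F (suc t)) H (levelBound e D (suc t)) G → Level (F (suc t)) H (levelBound e D (suc t)) (λ _ → ⊤)
    forget l = record { copies = Level.copies l ; isCopy = Level.isCopy l ; distinct = Level.distinct l ; good = λ _ → tt ; dense = Level.dense l }

  contradiction : ∀ t → e ≤ edgeCount t → excess t ≤ d → 1 ≤ n → levelThreshold e D t ≤ n → ⊥
  contradiction t e≤ d≥ 1≤n n≥ = nonempty (Level.copies lvl) (Level.isCopy lvl) (ℕP.≤-trans (ℕP.m^n>0 n {{ℕ.>-nonZero 1≤n}} (Pattern.dim (F t))) (Level.dense lvl))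
    where
    lvl = level t d≥ n≥
    nonempty : ∀ L → All (Copies.Copy (F t) H) L → 1 ≤ levelBound e D t * length L → ⊥
    nonempty []      _        1≤ = ℕP.<-irrefl refl (ℕP.≤-trans 1≤ (ℕP.≤-reflexive (ℕP.*-zeroʳ (levelBound e D t))))
    nonempty (φ ∷ L) (cφ ∷ _) _  = Bounding.copy-short (F t) (4 + suc t + slack t) (admissible (props t)) H e d (ℕP.≤-trans (excess-≥ t) d≥) noWin cφ (ℕP.≤-trans e≤ (ℕP.≤-reflexive (sym (length-E t))))

-- Edges as copies of F₂

card-0 : ∀ {n} (p : Subset n) → ∣ p ∣ ≡ 0 → p ≡ Subset.⊥
card-0 []          _  = refl
card-0 (false ∷ p) eq = cong (false ∷_) (card-0 p eq)

card-1 : ∀ {n} (p : Subset n) → ∣ p ∣ ≡ 1 → ∃[ a ] p ≡ ⁅ a ⁆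
card-1 (true ∷ p)  eq = zero , cong (true ∷_) (card-0 p (ℕP.suc-injective eq))
card-1 (false ∷ p) eq = let a , e = card-1 p eq in suc a , cong (false ∷_) e

card-2 : ∀ {n} (p : Subset n) → ∣ p ∣ ≡ 2 → ∃[ a ] ∃[ b ] (a ≢ b × p ≡ ⁅ a ⁆ ∪ ⁅ b ⁆)
card-2 (true ∷ p)  eq = let b , e = card-1 p (ℕP.suc-injective eq) in zero , suc b , (λ ()) , cong (true ∷_) (trans e (sym (SubsetP.∪-identityˡ ⁅ b ⁆)))
card-2 (false ∷ p) eq = let a , b , ne , e = card-2 p eq in suc a , suc b , (λ e' → ne (FinP.suc-injective e')) , cong (false ∷_) e

card-3 : ∀ {n} (p : Subset n) → ∣ p ∣ ≡ 3 → ∃[ a ] ∃[ b ] ∃[ c ] (a ≢ b × a ≢ c × b ≢ c × p ≡ ⁅ a ⁆ ∪ (⁅ b ⁆ ∪ ⁅ c ⁆))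
card-3 (true ∷ p)  eq = let b , c , ne , e = card-2 p (ℕP.suc-injective eq) in
  zero , suc b , suc c , (λ ()) , (λ ()) , (λ e' → ne (FinP.suc-injective e')) , cong (true ∷_) (trans e (sym (SubsetP.∪-identityˡ (⁅ b ⁆ ∪ ⁅ c ⁆))))
card-3 (false ∷ p) eq = let a , b , c , ab , ac , bc , e = card-3 p eq in
  suc a , suc b , suc c , (λ e' → ab (FinP.suc-injective e')) , (λ e' → ac (FinP.suc-injective e')) , (λ e' → bc (FinP.suc-injective e')) , cong (false ∷_) e

module Edges {n : ℕ} (H : ThreeGraph n) where

  private
    Vtx₂ = Fin 3 ⊎ Fin 0

    ofEdge : ∀ (p : Subset n) → ∣ p ∣ ≡ 3 → ∃[ φ ] (Inj {Vtx₂} φ × img φ (r0 , r1 , r2) ≡ p)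
    ofEdge p eq = φ , inj , sym e
      where
      c3 = card-3 p eq
      a = proj₁ c3
      b = proj₁ (proj₂ c3)
      c = proj₁ (proj₂ (proj₂ c3))
      ab = proj₁ (proj₂ (proj₂ (proj₂ c3)))
      ac = proj₁ (proj₂ (proj₂ (proj₂ (proj₂ c3))))
      bc = proj₁ (proj₂ (proj₂ (proj₂ (proj₂ (proj₂ c3)))))
      e = proj₂ (proj₂ (proj₂ (proj₂ (proj₂ (proj₂ c3)))))
      φ : Vtx₂ → Fin n
      φ r0 = a
      φ r1 = b
      φ r2 = c
      inj : Inj φ
      inj r0 r0 _ = refl
      inj r1 r1 _ = refl
      inj r2 r2 _ = refl
      inj r0 r1 q = ⊥-elim (ab q)
      inj r0 r2 q = ⊥-elim (ac q)
      inj r1 r0 q = ⊥-elim (ab (sym q))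
      inj r1 r2 q = ⊥-elim (bc q)
      inj r2 r0 q = ⊥-elim (ac (sym q))
      inj r2 r1 q = ⊥-elim (bc (sym q))

    maps : ∀ (es : List (Subset n)) → All (λ E → ∣ E ∣ ≡ 3) es → List (Vtx₂ → Fin n)
    maps []       _        = []
    maps (E ∷ es) (c ∷ cs) = proj₁ (ofEdge E c) ∷ maps es cs

    length-maps : ∀ es cs → length (maps es cs) ≡ length es
    length-maps []       []       = refl
    length-maps (E ∷ es) (c ∷ cs) = cong suc (length-maps es cs)

    maps-copy : ∀ es cs → (∀ {E} → E ∈ es → E ∈ edges H) → All (Copies.Copy F₂ H) (maps es cs)
    maps-copy []       []       sub = []
    maps-copy (E ∷ es) (c ∷ cs) sub = (proj₁ (proj₂ (ofEdge E c)) , subst (_∈ edges H) (sym (proj₂ (proj₂ (ofEdge E c)))) (sub (here refl)) ∷ []) ∷ maps-copy es cs (sub ∘ there)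

    apart : ∀ {φ ψ : Vtx₂ → Fin n} → img φ (r0 , r1 , r2) ≢ img ψ (r0 , r1 , r2) → Copies.Distinct F₂ H φ ψ
    apart {φ} {ψ} ne with φ r0 Data.Fin.≟ ψ r0 | φ r1 Data.Fin.≟ ψ r1 | φ r2 Data.Fin.≟ ψ r2
    ... | no q  | _     | _     = r0 , q
    ... | yes _ | no q  | _     = r1 , q
    ... | yes _ | yes _ | no q  = r2 , q
    ... | yes p | yes q | yes r = ⊥-elim (ne (cong₂ _∪_ (cong ⁅_⁆ p) (cong₂ _∪_ (cong ⁅_⁆ q) (cong ⁅_⁆ r))))

    maps-distinct : ∀ es cs → Unique es → AllPairs (Copies.Distinct F₂ H) (maps es cs)
    maps-distinct []       []       _       = []
    maps-distinct (E ∷ es) (c ∷ cs) (u ∷ us) = others es cs u ∷ maps-distinct es cs us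
      where
      others : ∀ es cs → All (E ≢_) es → All (Copies.Distinct F₂ H (proj₁ (ofEdge E c))) (maps es cs)
      others []       []        _        = []
      others (E' ∷ es) (c' ∷ cs) (ne ∷ nes) = apart (λ q → ne (trans (sym (proj₂ (proj₂ (ofEdge E c)))) (trans q (proj₂ (proj₂ (ofEdge E' c')))))) ∷ others es cs nes

  level₂ : ∀ D → n ^ 2 ≤ D * numEdges H → Level F₂ H D (λ _ → ⊤)
  level₂ D dense = record
    { copies = maps (edges H) (uniform H) ; isCopy = maps-copy (edges H) (uniform H) id
    ; distinct = maps-distinct (edges H) (uniform H) (distinct H) ; good = λ _ → tt
    ; dense = subst (λ l → n ^ 2 ≤ D * l) (sym (length-maps (edges H) (uniform H))) dense }

-- The existence of the configuration is decidable, so refuting its absence produces one.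
winning : ∀ e D t → e ≤ edgeCount t → ∃[ n₀ ] (∀ {n} → n₀ ≤ n → (H : ThreeGraph n) → n ^ 2 ≤ D * numEdges H → Win e (excess t) H)
winning e D t e≤ = suc (levelThreshold e D t) , λ {n} n≥ H dense → stable (win? e (excess t) H) (λ noWin →
    Chain.contradiction H e (excess t) noWin D (Edges.level₂ H D dense) t e≤ ℕP.≤-refl (ℕP.≤-trans (s≤s z≤n) n≥) (ℕP.≤-trans (ℕP.n≤1+n _) n≥))
  where
  stable : ∀ {A : Set} → Dec A → ¬ ¬ A → A
  stable (yes a) _   = a
  stable (no ¬a) ¬¬a = ⊥-elim (¬¬a ¬a)

-- The exponential series and the choice of the level

unitFraction : ∀ k → ((ℤ.+ 1) ℚ./ suc k) ⊗ ι (suc k) ≡ 1ℚ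
unitFraction k = ℚP.toℚᵘ-injective (begin
  ℚ.toℚᵘ (((ℤ.+ 1) ℚ./ suc k) ⊗ ι (suc k))                  ≈⟨ ℚP.toℚᵘ-homo-* ((ℤ.+ 1) ℚ./ suc k) (ι (suc k)) ⟩
  ℚ.toℚᵘ ((ℤ.+ 1) ℚ./ suc k) ℚᵘ.* ℚ.toℚᵘ (ι (suc k))        ≈⟨ ℚᵘP.*-cong (ℚP.toℚᵘ-fromℚᵘ (ℚᵘ.mkℚᵘ (ℤ.+ 1) k)) (ι-toℚᵘ (suc k)) ⟩
  ℚᵘ.mkℚᵘ (ℤ.+ 1) k ℚᵘ.* ℚᵘ.mkℚᵘ (ℤ.+ suc k) 0                ≈⟨ ℚᵘ.*≡* (cong ℤ.+_ (trans (ℕP.*-identityʳ _) (trans (ℕP.+-identityʳ (suc k)) (sym (trans (ℕP.*-identityˡ _) (ℕP.*-identityʳ (suc k))))))) ⟩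
  ℚ.toℚᵘ 1ℚ                                               ∎)
  where open SetoidReasoning

expTerm-nonneg : ∀ {q} → 0ℚ ≤ℚ q → ∀ k → 0ℚ ≤ℚ expTerm q k
expTerm-nonneg q≥0 zero    = 0≤ind true
expTerm-nonneg q≥0 (suc k) = 0≤⊗ (0≤⊗ (expTerm-nonneg q≥0 k) q≥0) (unit≥0 k)
  where
  unit≥0 : ∀ k → 0ℚ ≤ℚ (ℤ.+ 1) ℚ./ suc k
  unit≥0 k = ⊗-cancelˡ-≤ (ι (suc k)) (1≤ι (s≤s z≤n)) (subst₂ _≤ℚ_ (sym (ℚP.*-zeroʳ (ι (suc k)))) (sym (trans (ℚP.*-comm (ι (suc k)) _) (unitFraction k))) (0≤ind true))

-- Two terms of the binomial expansion of (1 + q)^(k+1), divided by (k+1)!.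
expTerm-suc : ∀ {q} → 0ℚ ≤ℚ q → ∀ k → expTerm q (suc k) ⊕ expTerm q k ≤ℚ expTerm (1ℚ ⊕ q) (suc k)
expTerm-suc {q} q≥0 zero    = ℚP.≤-reflexive (solve 1 (λ q → con 1ℚ :* q :* con 1ℚ :+ con 1ℚ := con 1ℚ :* (con 1ℚ :+ q) :* con 1ℚ) refl q)
expTerm-suc {q} q≥0 (suc k) = ≤ℚ-by (r ⊗ (c ⊕ (1ℚ ⊕ q) ⊗ (a ⊖ (b ⊕ c))))
  (0≤⊗ r≥0 (0≤⊕ (expTerm-nonneg q≥0 k) (0≤⊗ (0≤⊕ (0≤ind true) q≥0) (0≤⊖ (expTerm-suc q≥0 k)))))
  (trans (solve 5 (λ a b c q r → a :* (con 1ℚ :+ q) :* r := b :* q :* r :+ (r :* (b :+ c :* q)) :+ r :* (c :+ (con 1ℚ :+ q) :* (a :- (b :+ c)))) refl a b c q r)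
    (cong (λ w → b ⊗ q ⊗ r ⊕ w ⊕ r ⊗ (c ⊕ (1ℚ ⊕ q) ⊗ (a ⊖ (b ⊕ c)))) collapse))
  where
  r = (ℤ.+ 1) ℚ./ suc (suc k)
  a = expTerm (1ℚ ⊕ q) (suc k)
  b = expTerm q (suc k)
  c = expTerm q k
  r≥0 : 0ℚ ≤ℚ r
  r≥0 = ⊗-cancelˡ-≤ (ι (suc (suc k))) (1≤ι (s≤s z≤n)) (subst₂ _≤ℚ_ (sym (ℚP.*-zeroʳ (ι (suc (suc k))))) (sym (trans (ℚP.*-comm (ι (suc (suc k))) r) (unitFraction (suc k)))) (0≤ind true))
  c⊗q : c ⊗ q ≡ ι (suc k) ⊗ b
  c⊗q = sym (trans (solve 3 (λ i x r → i :* (x :* r) := x :* (r :* i)) refl (ι (suc k)) (c ⊗ q) ((ℤ.+ 1) ℚ./ suc k)) (trans (cong (c ⊗ q ⊗_) (unitFraction k)) (ℚP.*-identityʳ (c ⊗ q))))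
  collapse : r ⊗ (b ⊕ c ⊗ q) ≡ b
  collapse = trans (cong (λ w → r ⊗ (b ⊕ w)) c⊗q) (trans (solve 3 (λ r b i → r :* (b :+ i :* b) := r :* (con 1ℚ :+ i) :* b) refl r b (ι (suc k)))
    (trans (cong (λ w → r ⊗ w ⊗ b) (sym (ι-suc (suc k)))) (trans (cong (_⊗ b) (unitFraction (suc k))) (ℚP.*-identityˡ b))))

expPartial-suc : ∀ {q} → 0ℚ ≤ℚ q → ∀ N → expPartial q (suc N) ⊕ expPartial q N ≤ℚ expPartial (1ℚ ⊕ q) (suc N)
expPartial-suc {q} q≥0 zero    = ≤ℚ-by (expTerm (1ℚ ⊕ q) 1 ⊖ (expTerm q 1 ⊕ 1ℚ)) (0≤⊖ (expTerm-suc q≥0 0))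
  (solve 2 (λ a b → con 1ℚ :+ a := con 1ℚ :+ b :+ con 1ℚ :+ (a :- (b :+ con 1ℚ))) refl (expTerm (1ℚ ⊕ q) 1) (expTerm q 1))
expPartial-suc {q} q≥0 (suc N) = ℚP.≤-trans
  (ℚP.≤-reflexive (solve 4 (λ S T s t → S :+ T :+ (s :+ t) := (S :+ s) :+ (T :+ t)) refl (expPartial q (suc N)) (expTerm q (suc (suc N))) (expPartial q N) (expTerm q (suc N))))
  (ℚP.+-mono-≤ (expPartial-suc q≥0 N) (expTerm-suc q≥0 (suc N)))

-- Raising the exponent by one at least doubles the partial sums, by `expPartial-suc`.
2^≤exp : ∀ m → ι (2 ^ m) ≤ℚ expPartial (ι m) m
2^≤exp zero    = ℚP.≤-reflexive ι-1
2^≤exp (suc m) = subst₂ _≤ℚ_ (sym (trans (ι-+ (2 ^ m) (2 ^ m + 0)) (cong (λ k → ι (2 ^ m) ⊕ ι k) (ℕP.+-identityʳ (2 ^ m))))) (cong (λ q → expPartial q (suc m)) (sym (ι-suc m)))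
  (ℚP.≤-trans (ℚP.+-mono-≤ (ℚP.≤-trans (2^≤exp m) (≤ℚ-by (expTerm (ι m) (suc m)) (expTerm-nonneg (0≤ι m) (suc m)) refl)) (2^≤exp m)) (expPartial-suc (0≤ι m) m))

ι-^ : ∀ m d → ι m ^ℚ d ≡ ι (m ^ d)
ι-^ m zero    = sym ι-1
ι-^ m (suc d) = trans (cong (ι m ⊗_) (ι-^ m d)) (sym (ι-* m (m ^ d)))

-- The integer `m`, at least log₂ e, serves as `q` for every `ε`: already the `m`-th partial sum
-- reaches `e`.
excessOK : ∀ e d m → 1 ≤ m → m ^ d ≤ e ^ 18 → e ≤ 2 ^ m → ∀ d' → d' ≤ d → ExcessOK e d'
excessOK e d m 1≤m le e≤ d' d'≤d ε ε>0 = ι m , 0≤ι m ,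
  subst₂ _≤ℚ_ (sym (ι-^ m d')) (ι≡ℕ→ℚ (e ^ 18)) (ι-mono (ℕP.≤-trans (ℕP.^-monoʳ-≤ m {{ℕ.>-nonZero 1≤m}} d'≤d) le)) ,
  m , ℚP.≤-<-trans (ℚP.≤-trans (subst (_≤ℚ ι (2 ^ m)) (ι≡ℕ→ℚ e) (ι-mono e≤)) (2^≤exp m))
        (subst (_< expPartial (ι m) m ⊕ ε) (ℚP.+-identityʳ (expPartial (ι m) m)) (ℚP.+-monoʳ-< (expPartial (ι m) m) ε>0))

ceilLog : ∀ e → 1 ≤ e → ∃[ m ] (e ≤ 2 ^ m × (m ≡ 0 ⊎ 2 ^ m <ᴺ 2 * e))
ceilLog (suc zero)    _ = 0 , s≤s z≤n , inj₁ refl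
ceilLog (suc (suc e)) _ with ceilLog (suc e) (s≤s z≤n)
... | m , le , lt with suc (suc e) ℕP.≤? 2 ^ m
...   | yes le' = m , le' , [ inj₁ , (λ lt → inj₂ (ℕP.<-≤-trans lt (ℕP.*-monoʳ-≤ 2 (ℕP.n≤1+n (suc e))))) ]′ lt
...   | no  gt  = suc m , ℕP.≤-trans (s≤s le) (ℕP.≤-trans (ℕP.+-monoˡ-≤ (2 ^ m) (ℕP.m^n>0 2 m)) (ℕP.≤-reflexive (cong (2 ^ m +_) (sym (ℕP.+-identityʳ (2 ^ m)))))) ,
                  inj₂ (ℕP.*-monoʳ-< 2 (ℕP.≰⇒> gt))

pow-fact : ∀ m N → m ^ N * m ! ≤ (m + N) !
pow-fact m zero    = ℕP.≤-reflexive (trans (ℕP.*-identityˡ (m !)) (cong _! (sym (ℕP.+-identityʳ m))))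
pow-fact m (suc N) = begin
  m * m ^ N * m !          ≡⟨ ℕP.*-assoc m (m ^ N) (m !) ⟩
  m * (m ^ N * m !)        ≤⟨ ℕP.*-mono-≤ (ℕP.≤-trans (ℕP.m≤m+n m N) (ℕP.n≤1+n (m + N))) (pow-fact m N) ⟩
  suc (m + N) * (m + N) !  ≡⟨ cong _! (ℕP.+-suc m N) ⟨
  (m + suc N) !            ∎
  where open ℕP.≤-Reasoning

fact-+ : ∀ m N → (m + N) ! ≤ m ! * N ! * 2 ^ (m + N)
fact-+ zero    N = ℕP.≤-trans (ℕP.≤-reflexive (sym (trans (ℕP.*-identityʳ (1 * N !)) (ℕP.*-identityˡ (N !))))) (ℕP.*-monoʳ-≤ (1 * N !) (ℕP.m^n>0 2 N))
fact-+ (suc m) zero = ℕP.≤-trans (ℕP.≤-reflexive (trans (cong (λ k → (suc k) !) (ℕP.+-identityʳ m)) (sym (trans (ℕP.*-identityʳ ((suc m) ! * 1)) (ℕP.*-identityʳ ((suc m) !)))))) (ℕP.*-monoʳ-≤ ((suc m) ! * 1) (ℕP.m^n>0 2 (suc (m + 0))))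
fact-+ (suc m) (suc N) = begin
  suc (m + suc N) * (m + suc N) !
    ≡⟨ ℕP.*-distribʳ-+ ((m + suc N) !) (suc m) (suc N) ⟩
  suc m * (m + suc N) ! + suc N * (m + suc N) !
    ≤⟨ ℕP.+-mono-≤ (ℕP.*-monoʳ-≤ (suc m) (fact-+ m (suc N))) (ℕP.*-monoʳ-≤ (suc N) (subst (λ k → k ! ≤ (suc m) ! * N ! * 2 ^ k) (sym (ℕP.+-suc m N)) (fact-+ (suc m) N))) ⟩
  suc m * (m ! * (suc N) ! * X) + suc N * ((suc m) ! * N ! * X)
    ≡⟨ solveℕ 5 (λ m N a b x → m ⊠ (a ⊠ (N ⊠ b) ⊠ x) ⊞ N ⊠ (m ⊠ a ⊠ b ⊠ x) ≜ m ⊠ a ⊠ (N ⊠ b) ⊠ (num 2 ⊠ x)) refl (suc m) (suc N) (m !) (N !) X ⟩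
  (suc m) ! * (suc N) ! * (2 * X) ∎
  where
  open ℕP.≤-Reasoning
  X = 2 ^ (m + suc N)

-- The binomial coefficient of m + N over m lies between m^N / N! and 2^(m+N).
pow-≤ : ∀ m N → m ^ N ≤ N ! * 2 ^ (m + N)
pow-≤ m N = ℕP.*-cancelʳ-≤ (m ^ N) (N ! * 2 ^ (m + N)) (m !) {{fact-nonZero m}} (begin
  m ^ N * m !                   ≤⟨ pow-fact m N ⟩
  (m + N) !                     ≤⟨ fact-+ m N ⟩
  m ! * N ! * 2 ^ (m + N)       ≡⟨ trans (ℕP.*-assoc (m !) (N !) _) (ℕP.*-comm (m !) (N ! * 2 ^ (m + N))) ⟩
  N ! * 2 ^ (m + N) * m !       ∎)
  where
  open ℕP.≤-Reasoning
  fact-nonZero : ∀ m → ℕ.NonZero (m !)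
  fact-nonZero m = ℕ.>-nonZero (pos m)
    where
    pos : ∀ m → 1 ≤ m !
    pos zero    = s≤s z≤n
    pos (suc m) = ℕP.*-mono-≤ {1} {suc m} (s≤s z≤n) (pos m)

edgeCount-fact : ∀ t → 8 * edgeCount t ≡ 3 * (4 + t) !
edgeCount-fact zero    = refl
edgeCount-fact (suc t) = begin
  8 * ((5 + t) * edgeCount t)   ≡⟨ trans (sym (ℕP.*-assoc 8 (5 + t) (edgeCount t))) (trans (cong (_* edgeCount t) (ℕP.*-comm 8 (5 + t))) (ℕP.*-assoc (5 + t) 8 (edgeCount t))) ⟩
  (5 + t) * (8 * edgeCount t)   ≡⟨ cong ((5 + t) *_) (edgeCount-fact t) ⟩
  (5 + t) * (3 * (4 + t) !)     ≡⟨ trans (sym (ℕP.*-assoc (5 + t) 3 ((4 + t) !))) (trans (cong (_* (4 + t) !) (ℕP.*-comm (5 + t) 3)) (ℕP.*-assoc 3 (5 + t) ((4 + t) !))) ⟩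
  3 * ((5 + t) * (4 + t) !)     ∎
  where open ≡-Reasoning

-- Absorbs the powers of two in `large-case`. The inequality first holds at `edgeCount 3`, so
-- smaller levels are checked by numbers.
edgeCount-large : ∀ t → 16 * 2 ^ (7 + t) ≤ 3 * edgeCount (3 + t)
edgeCount-large zero    = ℕP.≤ᵇ⇒≤ 2048 5670 _
edgeCount-large (suc t) = begin
  16 * (2 * 2 ^ (7 + t))               ≡⟨ trans (sym (ℕP.*-assoc 16 2 (2 ^ (7 + t)))) (ℕP.*-assoc 2 16 (2 ^ (7 + t))) ⟩
  2 * (16 * 2 ^ (7 + t))               ≤⟨ ℕP.*-mono-≤ {2} {8 + t} (s≤s (s≤s z≤n)) (edgeCount-large t) ⟩
  (8 + t) * (3 * edgeCount (3 + t))    ≡⟨ trans (sym (ℕP.*-assoc (8 + t) 3 (edgeCount (3 + t)))) (trans (cong (_* edgeCount (3 + t)) (ℕP.*-comm (8 + t) 3)) (ℕP.*-assoc 3 (8 + t) (edgeCount (3 + t)))) ⟩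
  3 * ((8 + t) * edgeCount (3 + t))    ∎
  where open ℕP.≤-Reasoning

log<⇒ : ∀ m e b → 2 ^ m <ᴺ 2 * e → e ≤ 2 ^ b → m ≤ b
log<⇒ m e b lt le = ℕP.≮⇒≥ (λ b<m → ℕP.<-irrefl refl (ℕP.<-≤-trans lt (ℕP.≤-trans (ℕP.*-monoʳ-≤ 2 le) (ℕP.^-monoʳ-≤ 2 b<m))))

-- Three quantities are each paid by one factor `e`: N! through the edge count, 2^m through the
-- choice of `m`, and 16·2^N through `edgeCount-large`.
large-case : ∀ t m e → edgeCount (3 + t) <ᴺ e → 2 ^ m <ᴺ 2 * e → m ^ (7 + t) ≤ e ^ 3
large-case t m e ec< lt = ℕP.*-cancelˡ-≤ 3 (begin
  3 * m ^ N                             ≤⟨ ℕP.*-monoʳ-≤ 3 (pow-≤ m N) ⟩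
  3 * (N ! * 2 ^ (m + N))               ≡⟨ trans (sym (ℕP.*-assoc 3 (N !) _)) (cong₂ _*_ (sym (edgeCount-fact (3 + t))) (ℕP.^-distribˡ-+-* 2 m N)) ⟩
  8 * edgeCount (3 + t) * (2 ^ m * 2 ^ N) ≤⟨ ℕP.*-mono-≤ (ℕP.*-monoʳ-≤ 8 (ℕP.<⇒≤ ec<)) (ℕP.*-monoˡ-≤ (2 ^ N) (ℕP.<⇒≤ lt)) ⟩
  8 * e * (2 * e * 2 ^ N)               ≡⟨ solveℕ 2 (λ e x → num 8 ⊠ e ⊠ (num 2 ⊠ e ⊠ x) ≜ num 16 ⊠ x ⊠ (e ⊠ e)) refl e (2 ^ N) ⟩
  16 * 2 ^ N * (e * e)                  ≤⟨ ℕP.*-monoˡ-≤ (e * e) (ℕP.≤-trans (edgeCount-large t) (ℕP.*-monoʳ-≤ 3 (ℕP.<⇒≤ ec<))) ⟩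
  3 * e * (e * e)                       ≡⟨ solveℕ 1 (λ e → num 3 ⊠ e ⊠ (e ⊠ e) ≜ num 3 ⊠ (e ⊠ (e ⊠ (e ⊠ num 1)))) refl e ⟩
  3 * e ^ 3                             ∎)
  where
  open ℕP.≤-Reasoning
  N = 7 + t

middle-case : ∀ m e N b lo → m ≤ b → lo ≤ e → (b ^ N ℕ.≤ᵇ lo ^ 3) ≡ Data.Bool.true → m ^ N ≤ e ^ 3
middle-case m e N b lo m≤b lo≤e eq = ℕP.≤-trans (ℕP.^-monoˡ-≤ N m≤b) (ℕP.≤-trans (ℕP.≤ᵇ⇒≤ (b ^ N) (lo ^ 3) (≡⇒T eq)) (ℕP.^-monoˡ-≤ 3 lo≤e))

logPower : ∀ t m e → edgeCount t <ᴺ e → e ≤ edgeCount (suc t) → 2 ^ m <ᴺ 2 * e → m ^ (4 + t) ≤ e ^ 3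
-- The range from 10 to 45 is split because 6^4 exceeds 10³.
logPower zero m e lo hi lt with e ℕP.≤? 16
... | yes e≤16 = middle-case m e 4 4 10 (log<⇒ m e 4 lt e≤16) lo refl
... | no  e≰16 = middle-case m e 4 6 17 (log<⇒ m e 6 lt (ℕP.≤-trans hi (ℕP.≤ᵇ⇒≤ 45 64 _))) (ℕP.≰⇒> e≰16) refl
logPower (suc zero) m e lo hi lt = middle-case m e 5 9 46 (log<⇒ m e 9 lt (ℕP.≤-trans hi (ℕP.≤ᵇ⇒≤ 270 512 _))) lo refl
logPower (suc (suc zero)) m e lo hi lt = middle-case m e 6 11 271 (log<⇒ m e 11 lt (ℕP.≤-trans hi (ℕP.≤ᵇ⇒≤ 1890 2048 _))) lo refl
logPower (suc (suc (suc t))) m e lo hi lt = large-case t m e lo lt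

-- Descending to the least admissible level makes `e` exceed the previous edge count, which
-- `logPower` needs. At the lowest level the exponent is 3 and m ≤ e suffices.
stage : ∀ e → 3 ≤ e → ∃[ t ] (e ≤ edgeCount t × ∀ m → 2 ^ m <ᴺ 2 * e → m ^ (3 + t) ≤ e ^ 3)
stage e 3≤e = search e (grows e)
  where
  grows : ∀ e → e ≤ edgeCount e
  grows zero    = z≤n
  grows (suc e) = ℕP.≤-trans (ℕP.≤-trans (s≤s (grows e)) (ℕP.+-monoˡ-≤ (edgeCount e) (1≤edgeCount e))) (ℕP.+-monoʳ-≤ (edgeCount e) (ℕP.m≤m+n (edgeCount e) _))
    where
    1≤edgeCount : ∀ t → 1 ≤ edgeCount t
    1≤edgeCount zero    = s≤s z≤n
    1≤edgeCount (suc t) = ℕP.*-mono-≤ {1} {5 + t} (s≤s z≤n) (1≤edgeCount t)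
  log≤ : ∀ m → 2 ^ m <ᴺ 2 * e → m ≤ e
  log≤ m lt = log<⇒ m e e lt (ℕP.<⇒≤ (n<2^n e))
    where
    n<2^n : ∀ n → n <ᴺ 2 ^ n
    n<2^n zero    = s≤s z≤n
    n<2^n (suc n) = ℕP.≤-trans (s≤s (n<2^n n)) (ℕP.≤-trans (ℕP.+-monoˡ-≤ (2 ^ n) (ℕP.m^n>0 2 n)) (ℕP.≤-reflexive (cong (2 ^ n +_) (sym (ℕP.+-identityʳ (2 ^ n))))))
  search : ∀ t → e ≤ edgeCount t → ∃[ t ] (e ≤ edgeCount t × ∀ m → 2 ^ m <ᴺ 2 * e → m ^ (3 + t) ≤ e ^ 3)
  search zero    le = zero , le , λ m lt → ℕP.^-monoˡ-≤ 3 (log≤ m lt)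
  search (suc t) le with e ℕP.≤? edgeCount t
  ... | yes le' = search t le'
  ... | no  gt  = suc t , le , λ m lt → logPower t m e (ℕP.≰⇒> gt) le lt

-- Density and the final bound

-- The denominator of `ε` works, since a positive numerator is at least 1.
density : ∀ ε → 0ℚ < ε → ∃[ D ] 1ℚ ≤ℚ ι D ⊗ ε
density ε ε>0 = ℚ.↧ₙ ε , ℚP.toℚᵘ-cancel-≤ (ℚᵘP.≤-respʳ-≃ (ℚᵘP.≃-sym (ℚᵘP.≃-trans (ℚP.toℚᵘ-homo-* (ι (ℚ.↧ₙ ε)) ε) (ℚᵘP.*-congʳ (ι-toℚᵘ (ℚ.↧ₙ ε))))) (core ε ε>0))
  where
  core : ∀ ε → 0ℚ < ε → ℚ.toℚᵘ 1ℚ ℚᵘ.≤ ℚᵘ.mkℚᵘ (ℤ.+ (ℚ.↧ₙ ε)) 0 ℚᵘ.* ℚ.toℚᵘ ε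
  core (ℚ.mkℚ (ℤ.+ suc a) b c) _ = ℚᵘ.*≤* (ℤ.+≤+ (ℕP.≤-trans (ℕP.≤-reflexive (trans (ℕP.+-identityʳ _) (ℕP.+-identityʳ _))) (ℕP.≤-trans (ℕP.m≤m*n (suc b) (suc a)) (ℕP.≤-reflexive (sym (ℕP.*-identityʳ _))))))
  core (ℚ.mkℚ (ℤ.+ zero) b c) ε>0 = ⊥-elim (ℚP.<-irrefl (sym (ℚP.↥p≡0⇒p≡0 (ℚ.mkℚ (ℤ.+ zero) b c) refl)) ε>0)
  core (ℚ.mkℚ (ℤ.-[1+ a ]) b c) ε>0 = ⊥-elim (ℚP.<-asym ε>0 (ℚP.negative⁻¹ (ℚ.mkℚ (ℤ.-[1+ a ]) b c)))

theorem1p2 : (e : ℕ) → 3 ≤ e → (ε : ℚ) → 0ℚ < ε → ε < 1ℚ →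
    ∃[ n₀ ] ((n : ℕ) → n₀ ≤ n → (H : ThreeGraph n) →
    ε Data.Rational.* ℕ→ℚ (n * n) Data.Rational.≤ ℕ→ℚ (numEdges H) →
    ContainsConfig e H)
theorem1p2 e 3≤e ε ε>0 ε<1 = n₀ , λ n n≥ H dense →
  let S , S⊆ , len , small = win n≥ H (ι-cancel-≤ (enough n H dense)) in
  S , S⊆ , len , inj₂ (excessOK e (excess t) m 1≤m bound e≤2^m (∣ ⋃ S ∣ ∸ e) (ℕP.≤-trans (ℕP.∸-monoˡ-≤ e small) (ℕP.≤-reflexive (ℕP.m+n∸m≡n e (excess t)))))
  where
  st = stage e 3≤e
  t = proj₁ st
  D = proj₁ (density ε ε>0)
  n₀ = proj₁ (winning e D t (proj₁ (proj₂ st)))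
  win = λ {n} → proj₂ (winning e D t (proj₁ (proj₂ st))) {n}
  cl = ceilLog e (ℕP.≤-trans (s≤s z≤n) 3≤e)
  m = proj₁ cl
  e≤2^m : e ≤ 2 ^ m
  e≤2^m = proj₁ (proj₂ cl)
  1≤m : 1 ≤ m
  1≤m = pos m e≤2^m
    where
    pos : ∀ m → e ≤ 2 ^ m → 1 ≤ m
    pos zero    le with ℕP.≤-trans 3≤e le
    ... | s≤s ()
    pos (suc _) _ = s≤s z≤n
  -- The sixth power of m^(3+t) ≤ e³.
  bound : m ^ excess t ≤ e ^ 18
  bound = ℕP.≤-trans (ℕP.≤-reflexive (trans (cong (m ^_) (ℕP.*-comm 6 (3 + t))) (sym (ℕP.^-*-assoc m (3 + t) 6)))) (ℕP.≤-trans (ℕP.^-monoˡ-≤ 6 (small m (proj₂ (proj₂ cl)))) (ℕP.≤-reflexive (ℕP.^-*-assoc e 3 6)))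
    where
    small : ∀ m → (m ≡ 0 ⊎ 2 ^ m <ᴺ 2 * e) → m ^ (3 + t) ≤ e ^ 3
    small m (inj₁ refl) = z≤n
    small m (inj₂ lt)   = proj₂ (proj₂ st) m lt
  enough : ∀ n (H : ThreeGraph n) → ε ⊗ ℕ→ℚ (n * n) ≤ℚ ℕ→ℚ (numEdges H) → ι (n ^ 2) ≤ℚ ι (D * numEdges H)
  enough n H dense = begin
    ι (n ^ 2)                    ≡⟨ cong (λ k → ι (n * k)) (ℕP.*-identityʳ n) ⟩
    ι (n * n)                    ≡⟨ ℚP.*-identityˡ (ι (n * n)) ⟨
    1ℚ ⊗ ι (n * n)               ≤⟨ ⊗-mono-≤ (ℚP.≤-trans (0≤ind true) (proj₂ (density ε ε>0))) (0≤ι (n * n)) (proj₂ (density ε ε>0)) ℚP.≤-refl ⟩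
    ι D ⊗ ε ⊗ ι (n * n)          ≡⟨ ℚP.*-assoc (ι D) ε (ι (n * n)) ⟩
    ι D ⊗ (ε ⊗ ι (n * n))        ≤⟨ ⊗-monoˡ-≤ (0≤ι D) (subst₂ _≤ℚ_ (cong (ε ⊗_) (sym (ι≡ℕ→ℚ (n * n)))) (sym (ι≡ℕ→ℚ (numEdges H))) dense) ⟩
    ι D ⊗ ι (numEdges H)         ≡⟨ ι-* D (numEdges H) ⟨
    ι (D * numEdges H)           ∎
    where open ℚP.≤-Reasoning
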